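{- Let $W$ be a finite Coxeter group with simple reflections $S=\{s_1,\ldots,s_n\}$ and Coxeter matrix $(m_{ij})$ such that $m_{ij}\le 4$ for all $i,j$. Let $v\in\mathbb{R}_{>0}^n$ be the vector with $v_i$ equal to the minimum number of occurrences of $s_i$ in a reduced word of the longest element $w_0$ of $W$. Then there exists a restricted generalized Cartan matrix $A\in\mathbb{R}^{n\times n}$ of $(W,S)$ such that $Av\ge \mathbf{0}$ entrywise.
   Context: $W=\langle s_1,\dots,s_n \mid (s_is_j)^{m_{ij}}=\mathrm{id}\rangle$. A generalized Cartan matrix of $(W,S)$ is a real $n\times n$ matrix $A$ with $A_{ii}=2$ for all $i$, $A_{ij}\le0$ for $i\ne j$, $A_{ij}<0$ if and only if $A_{ji}<0$, and $A_{ij}A_{ji}=4\cos^2(\pi/m_{ij})$ for $i\ne j$. It is restricted if $m_{ij}=3$ implies $A_{ij}=A_{ji}=-1$. -}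

module Defs where

open import Level using (0ℓ)
open import Data.Nat as ℕ using (ℕ; zero; suc)
open import Data.Fin using (Fin)
open import Data.List using (List; []; _∷_; _++_; length; concat; replicate; filter)
open import Data.List.Membership.Propositional using (_∈_)
open import Data.Product using (Σ; ∃; _×_; _,_)
open import Relation.Nullary using (¬_)
open import Relation.Binary.PropositionalEquality using (_≡_; _≢_)
open import Relation.Binary.Structures using (IsTotalOrder)
open import Algebra.Bundles using (CommutativeRing)
import Algebra.Definitions.RawMonoid as RawMonoidDefs
import Data.Fin as F

-- The real numbers, axiomatised as a Dedekind-complete ordered field
-- (unique up to isomorphism).  Equality is the setoid equality _≈_.

record RealField : Set₁ where
  field
    commRing : CommutativeRing 0ℓ 0ℓ
  open CommutativeRing commRing public
  field
    _≤_          : Carrier → Carrier → Set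
    isTotalOrder : IsTotalOrder _≈_ _≤_
    0≉1          : ¬ (0# ≈ 1#)
    inverse      : ∀ x → ¬ (x ≈ 0#) → ∃ λ y → x * y ≈ 1#
    +-mono-≤     : ∀ {x y} z → x ≤ y → (x + z) ≤ (y + z)
    *-nonneg     : ∀ {x y} → 0# ≤ x → 0# ≤ y → 0# ≤ (x * y)
    complete     : (P : Carrier → Set) → ∃ P →
                   (∃ λ b → ∀ x → P x → x ≤ b) →
                   ∃ λ s → (∀ x → P x → x ≤ s) ×
                           (∀ b → (∀ x → P x → x ≤ b) → s ≤ b)

  _<_ : Carrier → Carrier → Set
  x < y = (x ≤ y) × ¬ (x ≈ y)

  open RawMonoidDefs +-rawMonoid public using (sum) renaming (_×_ to _·ℕ_)

  fromℕ : ℕ → Carrier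
  fromℕ k = k ·ℕ 1#

record CoxeterMatrix (n : ℕ) : Set where
  field
    m      : Fin n → Fin n → ℕ
    diag   : ∀ i → m i i ≡ 1
    sym    : ∀ i j → m i j ≡ m j i
    offdiag : ∀ i j → i ≢ j → 2 ℕ.≤ m i j
open CoxeterMatrix public

Word : ℕ → Set
Word n = List (Fin n)

relator : ∀ {n} → CoxeterMatrix n → Fin n → Fin n → Word n
relator M i j = concat (replicate (m M i j) (i ∷ j ∷ []))

data Step {n} (M : CoxeterMatrix n) : Word n → Word n → Set where
  insert : ∀ u v i j → Step M (u ++ v) (u ++ relator M i j ++ v)
  delete : ∀ u v i j → Step M (u ++ relator M i j ++ v) (u ++ v)

-- equality in W = ⟨ s_i | (s_i s_j)^{m_ij} ⟩ : reflexive–transitive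
-- closure of elementary moves (symmetric since moves are reversible)
data Equal {n} (M : CoxeterMatrix n) : Word n → Word n → Set where
  done : ∀ {u} → Equal M u u
  step : ∀ {u v w} → Step M u v → Equal M v w → Equal M u w

IsFinite : ∀ {n} → CoxeterMatrix n → Set
IsFinite {n} M = Σ (List (Word n)) λ L → ∀ w → ∃ λ u → u ∈ L × Equal M w u

Reduced : ∀ {n} → CoxeterMatrix n → Word n → Set
Reduced M w = ∀ u → Equal M u w → length w ℕ.≤ length u

IsLongestWord : ∀ {n} → CoxeterMatrix n → Word n → Set
IsLongestWord M w0 = Reduced M w0 × (∀ u → Reduced M u → length u ℕ.≤ length w0)

count : ∀ {n} → Fin n → Word n → ℕ
count i w = length (filter (F._≟ i) w)

IsMinOccurrences : ∀ {n} → CoxeterMatrix n → Word n → Fin n → ℕ → Set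
IsMinOccurrences M w0 i k =
  (∃ λ u → Reduced M u × Equal M u w0 × count i u ≡ k) ×
  (∀ u → Reduced M u → Equal M u w0 → k ℕ.≤ count i u)

-- 4 cos²(π/m) for m ∈ {2,3,4} (the only off-diagonal values allowed
-- when all m_ij ≤ 4): 4cos²(π/2)=0, 4cos²(π/3)=1, 4cos²(π/4)=2.
-- Other arguments never occur under the hypothesis m_ij ≤ 4.
fourCos² : ℕ → ℕ
fourCos² 3 = 1
fourCos² 4 = 2
fourCos² _ = 0

module _ (R : RealField) where
  open RealField R

  Matrix : ℕ → Set
  Matrix n = Fin n → Fin n → Carrier

  record IsGCM {n} (M : CoxeterMatrix n) (A : Matrix n) : Set where
    field
      diag2   : ∀ i → A i i ≈ fromℕ 2
      nonpos  : ∀ i j → i ≢ j → A i j ≤ 0#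
      negSym  : ∀ i j → i ≢ j → (A i j < 0#) → (A j i < 0#)
      product : ∀ i j → i ≢ j → (A i j * A j i) ≈ fromℕ (fourCos² (m M i j))

  record IsRestrictedGCM {n} (M : CoxeterMatrix n) (A : Matrix n) : Set where
    field
      isGCM      : IsGCM M A
      restricted : ∀ i j → m M i j ≡ 3 → (A i j ≈ - 1#) × (A j i ≈ - 1#)

-- W acts faithfully on its root lattice through an integral Cartan matrix, and w₀ makes all roots negative;
-- a null vector a ≥ 0 of an affine subdiagram would satisfy w₀ a ≥ a, so every component of the diagram has
-- type A, B, D, E or F₄.  The numbers v are then found type by type.  A word that negates all simple roots of
-- a component contains a reduced word of w₀ there, which bounds v from above.  From below, letters other than
-- i fix the weight ωᵢ, so a word for w₀ contains i at least as often as the distance from ωᵢ to w₀ ωᵢ modulo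
-- the other letters requires; in the classical types this is read off from (signed) permutations, in the
-- exceptional ones the orbit is enumerated.  At a vertex i all of whose edges are labelled 3 the values satisfy
-- 2 vᵢ ≥ Σ vⱼ over the neighbours j, and it remains to split the product 2 at an edge labelled 4: as 2 · 1 at an
-- end of the diagram, and as 4/3 · 3/2 in F₄.
module Submission where

open import Defs
open import Data.Nat using (ℕ; zero; suc; _≤_; _<_; z≤n; s≤s)
import Data.Nat as ℕ
import Data.Nat.Properties as ℕₚ
open import Data.Integer using (ℤ; +_; -[1+_]; _+_; _*_; _-_; -_; 0ℤ; 1ℤ; +≤+; +<+)
  renaming (_≤_ to _≤ᶻ_; _<_ to _<ᶻ_)
import Data.Integer as ℤ
import Data.Integer.Properties as ℤₚ
open import Data.Integer.Tactic.RingSolver using (solve-∀)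
open import Data.Fin using (Fin; toℕ)
import Data.Fin as F
import Data.Fin.Properties as Fₚ
open import Data.List using (List; []; _∷_; _++_; length; filter; foldr; reverse)
import Data.List as L
import Data.List.Properties as Lₚ
open import Data.Product using (Σ; ∃; _×_; _,_; proj₁; proj₂)
open import Data.Sum using (_⊎_; inj₁; inj₂)
open import Data.Empty using (⊥; ⊥-elim)
open import Function using (_∘_; case_of_)
open import Relation.Nullary using (¬_; Dec; yes; no; _×-dec_; _⊎-dec_; _→-dec_)
open import Relation.Binary.PropositionalEquality
  using (_≡_; _≢_; _≗_; refl; cong; cong₂; subst; subst₂; trans)
  renaming (sym to ≡-sym)
open import Algebra.Properties.Semiring.Sum ℤₚ.+-*-semiring
  using (sum; sum-cong-≗; ∑-distrib-+; ∑-comm; *-distribˡ-sum; sum-replicate-zero)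
open import Data.Integer.Solver using (module +-*-Solver)
module Solver = +-*-Solver
open import Data.List.Relation.Unary.All using (All; []; _∷_)
import Data.List.Relation.Unary.All as All
import Data.List.Relation.Unary.All.Properties as Allₚ
open import Data.List.Relation.Unary.Any using (here; there)
import Data.List.Relation.Unary.Any.Properties as Anyₚ
open import Data.List.Membership.Propositional using (_∈_; find)
open import Data.List.Membership.Propositional.Properties using (∈-filter⁺; ∈-filter⁻; ∈-upTo⁺; ∈-upTo⁻; ∈-map⁺; ∈-map⁻)
open import Data.Bool using (Bool; true; false; if_then_else_; not; _∧_; _∨_; T)
import Data.Bool.Properties as Boolₚ
open import Data.Maybe using (Maybe; just; nothing)
open import Data.Unit using (tt)
open import Function.Bundles using (module Equivalence)
open import Relation.Nullary.Decidable using (¬?)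
open import Data.Bool.ListAction using () renaming (all to allᵇ; any to anyᵇ)
import Data.Maybe.Properties as Maybeₚ
open import Relation.Binary.Definitions using (tri<; tri≈; tri>)
open import Algebra.Bundles using (CommutativeRing; CommutativeMonoid)
open import Relation.Binary.Structures using (IsTotalOrder)

-- The action on the root lattice

module Group {n : ℕ} (M : CoxeterMatrix n) where

  infix 4 _~_
  _~_ : Word n → Word n → Set
  _~_ = Equal M

  ~-trans : ∀ {u v w} → u ~ v → v ~ w → u ~ w
  ~-trans done       q = q
  ~-trans (step s p) q = step s (~-trans p q)

  Step-sym : ∀ {u v} → Step M u v → Step M v u
  Step-sym (insert u v i j) = delete u v i j
  Step-sym (delete u v i j) = insert u v i j

  ~-sym : ∀ {u v} → u ~ v → v ~ u
  ~-sym done       = done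
  ~-sym (step s p) = ~-trans (~-sym p) (step (Step-sym s) done)

  ~-reflexive : ∀ {u v} → u ≡ v → u ~ v
  ~-reflexive refl = done

  Step-++ˡ : ∀ x {u v} → Step M u v → Step M (x ++ u) (x ++ v)
  Step-++ˡ x (insert u v i j) = subst₂ (Step M)
    (Lₚ.++-assoc x u v) (Lₚ.++-assoc x u _) (insert (x ++ u) v i j)
  Step-++ˡ x (delete u v i j) = subst₂ (Step M)
    (Lₚ.++-assoc x u _) (Lₚ.++-assoc x u v) (delete (x ++ u) v i j)

  Step-++ʳ : ∀ y {u v} → Step M u v → Step M (u ++ y) (v ++ y)
  Step-++ʳ y (insert u v i j) = subst₂ (Step M)
    (≡-sym (Lₚ.++-assoc u v y))
    (≡-sym (trans (Lₚ.++-assoc u _ y) (cong (u ++_) (Lₚ.++-assoc (relator M i j) v y))))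
    (insert u (v ++ y) i j)
  Step-++ʳ y (delete u v i j) = Step-sym (Step-++ʳ y (insert u v i j))

  ++⁺ˡ : ∀ x {u v} → u ~ v → x ++ u ~ x ++ v
  ++⁺ˡ x done       = done
  ++⁺ˡ x (step s p) = step (Step-++ˡ x s) (++⁺ˡ x p)

  ++⁺ʳ : ∀ y {u v} → u ~ v → u ++ y ~ v ++ y
  ++⁺ʳ y done       = done
  ++⁺ʳ y (step s p) = step (Step-++ʳ y s) (++⁺ʳ y p)

  ++⁺ : ∀ {u v x y} → u ~ v → x ~ y → u ++ x ~ v ++ y
  ++⁺ {v = v} {x = x} p q = ~-trans (++⁺ʳ x p) (++⁺ˡ v q)

  relator~[] : ∀ i j → relator M i j ~ []
  relator~[] i j = ~-trans (~-reflexive (≡-sym (Lₚ.++-identityʳ _)))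
                           (step (delete [] [] i j) done)

  ii~[] : ∀ i → i ∷ i ∷ [] ~ []
  ii~[] i = subst (λ k → L.concat (L.replicate k (i ∷ i ∷ [])) ~ []) (diag M i) (relator~[] i i)

  cancel : ∀ i v → i ∷ i ∷ v ~ v
  cancel i v = ++⁺ʳ v (ii~[] i)

  ++-reverse~[] : ∀ u → u ++ reverse u ~ []
  ++-reverse~[] []      = done
  ++-reverse~[] (i ∷ u) = ~-trans
    (~-reflexive (cong (i ∷_) (trans (cong (u ++_) (Lₚ.unfold-reverse i u))
                                     (≡-sym (Lₚ.++-assoc u (reverse u) (i ∷ []))))))
    (~-trans (++⁺ˡ (i ∷ []) (++⁺ʳ (i ∷ []) (++-reverse~[] u))) (ii~[] i))

  reverse-++~[] : ∀ u → reverse u ++ u ~ []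
  reverse-++~[] u = subst (λ v → reverse u ++ v ~ []) (Lₚ.reverse-involutive u) (++-reverse~[] (reverse u))

  ++~[]⇒~reverse : ∀ u v → u ++ v ~ [] → u ~ reverse v
  ++~[]⇒~reverse u v p = ~-trans (~-reflexive (≡-sym (Lₚ.++-identityʳ u)))
    (~-trans (++⁺ˡ u (~-sym (++-reverse~[] v)))
    (~-trans (~-reflexive (≡-sym (Lₚ.++-assoc u v (reverse v)))) (++⁺ʳ (reverse v) p)))

  braid₂ : ∀ i j → m M i j ≡ 2 → i ∷ j ∷ [] ~ j ∷ i ∷ []
  braid₂ i j e = ++~[]⇒~reverse (i ∷ j ∷ []) (i ∷ j ∷ [])
    (subst (λ k → L.concat (L.replicate k (i ∷ j ∷ [])) ~ []) e (relator~[] i j))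

  braid₃ : ∀ i j → m M i j ≡ 3 → i ∷ j ∷ i ∷ [] ~ j ∷ i ∷ j ∷ []
  braid₃ i j e = ++~[]⇒~reverse (i ∷ j ∷ i ∷ []) (j ∷ i ∷ j ∷ [])
    (subst (λ k → L.concat (L.replicate k (i ∷ j ∷ [])) ~ []) e (relator~[] i j))

  braid₄ : ∀ i j → m M i j ≡ 4 → i ∷ j ∷ i ∷ j ∷ [] ~ j ∷ i ∷ j ∷ i ∷ []
  braid₄ i j e = ++~[]⇒~reverse (i ∷ j ∷ i ∷ j ∷ []) (i ∷ j ∷ i ∷ j ∷ [])
    (subst (λ k → L.concat (L.replicate k (i ∷ j ∷ [])) ~ []) e (relator~[] i j))

iterateRounds : {A : Set} → (A → A → A) → (A → A → A) → (A → A) →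
                A → A → A → A → A → ℕ → A × A
iterateRounds _⊕_ _⊗_ ⊖_ p q c d o zero    = o , o
iterateRounds _⊕_ _⊗_ ⊖_ p q c d o (suc k) =
  let a , b = iterateRounds _⊕_ _⊗_ ⊖_ p q c d o k
      b′    = (q ⊕ (⊖ b)) ⊕ (c ⊗ a)
  in (p ⊕ (⊖ a)) ⊕ (d ⊗ b′) , b′

module RankTwo where
  open Solver

  private
    polyRounds : ∀ {n} → ℤ → ℤ → ℕ → Polynomial n → Polynomial n → Polynomial n × Polynomial n
    polyRounds c d k p q = iterateRounds _:+_ _:*_ :-_ p q (con c) (con d) (con 0ℤ) k

  closes₂ : ∀ p q → iterateRounds _+_ _*_ -_ p q 0ℤ 0ℤ 0ℤ 2 ≡ (0ℤ , 0ℤ)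
  closes₂ p q = cong₂ _,_ (solve 2 (λ p q → proj₁ (polyRounds 0ℤ 0ℤ 2 p q) := con 0ℤ) refl p q)
                          (solve 2 (λ p q → proj₂ (polyRounds 0ℤ 0ℤ 2 p q) := con 0ℤ) refl p q)

  closes₃ : ∀ p q → iterateRounds _+_ _*_ -_ p q 1ℤ 1ℤ 0ℤ 3 ≡ (0ℤ , 0ℤ)
  closes₃ p q = cong₂ _,_ (solve 2 (λ p q → proj₁ (polyRounds 1ℤ 1ℤ 3 p q) := con 0ℤ) refl p q)
                          (solve 2 (λ p q → proj₂ (polyRounds 1ℤ 1ℤ 3 p q) := con 0ℤ) refl p q)

  closes₄ : ∀ p q → iterateRounds _+_ _*_ -_ p q 1ℤ (+ 2) 0ℤ 4 ≡ (0ℤ , 0ℤ)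
  closes₄ p q = cong₂ _,_ (solve 2 (λ p q → proj₁ (polyRounds 1ℤ (+ 2) 4 p q) := con 0ℤ) refl p q)
                          (solve 2 (λ p q → proj₂ (polyRounds 1ℤ (+ 2) 4 p q) := con 0ℤ) refl p q)

  closes₄′ : ∀ p q → iterateRounds _+_ _*_ -_ p q (+ 2) 1ℤ 0ℤ 4 ≡ (0ℤ , 0ℤ)
  closes₄′ p q = cong₂ _,_ (solve 2 (λ p q → proj₁ (polyRounds (+ 2) 1ℤ 4 p q) := con 0ℤ) refl p q)
                           (solve 2 (λ p q → proj₂ (polyRounds (+ 2) 1ℤ 4 p q) := con 0ℤ) refl p q)

-- The action on the root lattice ℤⁿ for an integral generalized Cartan matrix (2 on the diagonal,
-- -c off it); for m = 4 the pair of entries (1, 2) is oriented by the order on Fin n.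
module Lattice {n : ℕ} (M : CoxeterMatrix n) (m≤4 : ∀ i j → m M i j ≤ 4) where

  open Group M

  label : ℕ → ℕ → ℕ → ℤ
  label 3 _ _ = 1ℤ
  label 4 a b with a ℕ.<? b
  ... | yes _ = 1ℤ
  ... | no  _ = + 2
  label _ _ _ = 0ℤ

  c : Fin n → Fin n → ℤ
  c i j with i F.≟ j
  ... | yes _ = 0ℤ
  ... | no  _ = label (m M i j) (toℕ i) (toℕ j)

  data Bond (i j : Fin n) : Set where
    bond₂  : m M i j ≡ 2 → c i j ≡ 0ℤ → c j i ≡ 0ℤ → Bond i j
    bond₃  : m M i j ≡ 3 → c i j ≡ 1ℤ → c j i ≡ 1ℤ → Bond i j
    bond₄  : m M i j ≡ 4 → c i j ≡ 1ℤ → c j i ≡ + 2 → Bond i j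
    bond₄′ : m M i j ≡ 4 → c i j ≡ + 2 → c j i ≡ 1ℤ → Bond i j

  c-diag : ∀ i → c i i ≡ 0ℤ
  c-diag i with i F.≟ i
  ... | yes _  = refl
  ... | no i≢i = ⊥-elim (i≢i refl)

  c-off : ∀ i j → i ≢ j → c i j ≡ label (m M i j) (toℕ i) (toℕ j)
  c-off i j i≢j with i F.≟ j
  ... | yes i≡j = ⊥-elim (i≢j i≡j)
  ... | no _    = refl

  private
    mkBond : ∀ {i j} k → m M i j ≡ k → 2 ≤ k → k ≤ 4 → i ≢ j →
             c i j ≡ label k (toℕ i) (toℕ j) → c j i ≡ label k (toℕ j) (toℕ i) → Bond i j
    mkBond 2 e _ _ _ p q = bond₂ e p q
    mkBond 3 e _ _ _ p q = bond₃ e p q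
    mkBond {i} {j} 4 e _ _ i≢j p q with toℕ i ℕ.<? toℕ j | toℕ j ℕ.<? toℕ i
    ... | yes a | yes b = ⊥-elim (ℕₚ.<-asym a b)
    ... | yes a | no  b = bond₄ e p q
    ... | no  a | yes b = bond₄′ e p q
    ... | no  a | no  b = ⊥-elim (i≢j (Fₚ.toℕ-injective (ℕₚ.≤-antisym (ℕₚ.≮⇒≥ b) (ℕₚ.≮⇒≥ a))))
    mkBond (suc (suc (suc (suc (suc k))))) _ _ (s≤s (s≤s (s≤s (s≤s ())))) _ _ _
    mkBond 0 _ () _ _ _ _
    mkBond 1 _ (s≤s ()) _ _ _ _

  bond : ∀ i j → i ≢ j → Bond i j
  bond i j i≢j = mkBond (m M i j) refl (offdiag M i j i≢j) (m≤4 i j) i≢j (c-off i j i≢j)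
    (trans (c-off j i (i≢j ∘ ≡-sym))
           (cong (λ k → label k (toℕ j) (toℕ i)) (CoxeterMatrix.sym M j i)))

  c≥0 : ∀ i j → 0ℤ ≤ᶻ c i j
  c≥0 i j with i F.≟ j
  ... | yes _ = ℤₚ.≤-refl
  ... | no  _ = go (m M i j)
    where
    go : ∀ k → 0ℤ ≤ᶻ label k (toℕ i) (toℕ j)
    go 0 = ℤₚ.≤-refl
    go 1 = ℤₚ.≤-refl
    go 2 = ℤₚ.≤-refl
    go 3 = +≤+ z≤n
    go 4 with toℕ i ℕ.<? toℕ j
    ... | yes _ = +≤+ z≤n
    ... | no  _ = +≤+ z≤n
    go (suc (suc (suc (suc (suc k))))) = ℤₚ.≤-refl

  V : Set
  V = Fin n → ℤ

  e : Fin n → V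
  e i j with i F.≟ j
  ... | yes _ = 1ℤ
  ... | no  _ = 0ℤ

  e-same : ∀ i → e i i ≡ 1ℤ
  e-same i with i F.≟ i
  ... | yes _  = refl
  ... | no i≢i = ⊥-elim (i≢i refl)

  e-diff : ∀ {i j} → i ≢ j → e i j ≡ 0ℤ
  e-diff {i} {j} i≢j with i F.≟ j
  ... | yes i≡j = ⊥-elim (i≢j i≡j)
  ... | no _    = refl

  e≥0 : ∀ i j → 0ℤ ≤ᶻ e i j
  e≥0 i j with i F.≟ j
  ... | yes _ = +≤+ z≤n
  ... | no  _ = +≤+ z≤n

  sum-e : ∀ {k} (i : Fin k) (f : Fin k → ℤ) (g : Fin k → ℤ) →
          (∀ j → j ≢ i → g j ≡ 0ℤ) → g i ≡ 1ℤ → sum (λ j → f j * g j) ≡ f i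
  sum-e {suc k} F.zero f g off on = trans (cong₂ _+_ (trans (cong (f F.zero *_) on) (ℤₚ.*-identityʳ (f F.zero)))
      (trans (sum-cong-≗ (λ j → trans (cong (f (F.suc j) *_) (off (F.suc j) (λ ()))) (ℤₚ.*-zeroʳ (f (F.suc j)))))
             (sum-replicate-zero k))) (ℤₚ.+-identityʳ (f F.zero))
  sum-e {suc k} (F.suc i) f g off on = trans (cong₂ _+_
      (trans (cong (f F.zero *_) (off F.zero (λ ()))) (ℤₚ.*-zeroʳ (f F.zero)))
      (sum-e i (f ∘ F.suc) (g ∘ F.suc) (λ j j≢i → off (F.suc j) (j≢i ∘ Fₚ.suc-injective)) on))
    (ℤₚ.+-identityˡ (f (F.suc i)))

  -- π i x = - ⟨ x , αᵢ^∨ ⟩, so that sᵢ x = x + π i x αᵢ.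
  N : Fin n → V → ℤ
  N i x = sum (λ k → c k i * x k)

  π : Fin n → V → ℤ
  π i x = N i x - + 2 * x i

  s : Fin n → V → V
  s i x j = x j + π i x * e i j

  N-cong : ∀ i {x y} → x ≗ y → N i x ≡ N i y
  N-cong i x≗y = sum-cong-≗ (λ k → cong (c k i *_) (x≗y k))

  π-cong : ∀ i {x y} → x ≗ y → π i x ≡ π i y
  π-cong i x≗y = cong₂ _-_ (N-cong i x≗y) (cong (+ 2 *_) (x≗y i))

  s-cong : ∀ i {x y} → x ≗ y → s i x ≗ s i y
  s-cong i x≗y j = cong₂ _+_ (x≗y j) (cong (_* e i j) (π-cong i x≗y))

  N-+ : ∀ i x y → N i (λ k → x k + y k) ≡ N i x + N i y
  N-+ i x y = trans (sum-cong-≗ (λ k → ℤₚ.*-distribˡ-+ (c k i) (x k) (y k)))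
                    (∑-distrib-+ (λ k → c k i * x k) (λ k → c k i * y k))

  N-* : ∀ i a x → N i (λ k → a * x k) ≡ a * N i x
  N-* i a x = trans (sum-cong-≗ (λ k → lem (c k i) a (x k))) (≡-sym (*-distribˡ-sum a (λ k → c k i * x k)))
    where lem : ∀ p q r → p * (q * r) ≡ q * (p * r)
          lem = solve-∀

  N-e : ∀ i j → N i (e j) ≡ c j i
  N-e i j = sum-e j (λ k → c k i) (e j) (λ k k≢j → e-diff (k≢j ∘ ≡-sym)) (e-same j)

  π-+ : ∀ i x y → π i (λ k → x k + y k) ≡ π i x + π i y
  π-+ i x y = trans (cong (_- _) (N-+ i x y)) (lem (N i x) (N i y) (x i) (y i))
    where lem : ∀ p q r t → (p + q) - + 2 * (r + t) ≡ (p - + 2 * r) + (q - + 2 * t)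
          lem = solve-∀

  π-* : ∀ i a x → π i (λ k → a * x k) ≡ a * π i x
  π-* i a x = trans (cong (_- _) (N-* i a x)) (lem a (N i x) (x i))
    where lem : ∀ a p r → a * p - + 2 * (a * r) ≡ a * (p - + 2 * r)
          lem = solve-∀

  π-0 : ∀ i → π i (λ _ → 0ℤ) ≡ 0ℤ
  π-0 i = π-* i 0ℤ (λ _ → 0ℤ)

  π-same : ∀ i → π i (e i) ≡ - + 2
  π-same i rewrite N-e i i | c-diag i | e-same i = refl

  π-diff : ∀ {i j} → i ≢ j → π i (e j) ≡ c j i
  π-diff {i} {j} i≢j rewrite N-e i j | e-diff {j} {i} (i≢j ∘ ≡-sym) = ℤₚ.+-identityʳ _

  s-+ : ∀ i x y → s i (λ k → x k + y k) ≗ (λ k → s i x k + s i y k)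
  s-+ i x y j = trans (cong (λ z → (x j + y j) + z * e i j) (π-+ i x y)) (lem (x j) (y j) (π i x) (π i y) (e i j))
    where lem : ∀ a b p q t → (a + b) + (p + q) * t ≡ (a + p * t) + (b + q * t)
          lem = solve-∀

  s-* : ∀ i a x → s i (λ k → a * x k) ≗ (λ k → a * s i x k)
  s-* i a x j = trans (cong (λ z → a * x j + z * e i j) (π-* i a x)) (lem a (x j) (π i x) (e i j))
    where lem : ∀ a b p t → a * b + (a * p) * t ≡ a * (b + p * t)
          lem = solve-∀

  s-0 : ∀ i → s i (λ _ → 0ℤ) ≗ (λ _ → 0ℤ)
  s-0 i j rewrite π-0 i = refl

  act : Word n → V → V
  act u x = foldr s x u

  act-++ : ∀ u v x → act (u ++ v) x ≡ act u (act v x)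
  act-++ u v x = Lₚ.foldr-++ s x u v

  act-cong : ∀ u {x y} → x ≗ y → act u x ≗ act u y
  act-cong []      p = p
  act-cong (i ∷ u) p = s-cong i (act-cong u p)

  act-+ : ∀ u x y → act u (λ k → x k + y k) ≗ (λ k → act u x k + act u y k)
  act-+ []      x y j = refl
  act-+ (i ∷ u) x y j = trans (s-cong i (act-+ u x y) j) (s-+ i (act u x) (act u y) j)

  act-* : ∀ u a x → act u (λ k → a * x k) ≗ (λ k → a * act u x k)
  act-* []      a x j = refl
  act-* (i ∷ u) a x j = trans (s-cong i (act-* u a x) j) (s-* i a (act u x) j)

  act-0 : ∀ u → act u (λ _ → 0ℤ) ≗ (λ _ → 0ℤ)
  act-0 []      j = refl
  act-0 (i ∷ u) j = trans (s-cong i (act-0 u) j) (s-0 i j)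

  act-neg : ∀ u x → act u (λ k → - x k) ≗ (λ k → - act u x k)
  act-neg u x j = trans (act-cong u (λ k → ≡-sym (ℤₚ.-1*i≡-i (x k))) j)
                        (trans (act-* u (- 1ℤ) x j) (ℤₚ.-1*i≡-i _))

  act-sum : ∀ {k} u (a : Fin k → ℤ) (x : Fin k → V) →
            act u (λ j → sum (λ l → a l * x l j)) ≗ (λ j → sum (λ l → a l * act u (x l) j))
  act-sum {zero}  u a x j = act-0 u j
  act-sum {suc k} u a x j = trans (act-+ u (λ j → a F.zero * x F.zero j) _ j)
    (cong₂ _+_ (act-* u (a F.zero) (x F.zero) j) (act-sum u (a ∘ F.suc) (x ∘ F.suc) j))

  expand : ∀ x → x ≗ (λ j → sum (λ l → x l * e l j))
  expand x j = ≡-sym (sum-e j x (λ l → e l j) (λ k k≢j → e-diff k≢j) (e-same j))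

  act-expand : ∀ u x → act u x ≗ (λ j → sum (λ l → x l * act u (e l) j))
  act-expand u x j = trans (act-cong u (expand x) j) (act-sum u x e j)

  -- Within a rank-two subgroup an element moves x only in the αᵢ- and αⱼ-directions.
  module Plane (i j : Fin n) (i≢j : i ≢ j) (x : V) where
    st : ℤ × ℤ → V
    st (a , b) k = (x k + a * e i k) + b * e j k

    fᵢ fⱼ : ℤ × ℤ → ℤ × ℤ
    fᵢ (a , b) = (π i x - a) + c j i * b , b
    fⱼ (a , b) = a , (π j x - b) + c i j * a

    rounds : ℕ → ℤ × ℤ
    rounds = iterateRounds _+_ _*_ -_ (π i x) (π j x) (c i j) (c j i) 0ℤ

    π-st : ∀ k a b → π k (st (a , b)) ≡ (π k x + a * π k (e i)) + b * π k (e j)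
    π-st k a b = trans (π-+ k (λ l → x l + a * e i l) (λ l → b * e j l))
      (cong₂ _+_ (trans (π-+ k x (λ l → a * e i l)) (cong (λ z → π k x + z) (π-* k a (e i)))) (π-* k b (e j)))

    s-stᵢ : ∀ ab → s i (st ab) ≗ st (fᵢ ab)
    s-stᵢ (a , b) k = trans
      (cong (λ z → st (a , b) k + z * e i k) (trans (π-st i a b) (cong₂ (λ y z → (π i x + a * y) + b * z) (π-same i) (π-diff i≢j))))
      (lem (x k) a b (π i x) (c j i) (e i k) (e j k))
      where lem : ∀ x a b p q t u → ((x + a * t) + b * u) + ((p + a * (- + 2)) + b * q) * t
                                    ≡ (x + ((p - a) + q * b) * t) + b * u
            lem = solve-∀

    s-stⱼ : ∀ ab → s j (st ab) ≗ st (fⱼ ab)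
    s-stⱼ (a , b) k = trans
      (cong (λ z → st (a , b) k + z * e j k)
        (trans (π-st j a b) (cong₂ (λ y z → (π j x + a * y) + b * z) (π-diff (i≢j ∘ ≡-sym)) (π-same j))))
      (lem (x k) a b (π j x) (c i j) (e i k) (e j k))
      where lem : ∀ x a b p q t u → ((x + a * t) + b * u) + ((p + a * q) + b * (- + 2)) * u
                                    ≡ (x + a * t) + ((p - b) + q * a) * u
            lem = solve-∀

    st-0 : x ≗ st (0ℤ , 0ℤ)
    st-0 k = lem (x k) (e i k) (e j k)
      where lem : ∀ x t u → x ≡ (x + 0ℤ * t) + 0ℤ * u
            lem = solve-∀

    act-rounds : ∀ k → act (L.concat (L.replicate k (i ∷ j ∷ []))) x ≗ st (rounds k)
    act-rounds zero    l = st-0 l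
    act-rounds (suc k) l = trans (s-cong i (s-cong j (act-rounds k)) l)
      (trans (s-cong i (s-stⱼ (rounds k)) l) (s-stᵢ (fⱼ (rounds k)) l))

    closing : ∀ k → m M i j ≡ k → rounds k ≡ (0ℤ , 0ℤ) → act (relator M i j) x ≗ x
    closing k refl eq l = trans (act-rounds k l) (trans (cong (λ ab → st ab l) eq) (≡-sym (st-0 l)))

  relator-fixes : ∀ i j x → act (relator M i j) x ≗ x
  relator-fixes i j x with i F.≟ j
  ... | yes refl rewrite diag M i = λ l → trans
          (cong (λ z → s i x l + z * e i l) (trans (π-+ i x (λ k → π i x * e i k))
            (cong (λ z → π i x + z) (trans (π-* i (π i x) (e i)) (cong (π i x *_) (π-same i))))))
          (lem (x l) (π i x) (e i l))
    where lem : ∀ y p t → (y + p * t) + (p + p * (- + 2)) * t ≡ y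
          lem = solve-∀
  ... | no i≢j = go (bond i j i≢j)
    where
    open Plane i j i≢j x
    rounds′ : ℕ → ℤ → ℤ → ℤ × ℤ
    rounds′ k a b = iterateRounds _+_ _*_ -_ (π i x) (π j x) a b 0ℤ k

    go : Bond i j → act (relator M i j) x ≗ x
    go (bond₂ e p q)  = closing 2 e (trans (cong₂ (rounds′ 2) p q) (RankTwo.closes₂ (π i x) (π j x)))
    go (bond₃ e p q)  = closing 3 e (trans (cong₂ (rounds′ 3) p q) (RankTwo.closes₃ (π i x) (π j x)))
    go (bond₄ e p q)  = closing 4 e (trans (cong₂ (rounds′ 4) p q) (RankTwo.closes₄ (π i x) (π j x)))
    go (bond₄′ e p q) = closing 4 e (trans (cong₂ (rounds′ 4) p q) (RankTwo.closes₄′ (π i x) (π j x)))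

0≤* : ∀ {a b} → 0ℤ ≤ᶻ a → 0ℤ ≤ᶻ b → 0ℤ ≤ᶻ a * b
0≤* {+ a} {+ b} _ _ = subst (0ℤ ≤ᶻ_) (ℤₚ.pos-* a b) (+≤+ z≤n)
0≤* {+ a} { -[1+ b ]} _ ()
0≤* { -[1+ a ]} () _

0<* : ∀ {a b} → 0ℤ <ᶻ a → 0ℤ <ᶻ b → 0ℤ <ᶻ a * b
0<* {+ suc a} {+ suc b} _ _ = +<+ (s≤s z≤n)
0<* {+ zero} (+<+ ()) _
0<* {+ suc a} {+ zero} _ (+<+ ())

0≤+ : ∀ {a b} → 0ℤ ≤ᶻ a → 0ℤ ≤ᶻ b → 0ℤ ≤ᶻ a + b
0≤+ p q = ℤₚ.+-mono-≤ p q

sum-≥0 : ∀ {k} (f : Fin k → ℤ) → (∀ i → 0ℤ ≤ᶻ f i) → 0ℤ ≤ᶻ sum f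
sum-≥0 {zero}  f p = ℤₚ.≤-refl
sum-≥0 {suc k} f p = 0≤+ (p F.zero) (sum-≥0 (f ∘ F.suc) (p ∘ F.suc))

sum-≥ : ∀ {k} (f : Fin k → ℤ) → (∀ i → 0ℤ ≤ᶻ f i) → ∀ i → f i ≤ᶻ sum f
sum-≥ {suc k} f p F.zero    = subst (_≤ᶻ sum f) (ℤₚ.+-identityʳ (f F.zero))
  (ℤₚ.+-monoʳ-≤ (f F.zero) (sum-≥0 (f ∘ F.suc) (p ∘ F.suc)))
sum-≥ {suc k} f p (F.suc i) = ℤₚ.≤-trans (sum-≥ (f ∘ F.suc) (p ∘ F.suc) i)
  (subst (_≤ᶻ sum f) (ℤₚ.+-identityˡ (sum (f ∘ F.suc))) (ℤₚ.+-monoˡ-≤ (sum (f ∘ F.suc)) (p F.zero)))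

≤-neg-flip : ∀ {a} → 0ℤ ≤ᶻ - a → a ≤ᶻ 0ℤ
≤-neg-flip {a} p = subst (_≤ᶻ 0ℤ) (ℤₚ.neg-involutive a) (ℤₚ.neg-mono-≤ p)

unit-factor : ∀ a b → 0ℤ <ᶻ a → a * b ≡ 1ℤ → a ≡ 1ℤ
unit-factor (+ suc a) (+ b) _ p = cong +_ (ℕₚ.m*n≡1⇒m≡1 (suc a) b (ℤₚ.+-injective (trans (ℤₚ.pos-* (suc a) b) p)))
unit-factor (+ suc a) (-[1+ b ]) _ ()
unit-factor (+ zero) b (+<+ ()) _

module Tits {n : ℕ} (M : CoxeterMatrix n) (m≤4 : ∀ i j → m M i j ≤ 4) where

  open Group M public
  open Lattice M m≤4 public

  act-Step : ∀ {u v} → Step M u v → ∀ x → act u x ≗ act v x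
  act-Step (insert u v i j) x k = ≡-sym (trans
    (cong (λ f → f k) (trans (act-++ u (relator M i j ++ v) x) (cong (act u) (act-++ (relator M i j) v x))))
    (trans (act-cong u (relator-fixes i j (act v x)) k) (cong (λ f → f k) (≡-sym (act-++ u v x)))))
  act-Step (delete u v i j) x k = ≡-sym (act-Step (insert u v i j) x k)

  act-~ : ∀ {u v} → u ~ v → ∀ x → act u x ≗ act v x
  act-~ done       x k = refl
  act-~ (step p q) x k = trans (act-Step p x k) (act-~ q x k)

  s-same : ∀ i → s i (e i) ≗ (λ k → - e i k)
  s-same i k = trans (cong (λ z → e i k + z * e i k) (π-same i)) (lem (e i k))
    where lem : ∀ t → t + (- + 2) * t ≡ - t
          lem = solve-∀

  s-diff : ∀ {i j} → i ≢ j → s i (e j) ≗ (λ k → e j k + c j i * e i k)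
  s-diff {i} {j} i≢j k = cong (λ z → e j k + z * e i k) (π-diff i≢j)

  Pos Neg : V → Set
  Pos x = (∀ k → 0ℤ ≤ᶻ x k) × ∃ λ k → 0ℤ <ᶻ x k
  Neg x = Pos (λ k → - x k)

  Pos-cong : ∀ {x y} → x ≗ y → Pos x → Pos y
  Pos-cong p (q , k , r) = (λ j → subst (0ℤ ≤ᶻ_) (p j) (q j)) , k , subst (0ℤ <ᶻ_) (p k) r

  Neg-cong : ∀ {x y} → x ≗ y → Neg x → Neg y
  Neg-cong p = Pos-cong (cong -_ ∘ p)

  Pos-neg-neg : ∀ {x} → Pos x → Neg (λ k → - x k)
  Pos-neg-neg {x} = Pos-cong (λ k → ≡-sym (ℤₚ.neg-involutive (x k)))

  ¬Pos-Neg : ∀ {x} → Pos x → Neg x → ⊥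
  ¬Pos-Neg (p , k , q) (r , _) = ℤₚ.<-irrefl refl (ℤₚ.<-≤-trans q (≤-neg-flip (r k)))

  Pos-e : ∀ i → Pos (e i)
  Pos-e i = e≥0 i , i , subst (0ℤ <ᶻ_) (≡-sym (e-same i)) (+<+ (s≤s z≤n))

  Pos-comb : ∀ {a b x y} → 0ℤ ≤ᶻ a → 0ℤ ≤ᶻ b → 0ℤ <ᶻ a ⊎ 0ℤ <ᶻ b → Pos x → Pos y →
             Pos (λ k → a * x k + b * y k)
  Pos-comb a≥0 b≥0 (inj₁ a>0) (p , k , q) (p′ , _) =
    (λ j → 0≤+ (0≤* a≥0 (p j)) (0≤* b≥0 (p′ j))) , k , ℤₚ.+-mono-<-≤ (0<* a>0 q) (0≤* b≥0 (p′ k))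
  Pos-comb a≥0 b≥0 (inj₂ b>0) (p , _) (p′ , k , q) =
    (λ j → 0≤+ (0≤* a≥0 (p j)) (0≤* b≥0 (p′ j))) , k , ℤₚ.+-mono-≤-< (0≤* a≥0 (p k)) (0<* b>0 q)

  Short : Word n → Fin n → Set
  Short u i = ∃ λ u′ → (u ~ u′ ++ i ∷ []) × length u′ < length u

  -- cmb is the plane spanned by αₛ and αₜ.
  module Dihedral (i t : Fin n) (i≢t : i ≢ t) where
    cmb : ℤ → ℤ → V
    cmb a b k = a * e i k + b * e t k

    s-cmbᵢ : ∀ a b → s i (cmb a b) ≗ cmb (c t i * b - a) b
    s-cmbᵢ a b k = trans (s-+ i (λ k → a * e i k) (λ k → b * e t k) k)
      (trans (cong₂ _+_ (trans (s-* i a (e i) k) (cong (a *_) (s-same i k)))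
                        (trans (s-* i b (e t) k) (cong (b *_) (s-diff i≢t k))))
             (lem a b (c t i) (e i k) (e t k)))
      where lem : ∀ a b c p q → a * (- p) + b * (q + c * p) ≡ (c * b - a) * p + b * q
            lem = solve-∀

    s-cmbₜ : ∀ a b → s t (cmb a b) ≗ cmb a (c i t * a - b)
    s-cmbₜ a b k = trans (s-+ t (λ k → a * e i k) (λ k → b * e t k) k)
      (trans (cong₂ _+_ (trans (s-* t a (e i) k) (cong (a *_) (s-diff (i≢t ∘ ≡-sym) k)))
                        (trans (s-* t b (e t) k) (cong (b *_) (s-same t k))))
             (lem a b (c i t) (e i k) (e t k)))
      where lem : ∀ a b c p q → a * (p + c * q) + b * (- q) ≡ a * p + (c * a - b) * q
            lem = solve-∀

    e-cmb : e i ≗ cmb 1ℤ 0ℤ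
    e-cmb k = lem (e i k) (e t k)
      where lem : ∀ p q → p ≡ 1ℤ * p + 0ℤ * q
            lem = solve-∀

    b₁ a₂ b₃ : ℤ
    b₁ = c i t * 1ℤ - 0ℤ
    a₂ = c t i * b₁ - 1ℤ
    b₃ = c i t * a₂ - b₁

    act₁ : act (t ∷ []) (e i) ≗ cmb 1ℤ b₁
    act₁ k = trans (s-cong t e-cmb k) (s-cmbₜ 1ℤ 0ℤ k)

    act₂ : act (i ∷ t ∷ []) (e i) ≗ cmb a₂ b₁
    act₂ k = trans (s-cong i act₁ k) (s-cmbᵢ 1ℤ b₁ k)

    act₃ : act (t ∷ i ∷ t ∷ []) (e i) ≗ cmb a₂ b₃
    act₃ k = trans (s-cong t act₂ k) (s-cmbₜ a₂ b₁ k)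

  Core : ℕ → Set
  Core N = ∀ u i → length u < N → Pos (act u (e i)) ⊎ Short u i

  -- With u = v · d for a longest possible alternating d in s and t, either both v s and v t are longer
  -- than v, and then u αₛ is a nonnegative combination of v αₛ and v αₜ, or d has length m(s,t) and the
  -- braid relation lets u end in s.
  module CoreStep {N : ℕ} (IH : Core N) (u : Word n) (u≤N : length u ≤ N) (i t : Fin n) (i≢t : i ≢ t) where
    open Dihedral i t i≢t

    Result : Set
    Result = Pos (act u (e i)) ⊎ Short u i

    stage : ∀ v y x d → u ~ v ++ y ∷ d → length v ℕ.+ suc (length d) ≤ length u →
            (∀ v′ → u ~ v′ ++ x ∷ y ∷ d → length v′ ℕ.+ suc (suc (length d)) ≤ length u → Result) →
            (Pos (act v (e x)) → Pos (act v (e y)) → Pos (act u (e i))) → Result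
    stage v y x d u~ len next stuck with
      IH v y (ℕₚ.<-≤-trans (ℕₚ.<-≤-trans (ℕₚ.m<m+n (length v) (s≤s z≤n)) len) u≤N)
    ... | inj₂ (v′ , v~ , lt) = shorter (IH (v′ ++ d) i (ℕₚ.<-≤-trans lt′ u≤N))
      where
      lt′ : length (v′ ++ d) < length u
      lt′ = subst (_< length u) (≡-sym (Lₚ.length-++ v′))
        (ℕₚ.<-≤-trans (ℕₚ.+-mono-<-≤ lt (ℕₚ.n≤1+n (length d))) len)
      u~′ : u ~ v′ ++ d
      u~′ = ~-trans u~ (~-trans (++⁺ʳ (y ∷ d) v~) (~-trans (~-reflexive (Lₚ.++-assoc v′ (y ∷ []) (y ∷ d)))
              (++⁺ˡ v′ (cancel y d))))
      shorter : Pos (act (v′ ++ d) (e i)) ⊎ Short (v′ ++ d) i → Result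
      shorter (inj₁ pos)           = inj₁ (Pos-cong (λ k → ≡-sym (act-~ u~′ (e i) k)) pos)
      shorter (inj₂ (z , z~ , lt″)) = inj₂ (z , ~-trans u~′ z~ , ℕₚ.<-trans lt″ lt′)
    ... | inj₁ pos-y with IH v x (ℕₚ.<-≤-trans (ℕₚ.<-≤-trans (ℕₚ.m<m+n (length v) (s≤s z≤n)) len) u≤N)
    ... | inj₁ pos-x = inj₁ (stuck pos-x pos-y)
    ... | inj₂ (v′ , v~ , lt) = next v′
      (~-trans u~ (~-trans (++⁺ʳ (y ∷ d) v~) (~-reflexive (Lₚ.++-assoc v′ (x ∷ []) (y ∷ d)))))
      (subst (_≤ length u) (≡-sym (ℕₚ.+-suc (length v′) (suc (length d))))
        (ℕₚ.≤-trans (ℕₚ.+-monoˡ-≤ (suc (length d)) lt) len))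

    finish : ∀ v w w′ → w ~ w′ ++ i ∷ [] → u ~ v ++ w → length v ℕ.+ suc (length w′) ≤ length u → Result
    finish v w w′ w~ u~ len = inj₂ (v ++ w′
      , ~-trans u~ (~-trans (++⁺ˡ v w~) (~-reflexive (≡-sym (Lₚ.++-assoc v w′ (i ∷ [])))))
      , subst (_≤ length u) (trans (ℕₚ.+-suc (length v) (length w′)) (cong suc (≡-sym (Lₚ.length-++ v)))) len)

    comb : ∀ v d a b → u ~ v ++ d → act d (e i) ≗ cmb a b → 0ℤ ≤ᶻ a → 0ℤ ≤ᶻ b → 0ℤ <ᶻ a ⊎ 0ℤ <ᶻ b →
           Pos (act v (e i)) → Pos (act v (e t)) → Pos (act u (e i))
    comb v d a b u~ d≗ a≥0 b≥0 ab pᵢ pₜ = Pos-cong (λ k → ≡-sym (eq k)) (Pos-comb a≥0 b≥0 ab pᵢ pₜ)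
      where
      eq : act u (e i) ≗ (λ k → a * act v (e i) k + b * act v (e t) k)
      eq k = trans (act-~ u~ (e i) k) (trans (cong (λ f → f k) (act-++ v d (e i)))
        (trans (act-cong v d≗ k) (trans (act-+ v (λ k → a * e i k) (λ k → b * e t k) k)
          (cong₂ _+_ (act-* v a (e i) k) (act-* v b (e t) k)))))

    run : ∀ v → u ≡ v ++ t ∷ [] → Bond i t → Result
    run v refl b = go b
      where
      len : length v ℕ.+ 1 ≤ length u
      len = ℕₚ.≤-reflexive (≡-sym (Lₚ.length-++ v))
      1≥0 : 0ℤ ≤ᶻ 1ℤ
      1≥0 = +≤+ z≤n
      1>0 : 0ℤ <ᶻ 1ℤ
      1>0 = +<+ (s≤s z≤n)
      val : ∀ {A B : ℤ → ℤ → ℤ} d {p q a b} → c i t ≡ p → c t i ≡ q →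
            act d (e i) ≗ cmb (A (c i t) (c t i)) (B (c i t) (c t i)) → A p q ≡ a → B p q ≡ b →
            act d (e i) ≗ cmb a b
      val d refl refl f refl refl = f
      A₁ A₂ B₁ B₃ : ℤ → ℤ → ℤ
      A₁ p q = 1ℤ
      B₁ p q = p * 1ℤ - 0ℤ
      A₂ p q = q * B₁ p q - 1ℤ
      B₃ p q = p * A₂ p q - B₁ p q
      go : Bond i t → Result
      go (bond₂ mm p q) = stage v t i [] done len
        (λ v₁ u~ l → finish v₁ (i ∷ t ∷ []) (t ∷ []) (braid₂ i t mm) u~ l)
        (comb v (t ∷ []) 1ℤ 0ℤ done (val {A₁} {B₁} (t ∷ []) p q act₁ refl refl) 1≥0 (+≤+ z≤n) (inj₁ 1>0))
      go (bond₃ mm p q) = stage v t i [] done len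
        (λ v₁ u~ l → stage v₁ i t (t ∷ []) u~ l
          (λ v₂ u~ l → finish v₂ (t ∷ i ∷ t ∷ []) (i ∷ t ∷ []) (~-sym (braid₃ i t mm)) u~ l)
          (λ pₜ pᵢ → comb v₁ (i ∷ t ∷ []) 0ℤ 1ℤ u~ (val {A₂} {B₁} (i ∷ t ∷ []) p q act₂ refl refl) (+≤+ z≤n) 1≥0 (inj₂ 1>0) pᵢ pₜ))
        (comb v (t ∷ []) 1ℤ 1ℤ done (val {A₁} {B₁} (t ∷ []) p q act₁ refl refl) 1≥0 1≥0 (inj₁ 1>0))
      go (bond₄ mm p q) = stage v t i [] done len
        (λ v₁ u~ l → stage v₁ i t (t ∷ []) u~ l
          (λ v₂ u~ l → stage v₂ t i (i ∷ t ∷ []) u~ l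
            (λ v₃ u~ l → finish v₃ (i ∷ t ∷ i ∷ t ∷ []) (t ∷ i ∷ t ∷ []) (braid₄ i t mm) u~ l)
            (comb v₂ (t ∷ i ∷ t ∷ []) 1ℤ 0ℤ u~ (val {A₂} {B₃} (t ∷ i ∷ t ∷ []) p q act₃ refl refl) 1≥0 (+≤+ z≤n) (inj₁ 1>0)))
          (λ pₜ pᵢ → comb v₁ (i ∷ t ∷ []) 1ℤ 1ℤ u~ (val {A₂} {B₁} (i ∷ t ∷ []) p q act₂ refl refl) 1≥0 1≥0 (inj₂ 1>0) pᵢ pₜ))
        (comb v (t ∷ []) 1ℤ 1ℤ done (val {A₁} {B₁} (t ∷ []) p q act₁ refl refl) 1≥0 1≥0 (inj₁ 1>0))
      go (bond₄′ mm p q) = stage v t i [] done len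
        (λ v₁ u~ l → stage v₁ i t (t ∷ []) u~ l
          (λ v₂ u~ l → stage v₂ t i (i ∷ t ∷ []) u~ l
            (λ v₃ u~ l → finish v₃ (i ∷ t ∷ i ∷ t ∷ []) (t ∷ i ∷ t ∷ []) (braid₄ i t mm) u~ l)
            (comb v₂ (t ∷ i ∷ t ∷ []) 1ℤ 0ℤ u~ (val {A₂} {B₃} (t ∷ i ∷ t ∷ []) p q act₃ refl refl) 1≥0 (+≤+ z≤n) (inj₁ 1>0)))
          (λ pₜ pᵢ → comb v₁ (i ∷ t ∷ []) 1ℤ (+ 2) u~ (val {A₂} {B₁} (i ∷ t ∷ []) p q act₂ refl refl) 1≥0 (+≤+ z≤n) (inj₁ 1>0) pᵢ pₜ))
        (comb v (t ∷ []) 1ℤ (+ 2) done (val {A₁} {B₁} (t ∷ []) p q act₁ refl refl) 1≥0 (+≤+ z≤n) (inj₁ 1>0))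

  core : ∀ N → Core N
  core (suc N) u i (s≤s u≤N) with L.initLast u
  ... | [] = inj₁ (Pos-e i)
  ... | v L.∷ʳ′ t with i F.≟ t
  ...   | yes refl = inj₂ (v , done , subst (length v <_) (≡-sym (Lₚ.length-++ v)) (ℕₚ.m<m+n (length v) (s≤s z≤n)))
  ...   | no i≢t   = CoreStep.run (core N) (v ++ t ∷ []) u≤N i t i≢t v refl (bond i t i≢t)

  pos-or-short : ∀ u i → Pos (act u (e i)) ⊎ Short u i
  pos-or-short u i = core (suc (length u)) u i ℕₚ.≤-refl

  act-snoc-same : ∀ u i → act (u ++ i ∷ []) (e i) ≗ (λ k → - act u (e i) k)
  act-snoc-same u i k = trans (cong (λ f → f k) (act-++ u (i ∷ []) (e i)))
    (trans (act-cong u (s-same i) k) (act-neg u (e i) k))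

  pos-or-neg : ∀ u i → Pos (act u (e i)) ⊎ Neg (act u (e i))
  pos-or-neg u i = go (suc (length u)) u ℕₚ.≤-refl
    where
    go : ∀ N u → length u < N → Pos (act u (e i)) ⊎ Neg (act u (e i))
    go (suc N) u (s≤s l) with pos-or-short u i
    ... | inj₁ p = inj₁ p
    ... | inj₂ (u′ , u~ , lt) with go N u′ (ℕₚ.<-≤-trans lt l)
    ...   | inj₁ p = inj₂ (Neg-cong (λ k → ≡-sym (eq k)) (Pos-neg-neg p))
      where eq : act u (e i) ≗ (λ k → - act u′ (e i) k)
            eq k = trans (act-~ u~ (e i) k) (act-snoc-same u′ i k)
    ...   | inj₂ q = inj₁ (Pos-cong (λ k → ≡-sym (trans (act-~ u~ (e i) k) (act-snoc-same u′ i k))) q)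

-- Reduced words and the longest element

count-++ : ∀ {n} (i : Fin n) u w → count i (u ++ w) ≡ count i u ℕ.+ count i w
count-++ i u w = trans (cong length (Lₚ.filter-++ (F._≟ i) u w)) (Lₚ.length-++ (filter (F._≟ i) u))

count-∷ : ∀ {n} (i k : Fin n) u → count i (k ∷ u) ≡ count i (k ∷ []) ℕ.+ count i u
count-∷ i k u = count-++ i (k ∷ []) u

count≤count-∷ : ∀ {n} (i k : Fin n) u → count i u ≤ count i (k ∷ u)
count≤count-∷ i k u = subst (count i u ≤_) (≡-sym (count-∷ i k u)) (ℕₚ.m≤n+m (count i u) (count i (k ∷ [])))

module Reduction {n : ℕ} (M : CoxeterMatrix n) (m≤4 : ∀ i j → m M i j ≤ 4) where

  open Tits M m≤4 public

  AllPos AllNeg : Word n → Set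
  AllPos u = ∀ j → Pos (act u (e j))
  AllNeg u = ∀ j → Neg (act u (e j))

  AllPos⇒~[] : ∀ u → AllPos u → u ~ []
  AllPos⇒~[] u p = go (suc (length u)) u ℕₚ.≤-refl p
    where
    go : ∀ N u → length u < N → AllPos u → u ~ []
    go (suc N) u (s≤s l) p with L.initLast u
    ... | [] = done
    ... | v L.∷ʳ′ t with pos-or-short v t
    ...   | inj₁ q = ⊥-elim (¬Pos-Neg q (Pos-cong (act-snoc-same v t) (p t)))
    ...   | inj₂ (v′ , v~ , lt) = ~-trans u~v′ (go N v′ lt′ (λ j → Pos-cong (act-~ u~v′ (e j)) (p j)))
      where
      u~v′ : v ++ t ∷ [] ~ v′
      u~v′ = ~-trans (++⁺ʳ (t ∷ []) v~) (~-trans (~-reflexive (Lₚ.++-assoc v′ (t ∷ []) (t ∷ [])))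
        (~-trans (++⁺ˡ v′ (ii~[] t)) (~-reflexive (Lₚ.++-identityʳ v′))))
      lt′ : length v′ < N
      lt′ = ℕₚ.<-≤-trans lt (ℕₚ.≤-trans (subst (length v ≤_) (≡-sym (Lₚ.length-++ v)) (ℕₚ.m≤m+n (length v) 1)) l)

  act-reverse : ∀ u x → act u (act (reverse u) x) ≗ x
  act-reverse u x k = trans (cong (λ f → f k) (≡-sym (act-++ u (reverse u) x))) (act-~ (++-reverse~[] u) x k)

  act-reverse′ : ∀ u x → act (reverse u) (act u x) ≗ x
  act-reverse′ u x k = trans (cong (λ f → f k) (≡-sym (act-++ (reverse u) u x))) (act-~ (reverse-++~[] u) x k)

  ++reverse~[]⇒~ : ∀ u w → u ++ reverse w ~ [] → u ~ w
  ++reverse~[]⇒~ u w p = ~-trans (++~[]⇒~reverse u (reverse w) p) (~-reflexive (Lₚ.reverse-involutive w))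

  AllNeg-Pos : ∀ u → AllNeg u → ∀ x → Pos x → Neg (act u x)
  AllNeg-Pos u neg x (p , l , q) = Pos-cong (λ k → ≡-sym (eq k))
    ( (λ k → sum-≥0 (t k) (t≥0 k))
    , proj₁ (proj₂ (neg l))
    , ℤₚ.<-≤-trans (0<* q (proj₂ (proj₂ (neg l)))) (sum-≥ (t (proj₁ (proj₂ (neg l)))) (t≥0 _) l))
    where
    t : Fin n → Fin n → ℤ
    t k l = x l * - act u (e l) k
    t≥0 : ∀ k l → 0ℤ ≤ᶻ t k l
    t≥0 k l = 0≤* (p l) (proj₁ (neg l) k)
    lem : ∀ a b → (- 1ℤ) * (a * b) ≡ a * - b
    lem = solve-∀
    eq : ∀ k → - act u x k ≡ sum (t k)
    eq k = trans (cong -_ (act-expand u x k)) (trans (≡-sym (ℤₚ.-1*i≡-i _))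
      (trans (*-distribˡ-sum (- 1ℤ) (λ l → x l * act u (e l) k))
             (sum-cong-≗ (λ l → lem (x l) (act u (e l) k)))))

  AllNeg-Neg : ∀ u → AllNeg u → ∀ x → Neg x → Pos (act u x)
  AllNeg-Neg u neg x q = Pos-cong
    (λ k → trans (cong -_ (act-neg u x k)) (ℤₚ.neg-involutive (act u x k)))
    (AllNeg-Pos u neg (λ k → - x k) q)

  AllNeg-reverse : ∀ u → AllNeg u → AllNeg (reverse u)
  AllNeg-reverse u neg j with pos-or-neg (reverse u) j
  ... | inj₂ q = q
  ... | inj₁ p = ⊥-elim (¬Pos-Neg (Pos-e j) (Neg-cong (act-reverse u (e j)) (AllNeg-Pos u neg _ p)))

  AllNeg-unique : ∀ u w → AllNeg u → AllNeg w → u ~ w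
  AllNeg-unique u w p q = ++reverse~[]⇒~ u w (AllPos⇒~[] _ (λ j →
    Pos-cong (λ k → cong (λ f → f k) (≡-sym (act-++ u (reverse w) (e j))))
      (AllNeg-Neg u p _ (AllNeg-reverse w q j))))

  cancelʳ : ∀ t u → (u ++ t ∷ []) ++ t ∷ [] ~ u
  cancelʳ t u = ~-trans (~-reflexive (Lₚ.++-assoc u (t ∷ []) (t ∷ [])))
    (~-trans (++⁺ˡ u (ii~[] t)) (~-reflexive (Lₚ.++-identityʳ u)))

  ∷ʳ-cancel : ∀ t u w → u ++ t ∷ [] ~ w ++ t ∷ [] → u ~ w
  ∷ʳ-cancel t u w p = ~-trans (~-sym (cancelʳ t u)) (~-trans (++⁺ʳ (t ∷ []) p) (cancelʳ t w))

  count-mono-∷ : ∀ (i k : Fin n) {u v} → count i u ≤ count i v → count i (k ∷ u) ≤ count i (k ∷ v)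
  count-mono-∷ i k {u} {v} p = subst₂ _≤_ (≡-sym (count-∷ i k u)) (≡-sym (count-∷ i k v))
    (ℕₚ.+-monoʳ-≤ (count i (k ∷ [])) p)

  -- A reflection v sₜ v⁻¹ whose root v αₜ is simple is that simple reflection.
  conj-simple : ∀ k v t → act v (e t) ≗ e k → k ∷ v ++ t ∷ [] ~ v
  conj-simple k v t vt≗k = ++reverse~[]⇒~ (k ∷ v ++ t ∷ []) v (AllPos⇒~[] g pos)
    where
    g : Word n
    g = (k ∷ v ++ t ∷ []) ++ reverse v
    z : Fin n → V
    z j = act (reverse v) (e j)
    inner : ∀ j → act v (s t (z j)) ≗ (λ l → e j l + π t (z j) * e k l)
    inner j l = trans (act-+ v (z j) (λ l → π t (z j) * e t l) l)
      (cong₂ _+_ (act-reverse v (e j) l) (trans (act-* v (π t (z j)) (e t) l) (cong (π t (z j) *_) (vt≗k l))))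
    unfold-g : ∀ j → act g (e j) ≗ s k (λ l → e j l + π t (z j) * e k l)
    unfold-g j l = trans (cong (λ f → f l) (act-++ (k ∷ v ++ t ∷ []) (reverse v) (e j)))
      (trans (cong (λ f → s k f l) (act-++ v (t ∷ []) (z j))) (s-cong k (inner j) l))
    coord : ∀ j → k ≢ j → act g (e j) j ≡ 1ℤ
    coord j k≢j rewrite unfold-g j j | e-diff k≢j | e-same j =
      lem (π t (z j)) (π k (λ l → e j l + π t (z j) * e k l))
      where lem : ∀ a b → (1ℤ + a * 0ℤ) + b * 0ℤ ≡ 1ℤ
            lem = solve-∀
    zk : z k ≗ e t
    zk l = trans (act-cong (reverse v) (λ l → ≡-sym (vt≗k l)) l) (act-reverse′ v (e t) l)
    at-k : act g (e k) ≗ e k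
    at-k l = trans (unfold-g k l) (trans (s-cong k flipped l)
      (trans (act-neg (k ∷ []) (e k) l) (trans (cong -_ (s-same k l)) (ℤₚ.neg-involutive (e k l)))))
      where
      flipped : (λ l → e k l + π t (z k) * e k l) ≗ (λ l → - e k l)
      flipped l = trans (cong (λ a → e k l + a * e k l) (trans (π-cong t zk) (π-same t))) (lem (e k l))
        where lem : ∀ a → a + (- + 2) * a ≡ - a
              lem = solve-∀
    pos : AllPos g
    pos j with k F.≟ j
    ... | yes refl = Pos-cong (λ l → ≡-sym (at-k l)) (Pos-e k)
    ... | no k≢j with pos-or-neg g j
    ...   | inj₁ p = p
    ...   | inj₂ (q , _) = ⊥-elim (ℤₚ.<-irrefl refl (ℤₚ.<-≤-trans (+<+ (s≤s z≤n))
                             (subst (_≤ᶻ 0ℤ) (coord j k≢j) (≤-neg-flip (q j)))))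

  exchange : ∀ u t → Neg (act u (e t)) → ∃ λ u′ → (u ++ t ∷ [] ~ u′) × length u′ < length u ×
             (∀ i → count i u′ ≤ count i u)
  exchange [] t neg = ⊥-elim (¬Pos-Neg (Pos-e t) neg)
  exchange (k ∷ v) t neg with pos-or-neg v t
  ... | inj₂ q with exchange v t q
  ...   | v′ , v~ , lt , cnt = k ∷ v′ , ++⁺ˡ (k ∷ []) v~ , s≤s lt , (λ i → count-mono-∷ i k (cnt i))
  exchange (k ∷ v) t neg | inj₁ (p , l , l>0) =
    v , conj-simple k v t y≗e , ℕₚ.≤-refl ,
    (λ i → count≤count-∷ i k v)
    where
    y : V
    y = act v (e t)
    off : ∀ j → k ≢ j → y j ≡ 0ℤ
    off j k≢j = ℤₚ.≤-antisym
      (≤-neg-flip (subst (λ a → 0ℤ ≤ᶻ - a)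
        (trans (cong (λ a → y j + π k y * a) (e-diff k≢j))
               (trans (cong (λ a → y j + a) (ℤₚ.*-zeroʳ (π k y))) (ℤₚ.+-identityʳ (y j))))
        (proj₁ neg j))) (p j)
    yk>0 : 0ℤ <ᶻ y k
    yk>0 with k F.≟ l
    ... | yes refl = l>0
    ... | no k≢l   = ⊥-elim (ℤₚ.<-irrefl (≡-sym (off l k≢l)) l>0)
    y≗ : y ≗ (λ j → y k * e k j)
    y≗ j with k F.≟ j
    ... | yes refl = ≡-sym (ℤₚ.*-identityʳ (y k))
    ... | no k≢j   = trans (off j k≢j) (≡-sym (ℤₚ.*-zeroʳ (y k)))
    yk≡1 : y k ≡ 1ℤ
    yk≡1 = unit-factor (y k) (act (reverse v) (e k) t) yk>0
      (trans (≡-sym (act-* (reverse v) (y k) (e k) t))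
      (trans (act-cong (reverse v) (λ j → ≡-sym (y≗ j)) t) (trans (act-reverse′ v (e t) t) (e-same t))))
    y≗e : y ≗ e k
    y≗e j = trans (y≗ j) (trans (cong (_* e k j) yk≡1) (ℤₚ.*-identityˡ (e k j)))

  data Good : Word n → Set where
    nil  : Good []
    snoc : ∀ {u} t → Good u → Pos (act u (e t)) → Good (u ++ t ∷ [])

  deletion : ∀ u → ∃ λ u′ → Good u′ × (u ~ u′) × length u′ ≤ length u × (∀ i → count i u′ ≤ count i u)
  deletion u = go (suc (length u)) u ℕₚ.≤-refl
    where
    go : ∀ N u → length u < N →
         ∃ λ u′ → Good u′ × (u ~ u′) × length u′ ≤ length u × (∀ i → count i u′ ≤ count i u)
    go (suc N) u (s≤s l) with L.initLast u
    ... | [] = [] , nil , done , z≤n , (λ i → z≤n)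
    ... | v L.∷ʳ′ t with go N v (ℕₚ.<-≤-trans v<u l)
      where
      v<u : length v < length (v ++ t ∷ [])
      v<u = subst (length v <_) (≡-sym (Lₚ.length-++ v)) (ℕₚ.m<m+n (length v) (s≤s z≤n))
    ...   | v′ , good , v~ , len , cnt with pos-or-neg v′ t
    ...     | inj₁ p = v′ ++ t ∷ [] , snoc t good p , ++⁺ʳ (t ∷ []) v~ ,
                subst₂ _≤_ (≡-sym (Lₚ.length-++ v′)) (≡-sym (Lₚ.length-++ v)) (ℕₚ.+-monoˡ-≤ 1 len) ,
                (λ i → subst₂ _≤_ (≡-sym (count-++ i v′ (t ∷ []))) (≡-sym (count-++ i v (t ∷ [])))
                         (ℕₚ.+-monoˡ-≤ (count i (t ∷ [])) (cnt i)))
    ...     | inj₂ q with exchange v′ t q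
    ...       | x , x~ , x< , xcnt with go N x (ℕₚ.<-≤-trans x< (ℕₚ.≤-trans len (ℕₚ.≤-trans
                    (subst (length v ≤_) (≡-sym (Lₚ.length-++ v)) (ℕₚ.m≤m+n (length v) 1)) l)))
    ...         | y , gy , y~ , ylen , ycnt = y , gy , ~-trans (++⁺ʳ (t ∷ []) v~) (~-trans x~ y~) ,
                ℕₚ.≤-trans ylen (ℕₚ.≤-trans (ℕₚ.<⇒≤ x<) (ℕₚ.≤-trans len
                  (subst (length v ≤_) (≡-sym (Lₚ.length-++ v)) (ℕₚ.m≤m+n (length v) 1)))) ,
                (λ i → ℕₚ.≤-trans (ycnt i) (ℕₚ.≤-trans (xcnt i) (ℕₚ.≤-trans (cnt i)
                  (subst (count i v ≤_) (≡-sym (count-++ i v (t ∷ []))) (ℕₚ.m≤m+n (count i v) _)))))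

  Good⇒Reduced : ∀ {u} → Good u → Reduced M u
  Good⇒Reduced nil x x~ = z≤n
  Good⇒Reduced (snoc {u} t g p) x x~ with pos-or-short x t
  ... | inj₁ q = ⊥-elim (¬Pos-Neg p (Pos-cong (λ k → trans (act-~ x~ (e t) k) (act-snoc-same u t k)) q))
  ... | inj₂ (x′ , x~′ , lt) = subst (_≤ length x) (trans (ℕₚ.+-comm 1 (length u)) (≡-sym (Lₚ.length-++ u)))
      (ℕₚ.≤-trans (s≤s (Good⇒Reduced g x′ (∷ʳ-cancel t x′ u (~-trans (~-sym x~′) x~)))) lt)

  Good-increases : ∀ {u} → Good u → ∀ a → (∀ j → 0ℤ ≤ᶻ π j a) → ∀ k → a k ≤ᶻ act u a k
  Good-increases nil a p k = ℤₚ.≤-refl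
  Good-increases (snoc {u} t g q) a p k = subst (a k ≤ᶻ_) (≡-sym eq)
    (subst (_≤ᶻ (act u a k + π t a * act u (e t) k)) (ℤₚ.+-identityʳ (a k))
      (ℤₚ.+-mono-≤ (Good-increases g a p k) (0≤* (p t) (proj₁ q k))))
    where
    eq : act (u ++ t ∷ []) a k ≡ act u a k + π t a * act u (e t) k
    eq = trans (cong (λ f → f k) (act-++ u (t ∷ []) a)) (trans (act-+ u a (λ l → π t a * e t l) k)
      (cong (λ z → act u a k + z) (act-* u (π t a) (e t) k)))

  module Longest (w₀ : Word n) (longest : IsLongestWord M w₀) where

    AllNeg-w₀ : AllNeg w₀
    AllNeg-w₀ j with pos-or-neg w₀ j
    ... | inj₂ q = q
    ... | inj₁ p = let w , g , w~ , _ , _ = deletion w₀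
                       longer = proj₂ longest (w ++ j ∷ [])
                         (Good⇒Reduced (snoc j g (Pos-cong (act-~ w~ (e j)) p)))
                   in ⊥-elim (ℕₚ.<-irrefl refl (ℕₚ.<-≤-trans
                        (ℕₚ.≤-<-trans (proj₁ longest w (~-sym w~))
                          (subst (length w <_) (≡-sym (Lₚ.length-++ w)) (ℕₚ.m<m+n (length w) (s≤s z≤n)))) longer))

    ~w₀ : ∀ u → AllNeg u → u ~ w₀
    ~w₀ u p = AllNeg-unique u w₀ p AllNeg-w₀

    minOccurrences≤ : ∀ i k → IsMinOccurrences M w₀ i k → ∀ u → u ~ w₀ → k ≤ count i u
    minOccurrences≤ i k (_ , lower) u u~ =
      let u′ , g , u~u′ , _ , cnt = deletion u
      in ℕₚ.≤-trans (lower u′ (Good⇒Reduced g) (~-trans (~-sym u~u′) u~)) (cnt i)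

    -- For a ≥ 0 with ⟨ a , αⱼ^∨ ⟩ ≤ 0 for all j one would have w₀ a ≥ a, while w₀ a ≤ 0; this rules out
    -- all affine subdiagrams.
    no-antidominant : ∀ a → Pos a → (∀ j → 0ℤ ≤ᶻ π j a) → ⊥
    no-antidominant a (p , k , k>0) anti =
      let w , g , w~ , _ , _ = deletion w₀
          neg , _ = AllNeg-Pos w₀ AllNeg-w₀ a (p , k , k>0)
      in ℤₚ.<-irrefl refl (ℤₚ.<-≤-trans k>0 (ℤₚ.≤-trans (Good-increases g a anti k)
           (subst (_≤ᶻ 0ℤ) (act-~ w~ a k) (≤-neg-flip (neg k)))))

c-zero : ∀ {n} (M : CoxeterMatrix n) (m≤4 : ∀ i j → m M i j ≤ 4) i j → i ≢ j → m M i j ≡ 2 →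
         Lattice.c M m≤4 i j ≡ 0ℤ
c-zero M m≤4 i j i≢j e with Lattice.bond M m≤4 i j i≢j
... | Lattice.bond₂ _ p _  = p
... | Lattice.bond₃ f _ _  = ⊥-elim (case trans (≡-sym e) f of λ ())
... | Lattice.bond₄ f _ _  = ⊥-elim (case trans (≡-sym e) f of λ ())
... | Lattice.bond₄′ f _ _ = ⊥-elim (case trans (≡-sym e) f of λ ())

-- Diagrams are described by their Coxeter labels on initial segments of ℕ.
record Embedding {n} (M : CoxeterMatrix n) (lab : ℕ → ℕ → ℕ) (k : ℕ) : Set where
  field
    p    : ℕ → Fin n
    inj  : ∀ {a b} → a < k → b < k → p a ≡ p b → a ≡ b
    lab≡ : ∀ {a b} → a < k → b < k → m M (p a) (p b) ≡ lab a b

Closed : ∀ {n} (M : CoxeterMatrix n) → (ℕ → Fin n) → ℕ → Set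
Closed M p k = ∀ {a} → a < k → ∀ j → (∀ {b} → b < k → p b ≢ j) → m M (p a) j ≡ 2

countℕ : ℕ → List ℕ → ℕ
countℕ j []      = 0
countℕ j (a ∷ u) with a ℕ.≟ j
... | yes _ = suc (countℕ j u)
... | no  _ = countℕ j u

module Component {n : ℕ} (M : CoxeterMatrix n) (m≤4 : ∀ i j → m M i j ≤ 4)
  (p : ℕ → Fin n) (k : ℕ) (inj : ∀ {a b} → a < k → b < k → p a ≡ p b → a ≡ b) (closed : Closed M p k) where

  open Reduction M m≤4 public

  Outside : Fin n → Set
  Outside j = ∀ {b} → b < k → p b ≢ j

  inside? : ∀ j → Dec (∃ λ b → b < k × p b ≡ j)
  inside? j = ℕₚ.anyUpTo? (λ b → p b F.≟ j) k

  outside : ∀ {j} → ¬ (∃ λ b → b < k × p b ≡ j) → Outside j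
  outside ¬in b<k e = ¬in (_ , b<k , e)

  c-out : ∀ {a} → a < k → ∀ {j} → Outside j → c (p a) j ≡ 0ℤ
  c-out a<k {j} out = c-zero M m≤4 _ j (out a<k) (closed a<k j (λ b<k → out b<k))

  c-out′ : ∀ {a} → a < k → ∀ {j} → Outside j → c j (p a) ≡ 0ℤ
  c-out′ a<k {j} out = c-zero M m≤4 j _ (out a<k ∘ ≡-sym)
    (trans (CoxeterMatrix.sym M j _) (closed a<k j (λ b<k → out b<k)))

  s-out-in : ∀ {l} → Outside l → ∀ {b} → b < k → s l (e (p b)) ≗ e (p b)
  s-out-in {l} out {b} b<k j = trans (s-diff (out b<k ∘ ≡-sym) j)
    (trans (cong (λ z → e (p b) j + z * e l j) (c-out b<k out)) (ℤₚ.+-identityʳ (e (p b) j)))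

  Vanishes : V → Set
  Vanishes x = ∀ {b} → b < k → x (p b) ≡ 0ℤ

  s-in-vanishing : ∀ {a} → a < k → ∀ {x} → Vanishes x → s (p a) x ≗ x
  s-in-vanishing {a} a<k {x} van j = trans (cong (λ z → x j + z * e (p a) j) π≡0) (ℤₚ.+-identityʳ (x j))
    where
    term : ∀ l → c l (p a) * x l ≡ 0ℤ
    term l with inside? l
    ... | yes (b , b<k , refl) = trans (cong (c l (p a) *_) (van b<k)) (ℤₚ.*-zeroʳ (c l (p a)))
    ... | no ¬in = cong (_* x l) (c-out′ a<k (outside ¬in))
    π≡0 : π (p a) x ≡ 0ℤ
    π≡0 = cong₂ _-_ (trans (sum-cong-≗ term) (sum-replicate-zero n)) (cong (+ 2 *_) (van a<k))

  s-out-vanishing : ∀ {l} → Outside l → ∀ {x} → Vanishes x → Vanishes (s l x)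
  s-out-vanishing {l} out {x} van {b} b<k = trans (cong₂ (λ y z → y + π l x * z) (van b<k)
    (e-diff (out b<k ∘ ≡-sym))) (trans (ℤₚ.+-identityˡ (π l x * 0ℤ)) (ℤₚ.*-zeroʳ (π l x)))

  outer : Word n → Word n
  outer []      = []
  outer (l ∷ w) with inside? l
  ... | yes _ = outer w
  ... | no  _ = l ∷ outer w

  act-outer : ∀ w x → Vanishes x → (act w x ≗ act (outer w) x) × Vanishes (act w x)
  act-outer [] x van = (λ _ → refl) , van
  act-outer (l ∷ w) x van with inside? l | act-outer w x van
  ... | yes (b , b<k , refl) | eq , van′ =
        (λ j → trans (s-in-vanishing b<k {act w x} van′ j) (eq j)) ,
        (λ a<k → trans (s-in-vanishing b<k {act w x} van′ _) (van′ a<k))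
  ... | no ¬in | eq , van′ = s-cong l eq , s-out-vanishing (outside ¬in) {act w x} van′

  mp : List ℕ → Word n
  mp = L.map p

  Letters : List ℕ → Set
  Letters = All (_< k)

  act-outer-in : ∀ w {b} → b < k → act (outer w) (e (p b)) ≗ e (p b)
  act-outer-in [] b<k j = refl
  act-outer-in (l ∷ w) b<k with inside? l
  ... | yes _  = act-outer-in w b<k
  ... | no ¬in = λ j → trans (s-cong l (act-outer-in w b<k) j) (s-out-in (outside ¬in) b<k j)

  act-mp-vanishing : ∀ {u} → Letters u → ∀ {x} → Vanishes x → act (mp u) x ≗ x
  act-mp-vanishing [] van j = refl
  act-mp-vanishing {a ∷ u} (a<k ∷ ls) {x} van j =
    trans (s-cong (p a) (act-mp-vanishing ls {x} van) j) (s-in-vanishing a<k {x} van j)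

  Vanishes-e : ∀ {j} → Outside j → Vanishes (e j)
  Vanishes-e out b<k = e-diff (out b<k ∘ ≡-sym)

  count-outer : ∀ w {b} → b < k → count (p b) (outer w) ≡ 0
  count-outer [] b<k = refl
  count-outer (l ∷ w) {b} b<k with inside? l
  ... | yes _  = count-outer w b<k
  ... | no ¬in with l F.≟ p b
  ...   | yes refl = ⊥-elim (outside ¬in b<k refl)
  ...   | no _     = count-outer w b<k

  count-mp : ∀ {u} → Letters u → ∀ {b} → b < k → count (p b) (mp u) ≡ countℕ b u
  count-mp [] b<k = refl
  count-mp {a ∷ u} (a<k ∷ ls) {b} b<k with p a F.≟ p b | a ℕ.≟ b
  ... | yes _ | yes _    = cong suc (count-mp ls b<k)
  ... | no  _ | no  _    = count-mp ls b<k
  ... | yes q | no  a≢b  = ⊥-elim (a≢b (inj a<k b<k q))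
  ... | no  q | yes refl = ⊥-elim (q refl)

  AllNegIn : List ℕ → Set
  AllNegIn u = ∀ {b} → b < k → Neg (act (mp u) (e (p b)))

  module _ (w₀ : Word n) (longest : IsLongestWord M w₀) where
    open Longest w₀ longest

    complete : ∀ u → Letters u → AllNegIn u → mp u ++ outer w₀ ~ w₀
    complete u ls neg = ~w₀ _ allNeg
      where
      allNeg : AllNeg (mp u ++ outer w₀)
      allNeg j with inside? j
      ... | yes (b , b<k , refl) = Neg-cong (λ l → ≡-sym (trans
              (cong (λ f → f l) (act-++ (mp u) (outer w₀) (e (p b))))
              (act-cong (mp u) (act-outer-in w₀ b<k) l))) (neg b<k)
      ... | no ¬in = Neg-cong (λ l → trans (≡-sym (act-mp-vanishing ls {act w₀ (e j)} (proj₂ out) l))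
              (trans (act-cong (mp u) (proj₁ out) l)
                     (cong (λ f → f l) (≡-sym (act-++ (mp u) (outer w₀) (e j))))))
              (AllNeg-w₀ j)
        where out = act-outer w₀ (e j) (Vanishes-e (outside ¬in))

    minOccurrences-upper : ∀ u → Letters u → AllNegIn u → ∀ {b} → b < k → ∀ {v} →
                           IsMinOccurrences M w₀ (p b) v → v ≤ countℕ b u
    minOccurrences-upper u ls neg {b} b<k {v} occ = subst (v ≤_)
      (trans (count-++ (p b) (mp u) (outer w₀))
        (trans (cong₂ ℕ._+_ (count-mp ls b<k) (count-outer w₀ b<k)) (ℕₚ.+-identityʳ (countℕ b u))))
      (minOccurrences≤ (p b) v occ _ (complete u ls neg))

-- Weights: a linear functional f on the root lattice, moved by w, is recorded by its values on simple roots.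
record Functional (n : ℕ) : Set where
  field
    fn     : (Fin n → ℤ) → ℤ
    fn-cong : ∀ {x y} → x ≗ y → fn x ≡ fn y
    fn-lin : ∀ x t y → fn (λ j → x j + t * y j) ≡ fn x + t * fn y

coefficient : ∀ {n} → Fin n → Functional n
coefficient i = record { fn = λ x → x i ; fn-cong = λ q → q i ; fn-lin = λ _ _ _ → refl }

height : ∀ {n} → Functional n
height = record
  { fn = sum ; fn-cong = sum-cong-≗
  ; fn-lin = λ x t y → trans (∑-distrib-+ x (λ j → t * y j)) (cong (λ z → sum x + z) (≡-sym (*-distribˡ-sum t y))) }

module Weights {n : ℕ} (M : CoxeterMatrix n) (m≤4 : ∀ i j → m M i j ≤ 4) (F : Functional n) where
  open Reduction M m≤4
  open Functional F

  weight : Word n → V → ℤ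
  weight w x = fn (act (reverse w) x)

  weight-cong : ∀ w {x y} → x ≗ y → weight w x ≡ weight w y
  weight-cong w q = fn-cong (act-cong (reverse w) q)

  weight-~ : ∀ {u w} → u ~ w → ∀ x → weight u x ≡ weight w x
  weight-~ {u} {w} u~w x = fn-cong (act-~ ru~rw x)
    where
    ru~rw : reverse u ~ reverse w
    ru~rw = ~-sym (~-trans (~-reflexive (≡-sym (Lₚ.++-identityʳ (reverse w))))
      (~-trans (++⁺ˡ (reverse w) (~-sym (++-reverse~[] u)))
      (~-trans (++⁺ˡ (reverse w) (++⁺ʳ (reverse u) u~w))
      (~-trans (~-reflexive (≡-sym (Lₚ.++-assoc (reverse w) w (reverse u))))
               (++⁺ʳ (reverse u) (reverse-++~[] w))))))

  weight-∷ : ∀ l w x → weight (l ∷ w) x ≡ weight w (s l x)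
  weight-∷ l w x = cong fn (trans (cong (λ v → act v x) (Lₚ.unfold-reverse l w)) (act-++ (reverse w) (l ∷ []) x))

  weight-lin : ∀ w x t y → weight w (λ j → x j + t * y j) ≡ weight w x + t * weight w y
  weight-lin w x t y = trans (fn-cong (λ j → trans (act-+ (reverse w) x (λ l → t * y l) j)
    (cong (λ z → act (reverse w) x j + z) (act-* (reverse w) t y j)))) (fn-lin _ t _)

  weight-s : ∀ l w x → weight (l ∷ w) x ≡ weight w x + π l x * weight w (e l)
  weight-s l w x = trans (weight-∷ l w x) (weight-lin w x (π l x) (e l))

-- Certified lower bounds

∧-elim : ∀ {a b} → T (a ∧ b) → T a × T b
∧-elim = Equivalence.to Boolₚ.T-∧

∨-elim : ∀ {a b} → T (a ∨ b) → T a ⊎ T b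
∨-elim = Equivalence.to Boolₚ.T-∨

-- Multiplication by an entry of a Cartan matrix, avoiding ℤ._*_ for the entries 0 and 1.
scale : ℤ → ℤ → ℤ
scale (+ 0) z = 0ℤ
scale (+ 1) z = z
scale a     z = a * z

scale≡* : ∀ a z → scale a z ≡ a * z
scale≡* (+ 0)           z = refl
scale≡* (+ 1)           z = ≡-sym (ℤₚ.*-identityˡ z)
scale≡* (+ suc (suc a)) z = refl
scale≡* -[1+ a ]        z = refl

at : List ℤ → ℕ → ℤ
at []       _       = 0ℤ
at (x ∷ xs) zero    = x
at (x ∷ xs) (suc a) = at xs a

column : List (List ℤ) → ℕ → List ℤ
column []       _       = []
column (x ∷ xs) zero    = x
column (x ∷ xs) (suc a) = column xs a

axpy : ℤ → List ℤ → List ℤ → List ℤ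
axpy t (c ∷ cs) (x ∷ xs) = x + scale c t ∷ axpy t cs xs
axpy t _        _        = []

at-applyUpTo : ∀ (g : ℕ → ℤ) {k b} → b < k → at (L.applyUpTo g k) b ≡ g b
at-applyUpTo g {suc k} {zero}  _         = refl
at-applyUpTo g {suc k} {suc b} (s≤s b<k) = at-applyUpTo (g ∘ suc) b<k

column-applyUpTo : ∀ (g : ℕ → List ℤ) {k b} → b < k → column (L.applyUpTo g k) b ≡ g b
column-applyUpTo g {suc k} {zero}  _         = refl
column-applyUpTo g {suc k} {suc b} (s≤s b<k) = column-applyUpTo (g ∘ suc) b<k

applyUpTo-cong : ∀ {A : Set} {g h : ℕ → A} k → (∀ {b} → b < k → g b ≡ h b) → L.applyUpTo g k ≡ L.applyUpTo h k
applyUpTo-cong zero    q = refl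
applyUpTo-cong (suc k) q = cong₂ _∷_ (q (s≤s z≤n)) (applyUpTo-cong k (λ b<k → q (s≤s b<k)))

axpy-applyUpTo : ∀ t (g h : ℕ → ℤ) k →
  axpy t (L.applyUpTo g k) (L.applyUpTo h k) ≡ L.applyUpTo (λ b → h b + scale (g b) t) k
axpy-applyUpTo t g h zero    = refl
axpy-applyUpTo t g h (suc k) = cong (_ ∷_) (axpy-applyUpTo t (g ∘ suc) (h ∘ suc) k)

-- ⟨ -αᵇ , αₐ^∨ ⟩ for a Coxeter label m(a,b); a label 4 is oriented towards the larger index.
entry : ℕ → ℕ → ℕ → ℤ
entry 1 a b = - + 2
entry 3 a b = 1ℤ
entry 4 a b = if a ℕ.<ᵇ b then 1ℤ else + 2
entry _ a b = 0ℤ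

cartan : (ℕ → ℕ → ℕ) → ℕ → List (List ℤ)
cartan lab k = L.applyUpTo (λ a → L.applyUpTo (λ b → entry (lab a b) a b) k) k

_≡ᵇᶻ_ : ℤ → ℤ → Bool
(+ a)      ≡ᵇᶻ (+ b)      = a ℕ.≡ᵇ b
(-[1+ a ]) ≡ᵇᶻ (-[1+ b ]) = a ℕ.≡ᵇ b
_          ≡ᵇᶻ _          = false

_≡ᵇᴸ_ : List ℤ → List ℤ → Bool
[]       ≡ᵇᴸ []       = true
(x ∷ xs) ≡ᵇᴸ (y ∷ ys) = if x ≡ᵇᶻ y then xs ≡ᵇᴸ ys else false
_        ≡ᵇᴸ _        = false

≡ᵇᶻ⇒≡ : ∀ x y → T (x ≡ᵇᶻ y) → x ≡ y
≡ᵇᶻ⇒≡ (+ a)      (+ b)      q = cong +_ (ℕₚ.≡ᵇ⇒≡ a b q)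
≡ᵇᶻ⇒≡ (-[1+ a ]) (-[1+ b ]) q = cong -[1+_] (ℕₚ.≡ᵇ⇒≡ a b q)

≡ᵇᴸ⇒≡ : ∀ x y → T (x ≡ᵇᴸ y) → x ≡ y
≡ᵇᴸ⇒≡ []       []       q = refl
≡ᵇᴸ⇒≡ (x ∷ xs) (y ∷ ys) q with x ≡ᵇᶻ y in eq
... | true = cong₂ _∷_ (≡ᵇᶻ⇒≡ x y (subst T (≡-sym eq) tt)) (≡ᵇᴸ⇒≡ xs ys q)

data Tree : Set where
  leaf : Tree
  node : Tree → ℕ → List ℤ → ℕ → Tree → Tree

encode : List ℤ → ℕ
encode []       = 0
encode (x ∷ xs) = ℤ.∣ x + + 32 ∣ ℕ.+ 64 ℕ.* encode xs

search : Tree → ℕ → Maybe (List ℤ × ℕ)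
search leaf             c = nothing
search (node l d x t r) c =
  if c ℕ.≡ᵇ d then just (x , t) else (if c ℕ.<ᵇ d then search l c else search r c)

adjoin : Tree → ℕ → List ℤ → ℕ → Tree
adjoin leaf             c y s = node leaf c y s leaf
adjoin (node l d x t r) c y s =
  if c ℕ.<ᵇ d then node (adjoin l c y s) d x t r else node l d x t (adjoin r c y s)

allNodes : (List ℤ → ℕ → Bool) → Tree → Bool
allNodes P leaf             = true
allNodes P (node l d x t r) = P x t ∧ allNodes P l ∧ allNodes P r

allNodes-search : ∀ P D c {x t} → T (allNodes P D) → search D c ≡ just (x , t) → T (P x t)
allNodes-search P (node l d y s r) c ok eq with c ℕ.≡ᵇ d | c ℕ.<ᵇ d
allNodes-search P (node l d y s r) c ok refl | true | _ = proj₁ (∧-elim {P y s} ok)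
... | false | true  = allNodes-search P l c (proj₁ (∧-elim {allNodes P l} (proj₂ (∧-elim {P y s} ok)))) eq
... | false | false = allNodes-search P r c (proj₂ (∧-elim {allNodes P l} (proj₂ (∧-elim {P y s} ok)))) eq

-- Certification of distances in the W-orbit of a fundamental weight ωᵢ, up to the parabolic subgroup
-- W_J, J = S ∖ i: every weight is represented by its J-dominant translate, and before applying sᵢ only
-- coset representatives of W_K \ W_J have to be tried, where K ⊆ J commutes with sᵢ.
module Checker (cols : List (List ℤ)) (i : ℕ) (J K : List ℕ) where

  dual : ℕ → List ℤ → List ℤ
  dual a x = axpy (at x a) (column cols a) x

  dualPath : List ℕ → List ℤ → List ℤ
  dualPath []      x = x
  dualPath (a ∷ q) x = dualPath q (dual a x)

  negative : ℤ → Bool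
  negative (+ _)      = false
  negative (-[1+ _ ]) = true

  zero? : ℤ → Bool
  zero? (+ 0) = true
  zero? _     = false

  firstNegative : List ℕ → List ℤ → Maybe ℕ
  firstNegative []       x = nothing
  firstNegative (a ∷ as) x = if negative (at x a) then just a else firstNegative as x

  dominant : ℕ → List ℤ → List ℤ
  dominantWith : ℕ → List ℤ → Maybe ℕ → List ℤ
  dominant zero    x = x
  dominant (suc f) x = dominantWith f x (firstNegative J x)
  dominantWith f x nothing  = x
  dominantWith f x (just a) = dominant f (dual a x)

  selects : Maybe ℕ → ℕ → Bool
  selects nothing  a = false
  selects (just b) a = a ℕ.≡ᵇ b

  cosets : ℕ → List ℤ → List ℕ → List (List ℕ)
  cosets zero    x q = q ∷ []
  cosets (suc f) x q = q ∷ L.concatMap (λ a → descend a (dual a x)) J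
    where
    descend : ℕ → List ℤ → List (List ℕ)
    descend a y = if negative (at y a) ∧ selects (firstNegative J y) a then cosets f y (a ∷ q) else []

  closesTo : List ℤ → List (List ℕ × List ℤ) → ℕ × List ℤ → List ℤ → Bool
  closesTo ρ Rs (len , x) y = anyᵇ (λ b → (dual b x ≡ᵇᴸ y)) K
                            ∨ anyᵇ (λ r → (proj₂ r ≡ᵇᴸ y) ∧ (length (proj₁ r) ℕ.≤ᵇ suc len)) Rs

  cosetsClosed : List ℤ → List (List ℕ) → Bool
  cosetsClosed ρ R = go (L.map (λ q → q , dualPath q ρ) R)
    where
    go : List (List ℕ × List ℤ) → Bool
    go Rs = allᵇ (λ r → allᵇ (λ a → closesTo ρ Rs (length (proj₁ r) , proj₂ r) (dualPath (a ∷ proj₁ r) ρ)) J) Rs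

  near : Maybe (List ℤ × ℕ) → List ℤ → ℕ → Bool
  near nothing        x t = false
  near (just (y , s)) x t = (s ℕ.≤ᵇ suc t) ∧ (y ≡ᵇᴸ x)

  crosses : Tree → ℕ → List ℤ → Bool
  crosses D t x = at-dominant (dominant 200 (dual i x))
    where
    at-dominant : List ℤ → Bool
    at-dominant y = near (search D (encode y)) y t

  walk : Tree → ℕ → List ℕ → List ℤ → Bool
  walk D t []      x = crosses D t x
  walk D t (a ∷ q) x = if zero? (at x a) then true else walk D t q (dual a x)

  found : Maybe (List ℤ × ℕ) → List ℤ → ℕ → Bool
  found nothing        x t = false
  found (just (y , s)) x t = (s ℕ.≡ᵇ t) ∧ (y ≡ᵇᴸ x)

  certifies : List (List ℕ) → List ℤ → List ℤ → ℕ → Tree → Bool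
  certifies R start end d D =
    found (search D (encode start)) start 0 ∧
    found (search D (encode end)) end d ∧
    allNodes (λ x t → allᵇ (λ q → walk D t q x) R) D

  targets : List ℤ → List ℕ → List (List ℤ)
  targets x []      = dominant 200 (dual i x) ∷ []
  targets x (a ∷ q) = if zero? (at x a) then [] else targets (dual a x) q

  enter : ℕ → List (List ℤ) → Tree × List (List ℤ) → Tree × List (List ℤ)
  enterNew : ℕ → List ℤ → ℕ → List (List ℤ) → Tree × List (List ℤ) → Maybe (List ℤ × ℕ) → Tree × List (List ℤ)
  enter d []       acc       = acc
  enter d (x ∷ xs) (D , new) = enterNew d x (encode x) xs (D , new) (search D (encode x))
  enterNew d x c xs acc       (just _) = enter d xs acc
  enterNew d x c xs (D , new) nothing  = enter d xs (adjoin D c x d , x ∷ new)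

  explore : List (List ℕ) → ℕ → ℕ → List (List ℤ) → Tree → Tree
  exploreNext : List (List ℕ) → ℕ → ℕ → Tree × List (List ℤ) → Tree
  explore R zero    d front D = D
  explore R (suc f) d front D =
    exploreNext R f d (enter d (L.concatMap (λ x → L.concatMap (targets x) R) front) (D , []))
  exploreNext R f d (D , new) = explore R f (suc d) new D

  orbit : List (List ℕ) → ℕ → List ℤ → Tree
  orbit R d start = explore R d 1 (start ∷ []) (adjoin leaf (encode start) start 0)

others : ℕ → ℕ → List ℕ
others k i = filter (λ b → ¬? (b ℕ.≟ i)) (L.upTo k)

other : ℕ → ℕ → ℕ → Bool
other k i a = (a ℕ.<ᵇ k) ∧ (if a ℕ.≡ᵇ i then false else true)

commuting : (ℕ → ℕ → ℕ) → ℕ → ℕ → List ℕ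
commuting lab k i = filter (λ b → lab b i ℕ.≟ 2) (others k i)

δ : ℕ → ℕ → ℤ
δ i b = if i ℕ.≡ᵇ b then 1ℤ else 0ℤ

module _ (cols : List (List ℤ)) (i : ℕ) (J K : List ℕ) (k : ℕ) (u : List ℕ) (d : ℕ) where
  open Checker cols i J K

  ones target : List ℤ
  ones   = L.applyUpTo (λ _ → 1ℤ) k
  target = L.applyUpTo (δ i) k

  record Verdict (R : List (List ℕ)) (start : List ℤ) : Set where
    field
      letters  : T (allᵇ (ℕ._<ᵇ k) u)
      negated  : T (allᵇ negative (dualPath u ones))
      counted  : T (countℕ i u ℕ.≡ᵇ d)
      cosets-J : T (allᵇ (allᵇ (other k i)) R)
      closedᴿ  : T (cosetsClosed ones R)
      certified : T (certifies R start target d (orbit R d start))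

  verdict : List (List ℕ) → List ℤ → Bool
  verdict R start = allᵇ (ℕ._<ᵇ k) u ∧ allᵇ negative (dualPath u ones) ∧ (countℕ i u ℕ.≡ᵇ d)
                  ∧ allᵇ (allᵇ (other k i)) R ∧ cosetsClosed ones R ∧ certifies R start target d (orbit R d start)

  verdict-sound : ∀ R start → T (verdict R start) → Verdict R start
  verdict-sound R start ok =
    let c₁ , ok₁ = ∧-elim {allᵇ (ℕ._<ᵇ k) u} ok
        c₂ , ok₂ = ∧-elim {allᵇ negative (dualPath u ones)} ok₁
        c₃ , ok₃ = ∧-elim {countℕ i u ℕ.≡ᵇ d} ok₂
        c₄ , ok₄ = ∧-elim {allᵇ (allᵇ (other k i)) R} ok₃
        c₅ , c₆  = ∧-elim {cosetsClosed ones R} ok₄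
    in record { letters = c₁ ; negated = c₂ ; counted = c₃ ; cosets-J = c₄ ; closedᴿ = c₅ ; certified = c₆ }

  verdictFrom : ℕ → ℕ → List ℤ → Bool
  verdictFrom f g nbrs = verdict (cosets f nbrs []) (dominant g (dualPath (reverse u) target))

  verdictFrom-sound : ∀ f g nbrs → T (verdictFrom f g nbrs) →
                      Verdict (cosets f nbrs []) (dominant g (dualPath (reverse u) target))
  verdictFrom-sound f g nbrs = verdict-sound (cosets f nbrs []) (dominant g (dualPath (reverse u) target))

neighbours : (ℕ → ℕ → ℕ) → ℕ → ℕ → List ℤ
neighbours lab k i = L.applyUpTo (λ b → if (b ℕ.≡ᵇ i) ∨ (lab b i ℕ.≡ᵇ 2) then 0ℤ else 1ℤ) k

-- chain: the path 0 - 1 - 2 - …;  star t ℓ: the path 1 - 2 - … with 0 attached to vertex t by an edge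
-- labelled ℓ.  So star 1 3 is type A, star 1 4 type B, star 2 3 type D and star 3 3 type E.
chain : ℕ → ℕ → ℕ
chain (suc a)       (suc b)       = chain a b
chain zero          zero          = 1
chain zero          (suc zero)    = 3
chain (suc zero)    zero          = 3
chain zero          (suc (suc b)) = 2
chain (suc (suc a)) zero          = 2

star : ℕ → ℕ → ℕ → ℕ → ℕ
star t ℓ zero    zero    = 1
star t ℓ zero    (suc b) = if suc b ℕ.≡ᵇ t then ℓ else 2
star t ℓ (suc a) zero    = if suc a ℕ.≡ᵇ t then ℓ else 2
star t ℓ (suc a) (suc b) = chain a b

-- the path 0 - 1 = 2 - 3
labF : ℕ → ℕ → ℕ
labF 1 2 = 4
labF 2 1 = 4
labF a b = chain a b

All-reverse : ∀ {A : Set} {P : A → Set} {xs} → All P xs → All P (reverse xs)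
All-reverse [] = []
All-reverse {P = P} {x ∷ xs} (px ∷ pxs) = subst (All P) (≡-sym (Lₚ.unfold-reverse x xs)) (Allₚ.++⁺ (All-reverse pxs) (px ∷ []))

module Certified {n : ℕ} (M : CoxeterMatrix n) (m≤4 : ∀ i j → m M i j ≤ 4)
  {lab : ℕ → ℕ → ℕ} {k : ℕ} (E : Embedding M lab k) (closed : Closed M (Embedding.p E) k)
  (oriented : ∀ {a b} → a < b → b < k → lab a b ≡ 4 →
              Lattice.c M m≤4 (Embedding.p E b) (Embedding.p E a) ≡ 1ℤ)
  (i : ℕ) (i<k : i < k) where

  open Embedding E
  open Component M m≤4 p k inj closed

  cols : List (List ℤ)
  cols = cartan lab k
  J K : List ℕ
  J = others k i
  K = commuting lab k i

  open Checker cols i J K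

  J⇒ : ∀ {a} → a ∈ J → a < k × a ≢ i
  J⇒ a∈J = let q , r = ∈-filter⁻ (λ b → ¬? (b ℕ.≟ i)) {xs = L.upTo k} a∈J in ∈-upTo⁻ q , r

  ⇒J : ∀ {a} → a < k → a ≢ i → a ∈ J
  ⇒J a<k a≢i = ∈-filter⁺ (λ b → ¬? (b ℕ.≟ i)) (∈-upTo⁺ a<k) a≢i

  K⇒ : ∀ {a} → a ∈ K → a ∈ J × lab a i ≡ 2
  K⇒ a∈K = ∈-filter⁻ (λ b → lab b i ℕ.≟ 2) {xs = J} a∈K

  AllJ : List ℕ → Set
  AllJ = All (_∈ J)

  J-letters : ∀ {q} → AllJ q → Letters q
  J-letters = All.map (proj₁ ∘ J⇒)

  π-entry : ∀ {a b} → a < k → b < k → π (p a) (e (p b)) ≡ entry (lab a b) a b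
  π-entry {a} {b} a<k b<k with a ℕ.≟ b
  ... | yes refl rewrite ≡-sym (lab≡ a<k a<k) | diag M (p a) = π-same (p a)
  ... | no a≢b = trans (π-diff pa≢pb) (go (bond (p b) (p a) (pa≢pb ∘ ≡-sym)))
    where
    pa≢pb : p a ≢ p b
    pa≢pb q = a≢b (inj a<k b<k q)
    lab′ : ∀ {v} → m M (p b) (p a) ≡ v → lab a b ≡ v
    lab′ q = trans (≡-sym (lab≡ a<k b<k)) (trans (CoxeterMatrix.sym M (p a) (p b)) q)
    lab″ : ∀ {v} → m M (p b) (p a) ≡ v → lab b a ≡ v
    lab″ q = trans (≡-sym (lab≡ b<k a<k)) q
    four : ∀ x y → c (p b) (p a) ≡ x → c (p a) (p b) ≡ y → m M (p b) (p a) ≡ 4 →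
           (x ≡ 1ℤ × y ≡ + 2) ⊎ (x ≡ + 2 × y ≡ 1ℤ) → x ≡ entry 4 a b
    four x y q r mm alt with a ℕ.<? b
    ... | yes a<b with a ℕ.<ᵇ b | ℕₚ.<⇒<ᵇ a<b
    ...   | true | _ = trans (≡-sym q) (oriented a<b b<k (lab′ mm))
    four x y q r mm alt | no a≮b with a ℕ.<ᵇ b in eq
    ...   | true  = ⊥-elim (a≮b (ℕₚ.<ᵇ⇒< a b (subst T (≡-sym eq) tt)))
    ...   | false with alt
    ...     | inj₂ (x≡2 , _) = x≡2
    ...     | inj₁ (_ , y≡2) = ⊥-elim (case trans (≡-sym y≡2) (trans (≡-sym r)
                  (oriented (ℕₚ.≤∧≢⇒< (ℕₚ.≮⇒≥ a≮b) (a≢b ∘ ≡-sym)) a<k (lab″ mm))) of λ ())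
    go : Bond (p b) (p a) → c (p b) (p a) ≡ entry (lab a b) a b
    go (bond₂ mm q r)  rewrite lab′ mm = q
    go (bond₃ mm q r)  rewrite lab′ mm = q
    go (bond₄ mm q r)  rewrite lab′ mm = trans q (four 1ℤ (+ 2) q r mm (inj₁ (refl , refl)))
    go (bond₄′ mm q r) rewrite lab′ mm = trans q (four (+ 2) 1ℤ q r mm (inj₂ (refl , refl)))

  wd : List ℕ → Word n
  wd q = mp (reverse q)

  wd-∷ : ∀ a q → wd (a ∷ q) ≡ wd q ++ p a ∷ []
  wd-∷ a q = trans (cong mp (Lₚ.unfold-reverse a q)) (Lₚ.map-++ p (reverse q) (a ∷ []))

  wd-∷-++ : ∀ a q w → wd (a ∷ q) ++ w ≡ wd q ++ p a ∷ w
  wd-∷-++ a q w = trans (cong (_++ w) (wd-∷ a q)) (Lₚ.++-assoc (wd q) (p a ∷ []) w)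

  wd-∷ʳ : ∀ q a → wd (q ++ a ∷ []) ≡ p a ∷ wd q
  wd-∷ʳ q a = cong mp (Lₚ.reverse-++ q (a ∷ []))

  wd-++ : ∀ q r → wd (q ++ r) ≡ wd r ++ wd q
  wd-++ q r = trans (cong mp (Lₚ.reverse-++ q r)) (Lₚ.map-++ p (reverse r) (reverse q))

  mp-wd : ∀ q → mp q ++ wd q ~ []
  mp-wd q = subst (λ v → mp q ++ v ~ []) (≡-sym (Lₚ.reverse-map p q)) (++-reverse~[] (mp q))

  wd-mp : ∀ q → wd q ++ mp q ~ []
  wd-mp q = subst (λ v → v ++ mp q ~ []) (≡-sym (Lₚ.reverse-map p q)) (reverse-++~[] (mp q))

  wd-reverse : ∀ q → wd (reverse q) ≡ mp q
  wd-reverse q = cong mp (Lₚ.reverse-involutive q)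

  module State (F : Functional n) where
    open Weights M m≤4 F public

    st : Word n → List ℤ
    st w = L.applyUpTo (λ b → weight w (e (p b))) k

    st-~ : ∀ {u w} → u ~ w → st u ≡ st w
    st-~ u~w = applyUpTo-cong k (λ {b} _ → weight-~ u~w (e (p b)))

    st-dual : ∀ {a} → a < k → ∀ w → st (p a ∷ w) ≡ dual a (st w)
    st-dual {a} a<k w = trans
      (applyUpTo-cong k (λ {b} b<k → trans (weight-s (p a) w (e (p b)))
        (cong (λ z → weight w (e (p b)) + z) (trans
          (cong₂ _*_ (π-entry a<k b<k) (≡-sym (at-applyUpTo (λ b → weight w (e (p b))) a<k)))
          (≡-sym (scale≡* (entry (lab a b) a b) (at (st w) a)))))))
      (trans (≡-sym (axpy-applyUpTo (at (st w) a) (λ b → entry (lab a b) a b) (λ b → weight w (e (p b))) k))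
             (cong (λ cs → axpy (at (st w) a) cs (st w))
               (≡-sym (column-applyUpTo (λ a → L.applyUpTo (λ b → entry (lab a b) a b) k) a<k))))

    st-path : ∀ q → Letters q → ∀ w → st (wd q ++ w) ≡ dualPath q (st w)
    st-path []      _           w = refl
    st-path (a ∷ q) (a<k ∷ ls) w = trans (cong st (wd-∷-++ a q w))
      (trans (st-path q ls (p a ∷ w)) (cong (dualPath q) (st-dual a<k w)))

    st-out : ∀ {l} → Outside l → ∀ w → st (l ∷ w) ≡ st w
    st-out {l} out w = applyUpTo-cong k (λ {b} b<k → trans (weight-∷ l w (e (p b)))
      (weight-cong w (s-out-in out b<k)))

    st-outer : ∀ w → st (outer w) ≡ st []
    st-outer [] = refl
    st-outer (l ∷ w) with inside? l
    ... | yes _  = st-outer w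
    ... | no ¬in = trans (st-out (outside ¬in) (outer w)) (st-outer w)

    st-zero : ∀ {a} → a < k → ∀ w → at (st w) a ≡ 0ℤ → st (p a ∷ w) ≡ st w
    st-zero {a} a<k w eq = applyUpTo-cong k (λ {b} b<k → trans (weight-s (p a) w (e (p b)))
      (trans (cong (λ z → weight w (e (p b)) + π (p a) (e (p b)) * z)
               (trans (≡-sym (at-applyUpTo (λ b → weight w (e (p b))) a<k)) eq))
        (trans (cong (λ z → weight w (e (p b)) + z) (ℤₚ.*-zeroʳ (π (p a) (e (p b))))) (ℤₚ.+-identityʳ _))))

    st-cong : ∀ {q} → Letters q → ∀ {u w} → st u ≡ st w → st (mp q ++ u) ≡ st (mp q ++ w)
    st-cong []         eq = eq
    st-cong {a ∷ q} (a<k ∷ ls) {u} {w} eq = trans (st-dual a<k (mp q ++ u))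
      (trans (cong (dual a) (st-cong ls eq)) (≡-sym (st-dual a<k (mp q ++ w))))

  module H = State height
  module C = State (coefficient (p i))

  sum-e≡1 : ∀ j → sum (e j) ≡ 1ℤ
  sum-e≡1 j = trans (sum-cong-≗ (λ l → ≡-sym (ℤₚ.*-identityˡ (e j l))))
    (sum-e j (λ _ → 1ℤ) (e j) (λ l l≢j → e-diff (l≢j ∘ ≡-sym)) (e-same j))

  st[]-height : H.st [] ≡ L.applyUpTo (λ _ → 1ℤ) k
  st[]-height = applyUpTo-cong k (λ {b} _ → sum-e≡1 (p b))

  st[]-coefficient : C.st [] ≡ L.applyUpTo (δ i) k
  st[]-coefficient = applyUpTo-cong k at-b
    where
    at-b : ∀ {b} → b < k → e (p b) (p i) ≡ δ i b
    at-b {b} b<k with i ℕ.≡ᵇ b in eq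
    ... | true rewrite ℕₚ.≡ᵇ⇒≡ i b (subst T (≡-sym eq) tt) = e-same (p b)
    ... | false = e-diff (λ q → subst T eq (ℕₚ.≡⇒≡ᵇ i b (inj i<k b<k (≡-sym q))))

  applyUpTo-injective : ∀ {g h : ℕ → ℤ} {b} → L.applyUpTo g k ≡ L.applyUpTo h k → b < k → g b ≡ h b
  applyUpTo-injective {g} {h} {b} eq b<k =
    trans (≡-sym (at-applyUpTo g b<k)) (trans (cong (λ xs → at xs b) eq) (at-applyUpTo h b<k))

  Pos⇒height>0 : ∀ {x} → Pos x → 0ℤ <ᶻ sum x
  Pos⇒height>0 {x} (x≥0 , l , xl>0) = ℤₚ.<-≤-trans xl>0 (sum-≥ x x≥0 l)

  Neg⇒height<0 : ∀ {x} → Neg x → sum x <ᶻ 0ℤ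
  Neg⇒height<0 {x} neg = ℤₚ.neg-cancel-< (subst (0ℤ <ᶻ_)
    (trans (sum-cong-≗ (λ l → ≡-sym (ℤₚ.-1*i≡-i (x l))))
           (trans (≡-sym (*-distribˡ-sum (- 1ℤ) x)) (ℤₚ.-1*i≡-i (sum x)))) (Pos⇒height>0 neg))

  -- The height functional has trivial stabiliser in W.
  height-faithful : ∀ q r → Letters q → Letters r → H.st (wd q) ≡ H.st (wd r) → wd q ~ wd r
  height-faithful q r lq lr eq = ++reverse~[]⇒~ (wd q) (wd r) (~-trans flipped done)
    where
    same : ∀ x → H.weight (wd q) x ≡ H.weight (wd r) x
    same x = trans (expand-weight (wd q)) (trans (sum-cong-≗ (λ l → cong (x l *_) (basis l))) (≡-sym (expand-weight (wd r))))
      where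
      fixes : ∀ {j} → Outside j → ∀ s → Letters s → H.weight (wd s) (e j) ≡ sum (e j)
      fixes out s ls = sum-cong-≗ (λ l → trans (cong (λ v → act v _ l) (≡-sym (Lₚ.reverse-map p (reverse s))))
        (trans (cong (λ v → act (mp v) _ l) (Lₚ.reverse-involutive s)) (act-mp-vanishing ls (Vanishes-e out) l)))
      basis : ∀ l → H.weight (wd q) (e l) ≡ H.weight (wd r) (e l)
      basis l with inside? l
      ... | yes (b , b<k , refl) = applyUpTo-injective eq b<k
      ... | no ¬in = trans (fixes (outside ¬in) q lq) (≡-sym (fixes (outside ¬in) r lr))
      expand-weight : ∀ w → H.weight w x ≡ sum (λ l → x l * H.weight w (e l))
      expand-weight w = trans (sum-cong-≗ (act-expand (reverse w) x))
        (trans (∑-comm (λ j l → x l * act (reverse w) (e l) j))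
               (sum-cong-≗ (λ l → ≡-sym (*-distribˡ-sum (x l) (λ j → act (reverse w) (e l) j)))))
    g : Word n
    g = reverse (wd q) ++ wd r
    g-pos : AllPos g
    g-pos j with pos-or-neg g j
    ... | inj₁ pos = pos
    ... | inj₂ neg = ⊥-elim (ℤₚ.<-asym (Neg⇒height<0 neg) (subst (0ℤ <ᶻ_) (≡-sym value) (+<+ (s≤s z≤n))))
      where
      value : sum (act g (e j)) ≡ 1ℤ
      value = trans (cong sum (act-++ (reverse (wd q)) (wd r) (e j)))
        (trans (same (act (wd r) (e j)))
          (trans (sum-cong-≗ (act-reverse′ (wd r) (e j))) (sum-e≡1 j)))
    flipped : wd q ++ reverse (wd r) ~ []
    flipped = ~-trans (++⁺ʳ (reverse (wd r)) (~-sym r~q)) (++-reverse~[] (wd r))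
      where
      r~q : wd r ~ wd q
      r~q = ~-trans (++⁺ʳ (wd r) (~-sym (++-reverse~[] (wd q))))
        (~-trans (~-reflexive (Lₚ.++-assoc (wd q) (reverse (wd q)) (wd r)))
        (~-trans (++⁺ˡ (wd q) (AllPos⇒~[] g g-pos)) (~-reflexive (Lₚ.++-identityʳ (wd q)))))

  data Alive : List ℕ → List ℤ → Set where
    []  : ∀ {x} → Alive [] x
    _∷_ : ∀ {a q x} → zero? (at x a) ≡ false → Alive q (dual a x) → Alive (a ∷ q) x

  walk-sound : ∀ D t {q x} → Alive q x → T (walk D t q x) → T (crosses D t (dualPath q x))
  walk-sound D t []       ok = ok
  walk-sound D t (z ∷ al) ok rewrite z = walk-sound D t al ok

  zero?-sound : ∀ z → zero? z ≡ true → z ≡ 0ℤ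
  zero?-sound (+ 0) _ = refl

  alive? : ∀ q x → Alive q x ⊎ ∃ λ q₁ → ∃ λ a → ∃ λ q₂ → q ≡ q₁ ++ a ∷ q₂ × at (dualPath q₁ x) a ≡ 0ℤ
  alive? []      x = inj₁ []
  alive? (a ∷ q) x with zero? (at x a) in eq
  ... | true  = inj₂ ([] , a , q , refl , zero?-sound (at x a) eq)
  ... | false with alive? q (dual a x)
  ...   | inj₁ al = inj₁ (eq ∷ al)
  ...   | inj₂ (q₁ , b , q₂ , refl , z) = inj₂ (a ∷ q₁ , b , q₂ , refl , z)

  firstNegative-∈ : ∀ as x {a} → firstNegative as x ≡ just a → a ∈ as
  firstNegative-∈ (b ∷ as) x eq with negative (at x b)
  firstNegative-∈ (b ∷ as) x refl | true = here refl
  ... | false = there (firstNegative-∈ as x eq)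

  dominant-path : ∀ f x → ∃ λ q → AllJ q × dominant f x ≡ dualPath q x
  dominant-path zero    x = [] , [] , refl
  dominant-path (suc f) x with firstNegative J x in eq
  ... | nothing = [] , [] , refl
  ... | just a  = let q , qJ , r = dominant-path f (dual a x)
                  in a ∷ q , firstNegative-∈ J x eq ∷ qJ , r

  near-sound : ∀ r x t → T (near r x t) → ∃ λ t′ → r ≡ just (x , t′) × t′ ≤ suc t
  near-sound (just (y , t′)) x t ok with ∧-elim {t′ ℕ.≤ᵇ suc t} ok
  ... | le , eq rewrite ≡ᵇᴸ⇒≡ y x eq = t′ , refl , ℕₚ.≤ᵇ⇒≤ t′ (suc t) le

  found-sound : ∀ r x t → T (found r x t) → r ≡ just (x , t)
  found-sound (just (y , t′)) x t ok with ∧-elim {t′ ℕ.≡ᵇ t} ok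
  ... | e , eq rewrite ≡ᵇᴸ⇒≡ y x eq | ℕₚ.≡ᵇ⇒≡ t′ t e = refl

  commute-past : ∀ l y → All (λ b → m M l b ≡ 2) y → l ∷ y ~ y ++ l ∷ []
  commute-past l []      []        = done
  commute-past l (b ∷ y) (q ∷ qs) = ~-trans (++⁺ʳ y (braid₂ l b q)) (++⁺ˡ (b ∷ []) (commute-past l y qs))

  other-sound : ∀ {a} → T (other k i a) → a ∈ J
  other-sound {a} ok with ∧-elim {a ℕ.<ᵇ k} ok
  ... | lt , ne with a ℕ.≡ᵇ i in eq
  ...   | false = ⇒J (ℕₚ.<ᵇ⇒< a k lt) (λ q → subst T eq (ℕₚ.≡⇒≡ᵇ a i q))

  ρ : List ℤ
  ρ = L.applyUpTo (λ _ → 1ℤ) k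

  H-path : ∀ q → Letters q → H.st (wd q) ≡ dualPath q ρ
  H-path q ls = trans (cong H.st (≡-sym (Lₚ.++-identityʳ (wd q))))
    (trans (H.st-path q ls []) (cong (dualPath q) st[]-height))

  module Run (R : List (List ℕ)) ([]∈R : [] ∈ R) (R-letters : T (allᵇ (allᵇ (other k i)) R))
             (R-closed : T (cosetsClosed ρ R)) where

    R⇒J : ∀ {q} → q ∈ R → AllJ q
    R⇒J {q} q∈R = All.map other-sound (Allₚ.all⁺ (other k i) q (All.lookup (Allₚ.all⁺ (allᵇ (other k i)) R R-letters) q∈R))

    Rs : List (List ℕ × List ℤ)
    Rs = L.map (λ q → q , dualPath q ρ) R

    closes : ∀ q a → q ∈ R → a ∈ J →
      (∃ λ b → b ∈ K × dual b (dualPath q ρ) ≡ dualPath (a ∷ q) ρ) ⊎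
      (∃ λ r → r ∈ R × dualPath r ρ ≡ dualPath (a ∷ q) ρ × length r ≤ suc (length q))
    closes q a q∈R a∈J with ∨-elim (All.lookup (Allₚ.all⁺ _ J (All.lookup (Allₚ.all⁺ _ Rs R-closed)
                                     (∈-map⁺ (λ q → q , dualPath q ρ) q∈R))) a∈J)
    ... | inj₁ ok = let b , b∈K , eq = find (Anyₚ.any⁻ (λ b → dual b (dualPath q ρ) ≡ᵇᴸ dualPath (a ∷ q) ρ) K ok)
                    in inj₁ (b , b∈K , ≡ᵇᴸ⇒≡ _ _ eq)
    ... | inj₂ ok with find (Anyₚ.any⁻ (λ r → (proj₂ r ≡ᵇᴸ dualPath (a ∷ q) ρ) ∧ (length (proj₁ r) ℕ.≤ᵇ suc (length q))) Rs ok)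
    ...   | r , r∈Rs , ok′ with ∈-map⁻ (λ q → q , dualPath q ρ) r∈Rs
    ...     | r′ , r′∈R , refl with ∧-elim {dualPath r′ ρ ≡ᵇᴸ dualPath (a ∷ q) ρ} ok′
    ...       | eq , le = inj₂ (r′ , r′∈R , ≡ᵇᴸ⇒≡ _ _ eq , ℕₚ.≤ᵇ⇒≤ _ _ le)

    coset : ∀ Y → AllJ Y → ∃ λ y → ∃ λ q → All (_∈ K) y × q ∈ R × length q ≤ length Y × (wd Y ~ mp y ++ wd q)
    coset []      _          = [] , [] , [] , []∈R , z≤n , done
    coset (a ∷ Y) (a∈J ∷ YJ) with coset Y YJ
    ... | y , q , yK , q∈R , len , eq with closes q a q∈R a∈J
    ...   | inj₁ (b , b∈K , h) = y ++ b ∷ [] , q , Allₚ.++⁺ yK (b∈K ∷ []) , q∈R , ℕₚ.m≤n⇒m≤1+n len ,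
            ~-trans (~-reflexive (wd-∷ a Y)) (~-trans (++⁺ʳ (p a ∷ []) eq)
            (~-trans (~-reflexive (trans (Lₚ.++-assoc (mp y) (wd q) (p a ∷ [])) (cong (mp y ++_) (≡-sym (wd-∷ a q)))))
            (~-trans (++⁺ˡ (mp y) swap)
                     (~-reflexive (trans (≡-sym (Lₚ.++-assoc (mp y) (p b ∷ []) (wd q)))
                       (cong (_++ wd q) (≡-sym (Lₚ.map-++ p y (b ∷ [])))))))))
      where
      qJ = J-letters (R⇒J q∈R)
      b<k = proj₁ (J⇒ (proj₁ (K⇒ b∈K)))
      swap : wd (a ∷ q) ~ p b ∷ wd q
      swap = ~-trans (height-faithful (a ∷ q) (q ++ b ∷ []) (proj₁ (J⇒ a∈J) ∷ qJ) (Allₚ.++⁺ qJ (b<k ∷ []))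
          (trans (H-path (a ∷ q) (proj₁ (J⇒ a∈J) ∷ qJ)) (trans (≡-sym h)
            (trans (cong (dual b) (≡-sym (H-path q qJ)))
              (trans (≡-sym (H.st-dual b<k (wd q))) (cong H.st (≡-sym (wd-∷ʳ q b))))))))
        (~-reflexive (wd-∷ʳ q b))
    ...   | inj₂ (r , r∈R , h , le) = y , r , yK , r∈R , ℕₚ.≤-trans le (s≤s len) ,
            ~-trans (~-reflexive (wd-∷ a Y)) (~-trans (++⁺ʳ (p a ∷ []) eq)
            (~-trans (~-reflexive (trans (Lₚ.++-assoc (mp y) (wd q) (p a ∷ [])) (cong (mp y ++_) (≡-sym (wd-∷ a q)))))
                     (++⁺ˡ (mp y) (height-faithful (a ∷ q) r aq (J-letters (R⇒J r∈R))
                       (trans (H-path (a ∷ q) aq) (trans (≡-sym h) (≡-sym (H-path r (J-letters (R⇒J r∈R))))))))))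
      where aq = proj₁ (J⇒ a∈J) ∷ J-letters (R⇒J q∈R)

    -- If a letter a of q acts trivially on the weight reached so far, it can be dropped at the price of
    -- changing z within its coset of the stabiliser of the weight.
    reach : ∀ N Y z → AllJ Y → length Y < N → ∃ λ y → ∃ λ q → ∃ λ z′ → All (_∈ K) y × q ∈ R ×
            Alive q (C.st z′) × C.st z′ ≡ C.st z × (wd Y ++ z ~ mp y ++ wd q ++ z′)
    reach (suc N) Y z YJ (s≤s len) with coset Y YJ
    ... | y , q , yK , q∈R , q≤Y , eq with alive? q (C.st z)
    ...   | inj₁ al = y , q , z , yK , q∈R , al , refl ,
            ~-trans (++⁺ʳ z eq) (~-reflexive (Lₚ.++-assoc (mp y) (wd q) z))
    ...   | inj₂ (q₁ , a , q₂ , refl , z≡0) = combine (reach N (q₁ ++ q₂) z₂ (Allₚ.++⁺ q₁J q₂J) shorter)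
      where
      qJ  = R⇒J q∈R
      q₁J = Allₚ.++⁻ˡ q₁ qJ
      q₂J = All.tail (Allₚ.++⁻ʳ q₁ qJ)
      a<k = proj₁ (J⇒ (All.head (Allₚ.++⁻ʳ q₁ qJ)))
      z₂ : Word n
      z₂ = mp q₁ ++ p a ∷ wd q₁ ++ z
      st-z₂ : C.st z₂ ≡ C.st z
      st-z₂ = trans (C.st-cong (J-letters q₁J) (C.st-zero a<k (wd q₁ ++ z)
          (trans (cong (λ x → at x a) (C.st-path q₁ (J-letters q₁J) z)) z≡0)))
        (C.st-~ (~-trans (~-reflexive (≡-sym (Lₚ.++-assoc (mp q₁) (wd q₁) z))) (++⁺ʳ z (mp-wd q₁))))
      shorter : length (q₁ ++ q₂) < N
      shorter = ℕₚ.<-≤-trans (subst₂ _<_ (≡-sym (Lₚ.length-++ q₁)) (≡-sym (Lₚ.length-++ q₁))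
          (ℕₚ.+-monoʳ-< (length q₁) (ℕₚ.n<1+n (length q₂)))) (ℕₚ.≤-trans q≤Y len)
      moved : wd (q₁ ++ a ∷ q₂) ++ z ~ wd (q₁ ++ q₂) ++ z₂
      moved = ~-trans (~-reflexive (trans (cong (_++ z) (wd-++ q₁ (a ∷ q₂)))
          (trans (Lₚ.++-assoc (wd (a ∷ q₂)) (wd q₁) z) (wd-∷-++ a q₂ (wd q₁ ++ z)))))
        (~-trans (++⁺ˡ (wd q₂) (~-sym (~-trans (~-reflexive (≡-sym (Lₚ.++-assoc (wd q₁) (mp q₁) _)))
                   (++⁺ʳ _ (wd-mp q₁)))))
          (~-reflexive (trans (≡-sym (Lₚ.++-assoc (wd q₂) (wd q₁) z₂)) (cong (_++ z₂) (≡-sym (wd-++ q₁ q₂))))))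
      combine : (∃ λ y → ∃ λ q → ∃ λ z′ → All (_∈ K) y × q ∈ R × Alive q (C.st z′) × C.st z′ ≡ C.st z₂ ×
                  (wd (q₁ ++ q₂) ++ z₂ ~ mp y ++ wd q ++ z′)) → _
      combine (y′ , q′ , z′ , y′K , q′∈R , al , st≡ , eq′) =
        y ++ y′ , q′ , z′ , Allₚ.++⁺ yK y′K , q′∈R , al , trans st≡ st-z₂ ,
        ~-trans (++⁺ʳ z eq) (~-trans (~-reflexive (Lₚ.++-assoc (mp y) (wd (q₁ ++ a ∷ q₂)) z))
        (~-trans (++⁺ˡ (mp y) (~-trans moved eq′)) (~-reflexive (trans (≡-sym (Lₚ.++-assoc (mp y) (mp y′) _))
          (cong (_++ (wd q′ ++ z′)) (≡-sym (Lₚ.map-++ p y y′)))))))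

    module Bound (w₀ : Word n) (longest : IsLongestWord M w₀) (start : List ℤ) (d : ℕ) (D : Tree)
                 (ok : T (certifies R start (L.applyUpTo (δ i) k) d D))
                 (x₀ : ∃ λ q → AllJ q × start ≡ dualPath q (C.st w₀)) where
      open Longest w₀ longest

      record Located (w : Word n) (N : ℕ) : Set where
        constructor located
        field
          Y     : List ℕ
          z     : Word n
          t     : ℕ
          Y⊆J   : AllJ Y
          w~    : w ~ wd Y ++ z
          entry-z : search D (encode (C.st z)) ≡ just (C.st z , t)
          t≤N   : t ≤ N

      end : List ℤ
      end = L.applyUpTo (δ i) k

      ok-start : search D (encode start) ≡ just (start , 0)
      ok-start = found-sound (search D (encode start)) start 0
        (proj₁ (∧-elim {found (search D (encode start)) start 0} ok))

      ok-rest : T (found (search D (encode end)) end d) × T (allNodes (λ x t → allᵇ (λ q → walk D t q x) R) D)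
      ok-rest = ∧-elim {found (search D (encode end)) end d}
                       (proj₂ (∧-elim {found (search D (encode start)) start 0} ok))

      ok-end : search D (encode end) ≡ just (end , d)
      ok-end = found-sound (search D (encode end)) end d (proj₁ ok-rest)

      begin : Located w₀ 0
      begin = let q , qJ , eq = x₀
                  st≡ = trans (C.st-path q (J-letters qJ) w₀) (≡-sym eq)
              in located (reverse q) (wd q ++ w₀) 0 (All-reverse qJ)
                 (~-sym (~-trans (~-reflexive (trans (cong (_++ (wd q ++ w₀)) (wd-reverse q))
                   (≡-sym (Lₚ.++-assoc (mp q) (wd q) w₀)))) (++⁺ʳ w₀ (mp-wd q))))
                 (subst (λ x → search D (encode x) ≡ just (x , 0)) (≡-sym st≡) ok-start) z≤n

      step-J : ∀ {a w N} → a ∈ J → Located w N → Located (p a ∷ w) N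
      step-J {a} a∈J (located Y z t YJ w~ at-z t≤N) =
        located (Y ++ a ∷ []) z t (Allₚ.++⁺ YJ (a∈J ∷ []))
        (~-trans (++⁺ˡ (p a ∷ []) w~) (~-reflexive (cong (_++ z) (≡-sym (wd-∷ʳ Y a))))) at-z t≤N

      step-out : ∀ {l w N} → Outside l → Located w N → Located (l ∷ w) N
      step-out {l} out (located Y z t YJ w~ at-z t≤N) =
        located Y (l ∷ z) t YJ
        (~-trans (++⁺ˡ (l ∷ []) w~) (~-trans (++⁺ʳ z (commute-past l (wd Y) (commutes (All-reverse YJ))))
          (~-reflexive (Lₚ.++-assoc (wd Y) (l ∷ []) z))))
        (subst (λ x → search D (encode x) ≡ just (x , t)) (≡-sym (C.st-out out z)) at-z) t≤N
        where
        commutes : ∀ {q} → AllJ q → All (λ b → m M l b ≡ 2) (mp q)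
        commutes []           = []
        commutes (a∈J ∷ qJ) = trans (CoxeterMatrix.sym M l _) (closed (proj₁ (J⇒ a∈J)) l (λ b<k → out b<k)) ∷ commutes qJ

      step-i : ∀ {w N} → Located w N → Located (p i ∷ w) (suc N)
      step-i {w} {N} (located Y z t YJ w~ at-z t≤N) = finish (reach (suc (length Y)) Y z YJ ℕₚ.≤-refl)
        where
        finish : (∃ λ y → ∃ λ q → ∃ λ z′ → All (_∈ K) y × q ∈ R × Alive q (C.st z′) × C.st z′ ≡ C.st z ×
                    (wd Y ++ z ~ mp y ++ wd q ++ z′)) → Located (p i ∷ w) (suc N)
        finish (y , q , z′ , yK , q∈R , al , st≡ , eq) = cross (near-sound (search D (encode (dominant 200 (dual i x)))) (dominant 200 (dual i x)) t crossing) (dominant-path 200 (dual i x))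
          where
          x : List ℤ
          x = dualPath q (C.st z′)
          crossing : T (near (search D (encode (dominant 200 (dual i x)))) (dominant 200 (dual i x)) t)
          crossing = walk-sound D t al (subst (λ s → T (walk D t q s)) (≡-sym st≡)
            (All.lookup (Allₚ.all⁺ (λ q → walk D t q (C.st z)) R
              (allNodes-search (λ x t → allᵇ (λ q → walk D t q x) R) D (encode (C.st z)) (proj₂ ok-rest) at-z)) q∈R))
          yJ : AllJ y
          yJ = All.map (proj₁ ∘ K⇒) yK
          commutes : ∀ {r} → All (_∈ K) r → All (λ b → m M (p i) b ≡ 2) (mp r)
          commutes []         = []
          commutes (b∈K ∷ rK) = trans (CoxeterMatrix.sym M (p i) _)
            (trans (lab≡ (proj₁ (J⇒ (proj₁ (K⇒ b∈K)))) i<k) (proj₂ (K⇒ b∈K))) ∷ commutes rK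
          z₁ : Word n
          z₁ = p i ∷ wd q ++ z′
          st-z₁ : C.st z₁ ≡ dual i x
          st-z₁ = trans (C.st-dual i<k (wd q ++ z′)) (cong (dual i) (C.st-path q (J-letters (R⇒J q∈R)) z′))
          cross : (∃ λ t′ → search D (encode (dominant 200 (dual i x))) ≡ just (dominant 200 (dual i x) , t′) × t′ ≤ suc t) →
                  (∃ λ r → AllJ r × dominant 200 (dual i x) ≡ dualPath r (dual i x)) → Located (p i ∷ w) (suc N)
          cross (t′ , hit , t′≤) (r , rJ , dom≡) =
            located (reverse (y ++ r)) (wd r ++ z₁) t′ (All-reverse (Allₚ.++⁺ yJ rJ)) moved
            (subst (λ s → search D (encode s) ≡ just (s , t′)) (≡-sym st≡′) hit) (ℕₚ.≤-trans t′≤ (s≤s t≤N))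
            where
            st≡′ : C.st (wd r ++ z₁) ≡ dominant 200 (dual i x)
            st≡′ = trans (C.st-path r (J-letters rJ) z₁) (trans (cong (dualPath r) st-z₁) (≡-sym dom≡))
            moved : p i ∷ w ~ wd (reverse (y ++ r)) ++ wd r ++ z₁
            moved = ~-trans (++⁺ˡ (p i ∷ []) (~-trans w~ eq))
              (~-trans (++⁺ʳ (wd q ++ z′) (commute-past (p i) (mp y) (commutes yK)))
              (~-trans (~-reflexive (Lₚ.++-assoc (mp y) (p i ∷ []) (wd q ++ z′)))
              (~-trans (++⁺ˡ (mp y) (~-sym (~-trans (~-reflexive (≡-sym (Lₚ.++-assoc (mp r) (wd r) z₁))) (++⁺ʳ z₁ (mp-wd r)))))
                (~-reflexive (trans (≡-sym (Lₚ.++-assoc (mp y) (mp r) (wd r ++ z₁)))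
                  (cong (_++ (wd r ++ z₁)) (trans (≡-sym (Lₚ.map-++ p y r)) (≡-sym (wd-reverse (y ++ r))))))))))

      locate : ∀ v → Located (v ++ w₀) (count (p i) v)
      locate [] = begin
      locate (l ∷ v) with l F.≟ p i
      ... | yes refl = step-i (locate v)
      ... | no l≢pi with inside? l
      ...   | yes (a , a<k , refl) = step-J (⇒J a<k (λ a≡i → l≢pi (cong p a≡i))) (locate v)
      ...   | no ¬in = step-out (outside ¬in) (locate v)

      lower-bound : ∀ v → v ~ w₀ → d ≤ count (p i) v
      lower-bound v v~ = conclude (locate v)
        where
        vw₀~[] : v ++ w₀ ~ []
        vw₀~[] = ~-trans (++⁺ v~ (~-sym (~w₀ (reverse w₀) (AllNeg-reverse w₀ AllNeg-w₀)))) (++-reverse~[] w₀)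
        fixed : ∀ {q} → AllJ q → C.st (mp q) ≡ L.applyUpTo (δ i) k
        fixed [] = st[]-coefficient
        fixed {a ∷ q} (a∈J ∷ qJ) = trans (C.st-zero (proj₁ (J⇒ a∈J)) (mp q) (trans (cong (λ x → at x a) (fixed qJ))
            (trans (at-applyUpTo (δ i) (proj₁ (J⇒ a∈J))) (δ-zero (proj₂ (J⇒ a∈J)))))) (fixed qJ)
          where
          δ-zero : ∀ {a} → a ≢ i → δ i a ≡ 0ℤ
          δ-zero {a} a≢i with i ℕ.≡ᵇ a in eq
          ... | true  = ⊥-elim (a≢i (≡-sym (ℕₚ.≡ᵇ⇒≡ i a (subst T (≡-sym eq) tt))))
          ... | false = refl
        conclude : Located (v ++ w₀) (count (p i) v) → d ≤ count (p i) v
        conclude (located Y z t YJ ~z at-z t≤) = subst (_≤ count (p i) v)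
            (cong proj₂ (Maybeₚ.just-injective (trans (≡-sym at-end) ok-end))) t≤
          where
          z~ : z ~ mp Y
          z~ = ~-trans (++⁺ʳ z (~-sym (mp-wd Y))) (~-trans (~-reflexive (Lₚ.++-assoc (mp Y) (wd Y) z))
            (~-trans (++⁺ˡ (mp Y) (~-trans (~-sym ~z) vw₀~[])) (~-reflexive (Lₚ.++-identityʳ (mp Y)))))
          at-end : search D (encode end) ≡ just (end , t)
          at-end = subst (λ x → search D (encode x) ≡ just (x , t)) (trans (C.st-~ z~) (fixed YJ)) at-z

  []∈cosets : ∀ f x q → q ∈ cosets f x q
  []∈cosets zero    x q = here refl
  []∈cosets (suc f) x q = here refl

  module Conclusion (w₀ : Word n) (longest : IsLongestWord M w₀) (u : List ℕ) (d f g : ℕ) (nbrs : List ℤ)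
                    (ok : verdictFrom cols i J K k u d f g nbrs ≡ true) where

    R : List (List ℕ)
    R = cosets f nbrs []

    start : List ℤ
    start = dominant g (dualPath (reverse u) (L.applyUpTo (δ i) k))

    open Verdict (verdictFrom-sound cols i J K k u d f g nbrs (subst T (≡-sym ok) tt)) renaming (letters to letters?)

    letters : Letters u
    letters = All.map (λ {a} → ℕₚ.<ᵇ⇒< a k) (Allₚ.all⁺ (ℕ._<ᵇ k) u letters?)

    negative-sound : ∀ z → T (negative z) → z <ᶻ 0ℤ
    negative-sound -[1+ _ ] _ = ℤ.-<+

    allNegIn : AllNegIn u
    allNegIn {b} b<k with pos-or-neg (mp u) (p b)
    ... | inj₂ neg = neg
    ... | inj₁ pos = ⊥-elim (ℤₚ.<-asym (Pos⇒height>0 pos) (subst (_<ᶻ 0ℤ) eq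
        (negative-sound _ (Allₚ.applyUpTo⁻ (λ b → H.weight (wd u) (e (p b))) k
          (subst (All (T ∘ negative)) (≡-sym (H-path u letters)) (Allₚ.all⁺ negative (dualPath u ρ) negated)) b<k))))
      where
      eq : H.weight (wd u) (e (p b)) ≡ sum (act (mp u) (e (p b)))
      eq = cong (λ v → sum (act v (e (p b)))) (trans (≡-sym (Lₚ.reverse-map p (reverse u))) (cong mp (Lₚ.reverse-involutive u)))

    start-path : ∃ λ q → AllJ q × start ≡ dualPath q (C.st w₀)
    start-path = let q , qJ , eq = dominant-path g (dualPath (reverse u) (L.applyUpTo (δ i) k))
                 in q , qJ , trans eq (cong (dualPath q) (≡-sym st-w₀))
      where
      st-w₀ : C.st w₀ ≡ dualPath (reverse u) (L.applyUpTo (δ i) k)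
      st-w₀ = trans (C.st-~ (~-sym (complete w₀ longest u letters allNegIn)))
        (trans (cong (λ v → C.st (v ++ outer w₀)) (≡-sym (wd-reverse u)))
        (trans (C.st-path (reverse u) (All-reverse letters) (outer w₀))
          (cong (dualPath (reverse u)) (trans (C.st-outer w₀) st[]-coefficient))))

    minOccurrences≡ : ∀ {v} → IsMinOccurrences M w₀ (p i) v → v ≡ d
    minOccurrences≡ {v} occ@((x , _ , x~ , refl) , _) = ℕₚ.≤-antisym
      (subst (v ≤_) (ℕₚ.≡ᵇ⇒≡ (countℕ i u) d counted) (minOccurrences-upper w₀ longest u letters allNegIn i<k occ))
      (Run.Bound.lower-bound R ([]∈cosets f nbrs []) cosets-J closedᴿ w₀ longest start d
        (orbit R d start) certified start-path x x~)

-- Signed permutations and the classical types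

swap : ℕ → ℕ → ℕ
swap zero    zero          = 1
swap zero    (suc zero)    = 0
swap zero    (suc (suc b)) = suc (suc b)
swap (suc a) zero          = zero
swap (suc a) (suc b)       = suc (swap a b)

swap-left : ∀ a → swap a a ≡ suc a
swap-left zero    = refl
swap-left (suc a) = cong suc (swap-left a)

swap-right : ∀ a → swap a (suc a) ≡ a
swap-right zero    = refl
swap-right (suc a) = cong suc (swap-right a)

swap-above : ∀ {a b} → suc a < b → swap a b ≡ b
swap-above {zero}  {suc (suc b)} _       = refl
swap-above {zero}  {suc zero} (s≤s ())
swap-above {suc a} {suc b} (s≤s lt) = cong suc (swap-above lt)

swap-below : ∀ {a b} → b < a → swap a b ≡ b
swap-below {suc a} {zero}  _        = refl
swap-below {suc a} {suc b} (s≤s lt) = cong suc (swap-below lt)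

swap-involutive : ∀ a b → swap a (swap a b) ≡ b
swap-involutive zero    zero          = refl
swap-involutive zero    (suc zero)    = refl
swap-involutive zero    (suc (suc b)) = refl
swap-involutive (suc a) zero          = refl
swap-involutive (suc a) (suc b)       = cong suc (swap-involutive a b)

-- Signed permutations: (s , b) stands for ±E_b.  For t = 1 (type B) the letter 0 negates E₀; for
-- t = 2 (type D) it exchanges E₀ and -E₁.
Signed : Set
Signed = Bool × ℕ

letter : ℕ → ℕ → Signed → Signed
letter t zero    (s , b) = if b ℕ.<ᵇ t then (not s , t ℕ.∸ suc b) else (s , b)
letter t (suc a) (s , b) = s , swap a b

sig : ℕ → List ℕ → Signed → Signed
sig t []      x = x
sig t (a ∷ u) x = letter t a (sig t u x)

sig-++ : ∀ t u v x → sig t (u ++ v) x ≡ sig t u (sig t v x)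
sig-++ t []      v x = refl
sig-++ t (a ∷ u) v x = cong (letter t a) (sig-++ t u v x)

power : ℕ → List ℕ → List ℕ
power zero    g = []
power (suc m) g = g ++ power m g

countℕ-++ : ∀ j u v → countℕ j (u ++ v) ≡ countℕ j u ℕ.+ countℕ j v
countℕ-++ j []      v = refl
countℕ-++ j (a ∷ u) v with a ℕ.≟ j
... | yes _ = cong suc (countℕ-++ j u v)
... | no  _ = countℕ-++ j u v

countℕ-power : ∀ j m g → countℕ j g ≡ 1 → countℕ j (power m g) ≡ m
countℕ-power j zero    g q = refl
countℕ-power j (suc m) g q = trans (countℕ-++ j g (power m g)) (cong₂ ℕ._+_ q (countℕ-power j m g q))

countℕ-miss : ∀ j u → All (_≢ j) u → countℕ j u ≡ 0
countℕ-miss j []      []        = refl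
countℕ-miss j (a ∷ u) (q ∷ qs) with a ℕ.≟ j
... | yes r = ⊥-elim (q r)
... | no  _ = countℕ-miss j u qs

countℕ-hit : ∀ j u → countℕ j (j ∷ u) ≡ suc (countℕ j u)
countℕ-hit j u with j ℕ.≟ j
... | yes _  = refl
... | no j≢j = ⊥-elim (j≢j refl)

countℕ-skip : ∀ {j a} u → a ≢ j → countℕ j (a ∷ u) ≡ countℕ j u
countℕ-skip {j} {a} u q with a ℕ.≟ j
... | yes r = ⊥-elim (q r)
... | no  _ = refl

All-power : ∀ {P : ℕ → Set} m {g} → All P g → All P (power m g)
All-power zero    ps = []
All-power (suc m) ps = Allₚ.++⁺ ps (All-power m ps)

-- down j m = (j + m - 1) ⋯ (j + 1) j
down : ℕ → ℕ → List ℕ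
down j zero    = []
down j (suc m) = j ℕ.+ m ∷ down j m

down-letters : ∀ j m → All (λ a → j ≤ a × a < j ℕ.+ m) (down j m)
down-letters j zero    = []
down-letters j (suc m) = (ℕₚ.m≤m+n j m , ℕₚ.+-monoʳ-< j (ℕₚ.n<1+n m)) ∷
  All.map (λ (q , r) → q , ℕₚ.<-trans r (ℕₚ.+-monoʳ-< j (ℕₚ.n<1+n m))) (down-letters j m)

down-count : ∀ j m → countℕ j (down j (suc m)) ≡ 1
down-count j zero    = trans (cong (λ a → countℕ j (a ∷ [])) (ℕₚ.+-identityʳ j)) (countℕ-hit j [])
down-count j (suc m) = trans (countℕ-skip (down j (suc m)) (λ q → ℕₚ.<-irrefl (≡-sym q) (ℕₚ.m<m+n j (s≤s z≤n))))
                             (down-count j m)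

sig-down-bottom : ∀ t i m s → sig t (down (suc i) m) (s , i) ≡ (s , i ℕ.+ m)
sig-down-bottom t i zero    s = cong (s ,_) (≡-sym (ℕₚ.+-identityʳ i))
sig-down-bottom t i (suc m) s rewrite sig-down-bottom t i m s =
  cong (s ,_) (trans (swap-left (i ℕ.+ m)) (≡-sym (ℕₚ.+-suc i m)))

sig-down-low : ∀ t i m s b → b < i → sig t (down (suc i) m) (s , b) ≡ (s , b)
sig-down-low t i zero    s b lt = refl
sig-down-low t i (suc m) s b lt rewrite sig-down-low t i m s b lt =
  cong (s ,_) (swap-below (ℕₚ.<-≤-trans lt (ℕₚ.m≤m+n i m)))

sig-down-high : ∀ t i m s b → i ℕ.+ m < b → sig t (down (suc i) m) (s , b) ≡ (s , b)
sig-down-high t i zero    s b lt = refl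
sig-down-high t i (suc m) s b lt
  rewrite sig-down-high t i m s b (ℕₚ.<-trans (ℕₚ.+-monoʳ-< i (ℕₚ.n<1+n m)) lt) =
  cong (s ,_) (swap-above (subst (_< b) (ℕₚ.+-suc i m) lt))

sig-down-mid : ∀ t i m s b → i ≤ b → b < i ℕ.+ m → sig t (down (suc i) m) (s , suc b) ≡ (s , b)
sig-down-mid t i zero    s b le lt = ⊥-elim (ℕₚ.<-irrefl refl (ℕₚ.≤-<-trans le (subst (b <_) (ℕₚ.+-identityʳ i) lt)))
sig-down-mid t i (suc m) s b le lt with b ℕ.≟ i ℕ.+ m
... | yes refl rewrite sig-down-high t i m s (suc (i ℕ.+ m)) (ℕₚ.n<1+n (i ℕ.+ m)) = cong (s ,_) (swap-right (i ℕ.+ m))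
... | no b≢ = trans (cong (letter t (suc i ℕ.+ m)) (sig-down-mid t i m s b le b<))
                    (cong (s ,_) (swap-below b<))
  where b< : b < i ℕ.+ m
        b< = ℕₚ.≤∧≢⇒< (ℕₚ.≤-pred (subst (b <_) (ℕₚ.+-suc i m) lt)) b≢

-- The words below are written with the offset τ = t - 1, so that E_b with b ≥ τ is negated exactly.
module Flips (τ : ℕ) (τ≤1 : τ ≤ 1) where

  t : ℕ
  t = suc τ

  base : List ℕ
  base = 0 ∷ L.applyUpTo suc τ

  negate : ℕ → List ℕ
  negate zero    = base
  negate (suc r) = suc (τ ℕ.+ r) ∷ negate r ++ suc (τ ℕ.+ r) ∷ []

  private
    base-hit : ∀ {τ} → τ ≤ 1 → ∀ s → sig (suc τ) (0 ∷ L.applyUpTo suc τ) (s , τ) ≡ (not s , τ)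
    base-hit {zero}        _ s = refl
    base-hit {suc zero}    _ s = refl
    base-hit {suc (suc _)} (s≤s ()) s

    base-miss : ∀ {τ} → τ ≤ 1 → ∀ s b → τ < b → sig (suc τ) (0 ∷ L.applyUpTo suc τ) (s , b) ≡ (s , b)
    base-miss {zero}        _ s (suc b)       _ = refl
    base-miss {suc zero}    _ s (suc (suc b)) _ = refl
    base-miss {suc zero}    _ s (suc zero)    (s≤s ())
    base-miss {suc (suc _)} (s≤s ()) s b lt

    base-low : ∀ {τ} → τ ≤ 1 → ∀ s b → b < τ → ∃ λ s′ → sig (suc τ) (0 ∷ L.applyUpTo suc τ) (s , b) ≡ (s′ , b)
    base-low {suc zero}    _ s zero _ = not s , refl
    base-low {suc zero}    _ s (suc b) (s≤s ())
    base-low {suc (suc _)} (s≤s ()) s b lt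

  conjugate : ∀ r x → sig t (negate (suc r)) x ≡
              letter t (suc (τ ℕ.+ r)) (sig t (negate r) (letter t (suc (τ ℕ.+ r)) x))
  conjugate r x = cong (letter t (suc (τ ℕ.+ r))) (sig-++ t (negate r) (suc (τ ℕ.+ r) ∷ []) x)

  negate-hit : ∀ r s → sig t (negate r) (s , τ ℕ.+ r) ≡ (not s , τ ℕ.+ r)
  negate-hit zero    s rewrite ℕₚ.+-identityʳ τ = base-hit τ≤1 s
  negate-hit (suc r) s rewrite ℕₚ.+-suc τ r | conjugate r (s , suc (τ ℕ.+ r))
    | swap-right (τ ℕ.+ r) | negate-hit r s = cong (not s ,_) (swap-left (τ ℕ.+ r))

  negate-miss : ∀ r s b → τ ≤ b → b ≢ τ ℕ.+ r → sig t (negate r) (s , b) ≡ (s , b)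
  negate-miss zero    s b le ne = base-miss τ≤1 s b (ℕₚ.≤∧≢⇒< le (λ q → ne (trans (≡-sym q) (≡-sym (ℕₚ.+-identityʳ τ)))))
  negate-miss (suc r) s b le ne rewrite conjugate r (s , b)
    | negate-miss r s (swap (τ ℕ.+ r) b)
        (ℕₚ.≮⇒≥ (λ lt → ℕₚ.<⇒≱ lt (subst (τ ≤_) (trans (≡-sym (swap-involutive (τ ℕ.+ r) b))
           (swap-below (ℕₚ.<-≤-trans lt (ℕₚ.m≤m+n τ r)))) le)))
        (λ q → ne (trans (≡-sym (swap-involutive (τ ℕ.+ r) b)) (trans (cong (swap (τ ℕ.+ r)) q)
           (trans (swap-left (τ ℕ.+ r)) (≡-sym (ℕₚ.+-suc τ r))))))
    = cong (s ,_) (swap-involutive (τ ℕ.+ r) b)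

  negate-low : ∀ r s b → b < τ → ∃ λ s′ → sig t (negate r) (s , b) ≡ (s′ , b)
  negate-low zero    s b lt = base-low τ≤1 s b lt
  negate-low (suc r) s b lt with negate-low r s b lt
  ... | s′ , eq = s′ , trans (conjugate r (s , b))
    (trans (cong (λ c → letter t (suc (τ ℕ.+ r)) (sig t (negate r) (s , c))) fixed)
    (trans (cong (letter t (suc (τ ℕ.+ r))) eq) (cong (s′ ,_) fixed)))
    where fixed : swap (τ ℕ.+ r) b ≡ b
          fixed = swap-below (ℕₚ.<-≤-trans lt (ℕₚ.m≤m+n τ r))

  full : ℕ → List ℕ
  full zero    = []
  full (suc r) = negate r ++ full r

  full-miss : ∀ r s b → τ ℕ.+ r ≤ b → sig t (full r) (s , b) ≡ (s , b)
  full-miss zero    s b le = refl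
  full-miss (suc r) s b le rewrite sig-++ t (negate r) (full r) (s , b)
    | full-miss r s b (ℕₚ.≤-trans (ℕₚ.+-monoʳ-≤ τ (ℕₚ.n≤1+n r)) le) =
    negate-miss r s b (ℕₚ.≤-trans (ℕₚ.m≤m+n τ (suc r)) le)
      (λ q → ℕₚ.<-irrefl (≡-sym q) (ℕₚ.<-≤-trans (ℕₚ.+-monoʳ-< τ (ℕₚ.n<1+n r)) le))

  full-hit : ∀ r s b → τ ≤ b → b < τ ℕ.+ r → sig t (full r) (s , b) ≡ (not s , b)
  full-hit zero    s b le lt = ⊥-elim (ℕₚ.<-irrefl refl (ℕₚ.≤-<-trans le (subst (b <_) (ℕₚ.+-identityʳ τ) lt)))
  full-hit (suc r) s b le lt rewrite sig-++ t (negate r) (full r) (s , b) with b ℕ.≟ τ ℕ.+ r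
  ... | yes refl rewrite full-miss r s b ℕₚ.≤-refl = negate-hit r s
  ... | no ne rewrite full-hit r s b le (ℕₚ.≤∧≢⇒< (ℕₚ.≤-pred (subst (b <_) (ℕₚ.+-suc τ r) lt)) ne) =
        negate-miss r (not s) b le ne

  full-low : ∀ r s b → b < τ → ∃ λ s′ → sig t (full r) (s , b) ≡ (s′ , b)
  full-low zero    s b lt = s , refl
  full-low (suc r) s b lt with full-low r s b lt
  ... | s₁ , eq₁ with negate-low r s₁ b lt
  ...   | s₂ , eq₂ = s₂ , trans (sig-++ t (negate r) (full r) (s , b)) (trans (cong (sig t (negate r)) eq₁) eq₂)

  negate-letters : ∀ r → All (_≤ τ ℕ.+ r) (negate r)
  negate-letters zero    = z≤n ∷ Allₚ.applyUpTo⁺₁ suc τ (λ lt → subst (_ ≤_) (≡-sym (ℕₚ.+-identityʳ τ)) lt)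
  negate-letters (suc r) = le ∷ Allₚ.++⁺
    (All.map (λ q → ℕₚ.≤-trans q (ℕₚ.+-monoʳ-≤ τ (ℕₚ.n≤1+n r))) (negate-letters r)) (le ∷ [])
    where le = ℕₚ.≤-reflexive (≡-sym (ℕₚ.+-suc τ r))

  full-letters : ∀ r → All (_< τ ℕ.+ r) (full r)
  full-letters zero    = []
  full-letters (suc r) = Allₚ.++⁺
    (All.map (λ q → ℕₚ.≤-<-trans q (ℕₚ.+-monoʳ-< τ (ℕₚ.n<1+n r))) (negate-letters r))
    (All.map (λ q → ℕₚ.<-trans q (ℕₚ.+-monoʳ-< τ (ℕₚ.n<1+n r))) (full-letters r))

  -- A signed cycle on E_i, …, E_(i+m), i = τ + r, containing the letter suc i once; its (m+1)-st power
  -- negates them all.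
  cycle : ℕ → ℕ → List ℕ
  cycle r m = down (suc (τ ℕ.+ r)) m ++ negate r

  module _ (r m : ℕ) where
    private
      i : ℕ
      i = τ ℕ.+ r
      τ≤i : τ ≤ i
      τ≤i = ℕₚ.m≤m+n τ r
      g : List ℕ
      g = cycle r m

    cycle-bottom : ∀ s → sig t g (s , i) ≡ (not s , i ℕ.+ m)
    cycle-bottom s rewrite sig-++ t (down (suc i) m) (negate r) (s , i) | negate-hit r s = sig-down-bottom t i m _

    cycle-mid : ∀ s b → i ≤ b → b < i ℕ.+ m → sig t g (s , suc b) ≡ (s , b)
    cycle-mid s b le lt rewrite sig-++ t (down (suc i) m) (negate r) (s , suc b)
      | negate-miss r s (suc b) (ℕₚ.≤-trans τ≤i (ℕₚ.m≤n⇒m≤1+n le)) (λ q → ℕₚ.<-irrefl (≡-sym q) (s≤s le)) =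
      sig-down-mid t i m s b le lt

    cycle-fixed : ∀ s b → τ ≤ b → b < i → sig t g (s , b) ≡ (s , b)
    cycle-fixed s b le lt rewrite sig-++ t (down (suc i) m) (negate r) (s , b)
      | negate-miss r s b le (λ q → ℕₚ.<-irrefl q lt) = sig-down-low t i m s b lt

    cycle-low : ∀ s b → b < τ → ∃ λ s′ → sig t g (s , b) ≡ (s′ , b)
    cycle-low s b lt = let s′ , eq = negate-low r s b lt in
      s′ , trans (sig-++ t (down (suc i) m) (negate r) (s , b)) (trans (cong (sig t (down (suc i) m)) eq)
             (sig-down-low t i m s′ b (ℕₚ.<-≤-trans lt τ≤i)))

    power-shift : ∀ e c s → c ℕ.+ e ≤ m → sig t (power e g) (s , i ℕ.+ (c ℕ.+ e)) ≡ (s , i ℕ.+ c)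
    power-shift zero    c s le = cong (λ x → s , i ℕ.+ x) (ℕₚ.+-identityʳ c)
    power-shift (suc e) c s le = trans (sig-++ t g (power e g) _)
      (trans (cong (sig t g) (trans (cong (λ x → sig t (power e g) (s , i ℕ.+ x)) (ℕₚ.+-suc c e))
                (power-shift e (suc c) s (subst (_≤ m) (ℕₚ.+-suc c e) le))))
        (trans (cong (λ x → sig t g (s , x)) (ℕₚ.+-suc i c))
               (cycle-mid s (i ℕ.+ c) (ℕₚ.m≤m+n i c) (ℕₚ.+-monoʳ-< i (ℕₚ.<-≤-trans (ℕₚ.m<m+n c (s≤s z≤n)) le)))))

    power-+ : ∀ a b x → sig t (power (a ℕ.+ b) g) x ≡ sig t (power a g) (sig t (power b g) x)
    power-+ zero    b x = refl
    power-+ (suc a) b x = trans (sig-++ t g (power (a ℕ.+ b) g) x)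
      (trans (cong (sig t g) (power-+ a b x)) (≡-sym (sig-++ t g (power a g) _)))

    power-negates : ∀ s e f → e ℕ.+ f ≡ m → sig t (power (suc m) g) (s , i ℕ.+ e) ≡ (not s , i ℕ.+ e)
    power-negates s e f eq = trans (cong (λ x → sig t (power x g) (s , i ℕ.+ e))
        (trans (cong suc (trans (≡-sym eq) (ℕₚ.+-comm e f))) (≡-sym (ℕₚ.+-suc f e))))
      (trans (power-+ f (suc e) _) (trans (cong (sig t (power f g))
          (trans (sig-++ t g (power e g) _) (trans (cong (sig t g) (trans (power-shift e 0 s (subst (e ≤_) eq (ℕₚ.m≤m+n e f)))
             (cong (s ,_) (ℕₚ.+-identityʳ i)))) (cycle-bottom s))))
        (trans (cong (λ x → sig t (power f g) (not s , i ℕ.+ x)) (≡-sym eq))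
               (power-shift f e (not s) (ℕₚ.≤-reflexive eq)))))

    power-fixed : ∀ n s b → τ ≤ b → b < i → sig t (power n g) (s , b) ≡ (s , b)
    power-fixed zero    s b le lt = refl
    power-fixed (suc n) s b le lt = trans (sig-++ t g (power n g) _)
      (trans (cong (sig t g) (power-fixed n s b le lt)) (cycle-fixed s b le lt))

    power-low : ∀ n s b → b < τ → ∃ λ s′ → sig t (power n g) (s , b) ≡ (s′ , b)
    power-low zero    s b lt = s , refl
    power-low (suc n) s b lt =
      let s₁ , eq₁ = power-low n s b lt ; s₂ , eq₂ = cycle-low s₁ b lt
      in s₂ , trans (sig-++ t g (power n g) _) (trans (cong (sig t g) eq₁) eq₂)

    turn : List ℕ
    turn = power (suc m) g ++ full r

    turn-negates : ∀ s b → τ ≤ b → b ≤ i ℕ.+ m → sig t turn (s , b) ≡ (not s , b)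
    turn-negates s b le lt with b ℕ.<? i
    ... | yes b<i = trans (sig-++ t (power (suc m) g) (full r) _)
          (trans (cong (sig t (power (suc m) g)) (full-hit r s b le b<i)) (power-fixed (suc m) _ b le b<i))
    ... | no b≮i = trans (sig-++ t (power (suc m) g) (full r) _)
          (trans (cong (sig t (power (suc m) g)) (full-miss r s b (ℕₚ.≮⇒≥ b≮i)))
            (subst (λ x → sig t (power (suc m) g) (s , x) ≡ (not s , x)) b≡
              (power-negates s (b ℕ.∸ i) (i ℕ.+ m ℕ.∸ b) (ℕₚ.+-cancelˡ-≡ i _ _
                 (trans (≡-sym (ℕₚ.+-assoc i (b ℕ.∸ i) _)) (trans (cong (ℕ._+ (i ℕ.+ m ℕ.∸ b)) b≡) (ℕₚ.m+[n∸m]≡n lt)))))))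
      where b≡ : i ℕ.+ (b ℕ.∸ i) ≡ b
            b≡ = ℕₚ.m+[n∸m]≡n (ℕₚ.≮⇒≥ b≮i)

    turn-low : ∀ s b → b < τ → ∃ λ s′ → sig t turn (s , b) ≡ (s′ , b)
    turn-low s b lt =
      let s₁ , eq₁ = full-low r s b lt ; s₂ , eq₂ = power-low (suc m) s₁ b lt
      in s₂ , trans (sig-++ t (power (suc m) g) (full r) _) (trans (cong (sig t (power (suc m) g)) eq₁) eq₂)

    turn-letters : All (_< suc (i ℕ.+ m)) turn
    turn-letters = Allₚ.++⁺
      (All-power (suc m) (Allₚ.++⁺ (All.map proj₂ (down-letters (suc i) m))
        (All.map (λ q → s≤s (ℕₚ.≤-trans q (ℕₚ.m≤m+n i m))) (negate-letters r))))
      (All.map (λ q → ℕₚ.<-trans q (s≤s (ℕₚ.m≤m+n i m))) (full-letters r))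

  turn-count : ∀ r m → countℕ (suc (τ ℕ.+ r)) (turn r (suc m)) ≡ suc (suc m)
  turn-count r m = trans (countℕ-++ j (power (suc (suc m)) (cycle r (suc m))) (full r))
    (trans (cong₂ ℕ._+_ (countℕ-power j (suc (suc m)) (cycle r (suc m))
        (trans (countℕ-++ j (down j (suc m)) (negate r)) (cong₂ ℕ._+_ (down-count j m)
          (countℕ-miss j (negate r) (All.map (λ q e → ℕₚ.<-irrefl e (s≤s q)) (negate-letters r))))))
        (countℕ-miss j (full r) (All.map (λ q e → ℕₚ.<-irrefl e (ℕₚ.<-trans q (ℕₚ.n<1+n _))) (full-letters r))))
      (ℕₚ.+-identityʳ _))
    where j = suc (τ ℕ.+ r)

-- In type D the word pair b negates E_b and E_(b+1) with a single letter 0.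
pair : ℕ → List ℕ
pair zero    = 0 ∷ 1 ∷ []
pair (suc b) = suc b ∷ suc (suc b) ∷ pair b ++ suc (suc b) ∷ suc b ∷ []

pair-conj : ∀ b s c → sig 2 (pair (suc b)) (s , c) ≡
            letter 2 (suc b) (letter 2 (suc (suc b)) (sig 2 (pair b) (s , swap (suc b) (swap b c))))
pair-conj b s c = cong (λ x → letter 2 (suc b) (letter 2 (suc (suc b)) x)) (sig-++ 2 (pair b) (suc (suc b) ∷ suc b ∷ []) (s , c))

pair-left : ∀ b s → sig 2 (pair b) (s , b) ≡ (not s , b)
pair-right : ∀ b s → sig 2 (pair b) (s , suc b) ≡ (not s , suc b)
pair-left zero    s = refl
pair-left (suc b) s rewrite pair-conj b s (suc b) | swap-right b | swap-below {suc b} {b} (ℕₚ.n<1+n b)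
  | pair-left b s | swap-below {suc b} {b} (ℕₚ.n<1+n b) = cong (not s ,_) (swap-left b)
pair-right zero    s = refl
pair-right (suc b) s rewrite pair-conj b s (suc (suc b)) | swap-above {b} {suc (suc b)} (ℕₚ.n<1+n (suc b))
  | swap-right b | pair-right b s | swap-left b = cong (not s ,_) (swap-above {b} {suc (suc b)} (ℕₚ.n<1+n (suc b)))

swaps-injective : ∀ b {c x y} → swap (suc b) (swap b c) ≡ swap (suc b) x → swap b x ≡ y → c ≡ y
swaps-injective b {c} {x} r r′ = trans (≡-sym (swap-involutive b c)) (trans (cong (swap b)
  (trans (≡-sym (swap-involutive (suc b) (swap b c))) (trans (cong (swap (suc b)) r) (swap-involutive (suc b) x)))) r′)

pair-miss : ∀ b s c → c ≢ b → c ≢ suc b → sig 2 (pair b) (s , c) ≡ (s , c)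
pair-miss zero    s zero          p q = ⊥-elim (p refl)
pair-miss zero    s (suc zero)    p q = ⊥-elim (q refl)
pair-miss zero    s (suc (suc c)) p q = refl
pair-miss (suc b) s c p q rewrite pair-conj b s c
  | pair-miss b s (swap (suc b) (swap b c))
      (λ r → p (swaps-injective b (trans r (≡-sym (swap-below (ℕₚ.n<1+n b)))) (swap-left b)))
      (λ r → q (swaps-injective b (trans r (≡-sym (swap-right (suc b)))) (swap-above (ℕₚ.n<1+n (suc b)))))
  | swap-involutive (suc b) (swap b c) = cong (s ,_) (swap-involutive b c)

pair-letters : ∀ b → All (_≤ suc b) (pair b)
pair-letters zero    = z≤n ∷ s≤s z≤n ∷ []
pair-letters (suc b) = ℕₚ.n≤1+n (suc b) ∷ ℕₚ.≤-refl ∷ Allₚ.++⁺ (All.map ℕₚ.m≤n⇒m≤1+n (pair-letters b))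
                         (ℕₚ.≤-refl ∷ ℕₚ.n≤1+n (suc b) ∷ [])

pair-count : ∀ b → countℕ 0 (pair b) ≡ 1
pair-count zero    = refl
pair-count (suc b) = trans (countℕ-++ 0 (pair b) _) (cong (ℕ._+ 0) (pair-count b))

pairs : ℕ → ℕ → List ℕ
pairs o zero    = []
pairs o (suc r) = pair o ++ pairs (suc (suc o)) r

pairs-below : ∀ o r s b → b < o → sig 2 (pairs o r) (s , b) ≡ (s , b)
pairs-below o zero    s b lt = refl
pairs-below o (suc r) s b lt = trans (sig-++ 2 (pair o) (pairs (suc (suc o)) r) _)
  (trans (cong (sig 2 (pair o)) (pairs-below (suc (suc o)) r s b (ℕₚ.m<n⇒m<1+n (ℕₚ.m<n⇒m<1+n lt))))
         (pair-miss o s b (λ q → ℕₚ.<-irrefl q lt) (λ q → ℕₚ.<-irrefl q (ℕₚ.m<n⇒m<1+n lt))))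

pairs-hit : ∀ o r s b → o ≤ b → b < o ℕ.+ (r ℕ.+ r) → sig 2 (pairs o r) (s , b) ≡ (not s , b)
pairs-hit o zero    s b le lt = ⊥-elim (ℕₚ.<-irrefl refl (ℕₚ.≤-<-trans le (subst (b <_) (ℕₚ.+-identityʳ o) lt)))
pairs-hit o (suc r) s b le lt rewrite sig-++ 2 (pair o) (pairs (suc (suc o)) r) (s , b) with b ℕ.≟ o | b ℕ.≟ suc o
... | yes refl | _ rewrite pairs-below (suc (suc b)) r s b (ℕₚ.m<n⇒m<1+n (ℕₚ.n<1+n b)) = pair-left b s
... | no _ | yes refl rewrite pairs-below (suc (suc o)) r s (suc o) (ℕₚ.n<1+n (suc o)) = pair-right o s
... | no b≢o | no b≢so rewrite pairs-hit (suc (suc o)) r s b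
        (ℕₚ.≤∧≢⇒< (ℕₚ.≤∧≢⇒< le (b≢o ∘ ≡-sym)) (b≢so ∘ ≡-sym))
        (subst (b <_) (trans (cong (λ x → o ℕ.+ suc x) (ℕₚ.+-suc r r)) (trans (ℕₚ.+-suc o _) (cong suc (ℕₚ.+-suc o _)))) lt) =
      pair-miss o (not s) b b≢o b≢so

pairs-letters : ∀ o r → All (_< o ℕ.+ (r ℕ.+ r)) (pairs o r)
pairs-letters o zero    = []
pairs-letters o (suc r) rewrite ℕₚ.+-suc r r | ℕₚ.+-suc o (suc (r ℕ.+ r)) | ℕₚ.+-suc o (r ℕ.+ r) =
  Allₚ.++⁺ (All.map (λ q → ℕₚ.≤-trans (s≤s q) (s≤s (s≤s (ℕₚ.m≤m+n o (r ℕ.+ r))))) (pair-letters o)) (pairs-letters (suc (suc o)) r)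

pairs-count : ∀ o r → countℕ 0 (pairs o r) ≡ r
pairs-count o zero    = refl
pairs-count o (suc r) = trans (countℕ-++ 0 (pair o) (pairs (suc (suc o)) r))
  (cong₂ ℕ._+_ (pair-count o) (pairs-count (suc (suc o)) r))

swap-other : ∀ {a b} → b ≢ a → b ≢ suc a → swap a b ≡ b
swap-other {a} {b} p q with ℕₚ.<-cmp b a
... | tri< lt _ _ = swap-below lt
... | tri≈ _ eq _ = ⊥-elim (p eq)
... | tri> _ _ gt = swap-above (ℕₚ.≤∧≢⇒< gt (q ∘ ≡-sym))

swap-< : ∀ {k} a b → suc a < k → b < k → swap a b < k
swap-< a b a<k b<k with b ℕ.≟ a | b ℕ.≟ suc a
... | yes refl | _        = subst (_< _) (≡-sym (swap-left b)) a<k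
... | no _     | yes refl = subst (_< _) (≡-sym (swap-right a)) (ℕₚ.<-trans (ℕₚ.n<1+n a) a<k)
... | no p     | no q     = subst (_< _) (≡-sym (swap-other p q)) b<k

ℤ-cancelˡ : ∀ a {x y} → a + x ≡ a + y → x ≡ y
ℤ-cancelˡ a {x} {y} eq = trans (lem a x) (trans (cong (λ z → - a + z) eq) (≡-sym (lem a y)))
  where lem : ∀ a x → x ≡ - a + (a + x)
        lem = solve-∀

isNeg : ℤ → ℕ
isNeg (+ _)      = 0
isNeg (-[1+ _ ]) = 1

isNeg-neg : ∀ {z} → z <ᶻ 0ℤ → isNeg z ≡ 1
isNeg-neg { -[1+ _ ]} _ = refl
isNeg-neg {+ _} (+<+ ())

isNeg-≥0 : ∀ {z} → 0ℤ ≤ᶻ z → isNeg z ≡ 0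
isNeg-≥0 {+ _} _ = refl

isNeg≤1 : ∀ z → isNeg z ≤ 1
isNeg≤1 (+ _)      = z≤n
isNeg≤1 (-[1+ _ ]) = s≤s z≤n

negatives : (ℕ → ℤ) → ℕ → ℕ → ℕ
negatives f o zero    = 0
negatives f o (suc l) = isNeg (f o) ℕ.+ negatives f (suc o) l

negatives-cong : ∀ {f g} o l → (∀ b → o ≤ b → b < o ℕ.+ l → f b ≡ g b) → negatives f o l ≡ negatives g o l
negatives-cong o zero    q = refl
negatives-cong o (suc l) q = cong₂ ℕ._+_ (cong isNeg (q o ℕₚ.≤-refl (ℕₚ.m<m+n o (s≤s z≤n))))
  (negatives-cong (suc o) l (λ b le lt → q b (ℕₚ.<⇒≤ le) (subst (b <_) (≡-sym (ℕₚ.+-suc o l)) lt)))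

negatives-none : ∀ {f} o l → (∀ b → o ≤ b → b < o ℕ.+ l → 0ℤ ≤ᶻ f b) → negatives f o l ≡ 0
negatives-none o zero    q = refl
negatives-none o (suc l) q = cong₂ ℕ._+_ (isNeg-≥0 (q o ℕₚ.≤-refl (ℕₚ.m<m+n o (s≤s z≤n))))
  (negatives-none (suc o) l (λ b le lt → q b (ℕₚ.<⇒≤ le) (subst (b <_) (≡-sym (ℕₚ.+-suc o l)) lt)))

negatives-all : ∀ {f} o l → (∀ b → o ≤ b → b < o ℕ.+ l → f b <ᶻ 0ℤ) → negatives f o l ≡ l
negatives-all o zero    q = refl
negatives-all o (suc l) q = cong₂ ℕ._+_ (isNeg-neg (q o ℕₚ.≤-refl (ℕₚ.m<m+n o (s≤s z≤n))))
  (negatives-all (suc o) l (λ b le lt → q b (ℕₚ.<⇒≤ le) (subst (b <_) (≡-sym (ℕₚ.+-suc o l)) lt)))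

negatives-swap : ∀ f a o l → o ≤ a → suc a < o ℕ.+ l → negatives (f ∘ swap a) o l ≡ negatives f o l
negatives-swap f a o zero    le lt =
  ⊥-elim (ℕₚ.<-irrefl refl (ℕₚ.<-trans (ℕₚ.≤-<-trans le (ℕₚ.n<1+n a)) (subst (suc a <_) (ℕₚ.+-identityʳ o) lt)))
negatives-swap f a o (suc l) le lt with a ℕ.≟ o
... | no a≢o = cong₂ ℕ._+_ (cong (isNeg ∘ f) (swap-below o<a))
      (negatives-swap f a (suc o) l o<a (subst (suc a <_) (ℕₚ.+-suc o l) lt))
  where o<a = ℕₚ.≤∧≢⇒< le (a≢o ∘ ≡-sym)
negatives-swap f a .a (suc zero) le lt | yes refl =
  ⊥-elim (ℕₚ.<-irrefl refl (subst (suc a <_) (ℕₚ.+-comm a 1) lt))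
negatives-swap f a .a (suc (suc l)) le lt | yes refl = trans
  (cong₂ ℕ._+_ (cong (isNeg ∘ f) (swap-left a)) (cong₂ ℕ._+_ (cong (isNeg ∘ f) (swap-right a))
    (negatives-cong (suc (suc a)) l (λ b le _ → cong f (swap-above le)))))
  (trans (≡-sym (ℕₚ.+-assoc (isNeg (f (suc a))) (isNeg (f a)) rest))
    (trans (cong (ℕ._+ rest) (ℕₚ.+-comm (isNeg (f (suc a))) (isNeg (f a)))) (ℕₚ.+-assoc (isNeg (f a)) (isNeg (f (suc a))) rest)))
  where rest = negatives f (suc (suc a)) l

negatives-prefix : ∀ {f g} q o l → (∀ b → o ℕ.+ q ≤ b → f b ≡ g b) →
                   negatives f o (q ℕ.+ l) ≤ q ℕ.+ negatives g o (q ℕ.+ l)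
negatives-prefix zero    o l h = ℕₚ.≤-reflexive (negatives-cong o l (λ b le _ → h b (subst (_≤ b) (≡-sym (ℕₚ.+-identityʳ o)) le)))
negatives-prefix {f} {g} (suc q) o l h = ℕₚ.≤-trans
  (ℕₚ.+-mono-≤ (isNeg≤1 (f o)) (negatives-prefix q (suc o) l (λ b le → h b (subst (_≤ b) (≡-sym (ℕₚ.+-suc o q)) le))))
  (s≤s (ℕₚ.+-monoʳ-≤ q (ℕₚ.m≤n+m _ (isNeg (g o)))))

χ : ℕ → ℕ → ℤ
χ (suc a)       (suc b)       = χ a b
χ zero          zero          = - + 2
χ zero          (suc zero)    = 1ℤ
χ (suc zero)    zero          = 1ℤ
χ zero          (suc (suc b)) = 0ℤ
χ (suc (suc a)) zero          = 0ℤ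

chain-entry : ∀ a b x y → entry (chain a b) x y ≡ χ a b
chain-entry zero          zero          x y = refl
chain-entry zero          (suc zero)    x y = refl
chain-entry (suc zero)    zero          x y = refl
chain-entry zero          (suc (suc b)) x y = refl
chain-entry (suc (suc a)) zero          x y = refl
chain-entry (suc a)       (suc b)       x y = chain-entry a b x y

chain≢4 : ∀ a b → chain a b ≢ 4
chain≢4 zero          zero          ()
chain≢4 zero          (suc zero)    ()
chain≢4 (suc zero)    zero          ()
chain≢4 zero          (suc (suc b)) ()
chain≢4 (suc (suc a)) zero          ()
chain≢4 (suc a)       (suc b)       = chain≢4 a b

-- γ a b = [a = b + 1] - [a = b]
γ : ℕ → ℕ → ℤ
γ (suc a)       (suc b) = γ a b
γ zero          zero    = - 1ℤ
γ (suc zero)    zero    = 1ℤ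
γ (suc (suc a)) zero    = 0ℤ
γ zero          (suc b) = 0ℤ

γ-step : ∀ a b → γ a b ≡ γ (suc a) b + χ a b
γ-step zero          zero          = refl
γ-step zero          (suc zero)    = refl
γ-step zero          (suc (suc b)) = refl
γ-step (suc zero)    zero          = refl
γ-step (suc (suc a)) zero          = refl
γ-step (suc a)       (suc b)       = γ-step a b

γ-left : ∀ a → γ (suc a) a ≡ 1ℤ
γ-left zero    = refl
γ-left (suc a) = γ-left a

γ-right : ∀ a → γ a a ≡ - 1ℤ
γ-right zero    = refl
γ-right (suc a) = γ-right a

γ-other : ∀ a b → b ≢ a → b ≢ suc a → γ (suc a) b ≡ 0ℤ
γ-other zero    zero          p q = ⊥-elim (p refl)
γ-other zero    (suc zero)    p q = ⊥-elim (q refl)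
γ-other zero    (suc (suc b)) p q = refl
γ-other (suc a) zero          p q = refl
γ-other (suc a) (suc b)       p q = γ-other a b (p ∘ cong suc) (q ∘ cong suc)

module Labels {n : ℕ} (M : CoxeterMatrix n) (m≤4 : ∀ i j → m M i j ≤ 4)
  {lab : ℕ → ℕ → ℕ} {k : ℕ} (E : Embedding M lab k) where
  open Tits M m≤4
  open Embedding E

  p-≢ : ∀ {a b} → a < k → b < k → a ≢ b → p a ≢ p b
  p-≢ a<k b<k a≢b q = a≢b (inj a<k b<k q)

  π-label : ∀ {a b} → a < k → b < k → lab a b ≢ 4 → π (p a) (e (p b)) ≡ entry (lab a b) a b
  π-label {a} {b} a<k b<k ≢4 with a ℕ.≟ b
  ... | yes refl rewrite ≡-sym (lab≡ a<k a<k) | diag M (p a) = π-same (p a)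
  ... | no a≢b = trans (π-diff (p-≢ a<k b<k a≢b)) (go (bond (p a) (p b) (p-≢ a<k b<k a≢b)))
    where
    lab′ : ∀ {v} → m M (p a) (p b) ≡ v → lab a b ≡ v
    lab′ q = trans (≡-sym (lab≡ a<k b<k)) q
    go : Bond (p a) (p b) → c (p b) (p a) ≡ entry (lab a b) a b
    go (bond₂ mm q r)  rewrite lab′ mm = r
    go (bond₃ mm q r)  rewrite lab′ mm = r
    go (bond₄ mm q r)  = ⊥-elim (≢4 (lab′ mm))
    go (bond₄′ mm q r) = ⊥-elim (≢4 (lab′ mm))

  c-four : ∀ {a b} → a < k → b < k → a ≢ b → lab a b ≡ 4 → c (p a) (p b) * c (p b) (p a) ≡ + 2 × 0ℤ <ᶻ c (p a) (p b)
  c-four {a} {b} a<k b<k a≢b l with bond (p a) (p b) (p-≢ a<k b<k a≢b)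
  ... | bond₂ mm _ _ = ⊥-elim (case trans (≡-sym l) (trans (≡-sym (lab≡ a<k b<k)) mm) of λ ())
  ... | bond₃ mm _ _ = ⊥-elim (case trans (≡-sym l) (trans (≡-sym (lab≡ a<k b<k)) mm) of λ ())
  ... | bond₄ _ q r rewrite q | r = refl , +<+ (s≤s z≤n)
  ... | bond₄′ _ q r rewrite q | r = refl , +<+ (s≤s z≤n)

climb : ∀ {n} → (Fin n → ℤ) → ℤ → (ℕ → Fin n → ℤ) → ℕ → Fin n → ℤ
climb E₀ d x zero    j = E₀ j
climb E₀ d x (suc b) j = climb E₀ d x b j + d * x (suc b) j

-- Root vectors E_b with E_b - E_(b-1) a positive multiple of α_b, which a diagram of type B (τ = 0) or
-- D (τ = 1) permutes up to sign.
record SignedBasis {n : ℕ} (M : CoxeterMatrix n) (m≤4 : ∀ i j → m M i j ≤ 4) (p : ℕ → Fin n) (k τ : ℕ) : Set where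
  open Tits M m≤4
  field
    τ≤1 : τ ≤ 1
    t<k : suc τ < k
    d   : ℤ
    d>0 : 0ℤ <ᶻ d
    E₀  : V
  E : ℕ → V
  E = climb E₀ d (λ b → e (p b))
  field
    π-chain : ∀ a b → suc a < k → suc b < k → π (p (suc a)) (e (p (suc b))) ≡ χ a b
    π-E₀    : ∀ a → suc a < k → π (p (suc a)) E₀ ≡ d * γ (suc a) 0
    π-fix   : ∀ b → suc τ ≤ b → b < k → π (p 0) (E b) ≡ 0ℤ
    s-low   : ∀ b → b < suc τ → s (p 0) (E b) ≗ (λ j → - E (τ ℕ.∸ b) j)
    E₀-zero : E₀ (p 0) ≡ 1ℤ
    E₀-high : ∀ a → suc τ ≤ a → a < k → E₀ (p a) ≡ 0ℤ

module SignedChain {n : ℕ} (M : CoxeterMatrix n) (m≤4 : ∀ i j → m M i j ≤ 4)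
  (p : ℕ → Fin n) (k τ : ℕ) (inj : ∀ {a b} → a < k → b < k → p a ≡ p b → a ≡ b)
  (basis : SignedBasis M m≤4 p k τ) where

  open Tits M m≤4
  open SignedBasis basis

  t : ℕ
  t = suc τ

  π-E : ∀ a b → suc a < k → b < k → π (p (suc a)) (E b) ≡ d * γ (suc a) b
  π-E a zero    a<k b<k = π-E₀ a a<k
  π-E a (suc b) a<k b<k = trans (π-+ (p (suc a)) (E b) (λ j → d * e (p (suc b)) j))
    (trans (cong₂ _+_ (π-E a b a<k (ℕₚ.<-trans (ℕₚ.n<1+n b) b<k))
                      (trans (π-* (p (suc a)) d (e (p (suc b)))) (cong (d *_) (π-chain a b a<k b<k))))
      (trans (≡-sym (ℤₚ.*-distribˡ-+ d (γ (suc a) b) (χ a b))) (cong (d *_) (≡-sym (γ-step a b)))))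

  s-fix : ∀ i x → π i x ≡ 0ℤ → s i x ≗ x
  s-fix i x q j = trans (cong (λ z → x j + z * e i j) q) (ℤₚ.+-identityʳ (x j))

  signed : Signed → V
  signed (true  , b) = E b
  signed (false , b) = λ j → - E b j

  signed-not : ∀ s b j → signed (not s , b) j ≡ - signed (s , b) j
  signed-not true  b j = refl
  signed-not false b j = ≡-sym (ℤₚ.neg-involutive (E b j))

  s-suc : ∀ a b → suc a < k → b < k → s (p (suc a)) (E b) ≗ E (swap a b)
  s-suc a b a<k b<k j with b ℕ.≟ a | b ℕ.≟ suc a
  ... | yes refl | _ = trans
    (cong (λ z → E a j + z * e (p (suc a)) j) (trans (π-E a a a<k b<k) (trans (cong (d *_) (γ-left a)) (ℤₚ.*-identityʳ d))))
    (cong (λ z → E z j) (≡-sym (swap-left a)))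
  ... | no _ | yes refl = trans
    (cong (λ z → E (suc a) j + z * e (p (suc a)) j) (trans (π-E a (suc a) a<k b<k) (cong (d *_) (γ-right a))))
    (trans (lem (E a j) d (e (p (suc a)) j)) (cong (λ z → E z j) (≡-sym (swap-right a))))
    where lem : ∀ x d y → (x + d * y) + d * (- 1ℤ) * y ≡ x
          lem = solve-∀
  ... | no q | no r rewrite swap-other q r = s-fix (p (suc a)) (E b) (trans (π-E a b a<k b<k)
          (trans (cong (d *_) (γ-other a b q r)) (ℤₚ.*-zeroʳ d))) j

  s-E : ∀ {a b} → a < k → b < k → s (p a) (E b) ≗ signed (letter t a (true , b))
  s-E {suc a} {b} a<k b<k j = s-suc a b a<k b<k j
  s-E {zero}  {b} a<k b<k j with b ℕ.<ᵇ t in eq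
  ... | true  = s-low b (ℕₚ.<ᵇ⇒< b t (subst T (≡-sym eq) tt)) j
  ... | false = s-fix (p 0) (E b) (π-fix b (ℕₚ.≮⇒≥ (λ lt → subst T eq (ℕₚ.<⇒<ᵇ lt))) b<k) j

  letter-not : ∀ a s b → letter t a (not s , b) ≡ (not (proj₁ (letter t a (s , b))) , proj₂ (letter t a (s , b)))
  letter-not (suc a) s b = refl
  letter-not zero    s b with b ℕ.<ᵇ t
  ... | true  = refl
  ... | false = refl

  s-signed : ∀ {a} s {b} → a < k → b < k → Lattice.s M m≤4 (p a) (signed (s , b)) ≗ signed (letter t a (s , b))
  s-signed     true  a<k b<k j = s-E a<k b<k j
  s-signed {a} false {b} a<k b<k j = trans (act-neg (p a ∷ []) (E b) j)
    (trans (cong -_ (s-E a<k b<k j)) (trans (≡-sym (signed-not (proj₁ (letter t a (true , b))) _ j))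
      (cong (λ x → signed x j) (≡-sym (letter-not a true b)))))

  letter-< : ∀ a s b → a < k → b < k → proj₂ (letter t a (s , b)) < k
  letter-< (suc a) s b a<k b<k = swap-< a b a<k b<k
  letter-< zero    s b a<k b<k with b ℕ.<ᵇ t
  ... | true  = ℕₚ.≤-<-trans (ℕₚ.m∸n≤m τ b) (ℕₚ.<-trans (ℕₚ.n<1+n τ) t<k)
  ... | false = b<k

  act-signed : ∀ {u} → All (_< k) u → ∀ s {b} → b < k →
    (act (L.map p u) (signed (s , b)) ≗ signed (sig t u (s , b))) × proj₂ (sig t u (s , b)) < k
  act-signed []         s b<k = (λ _ → refl) , b<k
  act-signed {a ∷ u} (a<k ∷ ls) s {b} b<k =
    let eq , lt = act-signed ls s b<k
        s′ , b′ = sig t u (s , b)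
    in (λ j → trans (s-cong (p a) eq j) (s-signed s′ a<k lt j)) , letter-< a s′ b′ a<k lt

  e-p : ∀ {a b} → a < k → b < k → a ≢ b → e (p a) (p b) ≡ 0ℤ
  e-p a<k b<k a≢b = e-diff (λ q → a≢b (inj a<k b<k q))

  0<k : 0 < k
  0<k = ℕₚ.<-trans (s≤s z≤n) t<k

  E-at-0 : ∀ b → b < k → E b (p 0) ≡ 1ℤ
  E-at-0 zero    b<k = E₀-zero
  E-at-0 (suc b) b<k = trans (cong₂ (λ x y → x + d * y) (E-at-0 b (ℕₚ.<-trans (ℕₚ.n<1+n b) b<k)) (e-p b<k 0<k (λ ())))
    (cong (λ z → 1ℤ + z) (ℤₚ.*-zeroʳ d))

  E-before : ∀ j b → t ≤ j → j < k → b < j → E b (p j) ≡ 0ℤ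
  E-before j zero    t≤j j<k b<j = E₀-high j t≤j j<k
  E-before j (suc b) t≤j j<k b<j = trans (cong₂ (λ x y → x + d * y) (E-before j b t≤j j<k (ℕₚ.<-trans (ℕₚ.n<1+n b) b<j))
      (e-p (ℕₚ.<-trans b<j j<k) j<k (λ q → ℕₚ.<-irrefl q b<j))) (trans (ℤₚ.+-identityˡ (d * 0ℤ)) (ℤₚ.*-zeroʳ d))

  E-from : ∀ j b → t ≤ j → j ≤ b → b < k → E b (p j) ≡ d
  E-from j zero    t≤j j≤b b<k = ⊥-elim (ℕₚ.<⇒≱ (ℕₚ.<-≤-trans (s≤s z≤n) t≤j) j≤b)
  E-from j (suc b) t≤j j≤b b<k with j ℕ.≟ suc b
  ... | yes refl = trans (cong₂ (λ x y → x + d * y) (E-before (suc b) b t≤j b<k (ℕₚ.n<1+n b)) (e-same (p (suc b))))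
          (trans (ℤₚ.+-identityˡ (d * 1ℤ)) (ℤₚ.*-identityʳ d))
  ... | no j≢ = trans (cong₂ (λ x y → x + d * y)
          (E-from j b t≤j (ℕₚ.≤-pred (ℕₚ.≤∧≢⇒< j≤b j≢)) (ℕₚ.<-trans (ℕₚ.n<1+n b) b<k))
          (e-p b<k (ℕₚ.≤-<-trans j≤b b<k) (j≢ ∘ ≡-sym)))
          (trans (cong (λ z → d + z) (ℤₚ.*-zeroʳ d)) (ℤₚ.+-identityʳ d))

  cancel-d : ∀ x y → d * x ≡ d * y → x ≡ y
  cancel-d x y = ℤₚ.*-cancelˡ-≡ d x y {{ℤ.>-nonZero d>0}}

  Negates : List ℕ → Set
  Negates u = ∀ b → τ ≤ b → b < k → sig t u (true , b) ≡ (false , b)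

  Keeps : List ℕ → Set
  Keeps u = ∀ b → b < τ → ∃ λ s′ → sig t u (true , b) ≡ (s′ , b)

  act-negates : ∀ {u} → All (_< k) u → Negates u → ∀ b → τ ≤ b → b < k → act (L.map p u) (E b) ≗ (λ j → - E b j)
  act-negates ls neg b le lt j = trans (proj₁ (act-signed ls true lt) j) (cong (λ x → signed x j) (neg b le lt))

  negates-high : ∀ {u} → All (_< k) u → Negates u → ∀ b → τ ≤ b → suc b < k → Neg (act (L.map p u) (e (p (suc b))))
  negates-high {u} ls neg b le lt = Neg-cong (≡-sym ∘ eq) (Pos-neg-neg (Pos-e (p (suc b))))
    where
    w = L.map p u
    x = act w (e (p (suc b)))
    sum≡ : ∀ j → - (E b j + d * e (p (suc b)) j) ≡ - E b j + d * x j
    sum≡ j = trans (≡-sym (act-negates ls neg (suc b) (ℕₚ.m≤n⇒m≤1+n le) lt j))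
      (trans (act-+ w (E b) (λ l → d * e (p (suc b)) l) j)
        (cong₂ _+_ (act-negates ls neg b le (ℕₚ.<-trans (ℕₚ.n<1+n b) lt) j) (act-* w d (e (p (suc b))) j)))
    eq : x ≗ (λ j → - e (p (suc b)) j)
    eq j = cancel-d (x j) (- e (p (suc b)) j) (ℤ-cancelˡ (- E b j) (trans (≡-sym (sum≡ j)) (lem (E b j) d (e (p (suc b)) j))))
      where
      lem : ∀ a d y → - (a + d * y) ≡ - a + d * (- y)
      lem = solve-∀

module SignedBounds {n : ℕ} (M : CoxeterMatrix n) (m≤4 : ∀ i j → m M i j ≤ 4)
  (p : ℕ → Fin n) (k τ : ℕ) (inj : ∀ {a b} → a < k → b < k → p a ≡ p b → a ≡ b) (closed : Closed M p k)
  (basis : SignedBasis M m≤4 p k τ)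
  (E₀-out : ∀ l → (∀ {b} → b < k → p b ≢ l) → Lattice.π M m≤4 l (SignedBasis.E₀ basis) ≡ 0ℤ)
  (low : ∀ {u} → All (_< k) u → SignedChain.Negates M m≤4 p k τ inj basis u → SignedChain.Keeps M m≤4 p k τ inj basis u →
         ∀ b → b ≤ τ → Tits.Neg M m≤4 (Lattice.act M m≤4 (L.map p u) (Lattice.e M m≤4 (p b))))
  (w₀ : Word n) (longest : IsLongestWord M w₀) where

  open Component M m≤4 p k inj closed
  open SignedBasis basis
  open SignedChain M m≤4 p k τ inj basis using (t; Negates; Keeps; negates-high; act-negates; s-suc; s-fix; 0<k; E-at-0; E-before; E-from; e-p)
  open Longest w₀ longest

  t≤k : t ≤ k
  t≤k = ℕₚ.<⇒≤ t<k

  allNegIn : ∀ {u} → Letters u → Negates u → Keeps u → AllNegIn u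
  allNegIn ls neg keep {b} b<k with b ℕ.≤? τ
  ... | yes b≤τ = low ls neg keep b b≤τ
  allNegIn ls neg keep {zero}  b<k | no b≰τ = ⊥-elim (b≰τ z≤n)
  allNegIn ls neg keep {suc b} b<k | no b≰τ = negates-high ls neg b (ℕₚ.≤-pred (ℕₚ.≰⇒> b≰τ)) b<k

  open Flips τ τ≤1 hiding (t)

  τ+k∸τ : τ ℕ.+ (k ℕ.∸ τ) ≡ k
  τ+k∸τ = ℕₚ.m+[n∸m]≡n (ℕₚ.≤-trans (ℕₚ.n≤1+n τ) t≤k)

  U : List ℕ
  U = full (k ℕ.∸ τ)

  U-letters : Letters U
  U-letters = subst (λ x → All (_< x) U) τ+k∸τ (full-letters (k ℕ.∸ τ))

  U-negates : Negates U
  U-negates b le lt = full-hit (k ℕ.∸ τ) true b le (subst (b <_) (≡-sym τ+k∸τ) lt)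

  U-keeps : Keeps U
  U-keeps b lt = full-low (k ℕ.∸ τ) true b lt

  act-w₀ : ∀ b → τ ≤ b → b < k → act w₀ (E b) ≗ (λ j → - E b j)
  act-w₀ b le lt j = trans (act-~ (~-sym (complete w₀ longest U U-letters (allNegIn U-letters U-negates U-keeps))) (E b) j)
    (trans (cong (λ f → f j) (act-++ (mp U) (outer w₀) (E b)))
      (trans (act-cong (mp U) (outer-E w₀ b lt) j) (act-negates U-letters U-negates b le lt j)))
    where
    π-out : ∀ l → Outside l → ∀ b → b < k → π l (E b) ≡ 0ℤ
    π-out l out zero    b<k = E₀-out l out
    π-out l out (suc b) b<k = trans (π-+ l (E b) (λ j → d * e (p (suc b)) j))
      (cong₂ _+_ (π-out l out b (ℕₚ.<-trans (ℕₚ.n<1+n b) b<k)) (trans (π-* l d (e (p (suc b))))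
        (trans (cong (d *_) (trans (π-diff (out b<k ∘ ≡-sym)) (c-out b<k out))) (ℤₚ.*-zeroʳ d))))
    outer-E : ∀ w b → b < k → act (outer w) (E b) ≗ E b
    outer-E [] b b<k j = refl
    outer-E (l ∷ w) b b<k with inside? l
    ... | yes _  = outer-E w b b<k
    ... | no ¬in = λ j → trans (s-cong l (outer-E w b b<k) j) (s-fix l (E b) (π-out l (outside ¬in) b b<k) j)

  E-out : ∀ {l} → Outside l → ∀ b → b < k → s l (E b) ≗ E b
  E-out {l} out b b<k = s-fix l (E b) (π-out b b<k)
    where
    π-out : ∀ b → b < k → π l (E b) ≡ 0ℤ
    π-out zero    b<k = E₀-out l out
    π-out (suc b) b<k = trans (π-+ l (E b) (λ j → d * e (p (suc b)) j))
      (cong₂ _+_ (π-out b (ℕₚ.<-trans (ℕₚ.n<1+n b) b<k)) (trans (π-* l d (e (p (suc b))))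
        (trans (cong (d *_) (trans (π-diff (out b<k ∘ ≡-sym)) (c-out b<k out))) (ℤₚ.*-zeroʳ d))))

  module Coordinates (j : ℕ) (j<k : j < k) where
    open Weights M m≤4 (coefficient (p j))

    x : Word n → ℕ → ℤ
    x w b = weight w (E b)

    x-suc : ∀ {a} w b → suc a < k → b < k → x (p (suc a) ∷ w) b ≡ x w (swap a b)
    x-suc {a} w b a<k b<k = trans (weight-∷ (p (suc a)) w (E b)) (weight-cong w (s-suc a b a<k b<k))

    x-zero-high : ∀ w b → t ≤ b → b < k → x (p 0 ∷ w) b ≡ x w b
    x-zero-high w b t≤b b<k = trans (weight-∷ (p 0) w (E b)) (weight-cong w (s-fix (p 0) (E b) (π-fix b t≤b b<k)))

    x-zero-low : ∀ w b → b < t → x (p 0 ∷ w) b ≡ - x w (τ ℕ.∸ b)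
    x-zero-low w b b<t = trans (weight-∷ (p 0) w (E b)) (trans (weight-cong w (s-low b b<t))
      (act-neg (reverse w) (E (τ ℕ.∸ b)) (p j)))

    x-out : ∀ {l} → Outside l → ∀ w b → b < k → x (l ∷ w) b ≡ x w b
    x-out {l} out w b b<k = trans (weight-∷ l w (E b)) (weight-cong w (E-out out b b<k))

    x-end : ∀ {w} → w ~ w₀ → ∀ b → τ ≤ b → b < k → x w b ≡ - E b (p j)
    x-end {w} w~ b le lt = trans (weight-~ (~-trans w~ (~-sym (~w₀ (reverse w₀) (AllNeg-reverse w₀ AllNeg-w₀)))) (E b))
      (trans (cong (λ v → act v (E b) (p j)) (Lₚ.reverse-involutive w₀)) (act-w₀ b le lt (p j)))

  -- Lower bound for j ≥ t: each occurrence of j makes at most one more of the coordinates x_b, b ≥ j,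
  -- negative, and the first one only moves a zero into these coordinates.
  module High (j m : ℕ) (t≤j : t ≤ j) (j+m : j ℕ.+ suc m ≡ k) where
    j<k : j < k
    j<k = subst (j <_) j+m (ℕₚ.m<m+n j (s≤s z≤n))
    open Coordinates j j<k

    Initial : Word n → Set
    Initial w = ∀ b → b < k → x w b ≡ E b (p j)

    N⁻ : Word n → ℕ
    N⁻ w = negatives (x w) j (suc m)

    in-range : ∀ {b} → b < j ℕ.+ suc m → b < k
    in-range = subst (_ <_) j+m

    keep : ∀ u w → (∀ b → j ≤ b → b < k → x u b ≡ x w b) → N⁻ u ≡ N⁻ w
    keep u w q = negatives-cong j (suc m) (λ b le lt → q b le (in-range lt))

    Inv : Word n → Set
    Inv w = Initial w ⊎ suc (N⁻ w) ≤ count (p j) w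

    count-j : ∀ w → count (p j) (p j ∷ w) ≡ suc (count (p j) w)
    count-j w with p j F.≟ p j
    ... | yes _ = refl
    ... | no q  = ⊥-elim (q refl)

    preserve : ∀ l w → (Initial w → Initial (l ∷ w)) → N⁻ (l ∷ w) ≡ N⁻ w → Inv w → Inv (l ∷ w)
    preserve l w init eq (inj₁ i) = inj₁ (init i)
    preserve l w init eq (inj₂ q) = inj₂ (ℕₚ.≤-trans (subst (λ z → suc z ≤ count (p j) w) (≡-sym eq) q) (count≤count-∷ (p j) l w))

    E-swap : ∀ a b → suc a < k → b < k → suc a ≢ j → E (swap a b) (p j) ≡ E b (p j)
    E-swap a b a<k b<k a≢j with b ℕ.≟ a | b ℕ.≟ suc a
    ... | yes refl | _ rewrite swap-left b = same
      where same : E b (p j) + d * e (p (suc b)) (p j) ≡ E b (p j)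
            same = trans (cong (λ z → E b (p j) + d * z) (e-p a<k j<k a≢j))
                     (trans (cong (λ z → E b (p j) + z) (ℤₚ.*-zeroʳ d)) (ℤₚ.+-identityʳ (E b (p j))))
    ... | no _ | yes refl rewrite swap-right a = ≡-sym
      (trans (cong (λ z → E a (p j) + d * z) (e-p a<k j<k a≢j))
             (trans (cong (λ z → E a (p j) + z) (ℤₚ.*-zeroʳ d)) (ℤₚ.+-identityʳ (E a (p j)))))
    ... | no q | no r rewrite swap-other q r = refl

    advance : ∀ l w → Inv w → Inv (l ∷ w)
    advance l w inv with inside? l
    ... | no ¬in = preserve l w (λ i b b<k → trans (x-out (outside ¬in) w b b<k) (i b b<k))
                     (keep (l ∷ w) w (λ b _ b<k → x-out (outside ¬in) w b b<k)) inv
    advance .(p 0) w inv | yes (zero , _ , refl) = preserve (p 0) w init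
        (keep (p 0 ∷ w) w (λ b le b<k → x-zero-high w b (ℕₚ.≤-trans t≤j le) b<k)) inv
      where
      init : Initial w → Initial (p 0 ∷ w)
      init i b b<k with b ℕ.<? t
      ... | no b≮t  = trans (x-zero-high w b (ℕₚ.≮⇒≥ b≮t) b<k) (i b b<k)
      ... | yes b<t = trans (x-zero-low w b b<t) (trans (cong -_ (trans (i (τ ℕ.∸ b) (ℕₚ.<-trans τb<t t<k))
            (E-before j (τ ℕ.∸ b) t≤j j<k (ℕₚ.<-≤-trans τb<t t≤j))))
            (≡-sym (E-before j b t≤j j<k (ℕₚ.<-≤-trans b<t t≤j))))
        where τb<t : τ ℕ.∸ b < t
              τb<t = s≤s (ℕₚ.m∸n≤m τ b)
    advance .(p (suc a)) w inv | yes (suc a , a<k , refl) with suc a ℕ.≟ j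
    ... | no a≢j = preserve (p (suc a)) w (λ i b b<k → trans (x-suc w b a<k b<k)
            (trans (i (swap a b) (swap-< a b a<k b<k)) (E-swap a b a<k b<k a≢j))) eq inv
      where
      eq : N⁻ (p (suc a) ∷ w) ≡ N⁻ w
      eq with ℕₚ.<-cmp (suc a) j
      ... | tri≈ _ q _  = ⊥-elim (a≢j q)
      ... | tri< lt _ _ = keep (p (suc a) ∷ w) w (λ b le b<k → trans (x-suc w b a<k b<k) (cong (x w) (swap-above (ℕₚ.<-≤-trans lt le))))
      ... | tri> _ _ gt = trans (negatives-cong j (suc m) (λ b le lt → x-suc w b a<k (in-range lt)))
            (negatives-swap (x w) a j (suc m) (ℕₚ.≤-pred gt) (subst (suc a <_) (≡-sym j+m) a<k))
    ... | yes refl = bump inv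
      where
      bump : Inv w → Inv (p (suc a) ∷ w)
      bump (inj₁ i) = inj₂ (subst₂ (λ y z → suc y ≤ z) (≡-sym none) (≡-sym (count-j w)) (s≤s z≤n))
        where
        none : N⁻ (p (suc a) ∷ w) ≡ 0
        none = negatives-none (suc a) (suc m) nonneg
          where
          nonneg : ∀ b → suc a ≤ b → b < suc a ℕ.+ suc m → 0ℤ ≤ᶻ x (p (suc a) ∷ w) b
          nonneg b le lt with b ℕ.≟ suc a
          ... | yes refl = ℤₚ.≤-reflexive (≡-sym (trans (x-suc w b a<k (in-range lt)) (trans (cong (x w) (swap-right a))
                  (trans (i a (ℕₚ.<-trans (ℕₚ.n<1+n a) a<k)) (E-before (suc a) a t≤j j<k (ℕₚ.n<1+n a))))))
          ... | no b≢ = subst (0ℤ ≤ᶻ_) (≡-sym (trans (x-suc w b a<k (in-range lt))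
                  (trans (cong (x w) (swap-above (ℕₚ.≤∧≢⇒< le (b≢ ∘ ≡-sym))))
                  (trans (i b (in-range lt)) (E-from (suc a) b t≤j le (in-range lt)))))) (ℤₚ.<⇒≤ d>0)
      bump (inj₂ q) = inj₂ (subst (suc (N⁻ (p (suc a) ∷ w)) ≤_) (≡-sym (count-j w)) (s≤s (ℕₚ.≤-trans
        (ℕₚ.+-mono-≤ (isNeg≤1 (x (p (suc a) ∷ w) (suc a))) (ℕₚ.≤-reflexive rest))
        (ℕₚ.≤-trans (s≤s (ℕₚ.m≤n+m _ (isNeg (x w (suc a))))) q))))
        where
        rest : negatives (x (p (suc a) ∷ w)) (suc (suc a)) m ≡ negatives (x w) (suc (suc a)) m
        rest = negatives-cong (suc (suc a)) m (λ b le lt → trans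
          (x-suc w b a<k (in-range (subst (b <_) (≡-sym (ℕₚ.+-suc (suc a) m)) lt))) (cong (x w) (swap-above le)))

    invariant : ∀ w → Inv w
    invariant []      = inj₁ (λ b b<k → refl)
    invariant (l ∷ w) = advance l w (invariant w)

    x-end-neg : ∀ {w} → w ~ w₀ → ∀ b → j ≤ b → b < k → x w b <ᶻ 0ℤ
    x-end-neg w~ b le lt = subst (_<ᶻ 0ℤ) (≡-sym (trans (x-end w~ b (ℕₚ.≤-trans (ℕₚ.n≤1+n τ) (ℕₚ.≤-trans t≤j le)) lt)
      (cong -_ (E-from j b t≤j le lt)))) (ℤₚ.neg-mono-< d>0)

    lower : ∀ w → w ~ w₀ → suc (suc m) ≤ count (p j) w
    lower w w~ with invariant w
    ... | inj₁ i = ⊥-elim (ℤₚ.<-asym d>0 (subst (_<ᶻ 0ℤ) (trans (i j j<k) (E-from j j t≤j ℕₚ.≤-refl j<k))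
                     (x-end-neg w~ j ℕₚ.≤-refl j<k)))
    ... | inj₂ q = subst (λ z → suc z ≤ count (p j) w)
                     (negatives-all j (suc m) (λ b le lt → x-end-neg w~ b le (in-range lt))) q

    value : ∀ {v} → IsMinOccurrences M w₀ (p j) v → v ≡ suc (suc m)
    value {v} occ@((u , _ , u~ , refl) , _) = ℕₚ.≤-antisym
      (subst (v ≤_) (trans (cong (λ z → countℕ z (turn r (suc m))) (≡-sym j≡)) (turn-count r m))
        (minOccurrences-upper w₀ longest (turn r (suc m)) ls (allNegIn ls negs keeps) j<k occ))
      (lower u u~)
      where
      r = j ℕ.∸ t
      j≡ : suc (τ ℕ.+ r) ≡ j
      j≡ = ℕₚ.m+[n∸m]≡n t≤j
      top : suc (τ ℕ.+ r ℕ.+ suc m) ≡ k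
      top = trans (cong (ℕ._+ suc m) j≡) j+m
      ls : Letters (turn r (suc m))
      ls = subst (λ z → All (_< z) (turn r (suc m))) top (turn-letters r (suc m))
      negs : Negates (turn r (suc m))
      negs b le lt = turn-negates r (suc m) true b le (ℕₚ.≤-pred (subst (b <_) (≡-sym top) lt))
      keeps : Keeps (turn r (suc m))
      keeps b lt = turn-low r (suc m) true b lt

  -- Lower bound for the letter 0: it negates at most t of the coordinates.
  module Zero where
    open Coordinates 0 0<k

    N⁻ : Word n → ℕ
    N⁻ w = negatives (x w) 0 k

    N⁻-step : ∀ l w → N⁻ (l ∷ w) ≤ t ℕ.* count (p 0) (l ∷ []) ℕ.+ N⁻ w
    N⁻-step l w with inside? l
    ... | no ¬in = ℕₚ.≤-trans (ℕₚ.≤-reflexive (negatives-cong 0 k (λ b _ lt → x-out (outside ¬in) w b lt))) (ℕₚ.m≤n+m _ _)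
    ... | yes (suc a , a<k , refl) = ℕₚ.≤-trans (ℕₚ.≤-reflexive (trans
            (negatives-cong 0 k (λ b _ lt → x-suc w b a<k lt)) (negatives-swap (x w) a 0 k z≤n a<k))) (ℕₚ.m≤n+m _ _)
    ... | yes (zero , _ , refl) with p 0 F.≟ p 0
    ...   | no q  = ⊥-elim (q refl)
    ...   | yes _ = subst (λ z → N⁻ (p 0 ∷ w) ≤ z ℕ.+ N⁻ w) (≡-sym (ℕₚ.*-identityʳ t)) prefix
      where
      k≡ : t ℕ.+ (k ℕ.∸ t) ≡ k
      k≡ = ℕₚ.m+[n∸m]≡n t≤k
      g : ℕ → ℤ
      g b with b ℕ.<? k
      ... | yes _ = x w b
      ... | no _  = x (p 0 ∷ w) b
      g-in : ∀ b → b < k → g b ≡ x w b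
      g-in b lt with b ℕ.<? k
      ... | yes _ = refl
      ... | no q  = ⊥-elim (q lt)
      g-high : ∀ b → t ≤ b → x (p 0 ∷ w) b ≡ g b
      g-high b le with b ℕ.<? k
      ... | yes lt = x-zero-high w b le lt
      ... | no _   = refl
      prefix : N⁻ (p 0 ∷ w) ≤ t ℕ.+ N⁻ w
      prefix = subst (λ z → negatives (x (p 0 ∷ w)) 0 z ≤ t ℕ.+ N⁻ w) k≡
        (ℕₚ.≤-trans (negatives-prefix t 0 (k ℕ.∸ t) g-high)
          (ℕₚ.≤-reflexive (cong (t ℕ.+_) (trans (cong (negatives g 0) k≡) (negatives-cong 0 k (λ b _ lt → g-in b lt))))))

    bound : ∀ w → N⁻ w ≤ t ℕ.* count (p 0) w
    bound [] = ℕₚ.≤-reflexive (trans (negatives-none 0 k (λ b _ lt → subst (0ℤ ≤ᶻ_) (≡-sym (E-at-0 b lt)) (+≤+ z≤n)))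
      (≡-sym (ℕₚ.*-zeroʳ t)))
    bound (l ∷ w) = ℕₚ.≤-trans (N⁻-step l w) (ℕₚ.≤-trans (ℕₚ.+-monoʳ-≤ (t ℕ.* count (p 0) (l ∷ [])) (bound w))
      (ℕₚ.≤-reflexive (trans (≡-sym (ℕₚ.*-distribˡ-+ t (count (p 0) (l ∷ [])) (count (p 0) w)))
        (cong (t ℕ.*_) (≡-sym (count-∷ (p 0) l w))))))

    lower : ∀ w → w ~ w₀ → k ℕ.∸ τ ≤ t ℕ.* count (p 0) w
    lower w w~ = ℕₚ.≤-trans (ℕₚ.≤-trans (ℕₚ.≤-reflexive (≡-sym (negatives-all τ (k ℕ.∸ τ)
        (λ b le lt → neg b le (subst (b <_) τ+k∸τ lt))))) (suffix τ 0 (k ℕ.∸ τ)))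
      (subst (λ z → negatives (x w) 0 z ≤ t ℕ.* count (p 0) w) (≡-sym τ+k∸τ) (bound w))
      where
      neg : ∀ b → τ ≤ b → b < k → x w b <ᶻ 0ℤ
      neg b le lt = subst (_<ᶻ 0ℤ) (≡-sym (trans (x-end w~ b le lt) (cong -_ (E-at-0 b lt)))) ℤ.-<+
      suffix : ∀ q o l → negatives (x w) (o ℕ.+ q) l ≤ negatives (x w) o (q ℕ.+ l)
      suffix zero    o l = ℕₚ.≤-reflexive (cong (λ z → negatives (x w) z l) (ℕₚ.+-identityʳ o))
      suffix (suc q) o l = ℕₚ.≤-trans (subst (λ z → negatives (x w) z l ≤ negatives (x w) (suc o) (q ℕ.+ l))
        (≡-sym (ℕₚ.+-suc o q)) (suffix q (suc o) l)) (ℕₚ.m≤n+m _ (isNeg (x w o)))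

countℕ-negate : ∀ τ τ≤1 r → countℕ 0 (Flips.negate τ τ≤1 r) ≡ 1
countℕ-negate τ τ≤1 zero = cong suc (countℕ-miss 0 (L.applyUpTo suc τ) (Allₚ.applyUpTo⁺₂ suc τ (λ _ ())))
countℕ-negate τ τ≤1 (suc r) = trans (countℕ-++ 0 (Flips.negate τ τ≤1 r) _) (cong (ℕ._+ 0) (countℕ-negate τ τ≤1 r))

countℕ-full : ∀ τ τ≤1 r → countℕ 0 (Flips.full τ τ≤1 r) ≡ r
countℕ-full τ τ≤1 zero    = refl
countℕ-full τ τ≤1 (suc r) = trans (countℕ-++ 0 (Flips.negate τ τ≤1 r) _)
  (cong₂ ℕ._+_ (countℕ-negate τ τ≤1 r) (countℕ-full τ τ≤1 r))

module TypeB {n : ℕ} (M : CoxeterMatrix n) (m≤4 : ∀ i j → m M i j ≤ 4) {k : ℕ} (Em : Embedding M (star 1 4) k)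
  (1<k : 1 < k) where
  open Tits M m≤4
  open Embedding Em
  open Labels M m≤4 Em

  0<k : 0 < k
  0<k = ℕₚ.<-trans (s≤s z≤n) 1<k

  d : ℤ
  d = c (p 0) (p 1)

  E : ℕ → V
  E = climb (e (p 0)) d (λ b → e (p b))

  edge : d * c (p 1) (p 0) ≡ + 2 × 0ℤ <ᶻ d
  edge = c-four 0<k 1<k (λ ()) refl

  π-E₀ : ∀ a → suc a < k → π (p (suc a)) (e (p 0)) ≡ d * γ (suc a) 0
  π-E₀ zero    a<k = trans (π-diff (p-≢ a<k 0<k (λ ()))) (≡-sym (ℤₚ.*-identityʳ d))
  π-E₀ (suc a) a<k = trans (π-label a<k 0<k (λ ())) (≡-sym (ℤₚ.*-zeroʳ d))

  π-fix : ∀ b → 1 ≤ b → b < k → π (p 0) (E b) ≡ 0ℤ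
  π-fix (suc zero)    _ b<k = trans (π-+ (p 0) (e (p 0)) (λ j → d * e (p 1) j))
    (cong₂ _+_ (π-same (p 0)) (trans (π-* (p 0) d (e (p 1)))
      (trans (cong (d *_) (π-diff (p-≢ 0<k 1<k (λ ())))) (proj₁ edge))))
  π-fix (suc (suc b)) _ b<k = trans (π-+ (p 0) (E (suc b)) (λ j → d * e (p (suc (suc b))) j))
    (cong₂ _+_ (π-fix (suc b) (s≤s z≤n) (ℕₚ.<-trans (ℕₚ.n<1+n _) b<k)) (trans (π-* (p 0) d (e (p (suc (suc b)))))
      (trans (cong (d *_) (π-label 0<k b<k (λ ()))) (ℤₚ.*-zeroʳ d))))

  basis : SignedBasis M m≤4 p k 0
  basis = record
    { τ≤1 = z≤n ; t<k = 1<k ; d = d ; d>0 = proj₂ edge ; E₀ = e (p 0)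
    ; π-chain = λ a b a<k b<k → trans (π-label a<k b<k (chain≢4 a b)) (chain-entry a b (suc a) (suc b))
    ; π-E₀ = π-E₀ ; π-fix = π-fix
    ; s-low = λ { zero _ → s-same (p 0) ; (suc b) (s≤s ()) }
    ; E₀-zero = e-same (p 0)
    ; E₀-high = λ a 1≤a a<k → e-diff (p-≢ 0<k a<k (λ q → ℕₚ.<-irrefl q 1≤a)) }

  module Values (closed : Closed M p k) (w₀ : Word n) (longest : IsLongestWord M w₀) where
    module C = Component M m≤4 p k inj closed
    module S = SignedChain M m≤4 p k 0 inj basis

    low : ∀ {u} → All (_< k) u → S.Negates u → S.Keeps u → ∀ b → b ≤ 0 → Neg (act (L.map p u) (e (p b)))
    low ls neg keep zero _ = Neg-cong (λ j → ≡-sym (S.act-negates ls neg 0 z≤n 0<k j)) (Pos-neg-neg (Pos-e (p 0)))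

    module Bounds = SignedBounds M m≤4 p k 0 inj closed basis
      (λ l out → trans (π-diff (out 0<k ∘ ≡-sym)) (C.c-out 0<k out))
      low w₀ longest

    value-0 : ∀ {v} → IsMinOccurrences M w₀ (p 0) v → v ≡ k
    value-0 {v} occ@((u , _ , u~ , refl) , _) = ℕₚ.≤-antisym
      (subst (v ≤_) (countℕ-full 0 z≤n k) (C.minOccurrences-upper w₀ longest Bounds.U Bounds.U-letters
        (Bounds.allNegIn Bounds.U-letters Bounds.U-negates Bounds.U-keeps) 0<k occ))
      (subst (k ≤_) (ℕₚ.*-identityˡ _) (Bounds.Zero.lower u u~))

    value : ∀ j m → 1 ≤ j → j ℕ.+ suc m ≡ k → ∀ {v} → IsMinOccurrences M w₀ (p j) v → v ≡ suc (suc m)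
    value = Bounds.High.value

module TypeD {n : ℕ} (M : CoxeterMatrix n) (m≤4 : ∀ i j → m M i j ≤ 4) {k : ℕ} (Em : Embedding M (star 2 3) k)
  (2<k : 2 < k) where
  open Tits M m≤4
  open Embedding Em
  open Labels M m≤4 Em

  1<k : 1 < k
  1<k = ℕₚ.<-trans (s≤s (s≤s z≤n)) 2<k

  0<k : 0 < k
  0<k = ℕₚ.<-trans (s≤s z≤n) 1<k

  E₀ : V
  E₀ j = e (p 0) j + (- 1ℤ) * e (p 1) j

  E : ℕ → V
  E = climb E₀ (+ 2) (λ b → e (p b))

  π-split : ∀ i → π i E₀ ≡ π i (e (p 0)) + (- 1ℤ) * π i (e (p 1))
  π-split i = trans (π-+ i (e (p 0)) (λ j → (- 1ℤ) * e (p 1) j))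
    (cong (λ z → π i (e (p 0)) + z) (π-* i (- 1ℤ) (e (p 1))))

  π-up : ∀ i b → π i (E (suc b)) ≡ π i (E b) + + 2 * π i (e (p (suc b)))
  π-up i b = trans (π-+ i (E b) (λ j → + 2 * e (p (suc b)) j)) (cong (λ z → π i (E b) + z) (π-* i (+ 2) (e (p (suc b)))))

  π-chain : ∀ a b → suc a < k → suc b < k → π (p (suc a)) (e (p (suc b))) ≡ χ a b
  π-chain a b a<k b<k = trans (π-label a<k b<k (chain≢4 a b)) (chain-entry a b (suc a) (suc b))

  π-E₀ : ∀ a → suc a < k → π (p (suc a)) E₀ ≡ + 2 * γ (suc a) 0
  π-E₀ zero          a<k = trans (π-split (p 1)) (cong₂ (λ x y → x + (- 1ℤ) * y) (π-label a<k 0<k (λ ())) (π-chain 0 0 a<k a<k))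
  π-E₀ (suc zero)    a<k = trans (π-split (p 2)) (cong₂ (λ x y → x + (- 1ℤ) * y) (π-label a<k 0<k (λ ())) (π-chain 1 0 a<k 1<k))
  π-E₀ (suc (suc a)) a<k = trans (π-split (p (suc (suc (suc a)))))
    (cong₂ (λ x y → x + (- 1ℤ) * y) (π-label a<k 0<k (λ ())) (π-chain (suc (suc a)) 0 a<k 1<k))

  π₀-E₀ : π (p 0) E₀ ≡ - + 2
  π₀-E₀ = trans (π-split (p 0)) (cong₂ (λ x y → x + (- 1ℤ) * y) (π-same (p 0)) (π-label 0<k 1<k (λ ())))

  π₀-E₁ : π (p 0) (E 1) ≡ - + 2
  π₀-E₁ = trans (π-up (p 0) 0) (cong₂ (λ x y → x + + 2 * y) π₀-E₀ (π-label 0<k 1<k (λ ())))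

  π-fix : ∀ b → 2 ≤ b → b < k → π (p 0) (E b) ≡ 0ℤ
  π-fix (suc zero) (s≤s ()) _
  π-fix (suc (suc zero))    _ b<k = trans (π-up (p 0) 1) (cong₂ (λ x y → x + + 2 * y) π₀-E₁ (π-label 0<k b<k (λ ())))
  π-fix (suc (suc (suc b))) _ b<k = trans (π-up (p 0) (suc (suc b))) (cong₂ (λ x y → x + + 2 * y)
    (π-fix (suc (suc b)) (s≤s (s≤s z≤n)) (ℕₚ.<-trans (ℕₚ.n<1+n _) b<k)) (π-label 0<k b<k (λ ())))

  s-low : ∀ b → b < 2 → s (p 0) (E b) ≗ (λ j → - E (1 ℕ.∸ b) j)
  s-low zero _ j = trans (cong (λ z → E₀ j + z * e (p 0) j) π₀-E₀) (lem (e (p 0) j) (e (p 1) j))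
    where lem : ∀ x y → (x + (- 1ℤ) * y) + (- + 2) * x ≡ - ((x + (- 1ℤ) * y) + + 2 * y)
          lem = solve-∀
  s-low (suc zero) _ j = trans (cong (λ z → E 1 j + z * e (p 0) j) π₀-E₁) (lem (e (p 0) j) (e (p 1) j))
    where lem : ∀ x y → ((x + (- 1ℤ) * y) + + 2 * y) + (- + 2) * x ≡ - (x + (- 1ℤ) * y)
          lem = solve-∀
  s-low (suc (suc b)) (s≤s (s≤s ()))

  basis : SignedBasis M m≤4 p k 1
  basis = record
    { τ≤1 = s≤s z≤n ; t<k = 2<k ; d = + 2 ; d>0 = +<+ (s≤s z≤n) ; E₀ = E₀
    ; π-chain = π-chain ; π-E₀ = π-E₀ ; π-fix = π-fix ; s-low = s-low
    ; E₀-zero = cong₂ (λ x y → x + (- 1ℤ) * y) (e-same (p 0)) (e-diff (p-≢ 1<k 0<k (λ ())))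
    ; E₀-high = λ a 2≤a a<k → cong₂ (λ x y → x + (- 1ℤ) * y) (e-diff (p-≢ 0<k a<k (λ q → ℕₚ.<⇒≢ (ℕₚ.<-≤-trans (s≤s z≤n) 2≤a) q)))
        (e-diff (p-≢ 1<k a<k (λ q → ℕₚ.<⇒≢ 2≤a q))) }

  module Values (closed : Closed M p k) (w₀ : Word n) (longest : IsLongestWord M w₀) where
    module C = Component M m≤4 p k inj closed
    module S = SignedChain M m≤4 p k 1 inj basis

    private
      two : ∀ x y → + 2 * x ≡ + 2 * y → x ≡ y
      two x y = ℤₚ.*-cancelˡ-≡ (+ 2) x y

    -- 2α₀ = E₀ + E₁ and 2α₁ = E₁ - E₀, while E₁ ↦ -E₁ and E₀ ↦ ±E₀.
    low : ∀ {u} → All (_< k) u → S.Negates u → S.Keeps u → ∀ b → b ≤ 1 → Neg (act (L.map p u) (e (p b)))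
    low {u} ls neg keep b b≤1 with keep 0 (s≤s z≤n)
    ... | s′ , eq = go b b≤1 s′ (λ j → trans (proj₁ (S.act-signed ls true 0<k) j) (cong (λ x → S.signed x j) eq))
      where
      w = L.map p u
      f₀ f₁ : V
      f₀ = act w (e (p 0))
      f₁ = act w (e (p 1))
      split₀ : act w E₀ ≗ (λ j → f₀ j + (- 1ℤ) * f₁ j)
      split₀ j = trans (act-+ w (e (p 0)) (λ l → (- 1ℤ) * e (p 1) l) j) (cong (λ z → f₀ j + z) (act-* w (- 1ℤ) (e (p 1)) j))
      split₁ : ∀ j → - E 1 j ≡ act w E₀ j + + 2 * f₁ j
      split₁ j = trans (≡-sym (S.act-negates ls neg 1 (s≤s z≤n) 1<k j))
        (trans (act-+ w E₀ (λ l → + 2 * e (p 1) l) j) (cong (λ z → act w E₀ j + z) (act-* w (+ 2) (e (p 1)) j)))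
      double : ∀ j → + 2 * f₀ j ≡ act w E₀ j + - E 1 j
      double j = trans (lem (f₀ j) (f₁ j)) (cong₂ _+_ (≡-sym (split₀ j)) (trans (cong (_+ + 2 * f₁ j) (≡-sym (split₀ j))) (≡-sym (split₁ j))))
        where lem : ∀ a b → + 2 * a ≡ (a + (- 1ℤ) * b) + ((a + (- 1ℤ) * b) + + 2 * b)
              lem = solve-∀
      negate : ∀ {x : V} i → x ≗ (λ j → - e i j) → Neg x
      negate i q = Neg-cong (≡-sym ∘ q) (Pos-neg-neg (Pos-e i))
      go : ∀ b → b ≤ 1 → ∀ s′ → act w E₀ ≗ S.signed (s′ , 0) → Neg (act w (e (p b)))
      go (suc zero) _ true q = negate (p 0) (λ j → two (f₁ j) (- e (p 0) j) (ℤ-cancelˡ (act w E₀ j)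
        (trans (≡-sym (split₁ j)) (trans (lem (e (p 0) j) (e (p 1) j)) (cong (_+ + 2 * - e (p 0) j) (≡-sym (q j)))))))
        where lem : ∀ x y → - ((x + (- 1ℤ) * y) + + 2 * y) ≡ (x + (- 1ℤ) * y) + + 2 * (- x)
              lem = solve-∀
      go (suc zero) _ false q = negate (p 1) (λ j → two (f₁ j) (- e (p 1) j) (ℤ-cancelˡ (act w E₀ j)
        (trans (≡-sym (split₁ j)) (trans (lem (e (p 0) j) (e (p 1) j)) (cong (_+ + 2 * - e (p 1) j) (≡-sym (q j)))))))
        where lem : ∀ x y → - ((x + (- 1ℤ) * y) + + 2 * y) ≡ - (x + (- 1ℤ) * y) + + 2 * (- y)
              lem = solve-∀
      go zero _ true q = negate (p 1) (λ j → two (f₀ j) (- e (p 1) j) (trans (double j)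
        (trans (cong (λ z → z + - E 1 j) (q j)) (lem (e (p 0) j) (e (p 1) j)))))
        where lem : ∀ x y → (x + (- 1ℤ) * y) + - ((x + (- 1ℤ) * y) + + 2 * y) ≡ + 2 * (- y)
              lem = solve-∀
      go zero _ false q = negate (p 0) (λ j → two (f₀ j) (- e (p 0) j) (trans (double j)
        (trans (cong (λ z → z + - E 1 j) (q j)) (lem (e (p 0) j) (e (p 1) j)))))
        where lem : ∀ x y → - (x + (- 1ℤ) * y) + - ((x + (- 1ℤ) * y) + + 2 * y) ≡ + 2 * (- x)
              lem = solve-∀
      go (suc (suc b)) (s≤s ()) _ _

    module Bounds = SignedBounds M m≤4 p k 1 inj closed basis
      (λ l out → trans (π-split l) (cong₂ (λ x y → x + (- 1ℤ) * y)
        (trans (π-diff (out 0<k ∘ ≡-sym)) (C.c-out 0<k out)) (trans (π-diff (out 1<k ∘ ≡-sym)) (C.c-out 1<k out))))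
      low w₀ longest

    value : ∀ j m → 2 ≤ j → j ℕ.+ suc m ≡ k → ∀ {v} → IsMinOccurrences M w₀ (p j) v → v ≡ suc (suc m)
    value = Bounds.High.value

    value-0 : ∀ o r → o ≤ 1 → o ℕ.+ (r ℕ.+ r) ≡ k → ∀ {v} → IsMinOccurrences M w₀ (p 0) v → v ≡ r
    value-0 o r o≤1 k≡ {v} occ@((u , _ , u~ , refl) , _) = ℕₚ.≤-antisym
      (subst (v ≤_) (pairs-count o r) (C.minOccurrences-upper w₀ longest (pairs o r) ls (Bounds.allNegIn ls negs keeps) 0<k occ))
      (half v r (ℕₚ.≤-trans (ℕₚ.∸-monoˡ-≤ 1 (ℕₚ.≤-trans (ℕₚ.m≤n+m (r ℕ.+ r) o) (ℕₚ.≤-reflexive k≡)))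
        (subst (k ℕ.∸ 1 ≤_) (cong (v ℕ.+_) (ℕₚ.+-identityʳ v)) (Bounds.Zero.lower u u~))))
      where
      half : ∀ v r → (r ℕ.+ r) ℕ.∸ 1 ≤ v ℕ.+ v → r ≤ v
      half v r q with r ℕ.≤? v
      ... | yes le = le
      ... | no r≰v with ℕₚ.≰⇒> r≰v
      ...   | s≤s {n = r′} v≤r′ = ⊥-elim (ℕₚ.<-irrefl refl (ℕₚ.≤-<-trans (ℕₚ.+-mono-≤ v≤r′ v≤r′)
              (ℕₚ.<-≤-trans (subst (r′ ℕ.+ r′ <_) (≡-sym (ℕₚ.+-suc r′ r′)) (ℕₚ.n<1+n _)) q)))
      ls : All (_< k) (pairs o r)
      ls = subst (λ z → All (_< z) (pairs o r)) k≡ (pairs-letters o r)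
      negs : S.Negates (pairs o r)
      negs b le lt = pairs-hit o r true b (ℕₚ.≤-trans o≤1 le) (subst (b <_) (≡-sym k≡) lt)
      keeps : S.Keeps (pairs o r)
      keeps zero _ with 0 ℕ.<? o
      ... | yes 0<o = true , pairs-below o r true 0 0<o
      ... | no 0≮o  = false , pairs-hit o r true 0 (ℕₚ.≮⇒≥ 0≮o) (subst (0 <_) (≡-sym k≡) 0<k)
      keeps (suc b) (s≤s ())

perm : List ℕ → ℕ → ℕ
perm []      c = c
perm (a ∷ u) c = swap a (perm u c)

perm-++ : ∀ u v c → perm (u ++ v) c ≡ perm u (perm v c)
perm-++ []      v c = refl
perm-++ (a ∷ u) v c = cong (swap a) (perm-++ u v c)

sig-perm : ∀ u s c → sig 1 (L.map suc u) (s , c) ≡ (s , perm u c)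
sig-perm []      s c = refl
sig-perm (a ∷ u) s c = cong (letter 1 (suc a)) (sig-perm u s c)

map-down : ∀ j m → L.map suc (down j m) ≡ down (suc j) m
map-down j zero    = refl
map-down j (suc m) = cong (suc (j ℕ.+ m) ∷_) (map-down j m)

perm-down-0 : ∀ m → perm (down 0 m) 0 ≡ m
perm-down-0 m = cong proj₂ (trans (≡-sym (sig-perm (down 0 m) true 0))
  (trans (cong (λ u → sig 1 u (true , 0)) (map-down 0 m)) (sig-down-bottom 1 0 m true)))

perm-down-suc : ∀ m b → b < m → perm (down 0 m) (suc b) ≡ b
perm-down-suc m b lt = cong proj₂ (trans (≡-sym (sig-perm (down 0 m) true (suc b)))
  (trans (cong (λ u → sig 1 u (true , suc b)) (map-down 0 m)) (sig-down-mid 1 0 m true b z≤n lt)))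

reversal : ℕ → List ℕ
reversal zero    = []
reversal (suc k) = reversal k ++ down 0 (suc k)

reversal-letters : ∀ k → All (_< k) (reversal k)
reversal-letters zero    = []
reversal-letters (suc k) = Allₚ.++⁺ (All.map (λ q → ℕₚ.<-trans q (ℕₚ.n<1+n k)) (reversal-letters k))
                                    (All.map proj₂ (down-letters 0 (suc k)))

perm-above : ∀ {u k} → All (_< k) u → ∀ c → k < c → perm u c ≡ c
perm-above []         c lt = refl
perm-above (a<k ∷ ls) c lt = trans (cong (swap _) (perm-above ls c lt)) (swap-above (ℕₚ.≤-<-trans a<k lt))

perm-reversal : ∀ k c → c ≤ k → perm (reversal k) c ≡ k ℕ.∸ c
perm-reversal zero    zero    z≤n = refl
perm-reversal (suc k) zero    _ = trans (perm-++ (reversal k) (down 0 (suc k)) 0)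
  (trans (cong (perm (reversal k)) (perm-down-0 (suc k))) (perm-above (reversal-letters k) (suc k) (ℕₚ.n<1+n k)))
perm-reversal (suc k) (suc c) (s≤s le) = trans (perm-++ (reversal k) (down 0 (suc k)) (suc c))
  (trans (cong (perm (reversal k)) (perm-down-suc (suc k) c (s≤s le))) (perm-reversal k c le))

countℕ-down : ∀ j m → j < m → countℕ j (down 0 m) ≡ 1
countℕ-down j (suc m) lt with m ℕ.≟ j
... | yes refl = cong suc (countℕ-miss m (down 0 m) (All.map (λ (_ , q) e → ℕₚ.<-irrefl e q) (down-letters 0 m)))
... | no m≢j   = countℕ-down j m (ℕₚ.≤∧≢⇒< (ℕₚ.≤-pred lt) (m≢j ∘ ≡-sym))

countℕ-reversal : ∀ j k → countℕ j (reversal k) ≡ k ℕ.∸ j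
countℕ-reversal j zero    = ≡-sym (ℕₚ.0∸n≡0 j)
countℕ-reversal j (suc k) with j ℕ.≤? k
... | yes le = trans (countℕ-++ j (reversal k) (down 0 (suc k)))
  (trans (cong₂ ℕ._+_ (countℕ-reversal j k) (countℕ-down j (suc k) (s≤s le)))
    (trans (ℕₚ.+-comm (k ℕ.∸ j) 1) (≡-sym (ℕₚ.+-∸-assoc 1 le))))
... | no j≰k = trans (countℕ-miss j (reversal (suc k)) (All.map (λ q e → ℕₚ.<-irrefl e (ℕₚ.<-≤-trans q (ℕₚ.≰⇒> j≰k)))
      (reversal-letters (suc k)))) (≡-sym (ℕₚ.m≤n⇒m∸n≡0 (ℕₚ.≰⇒> j≰k)))

negatives-snoc : ∀ f o l → negatives f o (suc l) ≡ negatives f o l ℕ.+ isNeg (f (o ℕ.+ l))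
negatives-snoc f o zero    = trans (ℕₚ.+-identityʳ _) (cong (isNeg ∘ f) (≡-sym (ℕₚ.+-identityʳ o)))
negatives-snoc f o (suc l) = trans (cong (isNeg (f o) ℕ.+_) (trans (negatives-snoc f (suc o) l)
    (cong (λ z → negatives f (suc o) l ℕ.+ isNeg (f z)) (≡-sym (ℕₚ.+-suc o l)))))
  (≡-sym (ℕₚ.+-assoc (isNeg (f o)) (negatives f (suc o) l) _))

negatives-+ : ∀ f o l l′ → negatives f o (l ℕ.+ l′) ≡ negatives f o l ℕ.+ negatives f (o ℕ.+ l) l′
negatives-+ f o zero    l′ = cong (λ z → negatives f z l′) (≡-sym (ℕₚ.+-identityʳ o))
negatives-+ f o (suc l) l′ = trans (cong (isNeg (f o) ℕ.+_) (trans (negatives-+ f (suc o) l l′)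
    (cong (λ z → negatives f (suc o) l ℕ.+ negatives f z l′) (≡-sym (ℕₚ.+-suc o l)))))
  (≡-sym (ℕₚ.+-assoc (isNeg (f o)) (negatives f (suc o) l) _))

module TypeA {n : ℕ} (M : CoxeterMatrix n) (m≤4 : ∀ i j → m M i j ≤ 4) {k : ℕ} (Em : Embedding M chain k)
  (closed : Closed M (Embedding.p Em) k) (w₀ : Word n) (longest : IsLongestWord M w₀) where

  open Embedding Em
  open Component M m≤4 p k inj closed
  open Labels M m≤4 Em using (π-label; p-≢)
  open Longest w₀ longest

  S : ℕ → V
  S zero    j = 0ℤ
  S (suc c) j = S c j + 1ℤ * e (p c) j

  π-χ : ∀ a b → a < k → b < k → π (p a) (e (p b)) ≡ χ a b
  π-χ a b a<k b<k = trans (π-label a<k b<k (chain≢4 a b)) (chain-entry a b a b)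

  π-S : ∀ a c → a < k → c ≤ k → π (p a) (S c) ≡ γ (suc a) c - γ (suc a) 0
  π-S a zero    a<k c≤k = trans (π-0 (p a)) (≡-sym (ℤₚ.+-inverseʳ (γ (suc a) 0)))
  π-S a (suc c) a<k c<k = trans (π-+ (p a) (S c) (λ j → 1ℤ * e (p c) j))
    (trans (cong₂ _+_ (π-S a c a<k (ℕₚ.<⇒≤ c<k)) (trans (π-* (p a) 1ℤ (e (p c)))
        (trans (ℤₚ.*-identityˡ (π (p a) (e (p c)))) (π-χ a c a<k c<k))))
      (trans (lem (γ (suc a) c) (γ (suc a) 0) (χ a c)) (cong (_- γ (suc a) 0) (≡-sym (γ-step a c)))))
    where
    lem : ∀ x y z → (x - y) + z ≡ (x + z) - y
    lem = solve-∀

  S-swap : ∀ a c j → S (swap a c) j ≡ S c j + γ (suc a) c * e (p a) j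
  S-swap a c j with c ℕ.≟ a | c ℕ.≟ suc a
  ... | yes refl | _        rewrite swap-left c | γ-left c = refl
  ... | no _     | yes refl rewrite swap-right a | γ-right a = lem (S a j) (e (p a) j)
    where lem : ∀ x y → x ≡ (x + 1ℤ * y) + (- 1ℤ) * y
          lem = solve-∀
  ... | no q     | no r     rewrite swap-other q r | γ-other a c q r = ≡-sym (ℤₚ.+-identityʳ (S c j))

  -- S c stands for ε₀ - ε_c, with the letter a acting as the transposition of ε_a and ε_(a+1).
  s-S : ∀ {a} c → a < k → c ≤ k → s (p a) (S c) ≗ (λ j → S (swap a c) j + (- 1ℤ) * S (swap a 0) j)
  s-S {a} c a<k c≤k j = trans (cong (λ z → S c j + z * e (p a) j) (π-S a c a<k c≤k))
    (trans (lem (S c j) (γ (suc a) c) (γ (suc a) 0) (e (p a) j))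
      (cong₂ (λ x y → x + (- 1ℤ) * y) (≡-sym (S-swap a c j)) (≡-sym (S-swap a 0 j))))
    where lem : ∀ x g h y → x + (g - h) * y ≡ (x + g * y) + (- 1ℤ) * (0ℤ + h * y)
          lem = solve-∀

  swap-≤ : ∀ {a c} → a < k → c ≤ k → swap a c ≤ k
  swap-≤ {a} {c} a<k c≤k = ℕₚ.≤-pred (swap-< a c (s≤s a<k) (s≤s c≤k))

  act-S : ∀ {u} → Letters u → ∀ c → c ≤ k → (act (mp u) (S c) ≗ (λ j → S (perm u c) j + (- 1ℤ) * S (perm u 0) j)) × perm u c ≤ k
  act-S [] c c≤k = (λ j → lem (S c j)) , c≤k
    where lem : ∀ x → x ≡ x + (- 1ℤ) * 0ℤ
          lem = solve-∀
  act-S {a ∷ u} (a<k ∷ ls) c c≤k =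
    let eq , b = act-S ls c c≤k
        _ , b₀ = act-S ls 0 z≤n
    in (λ j → trans (s-cong (p a) eq j) (trans (s-+ (p a) (S (perm u c)) (λ l → (- 1ℤ) * S (perm u 0) l) j)
         (trans (cong₂ _+_ (s-S (perm u c) a<k b j) (trans (s-* (p a) (- 1ℤ) (S (perm u 0)) j)
                  (cong ((- 1ℤ) *_) (s-S (perm u 0) a<k b₀ j))))
           (lem (S (swap a (perm u c)) j) (S (swap a 0) j) (S (swap a (perm u 0)) j))))) , swap-≤ a<k b
    where lem : ∀ x y z → (x + (- 1ℤ) * y) + (- 1ℤ) * (z + (- 1ℤ) * y) ≡ x + (- 1ℤ) * z
          lem = solve-∀

  reversal-neg : AllNegIn (reversal k)
  reversal-neg {b} b<k = Neg-cong (≡-sym ∘ eq) (Pos-neg-neg (Pos-e (p (k ℕ.∸ suc b))))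
    where
    w = mp (reversal k)
    top : k ℕ.∸ b ≡ suc (k ℕ.∸ suc b)
    top = ℕₚ.+-∸-assoc 1 b<k
    at-S : ∀ c → c ≤ k → act w (S c) ≗ (λ j → S (k ℕ.∸ c) j + (- 1ℤ) * S k j)
    at-S c c≤k j = trans (proj₁ (act-S (reversal-letters k) c c≤k) j)
      (cong₂ (λ x y → S x j + (- 1ℤ) * S y j) (perm-reversal k c c≤k) (perm-reversal k 0 z≤n))
    eq : act w (e (p b)) ≗ (λ j → - e (p (k ℕ.∸ suc b)) j)
    eq j = ℤ-cancelˡ (act w (S b) j) (trans (≡-sym lhs) (trans (at-S (suc b) b<k j)
      (trans (lem (S (k ℕ.∸ suc b) j) (S k j) (e (p (k ℕ.∸ suc b)) j))
        (cong (λ z → z + - e (p (k ℕ.∸ suc b)) j) (≡-sym (trans (at-S b (ℕₚ.<⇒≤ b<k) j)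
          (cong (λ c → S c j + (- 1ℤ) * S k j) top)))))))
      where
      lhs : act w (S (suc b)) j ≡ act w (S b) j + act w (e (p b)) j
      lhs = trans (act-+ w (S b) (λ l → 1ℤ * e (p b) l) j)
        (cong (λ z → act w (S b) j + z) (trans (act-* w 1ℤ (e (p b)) j) (ℤₚ.*-identityˡ _)))
      lem : ∀ x y z → x + (- 1ℤ) * y ≡ ((x + 1ℤ * z) + (- 1ℤ) * y) + - z
      lem = solve-∀

  upper : ∀ {j} → j < k → ∀ {v} → IsMinOccurrences M w₀ (p j) v → v ≤ k ℕ.∸ j
  upper {j} j<k {v} occ = subst (v ≤_) (countℕ-reversal j k)
    (minOccurrences-upper w₀ longest (reversal k) (reversal-letters k) reversal-neg j<k occ)

  module Lower (j : ℕ) (j<k : j < k) where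
    open Weights M m≤4 (coefficient (p j))

    initial : ℕ → ℤ
    initial c = if c ℕ.≤ᵇ j then 0ℤ else - 1ℤ

    initial-low : ∀ c → c ≤ j → initial c ≡ 0ℤ
    initial-low c le with c ℕ.≤ᵇ j in eq
    ... | true  = refl
    ... | false = ⊥-elim (subst T eq (ℕₚ.≤⇒≤ᵇ le))

    initial-high : ∀ c → j < c → initial c ≡ - 1ℤ
    initial-high c lt with c ℕ.≤ᵇ j in eq
    ... | true  = ⊥-elim (ℕₚ.<⇒≱ lt (ℕₚ.≤ᵇ⇒≤ c j (subst T (≡-sym eq) tt)))
    ... | false = refl

    -- The weight w ωⱼ in ε-coordinates, shifted so that its entries are 0 and -1.
    f : Word n → ℕ → ℤ
    f []      = initial
    f (l ∷ w) with inside? l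
    ... | yes (a , _) = f w ∘ swap a
    ... | no _        = f w

    weight-S : ∀ w c → c ≤ k → weight w (S c) ≡ f w 0 - f w c
    weight-S [] c c≤k = trans (at-j c c≤k) (lem (initial c))
      where
      lem : ∀ x → - x ≡ 0ℤ - x
      lem = solve-∀
      at-j : ∀ c → c ≤ k → S c (p j) ≡ - initial c
      at-j zero    c≤k = refl
      at-j (suc c) c<k with c ℕ.≟ j
      ... | yes refl = trans (cong₂ (λ x y → x + 1ℤ * y) (trans (at-j c (ℕₚ.<⇒≤ c<k)) (cong -_ (initial-low c ℕₚ.≤-refl))) (e-same (p c)))
              (cong -_ (≡-sym (initial-high (suc c) (ℕₚ.n<1+n c))))
      ... | no c≢j = trans (cong₂ (λ x y → x + 1ℤ * y) (at-j c (ℕₚ.<⇒≤ c<k)) (e-diff (p-≢ c<k j<k c≢j)))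
              (trans (ℤₚ.+-identityʳ (- initial c)) (cong -_ same))
        where
        same : initial c ≡ initial (suc c)
        same with ℕₚ.<-cmp c j
        ... | tri< lt _ _ = trans (initial-low c (ℕₚ.<⇒≤ lt)) (≡-sym (initial-low (suc c) lt))
        ... | tri≈ _ q _  = ⊥-elim (c≢j q)
        ... | tri> _ _ gt = trans (initial-high c gt) (≡-sym (initial-high (suc c) (ℕₚ.m<n⇒m<1+n gt)))
    weight-S (l ∷ w) c c≤k with inside? l
    ... | no ¬in = trans (weight-∷ l w (S c)) (trans (weight-cong w (fixed c c≤k)) (weight-S w c c≤k))
      where
      fixed : ∀ c → c ≤ k → s l (S c) ≗ S c
      fixed zero    _   i = s-0 l i
      fixed (suc c) c<k i = trans (s-+ l (S c) (λ x → 1ℤ * e (p c) x) i)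
        (cong₂ _+_ (fixed c (ℕₚ.<⇒≤ c<k) i) (trans (s-* l 1ℤ (e (p c)) i) (cong (1ℤ *_) (s-out-in (outside ¬in) c<k i))))
    ... | yes (a , a<k , refl) = trans (weight-∷ (p a) w (S c)) (trans (weight-cong w (s-S c a<k c≤k))
          (trans (weight-lin w (S (swap a c)) (- 1ℤ) (S (swap a 0)))
            (trans (cong₂ (λ x y → x + (- 1ℤ) * y) (weight-S w (swap a c) (swap-≤ a<k c≤k)) (weight-S w (swap a 0) (swap-≤ a<k z≤n)))
              (lem (f w 0) (f w (swap a c)) (f w (swap a 0))))))
      where lem : ∀ x y z → (x - y) + (- 1ℤ) * (x - z) ≡ z - y
            lem = solve-∀

    bounded : ∀ w → negatives (f w) 0 (suc j) ≤ count (p j) w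
    bounded [] = ℕₚ.≤-reflexive (negatives-none 0 (suc j) (λ c _ lt → ℤₚ.≤-reflexive (≡-sym (initial-low c (ℕₚ.≤-pred lt)))))
    bounded (l ∷ w) with inside? l
    ... | no _ = ℕₚ.≤-trans (bounded w) (count≤count-∷ (p j) l w)
    ... | yes (a , a<k , refl) with ℕₚ.<-cmp a j
    ...   | tri< lt _ _ = ℕₚ.≤-trans (ℕₚ.≤-trans (ℕₚ.≤-reflexive (negatives-swap (f w) a 0 (suc j) z≤n (s≤s lt))) (bounded w)) (count≤count-∷ (p j) (p a) w)
    ...   | tri> _ _ gt = ℕₚ.≤-trans (ℕₚ.≤-trans (ℕₚ.≤-reflexive (negatives-cong 0 (suc j)
              (λ c _ lt → cong (f w) (swap-below (ℕₚ.≤-<-trans (ℕₚ.≤-pred lt) gt))))) (bounded w)) (count≤count-∷ (p j) (p a) w)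
    ...   | tri≈ _ refl _ = subst₂ _≤_ (≡-sym (negatives-snoc (f w ∘ swap a) 0 a)) (≡-sym (hit w))
              (ℕₚ.≤-trans (ℕₚ.+-mono-≤ (ℕₚ.≤-reflexive (negatives-cong 0 a (λ c _ lt → cong (f w) (swap-below lt)))) (isNeg≤1 (f w (swap a a))))
                (ℕₚ.≤-trans (ℕₚ.≤-reflexive (ℕₚ.+-comm _ 1)) (s≤s (ℕₚ.≤-trans
                  (subst (negatives (f w) 0 a ≤_) (≡-sym (negatives-snoc (f w) 0 a)) (ℕₚ.m≤m+n _ _)) (bounded w)))))
      where
      hit : ∀ w → count (p a) (p a ∷ w) ≡ suc (count (p a) w)
      hit w with p a F.≟ p a
      ... | yes _ = refl
      ... | no q  = ⊥-elim (q refl)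

    total : ∀ w → negatives (f w) 0 (suc k) ≡ k ℕ.∸ j
    total [] = trans (cong (negatives initial 0) (≡-sym (cong suc (ℕₚ.m+[n∸m]≡n (ℕₚ.<⇒≤ j<k)))))
      (trans (negatives-+ initial 0 (suc j) (k ℕ.∸ j)) (cong₂ ℕ._+_
        (negatives-none 0 (suc j) (λ c _ lt → ℤₚ.≤-reflexive (≡-sym (initial-low c (ℕₚ.≤-pred lt)))))
        (negatives-all (suc j) (k ℕ.∸ j) (λ c le _ → subst (_<ᶻ 0ℤ) (≡-sym (initial-high c le)) ℤ.-<+))))
    total (l ∷ w) with inside? l
    ... | no _ = total w
    ... | yes (a , a<k , refl) = trans (negatives-swap (f w) a 0 (suc k) z≤n (s≤s a<k)) (total w)

    ascent : ∀ w → w ~ w₀ → ∀ a → a < k → f w a ≤ᶻ f w (suc a)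
    ascent w w~ a a<k = ℤₚ.i-j≤0⇒i≤j (subst (_≤ᶻ 0ℤ) eq (≤-neg-flip (proj₁ (neg-e a) (p j))))
      where
      neg-e : ∀ a → Neg (act (reverse w) (e (p a)))
      neg-e a = Neg-cong (act-~ (~-sym rw~) (e (p a))) (AllNeg-w₀ (p a))
        where rw~ : reverse w ~ w₀
              rw~ = ~w₀ (reverse w) (AllNeg-reverse w (λ j → Neg-cong (act-~ (~-sym w~) (e j)) (AllNeg-w₀ j)))
      eq : weight w (e (p a)) ≡ f w a - f w (suc a)
      eq = ℤ-cancelˡ (weight w (S a)) (trans (trans (cong (λ z → weight w (S a) + z) (≡-sym (ℤₚ.*-identityˡ (weight w (e (p a))))))
          (≡-sym (weight-lin w (S a) 1ℤ (e (p a))))) (trans (weight-S w (suc a) a<k)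
        (trans (lem₂ (f w 0) (f w a) (f w (suc a))) (cong (λ z → z + (f w a - f w (suc a))) (≡-sym (weight-S w a (ℕₚ.<⇒≤ a<k)))))))
        where lem₂ : ∀ x y z → x - z ≡ (x - y) + (y - z)
              lem₂ = solve-∀
    monotone : ∀ w → w ~ w₀ → ∀ c c′ → c ≤ c′ → c′ ≤ k → f w c ≤ᶻ f w c′
    monotone w w~ c zero     z≤n _   = ℤₚ.≤-refl
    monotone w w~ c (suc c′) le  c<k with c ℕ.≟ suc c′
    ... | yes refl = ℤₚ.≤-refl
    ... | no c≢    = ℤₚ.≤-trans (monotone w w~ c c′ (ℕₚ.≤-pred (ℕₚ.≤∧≢⇒< le c≢)) (ℕₚ.<⇒≤ c<k)) (ascent w w~ c′ c<k)

    lower : ∀ w → w ~ w₀ → suc j ≤ count (p j) w ⊎ k ℕ.∸ j ≤ count (p j) w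
    lower w w~ with f w j ℤₚ.<? 0ℤ
    ... | yes neg = inj₁ (subst (_≤ count (p j) w) (negatives-all 0 (suc j)
            (λ c _ lt → ℤₚ.≤-<-trans (monotone w w~ c j (ℕₚ.≤-pred lt) (ℕₚ.<⇒≤ j<k)) neg)) (bounded w))
    ... | no ¬neg = inj₂ (subst (_≤ count (p j) w) first≡ (bounded w))
      where
      sj+ : suc j ℕ.+ (k ℕ.∸ j) ≡ suc k
      sj+ = cong suc (ℕₚ.m+[n∸m]≡n (ℕₚ.<⇒≤ j<k))
      first≡ : negatives (f w) 0 (suc j) ≡ k ℕ.∸ j
      first≡ = trans (≡-sym (ℕₚ.+-identityʳ _)) (trans (cong (negatives (f w) 0 (suc j) ℕ.+_) (≡-sym
        (negatives-none (suc j) (k ℕ.∸ j) (λ c le lt → ℤₚ.≤-trans (ℤₚ.≮⇒≥ ¬neg)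
          (monotone w w~ j c (ℕₚ.<⇒≤ le) (ℕₚ.≤-pred (subst (c <_) sj+ lt)))))))
        (trans (≡-sym (negatives-+ (f w) 0 (suc j) (k ℕ.∸ j))) (trans (cong (negatives (f w) 0) sj+) (total w))))

-- Classification of the components

≤-bool : ℤ → Bool
≤-bool (+ _)      = true
≤-bool (-[1+ _ ]) = false

≤-bool-sound : ∀ z → T (≤-bool z) → 0ℤ ≤ᶻ z
≤-bool-sound (+ _) _ = +≤+ z≤n

dotFrom : (ℕ → ℤ) → ℕ → List ℤ → ℤ
dotFrom f o []       = 0ℤ
dotFrom f o (μ ∷ μs) = μ * f o + dotFrom f (suc o) μs

dominates : (ℕ → ℕ → ℤ) → List ℤ → ℕ → ℤ → Bool
dominates ent μs j h = allᵇ ≤-bool μs ∧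
  allᵇ (λ b → ≤-bool (dotFrom (ent b) 0 μs + (if b ℕ.≡ᵇ j then h else 0ℤ))) (L.upTo (length μs))

sum-≥₂ : ∀ {k} (f : Fin k → ℤ) → (∀ i → 0ℤ ≤ᶻ f i) → ∀ {i j} → i ≢ j → f i + f j ≤ᶻ sum f
sum-≥₂ {suc k} f p {F.zero}  {F.zero}  i≢j = ⊥-elim (i≢j refl)
sum-≥₂ {suc k} f p {F.zero}  {F.suc j} i≢j = ℤₚ.+-monoʳ-≤ (f F.zero) (sum-≥ (f ∘ F.suc) (p ∘ F.suc) j)
sum-≥₂ {suc k} f p {F.suc i} {F.zero}  i≢j = subst (_≤ᶻ sum f) (ℤₚ.+-comm (f F.zero) (f (F.suc i)))
  (ℤₚ.+-monoʳ-≤ (f F.zero) (sum-≥ (f ∘ F.suc) (p ∘ F.suc) i))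
sum-≥₂ {suc k} f p {F.suc i} {F.suc j} i≢j = ℤₚ.≤-trans (sum-≥₂ (f ∘ F.suc) (p ∘ F.suc) (i≢j ∘ cong F.suc))
  (subst (_≤ᶻ sum f) (ℤₚ.+-identityˡ (sum (f ∘ F.suc))) (ℤₚ.+-monoˡ-≤ (sum (f ∘ F.suc)) (p F.zero)))

indicator : ∀ {P : Set} → Dec P → ℤ
indicator (yes _) = 1ℤ
indicator (no _)  = 0ℤ

module Obstructions {n : ℕ} (M : CoxeterMatrix n) (m≤4 : ∀ i j → m M i j ≤ 4)
  (w₀ : Word n) (longest : IsLongestWord M w₀) where

  open Reduction M m≤4
  open Longest w₀ longest

  π-≥0 : ∀ {x i} → (∀ j → 0ℤ ≤ᶻ x j) → x i ≡ 0ℤ → 0ℤ ≤ᶻ π i x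
  π-≥0 {x} {i} x≥0 xi≡0 = subst (0ℤ ≤ᶻ_) (≡-sym (trans (cong (λ z → N i x - + 2 * z) xi≡0) (ℤₚ.+-identityʳ (N i x))))
    (sum-≥0 _ (λ k → 0≤* (c≥0 k i) (x≥0 k)))

  π-≥term : ∀ {x i} → (∀ j → 0ℤ ≤ᶻ x j) → x i ≡ 0ℤ → ∀ k → c k i * x k ≤ᶻ π i x
  π-≥term {x} {i} x≥0 xi≡0 k = subst (c k i * x k ≤ᶻ_) (≡-sym (trans (cong (λ z → N i x - + 2 * z) xi≡0) (ℤₚ.+-identityʳ (N i x))))
    (sum-≥ (λ k → c k i * x k) (λ k → 0≤* (c≥0 k i) (x≥0 k)) k)

  c≥1 : ∀ {i j} → i ≢ j → m M i j ≢ 2 → 1ℤ ≤ᶻ c i j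
  c≥1 {i} {j} i≢j ≢2 with bond i j i≢j
  ... | bond₂ e _ _  = ⊥-elim (≢2 e)
  ... | bond₃ _ p _  = ℤₚ.≤-reflexive (≡-sym p)
  ... | bond₄ _ p _  = ℤₚ.≤-reflexive (≡-sym p)
  ... | bond₄′ _ p _ = subst (1ℤ ≤ᶻ_) (≡-sym p) (+≤+ (s≤s z≤n))

  product≥1 : ∀ {i j} → i ≢ j → m M i j ≢ 2 → 1ℤ ≤ᶻ c i j * c j i
  product≥1 {i} {j} i≢j ≢2 with bond i j i≢j
  ... | bond₂ e _ _   = ⊥-elim (≢2 e)
  ... | bond₃ _ p q  rewrite p | q = +≤+ (s≤s z≤n)
  ... | bond₄ _ p q  rewrite p | q = +≤+ (s≤s z≤n)
  ... | bond₄′ _ p q rewrite p | q = +≤+ (s≤s z≤n)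

  product≥2 : ∀ {i j} → i ≢ j → m M i j ≡ 4 → + 2 ≤ᶻ c i j * c j i
  product≥2 {i} {j} i≢j ≡4 with bond i j i≢j
  ... | bond₂ e _ _  = ⊥-elim (case trans (≡-sym ≡4) e of λ ())
  ... | bond₃ e _ _  = ⊥-elim (case trans (≡-sym ≡4) e of λ ())
  ... | bond₄ _ p q  rewrite p | q = ℤₚ.≤-refl
  ... | bond₄′ _ p q rewrite p | q = ℤₚ.≤-refl

  -- An affine diagram formed by part of an embedded diagram and one more vertex v attached at j: with
  -- μⱼ = 2ν the mark of v can be taken to be ν c(j,v), whatever the label of the new edge.
  module Forbid (p : ℕ → Fin n) (ent : ℕ → ℕ → ℤ) (μs : List ℤ)
    (inj : ∀ {a b} → a < length μs → b < length μs → p a ≡ p b → a ≡ b)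
    (ent≤ : ∀ a b → a < length μs → b < length μs → ent a b ≤ᶻ π (p a) (e (p b)))
    (v : Fin n) (out : ∀ {b} → b < length μs → p b ≢ v) (j : ℕ) (j< : j < length μs) (ν : ℕ) (μⱼ : at μs j ≡ + 2 * + suc ν) where

    combination : ℕ → List ℤ → V
    combination o []       l = 0ℤ
    combination o (μ ∷ μs) l = μ * e (p o) l + combination (suc o) μs l

    π-combination : ∀ i o xs → π i (combination o xs) ≡ dotFrom (λ b → π i (e (p b))) o xs
    π-combination i o []       = π-0 i
    π-combination i o (x ∷ xs) = trans (π-+ i (λ l → x * e (p o) l) (combination (suc o) xs))
      (cong₂ _+_ (π-* i x (e (p o))) (π-combination i (suc o) xs))

    dotFrom-mono : ∀ f g o xs → All (0ℤ ≤ᶻ_) xs → (∀ b → o ≤ b → b < o ℕ.+ length xs → f b ≤ᶻ g b) → dotFrom f o xs ≤ᶻ dotFrom g o xs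
    dotFrom-mono f g o []       []       h = ℤₚ.≤-refl
    dotFrom-mono f g o (x ∷ xs) (q ∷ qs) h = ℤₚ.+-mono-≤
      (mul x q (h o ℕₚ.≤-refl (ℕₚ.m<m+n o (s≤s z≤n))))
      (dotFrom-mono f g (suc o) xs qs (λ b le lt → h b (ℕₚ.<⇒≤ le) (subst (b <_) (≡-sym (ℕₚ.+-suc o (length xs))) lt)))
      where
      mul : ∀ x {y z} → 0ℤ ≤ᶻ x → y ≤ᶻ z → x * y ≤ᶻ x * z
      mul (+ x) _ q = ℤₚ.*-monoˡ-≤-nonNeg (+ x) q

    combination-≥0 : ∀ o xs → All (0ℤ ≤ᶻ_) xs → ∀ l → 0ℤ ≤ᶻ combination o xs l
    combination-≥0 o []       []       l = ℤₚ.≤-refl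
    combination-≥0 o (x ∷ xs) (q ∷ qs) l = 0≤+ (0≤* q (e≥0 (p o) l)) (combination-≥0 (suc o) xs qs l)

    combination-out : ∀ o xs l → (∀ b → o ≤ b → b < o ℕ.+ length xs → p b ≢ l) → combination o xs l ≡ 0ℤ
    combination-out o []       l h = refl
    combination-out o (x ∷ xs) l h = cong₂ _+_ (trans (cong (x *_) (e-diff (h o ℕₚ.≤-refl (ℕₚ.m<m+n o (s≤s z≤n))))) (ℤₚ.*-zeroʳ x))
      (combination-out (suc o) xs l (λ b le lt → h b (ℕₚ.<⇒≤ le) (subst (b <_) (≡-sym (ℕₚ.+-suc o (length xs))) lt)))

    combination-at : ∀ o xs r → r < length xs → (∀ {a b} → a < o ℕ.+ length xs → b < o ℕ.+ length xs → p a ≡ p b → a ≡ b) →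
                     combination o xs (p (o ℕ.+ r)) ≡ at xs r
    combination-at o (x ∷ xs) zero _ h rewrite ℕₚ.+-identityʳ o = trans (cong₂ _+_
        (trans (cong (x *_) (e-same (p o))) (ℤₚ.*-identityʳ x))
        (combination-out (suc o) xs (p o) (λ b le lt q → ℕₚ.<-irrefl
           (≡-sym (h (subst (b <_) (≡-sym (ℕₚ.+-suc o (length xs))) lt) (ℕₚ.m<m+n o (s≤s z≤n)) q)) le)))
      (ℤₚ.+-identityʳ x)
    combination-at o (x ∷ xs) (suc r) (s≤s lt) h = trans (cong₂ _+_
        (trans (cong (x *_) (e-diff (λ q → ℕₚ.<-irrefl (h (ℕₚ.m<m+n o (s≤s z≤n)) (ℕₚ.+-monoʳ-< o (s≤s lt)) q) (ℕₚ.m<m+n o (s≤s z≤n))))) (ℤₚ.*-zeroʳ x))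
        (trans (cong (λ z → combination (suc o) xs (p z)) (ℕₚ.+-suc o r))
          (combination-at (suc o) xs r lt (λ {a} {b} a< b< → h (subst (a <_) (≡-sym (ℕₚ.+-suc o (length xs))) a<) (subst (b <_) (≡-sym (ℕₚ.+-suc o (length xs))) b<)))))
      (ℤₚ.+-identityˡ (at xs r))

    νℤ μᵥ : ℤ
    νℤ = + suc ν
    μᵥ = νℤ * c (p j) v

    a : V
    a l = combination 0 μs l + μᵥ * e v l

    forbidden : ∀ q → 0ℤ ≤ᶻ q → q ≤ᶻ c (p j) v * c v (p j) → dominates ent μs j (νℤ * q) ≡ true → ⊥
    forbidden q q≥0 q≤ ok = no-antidominant a (a≥0 , p j , positive) antidominant
      where
      checks = ∧-elim {allᵇ ≤-bool μs} (subst T (≡-sym ok) tt)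
      μs≥0 : All (0ℤ ≤ᶻ_) μs
      μs≥0 = All.map (λ {z} → ≤-bool-sound z) (Allₚ.all⁺ ≤-bool μs (proj₁ checks))
      rows : ∀ {b} → b < length μs → 0ℤ ≤ᶻ dotFrom (ent b) 0 μs + (if b ℕ.≡ᵇ j then νℤ * q else 0ℤ)
      rows b< = ≤-bool-sound _ (All.lookup (Allₚ.all⁺ _ (L.upTo (length μs)) (proj₂ checks)) (∈-upTo⁺ b<))
      μᵥ≥0 : 0ℤ ≤ᶻ μᵥ
      μᵥ≥0 = 0≤* {νℤ} (+≤+ z≤n) (c≥0 (p j) v)
      a≥0 : ∀ l → 0ℤ ≤ᶻ a l
      a≥0 l = 0≤+ (combination-≥0 0 μs μs≥0 l) (0≤* μᵥ≥0 (e≥0 v l))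
      positive : 0ℤ <ᶻ a (p j)
      positive = subst (0ℤ <ᶻ_) (≡-sym (cong₂ _+_ (trans (combination-at 0 μs j j< inj) μⱼ)
        (trans (cong (μᵥ *_) (e-diff (out j< ∘ ≡-sym))) (ℤₚ.*-zeroʳ μᵥ)))) (+<+ (s≤s z≤n))
      π-a : ∀ i → π i a ≡ π i (combination 0 μs) + μᵥ * π i (e v)
      π-a i = trans (π-+ i (combination 0 μs) (λ l → μᵥ * e v l)) (cong (λ z → π i (combination 0 μs) + z) (π-* i μᵥ (e v)))
      antidominant : ∀ i → 0ℤ ≤ᶻ π i a
      antidominant i with ℕₚ.anyUpTo? (λ b → p b F.≟ i) (length μs)
      ... | yes (b , b< , refl) = subst (0ℤ ≤ᶻ_) (≡-sym (π-a (p b))) (ℤₚ.≤-trans (rows b<) (ℤₚ.+-mono-≤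
              (subst (dotFrom (ent b) 0 μs ≤ᶻ_) (≡-sym (π-combination (p b) 0 μs))
                (dotFrom-mono (ent b) (λ b′ → π (p b) (e (p b′))) 0 μs μs≥0 (λ b′ _ b′< → ent≤ b b′ b< b′<)))
              (subst (λ z → (if b ℕ.≡ᵇ j then νℤ * q else 0ℤ) ≤ᶻ μᵥ * z) (≡-sym (π-diff (out b<))) attach)))
        where
        attach : (if b ℕ.≡ᵇ j then νℤ * q else 0ℤ) ≤ᶻ μᵥ * c v (p b)
        attach with b ℕ.≡ᵇ j in eq
        ... | false = 0≤* μᵥ≥0 (c≥0 v (p b))
        ... | true rewrite ℕₚ.≡ᵇ⇒≡ b j (subst T (≡-sym eq) tt) =
              subst (νℤ * q ≤ᶻ_) (≡-sym (ℤₚ.*-assoc νℤ (c (p j) v) (c v (p j)))) (ℤₚ.*-monoˡ-≤-nonNeg νℤ q≤)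
      ... | no ¬in with i F.≟ v
      ...   | yes refl = subst (0ℤ ≤ᶻ_) (≡-sym (trans (π-a v) (cong (λ z → π v (combination 0 μs) + μᵥ * z) (π-same v))))
                (subst (_≤ᶻ π v (combination 0 μs) + μᵥ * - + 2) (lem (c (p j) v) νℤ)
                  (ℤₚ.+-monoˡ-≤ (μᵥ * - + 2) (subst (λ z → c (p j) v * z ≤ᶻ π v (combination 0 μs))
                    (trans (combination-at 0 μs j j< inj) μⱼ)
                    (π-≥term (combination-≥0 0 μs μs≥0) (combination-out 0 μs v (λ b _ b< → out b<)) (p j)))))
              where lem : ∀ x y → x * (+ 2 * y) + (y * x) * - + 2 ≡ 0ℤ
                    lem = solve-∀
      ...   | no i≢v = π-≥0 a≥0 (cong₂ _+_ (combination-out 0 μs i (λ b _ b< q → ¬in (b , b< , q)))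
                (trans (cong (μᵥ *_) (e-diff (i≢v ∘ ≡-sym))) (ℤₚ.*-zeroʳ μᵥ)))

  -- A cycle x - y - p j₁ - ⋯ - p j₂ - x.
  module Cycle (p : ℕ → Fin n) (j₁ j₂ : ℕ) (j₁≤j₂ : j₁ ≤ j₂)
    (inj : ∀ {a b} → a ≤ j₂ → b ≤ j₂ → p a ≡ p b → a ≡ b)
    (consecutive : ∀ {b} → j₁ ≤ b → b < j₂ → m M (p b) (p (suc b)) ≢ 2)
    (x y : Fin n) (x≢y : x ≢ y) (x∉ : ∀ {b} → j₁ ≤ b → b ≤ j₂ → p b ≢ x) (y∉ : ∀ {b} → j₁ ≤ b → b ≤ j₂ → p b ≢ y)
    (x-y : m M x y ≢ 2) (y-p : m M y (p j₁) ≢ 2) (p-x : m M (p j₂) x ≢ 2) where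

    On : Fin n → Set
    On l = (l ≡ x ⊎ l ≡ y) ⊎ ∃ λ b → b < suc j₂ × j₁ ≤ b × p b ≡ l

    on? : ∀ l → Dec (On l)
    on? l = ((l F.≟ x) ⊎-dec (l F.≟ y)) ⊎-dec ℕₚ.anyUpTo? (λ b → (j₁ ℕ.≤? b) ×-dec (p b F.≟ l)) (suc j₂)

    a : V
    a l = indicator (on? l)

    a-on : ∀ {l} → On l → a l ≡ 1ℤ
    a-on {l} o with on? l
    ... | yes _ = refl
    ... | no ¬o = ⊥-elim (¬o o)

    a-off : ∀ {l} → ¬ On l → a l ≡ 0ℤ
    a-off {l} ¬o with on? l
    ... | yes o = ⊥-elim (¬o o)
    ... | no _  = refl

    a≥0 : ∀ l → 0ℤ ≤ᶻ a l
    a≥0 l with on? l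
    ... | yes _ = +≤+ z≤n
    ... | no _  = +≤+ z≤n

    sym≢ : ∀ {i j} → m M i j ≢ 2 → m M j i ≢ 2
    sym≢ {i} {j} q r = q (trans (CoxeterMatrix.sym M i j) r)

    p≢ : ∀ {b b′} → b ≤ j₂ → b′ ≤ j₂ → b ≢ b′ → p b ≢ p b′
    p≢ le le′ ne q = ne (inj le le′ q)

    Adjacent : Fin n → Set
    Adjacent i = ∃ λ u → ∃ λ v → u ≢ v × On u × On v × (u ≢ i × m M u i ≢ 2) × (v ≢ i × m M v i ≢ 2)

    on-p : ∀ {b} → j₁ ≤ b → b ≤ j₂ → On (p b)
    on-p le le′ = inj₂ (_ , s≤s le′ , le , refl)

    adjacent : ∀ {i} → On i → Adjacent i
    adjacent (inj₁ (inj₁ refl)) = y , p j₂ , (y∉ j₁≤j₂ ℕₚ.≤-refl ∘ ≡-sym) , inj₁ (inj₂ refl) , on-p j₁≤j₂ ℕₚ.≤-refl ,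
      ((x≢y ∘ ≡-sym) , sym≢ x-y) , (x∉ j₁≤j₂ ℕₚ.≤-refl , p-x)
    adjacent (inj₁ (inj₂ refl)) = x , p j₁ , (x∉ ℕₚ.≤-refl j₁≤j₂ ∘ ≡-sym) , inj₁ (inj₁ refl) , on-p ℕₚ.≤-refl j₁≤j₂ ,
      (x≢y , x-y) , (y∉ ℕₚ.≤-refl j₁≤j₂ , sym≢ y-p)
    adjacent (inj₂ (b , s≤s b≤ , ≤b , refl)) with before b ≤b b≤ | after b ≤b b≤
      where
      Side : ℕ → Fin n → Set
      Side b u = On u × u ≢ p b × m M u (p b) ≢ 2
      before : ∀ b → j₁ ≤ b → b ≤ j₂ → ∃ λ u → Side b u × (u ≡ y ⊎ ∃ λ b′ → suc b′ ≡ b × j₁ ≤ b′ × u ≡ p b′)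
      before b ≤b b≤ with j₁ ℕ.≟ b
      ... | yes refl = y , (inj₁ (inj₂ refl) , (y∉ ≤b b≤ ∘ ≡-sym) , y-p) , inj₁ refl
      before zero    z≤n b≤ | no ne = ⊥-elim (ne refl)
      before (suc b) ≤b  b≤ | no ne = p b , (on-p j₁≤b (ℕₚ.<⇒≤ b≤) , p≢ (ℕₚ.<⇒≤ b≤) b≤ (ℕₚ.<⇒≢ (ℕₚ.n<1+n b)) ,
          consecutive j₁≤b b≤) , inj₂ (b , refl , j₁≤b , refl)
        where j₁≤b = ℕₚ.≤-pred (ℕₚ.≤∧≢⇒< ≤b ne)
      after : ∀ b → j₁ ≤ b → b ≤ j₂ → ∃ λ u → Side b u × (u ≡ x ⊎ (suc b ≤ j₂ × u ≡ p (suc b)))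
      after b ≤b b≤ with b ℕ.≟ j₂
      ... | yes refl = x , (inj₁ (inj₁ refl) , (x∉ ≤b b≤ ∘ ≡-sym) , sym≢ p-x) , inj₁ refl
      ... | no ne    = p (suc b) , (on-p (ℕₚ.m≤n⇒m≤1+n ≤b) sb≤ , p≢ sb≤ b≤ (ℕₚ.<⇒≢ (ℕₚ.n<1+n b) ∘ ≡-sym) ,
          sym≢ (consecutive ≤b sb≤)) , inj₂ (sb≤ , refl)
        where sb≤ = ℕₚ.≤∧≢⇒< b≤ ne
    ... | u , (on-u , u≢ , mu) , lu | v , (on-v , v≢ , mv) , rv = u , v , distinct lu rv , on-u , on-v , (u≢ , mu) , (v≢ , mv)
      where
      distinct : (u ≡ y ⊎ ∃ λ b′ → suc b′ ≡ b × j₁ ≤ b′ × u ≡ p b′) → (v ≡ x ⊎ (suc b ≤ j₂ × v ≡ p (suc b))) → u ≢ v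
      distinct (inj₁ refl) (inj₁ refl) q = x≢y (≡-sym q)
      distinct (inj₁ refl) (inj₂ (sb≤ , refl)) q = y∉ (ℕₚ.m≤n⇒m≤1+n ≤b) sb≤ (≡-sym q)
      distinct (inj₂ (b′ , refl , le , refl)) (inj₂ (sb≤ , refl)) q =
        p≢ (ℕₚ.<⇒≤ b≤) sb≤ (ℕₚ.<⇒≢ (ℕₚ.m<n⇒m<1+n (ℕₚ.n<1+n b′))) q
      distinct (inj₂ (b′ , refl , le , refl)) (inj₁ refl) q = x∉ le (ℕₚ.<⇒≤ b≤) q

    impossible : ⊥
    impossible = no-antidominant a (a≥0 , x , subst (0ℤ <ᶻ_) (≡-sym (a-on (inj₁ (inj₁ refl)))) (+<+ (s≤s z≤n))) antidominant
      where
      antidominant : ∀ i → 0ℤ ≤ᶻ π i a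
      antidominant i = decide (on? i)
        where
        decide : Dec (On i) → 0ℤ ≤ᶻ π i a
        decide (no ¬o) = π-≥0 a≥0 (a-off ¬o)
        decide (yes o) = let u , v , u≢v , on-u , on-v , (u≢i , mu) , (v≢i , mv) = adjacent o in
          subst (0ℤ ≤ᶻ_) (cong (λ z → N i a - + 2 * z) (≡-sym (a-on o)))
            (ℤₚ.i≤j⇒0≤j-i (ℤₚ.≤-trans (ℤₚ.+-mono-≤ (one u≢i mu on-u) (one v≢i mv on-v))
              (sum-≥₂ (λ k → c k i * a k) (λ k → 0≤* (c≥0 k i) (a≥0 k)) u≢v)))
          where
          one : ∀ {u} → u ≢ i → m M u i ≢ 2 → On u → 1ℤ ≤ᶻ c u i * a u
          one {u} u≢i mu on-u = subst (λ z → 1ℤ ≤ᶻ c u i * z) (≡-sym (a-on on-u))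
            (subst (1ℤ ≤ᶻ_) (≡-sym (ℤₚ.*-identityʳ (c u i))) (c≥1 u≢i mu))

  -- Affine diagrams of types B̃, C̃ and D̃: for a vertex v attached to an inner vertex j of a diagram of
  -- type B or D the null vector is E_j + E_(j+1) + d α_v, respectively 2 E_j + d c(j,v) α_v.
  module Inner (p : ℕ → Fin n) (k τ : ℕ) (inj : ∀ {a b} → a < k → b < k → p a ≡ p b → a ≡ b)
    (basis : SignedBasis M m≤4 p k τ)
    (Eτ≥0 : ∀ l → 0ℤ ≤ᶻ SignedBasis.E basis τ l) (E₀-out : ∀ l → (∀ {b} → b < k → p b ≢ l) → SignedBasis.E₀ basis l ≡ 0ℤ)
    (v : Fin n) (out : ∀ {b} → b < k → p b ≢ v) (j : ℕ) (t≤j : suc τ ≤ j) (j<k : j < k) where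

    open SignedBasis basis
    open SignedChain M m≤4 p k τ inj basis using (t; π-E; E-from; E-before; 0<k)

    E≥0 : ∀ b → τ ≤ b → ∀ l → 0ℤ ≤ᶻ E b l
    E≥0 b le l with τ ℕ.≟ b
    ... | yes refl = Eτ≥0 l
    E≥0 zero    z≤n l | no ne = ⊥-elim (ne refl)
    E≥0 (suc b) le  l | no ne = 0≤+ (E≥0 b (ℕₚ.≤-pred (ℕₚ.≤∧≢⇒< le ne)) l) (0≤* (ℤₚ.<⇒≤ d>0) (e≥0 (p (suc b)) l))

    E-out : ∀ b → b < k → ∀ l → (∀ {b} → b < k → p b ≢ l) → E b l ≡ 0ℤ
    E-out zero    b<k l o = E₀-out l o
    E-out (suc b) b<k l o = cong₂ _+_ (E-out b (ℕₚ.<-trans (ℕₚ.n<1+n b) b<k) l o)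
      (trans (cong (d *_) (e-diff (o b<k))) (ℤₚ.*-zeroʳ d))

    τ≤j : τ ≤ j
    τ≤j = ℕₚ.≤-trans (ℕₚ.n≤1+n τ) t≤j

    π-at-v : ∀ b → j ≤ b → b < k → c (p j) v * d ≤ᶻ π v (E b)
    π-at-v b j≤b b<k = subst (λ z → c (p j) v * z ≤ᶻ π v (E b)) (E-from j b t≤j j≤b b<k)
      (π-≥term (E≥0 b (ℕₚ.≤-trans τ≤j j≤b)) (E-out b b<k v out) (p j))

    module Combine (x : V) (g : ℤ) (g≥0 : 0ℤ ≤ᶻ g) (x≥0 : ∀ l → 0ℤ ≤ᶻ x l) (x-out : ∀ l → (∀ {b} → b < k → p b ≢ l) → x l ≡ 0ℤ)
      (x>0 : 0ℤ <ᶻ x (p j)) (at-v : + 2 * g ≤ᶻ π v x) (at-0 : 0ℤ ≤ᶻ π (p 0) x)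
      (at-suc : ∀ a → suc a < k → 0ℤ ≤ᶻ π (p (suc a)) x + g * c v (p (suc a))) where

      a : V
      a l = x l + g * e v l

      π-a : ∀ i → π i a ≡ π i x + g * π i (e v)
      π-a i = trans (π-+ i x (λ l → g * e v l)) (cong (λ z → π i x + z) (π-* i g (e v)))

      a≥0 : ∀ l → 0ℤ ≤ᶻ a l
      a≥0 l = 0≤+ (x≥0 l) (0≤* g≥0 (e≥0 v l))

      impossible : ⊥
      impossible = no-antidominant a (a≥0 , p j , ℤₚ.+-mono-<-≤ x>0 (0≤* g≥0 (e≥0 v (p j)))) antidominant
        where
        at-p : ∀ b → b < k → 0ℤ ≤ᶻ π (p b) x + g * c v (p b) → 0ℤ ≤ᶻ π (p b) a
        at-p b b<k = subst (0ℤ ≤ᶻ_) (≡-sym (trans (π-a (p b)) (cong (λ z → π (p b) x + g * z) (π-diff (out b<k)))))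
        antidominant : ∀ i → 0ℤ ≤ᶻ π i a
        antidominant i with ℕₚ.anyUpTo? (λ b → p b F.≟ i) k
        ... | yes (zero  , b<k , refl) = at-p 0 b<k (0≤+ at-0 (0≤* g≥0 (c≥0 v (p 0))))
        ... | yes (suc b , b<k , refl) = at-p (suc b) b<k (at-suc b b<k)
        ... | no ¬in with i F.≟ v
        ...   | yes refl = subst (0ℤ ≤ᶻ_) (≡-sym (trans (π-a v) (trans (cong (λ z → π v x + g * z) (π-same v)) (lem (π v x) g))))
                  (ℤₚ.i≤j⇒0≤j-i at-v)
                where lem : ∀ y g → y + g * - + 2 ≡ y - + 2 * g
                      lem = solve-∀
        ...   | no i≢v = π-≥0 a≥0 (cong₂ _+_ (x-out i (λ b<k q → ¬in (_ , b<k , q)))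
                  (trans (cong (g *_) (e-diff (i≢v ∘ ≡-sym))) (ℤₚ.*-zeroʳ g)))

    four : m M (p j) v ≡ 4 → ⊥
    four ≡4 = Combine.impossible (λ l → + 2 * E j l) g g≥0
        (λ l → 0≤* {+ 2} (+≤+ z≤n) (E≥0 j τ≤j l)) (λ l o → cong (+ 2 *_) (E-out j j<k l o))
        (0<* {+ 2} (+<+ (s≤s z≤n)) (subst (0ℤ <ᶻ_) (≡-sym (E-from j j t≤j ℕₚ.≤-refl j<k)) d>0))
        (subst₂ _≤ᶻ_ (cong (+ 2 *_) (ℤₚ.*-comm (c (p j) v) d)) (≡-sym (π-* v (+ 2) (E j)))
          (ℤₚ.*-monoˡ-≤-nonNeg (+ 2) (π-at-v j ℕₚ.≤-refl j<k)))
        (ℤₚ.≤-reflexive (≡-sym (trans (π-* (p 0) (+ 2) (E j)) (cong (+ 2 *_) (π-fix j t≤j j<k)))))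
        at-suc
      where
      g : ℤ
      g = d * c (p j) v
      g≥0 : 0ℤ ≤ᶻ g
      g≥0 = 0≤* (ℤₚ.<⇒≤ d>0) (c≥0 (p j) v)
      at-suc : ∀ a → suc a < k → 0ℤ ≤ᶻ π (p (suc a)) (λ l → + 2 * E j l) + g * c v (p (suc a))
      at-suc a a<k = subst (λ z → 0ℤ ≤ᶻ z + g * c v (p (suc a)))
          (≡-sym (trans (π-* (p (suc a)) (+ 2) (E j)) (cong (+ 2 *_) (π-E a j a<k j<k)))) inner
        where
        lem : ∀ d x y → d * (x * y - + 2) ≡ + 2 * (d * - 1ℤ) + (d * x) * y
        lem = solve-∀
        inner : 0ℤ ≤ᶻ + 2 * (d * γ (suc a) j) + g * c v (p (suc a))
        inner with j ℕ.≟ suc a | j ℕ.≟ a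
        ... | no r | no q rewrite γ-other a j q r = subst (λ z → 0ℤ ≤ᶻ + 2 * z + g * c v (p (suc a))) (≡-sym (ℤₚ.*-zeroʳ d))
              (0≤+ {0ℤ} ℤₚ.≤-refl (0≤* {g} g≥0 (c≥0 v (p (suc a)))))
        ... | _ | yes refl rewrite γ-left j = 0≤+ (0≤* {+ 2} (+≤+ z≤n) (0≤* {d} {1ℤ} (ℤₚ.<⇒≤ d>0) (+≤+ z≤n))) (0≤* {g} g≥0 (c≥0 v (p (suc a))))
        ... | yes refl | no _ rewrite γ-right a = subst (0ℤ ≤ᶻ_) (lem d (c (p (suc a)) v) (c v (p (suc a))))
              (0≤* (ℤₚ.<⇒≤ d>0) (ℤₚ.i≤j⇒0≤j-i (product≥2 (out j<k) ≡4)))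

    three : suc j < k → m M (p j) v ≢ 2 → ⊥
    three sj<k ≢2 = Combine.impossible (λ l → E j l + E (suc j) l) d (ℤₚ.<⇒≤ d>0)
        (λ l → 0≤+ (E≥0 j τ≤j l) (E≥0 (suc j) (ℕₚ.m≤n⇒m≤1+n τ≤j) l)) (λ l o → cong₂ _+_ (E-out j j<k l o) (E-out (suc j) sj<k l o))
        (subst (0ℤ <ᶻ_) (≡-sym (cong₂ _+_ (E-from j j t≤j ℕₚ.≤-refl j<k) (E-from j (suc j) t≤j (ℕₚ.n≤1+n j) sj<k))) (ℤₚ.+-mono-< d>0 d>0))
        (subst₂ _≤ᶻ_ (lem₀ d) (≡-sym (π-+ v (E j) (E (suc j)))) (ℤₚ.+-mono-≤ (d≤ (π-at-v j ℕₚ.≤-refl j<k)) (d≤ (π-at-v (suc j) (ℕₚ.n≤1+n j) sj<k))))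
        (ℤₚ.≤-reflexive (≡-sym (trans (π-+ (p 0) (E j) (E (suc j))) (cong₂ _+_ (π-fix j t≤j j<k) (π-fix (suc j) (ℕₚ.m≤n⇒m≤1+n t≤j) sj<k)))))
        at-suc
      where
      lem₀ : ∀ d → d + d ≡ + 2 * d
      lem₀ = solve-∀
      d≤ : ∀ {z} → c (p j) v * d ≤ᶻ z → d ≤ᶻ z
      d≤ q = ℤₚ.≤-trans (subst (_≤ᶻ c (p j) v * d) (ℤₚ.*-identityˡ d)
        (ℤₚ.*-monoʳ-≤-nonNeg d {{ℤ.nonNegative (ℤₚ.<⇒≤ d>0)}} (c≥1 (out j<k) ≢2))) q
      at-suc : ∀ a → suc a < k → 0ℤ ≤ᶻ π (p (suc a)) (λ l → E j l + E (suc j) l) + d * c v (p (suc a))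
      at-suc a a<k = subst (0ℤ ≤ᶻ_)
          (trans (lem₁ d (γ (suc a) j) (γ a j) (c v (p (suc a)))) (cong (_+ d * c v (p (suc a)))
            (≡-sym (trans (π-+ (p (suc a)) (E j) (E (suc j))) (cong₂ _+_ (π-E a j a<k j<k) (π-E a (suc j) a<k sj<k))))))
          (0≤* (ℤₚ.<⇒≤ d>0) inner)
        where
        lem₁ : ∀ d x y z → d * ((x + y) + z) ≡ (d * x + d * y) + d * z
        lem₁ = solve-∀
        γ-zero : ∀ a → γ a (suc a) ≡ 0ℤ
        γ-zero zero    = refl
        γ-zero (suc a) = γ-zero a
        inner : 0ℤ ≤ᶻ (γ (suc a) j + γ a j) + c v (p (suc a))
        inner with j ℕ.≟ suc a | j ℕ.≟ a
        ... | no r | no q rewrite γ-other a j q r = 0≤+ (γ≥0 a j q) (c≥0 v (p (suc a)))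
          where γ≥0 : ∀ a j → j ≢ a → 0ℤ ≤ᶻ 0ℤ + γ a j
                γ≥0 zero          zero    q = ⊥-elim (q refl)
                γ≥0 zero          (suc j) q = ℤₚ.≤-refl
                γ≥0 (suc zero)    zero    q = +≤+ z≤n
                γ≥0 (suc (suc a)) zero    q = ℤₚ.≤-refl
                γ≥0 (suc a)       (suc j) q = γ≥0 a j (q ∘ cong suc)
        ... | _ | yes refl rewrite γ-left j | γ-right j = 0≤+ {0ℤ} ℤₚ.≤-refl (c≥0 v (p (suc a)))
        ... | yes refl | no _ rewrite γ-right a | γ-zero a = ℤₚ.+-monoʳ-≤ (- 1ℤ) (c≥1 (out j<k ∘ ≡-sym) (λ q → ≢2 (trans (CoxeterMatrix.sym M (p (suc a)) v) q)))

entry₄ : ℤ → ℤ → ℕ → ℕ → ℕ → ℤ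
entry₄ x y 1 a b = - + 2
entry₄ x y 3 a b = 1ℤ
entry₄ x y 4 a b = if a ℕ.<ᵇ b then y else x
entry₄ x y _ a b = 0ℤ

chain-sym : ∀ a b → chain a b ≡ chain b a
chain-sym zero          zero          = refl
chain-sym zero          (suc zero)    = refl
chain-sym (suc zero)    zero          = refl
chain-sym zero          (suc (suc b)) = refl
chain-sym (suc (suc a)) zero          = refl
chain-sym (suc a)       (suc b)       = chain-sym a b

chain-diag : ∀ a → chain a a ≡ 1
chain-diag zero    = refl
chain-diag (suc a) = chain-diag a

chain-next : ∀ a → chain a (suc a) ≡ 3
chain-next zero    = refl
chain-next (suc a) = chain-next a

chain-far : ∀ {a b} → suc a < b → chain a b ≡ 2
chain-far {zero}  {suc (suc b)} _        = refl
chain-far {zero}  {suc zero} (s≤s ())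
chain-far {suc a} {suc b}       (s≤s lt) = chain-far lt

chain-shift : ∀ o a b → chain (o ℕ.+ a) (o ℕ.+ b) ≡ chain a b
chain-shift zero    a b = refl
chain-shift (suc o) a b = chain-shift o a b

star-sym : ∀ t ℓ a b → star t ℓ a b ≡ star t ℓ b a
star-sym t ℓ zero    zero    = refl
star-sym t ℓ zero    (suc b) = refl
star-sym t ℓ (suc a) zero    = refl
star-sym t ℓ (suc a) (suc b) = chain-sym a b

star-diag : ∀ t ℓ a → star t ℓ a a ≡ 1
star-diag t ℓ zero    = refl
star-diag t ℓ (suc a) = chain-diag a

star3≢4 : ∀ t a b → star t 3 a b ≢ 4
star3≢4 t zero    zero    ()
star3≢4 t zero    (suc b) with suc b ℕ.≡ᵇ t
... | true  = λ ()
... | false = λ ()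
star3≢4 t (suc a) zero    with suc a ℕ.≡ᵇ t
... | true  = λ ()
... | false = λ ()
star3≢4 t (suc a) (suc b) = chain≢4 a b

data Diagram : (ℕ → ℕ → ℕ) → ℕ → Set where
  dA : ∀ {k} → 1 ≤ k → Diagram chain k
  dB : ∀ {k} → 2 ≤ k → Diagram (star 1 4) k
  dD : ∀ {k} → 4 ≤ k → Diagram (star 2 3) k
  dE : ∀ {k} → 6 ≤ k → k ≤ 8 → Diagram (star 3 3) k
  dF : Diagram labF 4

module Embeddings {n : ℕ} (M : CoxeterMatrix n) where
  open Embedding

  Avoids : (ℕ → Fin n) → ℕ → Fin n → Set
  Avoids p k v = ∀ {b} → b < k → p b ≢ v

  relabel : ∀ {lab lab′ k k′} (σ : ℕ → ℕ) → (∀ {b} → b < k′ → σ b < k) →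
            (∀ {a b} → a < k′ → b < k′ → σ a ≡ σ b → a ≡ b) →
            (∀ {a b} → a < k′ → b < k′ → lab (σ a) (σ b) ≡ lab′ a b) → Embedding M lab k → Embedding M lab′ k′
  relabel σ σ< σ-inj q E .p b        = p E (σ b)
  relabel σ σ< σ-inj q E .inj  a< b< = σ-inj a< b< ∘ inj E (σ< a<) (σ< b<)
  relabel σ σ< σ-inj q E .lab≡ a< b< = trans (lab≡ E (σ< a<) (σ< b<)) (q a< b<)

  prepend : ∀ {lab lab′ k} (E : Embedding M lab k) (v : Fin n) → Avoids (p E) k v →
            (∀ a b → a < k → b < k → lab′ (suc a) (suc b) ≡ lab a b) → (∀ b → b < k → m M (p E b) v ≡ lab′ 0 (suc b)) →
            (∀ b → lab′ (suc b) 0 ≡ lab′ 0 (suc b)) → lab′ 0 0 ≡ 1 → Embedding M lab′ (suc k)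
  prepend E v out q r s′ d .p zero    = v
  prepend E v out q r s′ d .p (suc b) = p E b
  prepend E v out q r s′ d .inj {zero}  {zero}  _ _ _ = refl
  prepend E v out q r s′ d .inj {zero}  {suc b} _ (s≤s b<) eq = ⊥-elim (out b< (≡-sym eq))
  prepend E v out q r s′ d .inj {suc a} {zero}  (s≤s a<) _ eq = ⊥-elim (out a< eq)
  prepend E v out q r s′ d .inj {suc a} {suc b} (s≤s a<) (s≤s b<) eq = cong suc (inj E a< b< eq)
  prepend E v out q r s′ d .lab≡ {zero}  {zero}  _ _ = trans (diag M v) (≡-sym d)
  prepend E v out q r s′ d .lab≡ {zero}  {suc b} _ (s≤s b<) = trans (CoxeterMatrix.sym M v _) (r b b<)
  prepend E v out q r s′ d .lab≡ {suc a} {zero}  (s≤s a<) _ = trans (r a a<) (≡-sym (s′ a))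
  prepend E v out q r s′ d .lab≡ {suc a} {suc b} (s≤s a<) (s≤s b<) = trans (lab≡ E a< b<) (≡-sym (q a b a< b<))

  snoc : (ℕ → Fin n) → ℕ → Fin n → ℕ → Fin n
  snoc p k v b with b ℕ.≟ k
  ... | yes _ = v
  ... | no _  = p b

  snoc-init : ∀ p k v {b} → b < k → snoc p k v b ≡ p b
  snoc-init p k v {b} lt with b ℕ.≟ k
  ... | yes refl = ⊥-elim (ℕₚ.<-irrefl refl lt)
  ... | no _     = refl

  append : ∀ {lab k} (E : Embedding M lab k) (v : Fin n) → Avoids (p E) k v →
           (∀ b → b < k → m M (p E b) v ≡ lab b k) → (∀ b → lab k b ≡ lab b k) → lab k k ≡ 1 → Embedding M lab (suc k)
  append {lab} {k} E v out r s′ d = record { p = p′ ; inj = λ {a} {b} → inj′ a b ; lab≡ = λ {a} {b} → lab′ a b }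
    where
    p′ = snoc (p E) k v
    last : ∀ {b} → b < suc k → b ≢ k → b < k
    last b< ne = ℕₚ.≤∧≢⇒< (ℕₚ.≤-pred b<) ne
    inj′ : ∀ a b → a < suc k → b < suc k → p′ a ≡ p′ b → a ≡ b
    inj′ a b a< b< eq with a ℕ.≟ k | b ℕ.≟ k
    ... | yes refl | yes refl = refl
    ... | yes _    | no q     = ⊥-elim (out (last b< q) (≡-sym eq))
    ... | no q     | yes _    = ⊥-elim (out (last a< q) eq)
    ... | no q     | no r     = inj E (last a< q) (last b< r) eq
    lab′ : ∀ a b → a < suc k → b < suc k → m M (p′ a) (p′ b) ≡ lab a b
    lab′ a b a< b< with a ℕ.≟ k | b ℕ.≟ k
    ... | yes refl | yes refl = trans (diag M v) (≡-sym d)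
    ... | yes refl | no q     = trans (CoxeterMatrix.sym M v (p E b)) (trans (r b (last b< q)) (≡-sym (s′ b)))
    ... | no q     | yes refl = r a (last a< q)
    ... | no q     | no r     = lab≡ E (last a< q) (last b< r)

module Growth {n : ℕ} (M : CoxeterMatrix n) (m≤4 : ∀ i j → m M i j ≤ 4)
  (w₀ : Word n) (longest : IsLongestWord M w₀) where

  open Tits M m≤4
  open Embeddings M
  open Obstructions M m≤4 w₀ longest
  open Embedding

  label34 : ∀ i j → i ≢ j → m M i j ≢ 2 → m M i j ≡ 3 ⊎ m M i j ≡ 4
  label34 i j i≢j ≢2 with bond i j i≢j
  ... | bond₂ e _ _  = ⊥-elim (≢2 e)
  ... | bond₃ e _ _  = inj₁ e
  ... | bond₄ e _ _  = inj₂ e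
  ... | bond₄′ e _ _ = inj₂ e

  ≡3⇒≢2 : ∀ {i j} → m M i j ≡ 3 → m M i j ≢ 2
  ≡3⇒≢2 e f = case trans (≡-sym e) f of λ ()

  ≡4⇒≢2 : ∀ {i j} → m M i j ≡ 4 → m M i j ≢ 2
  ≡4⇒≢2 e f = case trans (≡-sym e) f of λ ()

  Oriented : (ℕ → ℕ → ℕ) → ℕ → (ℕ → Fin n) → ℤ → ℤ → Set
  Oriented lab k p x y = ∀ a b → a < b → b < k → lab a b ≡ 4 → c (p a) (p b) ≡ x × c (p b) (p a) ≡ y

  π-entry₄ : ∀ {lab k} (E : Embedding M lab k) → (∀ a b → lab a b ≡ lab b a) → ∀ x y → Oriented lab k (p E) x y →
             ∀ a b → a < k → b < k → π (p E a) (e (p E b)) ≡ entry₄ x y (lab a b) a b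
  π-entry₄ {lab} E lab-sym x y ori a b a< b< with a ℕ.≟ b
  ... | yes refl rewrite ≡-sym (lab≡ E a< a<) | diag M (p E a) = π-same (p E a)
  ... | no a≢b = trans (π-diff pa≢pb) (go (bond (p E a) (p E b) pa≢pb))
    where
    pa≢pb : p E a ≢ p E b
    pa≢pb q = a≢b (inj E a< b< q)
    lab′ : ∀ {v} → m M (p E a) (p E b) ≡ v → lab a b ≡ v
    lab′ q = trans (≡-sym (lab≡ E a< b<)) q
    four : m M (p E a) (p E b) ≡ 4 → c (p E b) (p E a) ≡ entry₄ x y (lab a b) a b
    four mm rewrite lab′ mm with a ℕ.<ᵇ b in eq
    ... | true  = proj₂ (ori a b (ℕₚ.<ᵇ⇒< a b (subst T (≡-sym eq) tt)) b< (lab′ mm))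
    ... | false = proj₁ (ori b a (ℕₚ.≤∧≢⇒< (ℕₚ.≮⇒≥ (λ lt → subst T eq (ℕₚ.<⇒<ᵇ lt))) (a≢b ∘ ≡-sym)) a<
                    (trans (lab-sym b a) (lab′ mm)))
    go : Bond (p E a) (p E b) → c (p E b) (p E a) ≡ entry₄ x y (lab a b) a b
    go (bond₂ mm q r) rewrite lab′ mm = r
    go (bond₃ mm q r) rewrite lab′ mm = r
    go (bond₄ mm q r)  = four mm
    go (bond₄′ mm q r) = four mm

  module Attached {lab : ℕ → ℕ → ℕ} {k : ℕ} (E : Embedding M lab k) (v : Fin n) (out : Avoids (p E) k v) where

    forbid : (lab-sym : ∀ a b → lab a b ≡ lab b a) (x y : ℤ) → Oriented lab k (p E) x y →
             (μs : List ℤ) → length μs ≤ k → ∀ j → j < length μs → ∀ ν → at μs j ≡ + 2 * + suc ν → ∀ q → 0ℤ ≤ᶻ q →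
             q ≤ᶻ c (p E j) v * c v (p E j) → dominates (λ a b → entry₄ x y (lab a b) a b) μs j (+ suc ν * q) ≡ true → ⊥
    forbid lab-sym x y ori μs le j j< ν μⱼ q q≥0 q≤ ok = Forbid.forbidden (p E) (λ a b → entry₄ x y (lab a b) a b) μs
      (λ a< b< → inj E (ℕₚ.<-≤-trans a< le) (ℕₚ.<-≤-trans b< le))
      (λ a b a< b< → ℤₚ.≤-reflexive (≡-sym (π-entry₄ E lab-sym x y ori a b (ℕₚ.<-≤-trans a< le) (ℕₚ.<-≤-trans b< le))))
      v (λ b< → out (ℕₚ.<-≤-trans b< le)) j j< ν μⱼ q q≥0 q≤ ok

    one : ∀ j → j < k → m M (p E j) v ≢ 2 → 1ℤ ≤ᶻ c (p E j) v * c v (p E j)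
    one j j< = product≥1 (out j<)

    two : ∀ j → j < k → m M (p E j) v ≡ 4 → + 2 ≤ᶻ c (p E j) v * c v (p E j)
    two j j< = product≥2 (out j<)

    Spur : ℕ → ℕ → Set
    Spur lo t = lo ≡ 0 ⊎ (lo ≡ 1 × 1 ≤ t × t < k × lab 0 t ≢ 2 × lab t 0 ≢ 2)

    private
      symv : ∀ {i j} → m M i j ≢ 2 → m M j i ≢ 2
      symv {i} {j} q r = q (trans (CoxeterMatrix.sym M i j) r)

      inj≤ : ∀ {j₂} → j₂ < k → ∀ {a b} → a ≤ j₂ → b ≤ j₂ → p E a ≡ p E b → a ≡ b
      inj≤ j₂< a≤ b≤ = inj E (ℕₚ.≤-<-trans a≤ j₂<) (ℕₚ.≤-<-trans b≤ j₂<)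

      consecutive : ∀ lo → (∀ c → lo ≤ c → suc c < k → lab c (suc c) ≢ 2) →
                    ∀ {j₂} → j₂ < k → ∀ {c} → lo ≤ c → c < j₂ → m M (p E c) (p E (suc c)) ≢ 2
      consecutive lo chained j₂< le lt q = chained _ le (ℕₚ.≤-<-trans lt j₂<)
        (trans (≡-sym (lab≡ E (ℕₚ.<-trans lt j₂<) (ℕₚ.≤-<-trans lt j₂<))) q)

      ordered : ∀ lo t → (∀ c → lo ≤ c → suc c < k → lab c (suc c) ≢ 2) → Spur lo t →
                ∀ a b → a < b → b < k → m M (p E a) v ≢ 2 → m M (p E b) v ≢ 2 → ⊥
      ordered lo t chained spur a b a<b b< qa qb with lo ℕ.≤? a
      ordered lo t chained spur a b a<b b< qa qb | yes lo≤a =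
        Cycle.impossible (p E) (suc a) b a<b (inj≤ b<)
          (λ le lt → consecutive lo chained b< (ℕₚ.≤-trans lo≤a (ℕₚ.≤-trans (ℕₚ.n≤1+n a) le)) lt)
          v (p E a) (out (ℕₚ.<-trans a<b b<) ∘ ≡-sym) (λ _ le → out (ℕₚ.≤-<-trans le b<))
          (λ le le′ q → ℕₚ.<-irrefl (inj E (ℕₚ.<-trans a<b b<) (ℕₚ.≤-<-trans le′ b<) (≡-sym q)) le)
          (symv qa) (consecutive lo chained b< lo≤a a<b) qb
      ordered lo t chained (inj₁ refl) a b a<b b< qa qb | no lo≰a = ⊥-elim (lo≰a z≤n)
      ordered lo t chained (inj₂ (refl , _)) (suc a) b a<b b< qa qb | no lo≰a = ⊥-elim (lo≰a (s≤s z≤n))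
      ordered lo t chained (inj₂ (refl , 1≤t , t< , q0t , qt0)) zero b a<b b< qa qb | no _ with t ℕ.≤? b
      ... | yes t≤b = Cycle.impossible (p E) t b t≤b (inj≤ b<) (λ le lt → consecutive 1 chained b< (ℕₚ.≤-trans 1≤t le) lt)
            v (p E 0) (out (ℕₚ.≤-<-trans z≤n b<) ∘ ≡-sym) (λ _ le → out (ℕₚ.≤-<-trans le b<))
            (λ le le′ q → ℕₚ.<-irrefl (inj E (ℕₚ.≤-<-trans z≤n b<) (ℕₚ.≤-<-trans le′ b<) (≡-sym q)) (ℕₚ.<-≤-trans 1≤t le))
            (symv qa) (λ q → q0t (trans (≡-sym (lab≡ E (ℕₚ.≤-<-trans z≤n b<) t<)) q)) qb
      ... | no t≰b = Cycle.impossible (p E) b t (ℕₚ.<⇒≤ (ℕₚ.≰⇒> t≰b)) (inj≤ t<) (λ le lt → consecutive 1 chained t< (ℕₚ.≤-trans a<b le) lt)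
            (p E 0) v (out (ℕₚ.≤-<-trans z≤n b<))
            (λ le le′ q → ℕₚ.<-irrefl (inj E (ℕₚ.≤-<-trans z≤n b<) (ℕₚ.≤-<-trans le′ t<) (≡-sym q)) (ℕₚ.<-≤-trans a<b le))
            (λ _ le → out (ℕₚ.≤-<-trans le t<))
            qa (symv qb) (λ q → qt0 (trans (≡-sym (lab≡ E t< (ℕₚ.≤-<-trans z≤n b<))) q))

    -- The chain starts at lo; if lo = 1 then the vertex 0 is joined to the chain at t.
    unique : ∀ lo t → (∀ c → lo ≤ c → suc c < k → lab c (suc c) ≢ 2) → Spur lo t →
             ∀ {a b} → a < k → b < k → a ≢ b → m M (p E a) v ≢ 2 → m M (p E b) v ≢ 2 → ⊥
    unique lo t chained spur {a} {b} a< b< a≢b qa qb with ℕₚ.<-cmp a b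
    ... | tri≈ _ q _  = a≢b q
    ... | tri< lt _ _ = ordered lo t chained spur a b lt b< qa qb
    ... | tri> _ _ gt = ordered lo t chained spur b a gt a< qb qa

    only : ∀ lo t → (∀ c → lo ≤ c → suc c < k → lab c (suc c) ≢ 2) → Spur lo t →
           ∀ {j} → j < k → m M (p E j) v ≢ 2 → ∀ b → b < k → b ≢ j → m M (p E b) v ≡ 2
    only lo t chained spur {j} j< qj b b< b≢j with m M (p E b) v ℕ.≟ 2
    ... | yes q = q
    ... | no q  = ⊥-elim (unique lo t chained spur b< j< b≢j q qj)

labF-sym : ∀ a b → labF a b ≡ labF b a
labF-sym 0 0 = refl
labF-sym 0 1 = refl
labF-sym 0 2 = refl
labF-sym 0 (suc (suc (suc b))) = refl
labF-sym 1 0 = refl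
labF-sym 1 1 = refl
labF-sym 1 2 = refl
labF-sym 1 (suc (suc (suc b))) = refl
labF-sym 2 0 = refl
labF-sym 2 1 = refl
labF-sym 2 2 = refl
labF-sym 2 (suc (suc (suc b))) = chain-sym 2 (suc (suc (suc b)))
labF-sym (suc (suc (suc a))) 0 = refl
labF-sym (suc (suc (suc a))) 1 = refl
labF-sym (suc (suc (suc a))) 2 = chain-sym (suc (suc (suc a))) 2
labF-sym (suc (suc (suc a))) (suc (suc (suc b))) = chain-sym a b

star-last-hit : ∀ t ℓ j → 1 ≤ j → star t ℓ j (suc j) ≡ 3
star-last-hit t ℓ (suc j) _ = chain-next j

star-last-miss : ∀ t ℓ j b → t < suc j → b < j → star t ℓ b (suc j) ≡ 2
star-last-miss t ℓ j zero t< _ with suc j ℕ.≡ᵇ t in eq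
... | true  = ⊥-elim (ℕₚ.<-irrefl (≡-sym (ℕₚ.≡ᵇ⇒≡ (suc j) t (subst T (≡-sym eq) tt))) t<)
... | false = refl
star-last-miss t ℓ j (suc b) t< lt = chain-far lt

reflect : ℕ → ℕ → ℕ
reflect k b = k ℕ.∸ suc b

reflect-< : ∀ {k b} → b < k → reflect k b < k
reflect-< {suc k} {b} lt = s≤s (ℕₚ.m∸n≤m k b)

reflect≤ : ∀ k j → k ≤ j ℕ.+ j → reflect k j ≤ j
reflect≤ k j le = ℕₚ.≤-trans (ℕₚ.∸-monoʳ-≤ k (ℕₚ.n≤1+n j))
  (ℕₚ.≤-trans (ℕₚ.∸-monoˡ-≤ j le) (ℕₚ.≤-reflexive (ℕₚ.m+n∸n≡m j j)))

reflect-reflect : ∀ {k b} → b < k → reflect k (reflect k b) ≡ b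
reflect-reflect {suc k} {b} (s≤s le) = ℕₚ.m∸[m∸n]≡n le

reflect-suc : ∀ {k b} → suc b < k → reflect k b ≡ suc (reflect k (suc b))
reflect-suc {suc k} {b} (s≤s lt) = ℕₚ.+-∸-assoc 1 lt

chain-reflect-< : ∀ k {a b} → a < b → b < k → chain (reflect k a) (reflect k b) ≡ chain a b
chain-reflect-< k {a} {b} a<b b< with suc a ℕ.≟ b
... | yes refl = trans (trans (cong (λ z → chain z (reflect k (suc a))) (reflect-suc b<))
      (trans (chain-sym (suc (reflect k (suc a))) (reflect k (suc a))) (chain-next (reflect k (suc a))))) (≡-sym (chain-next a))
... | no ne = trans (trans (chain-sym (reflect k a) (reflect k b)) (chain-far (subst (suc (reflect k b) <_)
      (≡-sym (reflect-suc (ℕₚ.≤-<-trans a<b b<))) (s≤s (ℕₚ.∸-monoʳ-< (s≤s (ℕₚ.≤∧≢⇒< a<b ne)) b<)))))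
      (≡-sym (chain-far (ℕₚ.≤∧≢⇒< a<b ne)))

chain-reflect : ∀ {k a b} → a < k → b < k → chain (reflect k a) (reflect k b) ≡ chain a b
chain-reflect {k} {a} {b} a< b< with ℕₚ.<-cmp a b
... | tri≈ _ refl _ = trans (chain-diag (reflect k a)) (≡-sym (chain-diag a))
... | tri< lt _ _ = chain-reflect-< k lt b<
... | tri> _ _ gt = trans (chain-sym (reflect k a) (reflect k b)) (trans (chain-reflect-< k gt a<) (chain-sym b a))

module Classification {n : ℕ} (M : CoxeterMatrix n) (m≤4 : ∀ i j → m M i j ≤ 4)
  (w₀ : Word n) (longest : IsLongestWord M w₀) where

  open Tits M m≤4
  open Embeddings M
  open Growth M m≤4 w₀ longest
  open Obstructions M m≤4 w₀ longest using (module Inner)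
  open Embedding

  record Extension (p₀ : ℕ → Fin n) (k : ℕ) : Set where
    constructor extension
    field
      {lab′}  : ℕ → ℕ → ℕ
      diagram : Diagram lab′ (suc k)
      embed   : Embedding M lab′ (suc k)
      covers  : ∀ b → b < k → ∃ λ b′ → b′ < suc k × p embed b′ ≡ p₀ b

  through : ∀ {p₀ k} (σ : ℕ → ℕ) → (∀ {b} → b < k → σ b < k) → (∀ {b} → b < k → σ (σ b) ≡ b) →
            Extension (p₀ ∘ σ) k → Extension p₀ k
  through {p₀} σ σ< σσ (extension d E′ cov) = extension d E′ (λ b b< →
    let b′ , b′< , eq = cov (σ b) (σ< b<) in b′ , b′< , trans eq (cong p₀ (σσ b<)))

  prepended : ∀ {lab lab′ k} (E : Embedding M lab k) (v : Fin n) (out : Avoids (p E) k v) (d : Diagram lab′ (suc k)) →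
              (∀ a b → a < k → b < k → lab′ (suc a) (suc b) ≡ lab a b) → (∀ b → b < k → m M (p E b) v ≡ lab′ 0 (suc b)) →
              (∀ b → lab′ (suc b) 0 ≡ lab′ 0 (suc b)) → lab′ 0 0 ≡ 1 → Extension (p E) k
  prepended E v out d q r s′ z = extension d (prepend E v out q r s′ z) (λ b b< → suc b , s≤s b< , refl)

  module Attach {lab : ℕ → ℕ → ℕ} {k : ℕ} (E : Embedding M lab k) (v : Fin n) (out : Avoids (p E) k v)
    (j : ℕ) (j< : j < k) (att : m M (p E j) v ≢ 2) where

    open Attached E v out

    3or4 : m M (p E j) v ≡ 3 ⊎ m M (p E j) v ≡ 4
    3or4 = label34 (p E j) v (out j<) att

    forbid₁ : (∀ a b → lab a b ≡ lab b a) → ∀ x y → Oriented lab k (p E) x y → ∀ μs → length μs ≤ k → j < length μs →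
              ∀ ν → at μs j ≡ + 2 * + suc ν → dominates (λ a b → entry₄ x y (lab a b) a b) μs j (+ suc ν * 1ℤ) ≡ true → ⊥
    forbid₁ ls x y ori μs le j<l ν μⱼ ok = forbid ls x y ori μs le j j<l ν μⱼ 1ℤ (+≤+ z≤n) (one j j< att) ok

    forbid₂ : m M (p E j) v ≡ 4 → (∀ a b → lab a b ≡ lab b a) → ∀ x y → Oriented lab k (p E) x y → ∀ μs → length μs ≤ k → j < length μs →
              ∀ ν → at μs j ≡ + 2 * + suc ν → dominates (λ a b → entry₄ x y (lab a b) a b) μs j (+ suc ν * + 2) ≡ true → ⊥
    forbid₂ ≡4 ls x y ori μs le j<l ν μⱼ ok = forbid ls x y ori μs le j j<l ν μⱼ (+ 2) (+≤+ z≤n) (two j j< ≡4) ok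

    appended : suc j ≡ k → Diagram lab (suc k) → m M (p E j) v ≡ lab j k → (∀ b → b < k → b ≢ j → m M (p E b) v ≡ 2) →
               (∀ b → b < j → lab b k ≡ 2) → (∀ b → lab k b ≡ lab b k) → lab k k ≡ 1 → Extension (p E) k
    appended refl d hit miss far s′ z = extension d (append E v out row s′ z) (λ b b< → b , ℕₚ.m<n⇒m<1+n b< , snoc-init (p E) k v b<)
      where
      row : ∀ b → b < suc j → m M (p E b) v ≡ lab b (suc j)
      row b b< with b ℕ.≟ j
      ... | yes refl = hit
      ... | no ne    = trans (miss b b< ne) (≡-sym (far b (ℕₚ.≤∧≢⇒< (ℕₚ.≤-pred b<) ne)))

  star-appended : ∀ {t ℓ k} (E : Embedding M (star t ℓ) k) v (out : Avoids (p E) k v) j (j< : j < k) → m M (p E j) v ≡ 3 →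
    1 ≤ j → suc j ≡ k → t < k → Diagram (star t ℓ) (suc k) → (∀ b → b < k → b ≢ j → m M (p E b) v ≡ 2) → Extension (p E) k
  star-appended {t} {ℓ} E v out j j< ≡3 1≤j refl t<k d miss = Attach.appended E v out j j< (≡3⇒≢2 ≡3) refl d
    (trans ≡3 (≡-sym (star-last-hit t ℓ j 1≤j))) miss (λ b → star-last-miss t ℓ j b t<k) (star-sym t ℓ (suc j)) (star-diag t ℓ (suc j))

  chained-chain : ∀ {k} c → 0 ≤ c → suc c < k → chain c (suc c) ≢ 2
  chained-chain c _ _ q = case trans (≡-sym (chain-next c)) q of λ ()

  chained-star : ∀ {t ℓ k} c → 1 ≤ c → suc c < k → star t ℓ c (suc c) ≢ 2
  chained-star (suc c) _ _ q = case trans (≡-sym (chain-next c)) q of λ ()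

  shift : ∀ o {L k} → o ℕ.+ L ≤ k → Embedding M chain k → Embedding M chain L
  shift o {L} {k} le = relabel (o ℕ.+_) (λ b< → ℕₚ.<-≤-trans (ℕₚ.+-monoʳ-< o b<) le) (λ _ _ → ℕₚ.+-cancelˡ-≡ o _ _)
    (λ {a} {b} _ _ → chain-shift o a b)

  -- A forbidden configuration inside the chain o, o + 1, …, o + L - 1.
  inside-chain : ∀ {k} (E : Embedding M chain k) v → Avoids (p E) k v → ∀ o j μs → o ℕ.+ length μs ≤ k → (j< : j < length μs) →
    m M (p E (o ℕ.+ j)) v ≢ 2 → ∀ ν → at μs j ≡ + 2 * + suc ν →
    dominates (λ a b → entry₄ 0ℤ 0ℤ (chain a b) a b) μs j (+ suc ν * 1ℤ) ≡ true → ⊥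
  inside-chain E v out o j μs le j< att ν μⱼ ok = Attach.forbid₁ (shift o le E) v (λ b< → out (ℕₚ.<-≤-trans (ℕₚ.+-monoʳ-< o b<) le))
    j j< att chain-sym 0ℤ 0ℤ (λ a b _ _ q → ⊥-elim (chain≢4 a b q)) μs ℕₚ.≤-refl j< ν μⱼ ok

  inside-chain₄ : ∀ {k} (E : Embedding M chain k) v → Avoids (p E) k v → ∀ o j μs → o ℕ.+ length μs ≤ k → (j< : j < length μs) →
    m M (p E (o ℕ.+ j)) v ≡ 4 → ∀ ν → at μs j ≡ + 2 * + suc ν →
    dominates (λ a b → entry₄ 0ℤ 0ℤ (chain a b) a b) μs j (+ suc ν * + 2) ≡ true → ⊥
  inside-chain₄ E v out o j μs le j< ≡4 ν μⱼ ok = Attach.forbid₂ (shift o le E) v (λ b< → out (ℕₚ.<-≤-trans (ℕₚ.+-monoʳ-< o b<) le))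
    j j< (≡4⇒≢2 ≡4) ≡4 chain-sym 0ℤ 0ℤ (λ a b _ _ q → ⊥-elim (chain≢4 a b q)) μs ℕₚ.≤-refl j< ν μⱼ ok

  module GrowA {k : ℕ} (E : Embedding M chain k) (v : Fin n) (out : Avoids (p E) k v) where

    private
      E7~ E8~ B~ : List ℤ
      E7~ = + 1 ∷ + 2 ∷ + 3 ∷ + 4 ∷ + 3 ∷ + 2 ∷ + 1 ∷ []
      E8~ = + 2 ∷ + 4 ∷ + 6 ∷ + 5 ∷ + 4 ∷ + 3 ∷ + 2 ∷ + 1 ∷ []
      B~  = + 1 ∷ + 2 ∷ + 1 ∷ []

    left : ∀ j → j < k → j ℕ.+ j < k → m M (p E j) v ≢ 2 → Extension (p E) k
    left j j< jj< att = go j j< jj< att (Attach.3or4 E v out j j< att)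
      where
      others-2 : ∀ j → (j< : j < k) → m M (p E j) v ≢ 2 → ∀ b → b < k → b ≢ j → m M (p E b) v ≡ 2
      others-2 j j< att = Attached.only E v out 0 0 chained-chain (inj₁ refl) j< att
      row : ∀ {ℓ} j → (j< : j < k) → m M (p E j) v ≢ 2 → m M (p E j) v ≡ ℓ → ∀ b → b < k → m M (p E b) v ≡ star (suc j) ℓ 0 (suc b)
      row {ℓ} j j< att eq b b< with b ℕ.≡ᵇ j in q
      ... | true  = trans (cong (λ z → m M (p E z) v) (ℕₚ.≡ᵇ⇒≡ b j (subst T (≡-sym q) tt))) eq
      ... | false = others-2 j j< att b b< (λ r → subst T q (ℕₚ.≡⇒≡ᵇ b j r))
      go : ∀ j → j < k → j ℕ.+ j < k → m M (p E j) v ≢ 2 → m M (p E j) v ≡ 3 ⊎ m M (p E j) v ≡ 4 → Extension (p E) k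
      go zero j< jj< att (inj₁ ≡3) = prepended E v out (dA (s≤s z≤n)) (λ a b _ _ → refl) row₀ (λ b → chain-sym (suc b) 0) refl
        where row₀ : ∀ b → b < k → m M (p E b) v ≡ chain 0 (suc b)
              row₀ zero    _  = ≡3
              row₀ (suc b) b< = others-2 0 j< att (suc b) b< (λ ())
      go zero j< jj< att (inj₂ ≡4) = prepended E v out (dB (s≤s j<)) (λ a b _ _ → refl) (row 0 j< att ≡4) (λ b → refl) refl
      go (suc j) j< jj< att (inj₂ ≡4) = ⊥-elim (inside-chain₄ E v out j 1 B~
        (subst (_≤ k) (≡-sym (trans (ℕₚ.+-comm j 3) refl)) (ℕₚ.≤-trans (s≤s (s≤s (ℕₚ.≤-trans (s≤s (ℕₚ.m≤n+m j j)) (ℕₚ.≤-reflexive (≡-sym (ℕₚ.+-suc j j)))))) jj<))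
        (s≤s (s≤s z≤n)) (subst (λ z → m M (p E z) v ≡ 4) (ℕₚ.+-comm 1 j) ≡4) 0 refl refl)
      go (suc zero) j< jj< att (inj₁ ≡3) = prepended E v out (dD (s≤s jj<)) (λ a b _ _ → refl) (row 1 j< att ≡3) (λ b → refl) refl
      go (suc (suc zero)) j< jj< att (inj₁ ≡3) with k ℕ.≤? 7
      ... | yes k≤7 = prepended E v out (dE (s≤s jj<) (s≤s k≤7)) (λ a b _ _ → refl) (row 2 j< att ≡3) (λ b → refl) refl
      ... | no k≰7  = ⊥-elim (inside-chain E v out 0 2 E8~ (ℕₚ.≰⇒> k≰7) (s≤s (s≤s (s≤s z≤n))) att 2 refl refl)
      go (suc (suc (suc j))) j< jj< att (inj₁ ≡3) = ⊥-elim (inside-chain E v out j 3 E7~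
        (ℕₚ.≤-trans (subst₂ _≤_ (ℕₚ.+-comm 7 j) (≡-sym (cong suc (cong (λ z → suc (suc (suc z))) (trans (ℕₚ.+-suc j (suc (suc j))) (cong suc (trans (ℕₚ.+-suc j (suc j)) (cong suc (ℕₚ.+-suc j j))))))))
          (s≤s (s≤s (s≤s (s≤s (s≤s (s≤s (s≤s (ℕₚ.m≤n+m j j))))))))) jj<)
        (s≤s (s≤s (s≤s (s≤s z≤n)))) (subst (λ z → m M (p E z) v ≢ 2) (ℕₚ.+-comm 3 j) att) 1 refl refl)

  reversed : ∀ {k} → Embedding M chain k → Embedding M chain k
  reversed {k} = relabel (reflect k) reflect-< (λ a< b< q → trans (≡-sym (reflect-reflect a<)) (trans (cong (reflect k) q) (reflect-reflect b<)))
    (λ a< b< → chain-reflect a< b<)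

  growA : ∀ {k} (E : Embedding M chain k) v → Avoids (p E) k v → ∀ j → j < k → m M (p E j) v ≢ 2 → Extension (p E) k
  growA {k} E v out j j< att with j ℕ.+ j ℕ.<? k
  ... | yes jj< = GrowA.left E v out j j< jj< att
  ... | no jj≮  = through (reflect k) reflect-< reflect-reflect (GrowA.left (reversed E) v (λ b< → out (reflect-< b<)) (reflect k j) (reflect-< j<)
        small (subst (λ z → m M (p E z) v ≢ 2) (≡-sym (reflect-reflect j<)) att))
    where
    small : reflect k j ℕ.+ reflect k j < k
    small = ℕₚ.<-≤-trans (ℕₚ.+-monoʳ-< (reflect k j) (ℕₚ.≤-<-trans (reflect≤ k j (ℕₚ.≮⇒≥ jj≮)) (ℕₚ.n<1+n j)))
              (ℕₚ.≤-reflexive (ℕₚ.m∸n+n≡m j<))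

  star-B-oriented : ∀ {k} {q : ℕ → Fin n} {x y} → c (q 0) (q 1) ≡ x → c (q 1) (q 0) ≡ y → Oriented (star 1 4) k q x y
  star-B-oriented p₁ p₂ zero    zero          () _ _
  star-B-oriented p₁ p₂ zero    (suc zero)    _ _ _ = p₁ , p₂
  star-B-oriented p₁ p₂ zero    (suc (suc b)) _ _ ()
  star-B-oriented p₁ p₂ (suc a) zero          () _ _
  star-B-oriented p₁ p₂ (suc a) (suc b)       _ _ r = ⊥-elim (chain≢4 a b r)

  labF-oriented : ∀ {k} {q : ℕ → Fin n} {x y} → c (q 1) (q 2) ≡ x → c (q 2) (q 1) ≡ y → Oriented labF k q x y
  labF-oriented p₁ p₂ 0 b _ _ r = ⊥-elim (chain≢4 0 b r)
  labF-oriented p₁ p₂ 1 2 _ _ _ = p₁ , p₂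
  labF-oriented p₁ p₂ 1 1 _ _ ()
  labF-oriented p₁ p₂ 1 0 () _ _
  labF-oriented p₁ p₂ 1 (suc (suc (suc b))) _ _ ()
  labF-oriented p₁ p₂ 2 1 (s≤s ()) _ _
  labF-oriented p₁ p₂ 2 0 () _ _
  labF-oriented p₁ p₂ 2 2 _ _ ()
  labF-oriented p₁ p₂ 2 (suc (suc (suc b))) _ _ r = ⊥-elim (chain≢4 2 (suc (suc (suc b))) r)
  labF-oriented p₁ p₂ (suc (suc (suc a))) b _ _ r = ⊥-elim (chain≢4 (suc (suc (suc a))) b r)

  bond-4 : ∀ i j → i ≢ j → m M i j ≡ 4 → (c i j ≡ 1ℤ × c j i ≡ + 2) ⊎ (c i j ≡ + 2 × c j i ≡ 1ℤ)
  bond-4 i j i≢j mm with bond i j i≢j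
  ... | bond₂ e _ _  = ⊥-elim (case trans (≡-sym mm) e of λ ())
  ... | bond₃ e _ _  = ⊥-elim (case trans (≡-sym mm) e of λ ())
  ... | bond₄ _ q r  = inj₁ (q , r)
  ... | bond₄′ _ q r = inj₂ (q , r)

  inner-tail : ∀ {j k} → j < k → suc j ≡ k ⊎ suc j < k
  inner-tail {j} {k} j< with suc j ℕ.≟ k
  ... | yes q = inj₁ q
  ... | no q  = inj₂ (ℕₚ.≤∧≢⇒< j< q)

  swap-<′ : ∀ {k} → 2 ≤ k → ∀ {b} → b < k → swap 0 b < k
  swap-<′ 2≤k b< = swap-< 0 _ 2≤k b<

  swap-inj : ∀ {a b} → swap 0 a ≡ swap 0 b → a ≡ b
  swap-inj {a} {b} q = trans (≡-sym (swap-involutive 0 a)) (trans (cong (swap 0) q) (swap-involutive 0 b))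

  module GrowB {k : ℕ} (E : Embedding M (star 1 4) k) (2≤k : 2 ≤ k) (v : Fin n) (out : Avoids (p E) k v) where

    private
      module B = TypeB M m≤4 E 2≤k
      p₀≢p₁ : p E 0 ≢ p E 1
      p₀≢p₁ q = case inj E (ℕₚ.<-trans (s≤s z≤n) 2≤k) 2≤k q of λ ()
      m₀₁ : m M (p E 0) (p E 1) ≡ 4
      m₀₁ = lab≡ E (ℕₚ.<-trans (s≤s z≤n) 2≤k) 2≤k

    only′ : ∀ {j} → j < k → m M (p E j) v ≢ 2 → ∀ b → b < k → b ≢ j → m M (p E b) v ≡ 2
    only′ = Attached.only E v out 1 1 chained-star (inj₂ (refl , s≤s z≤n , 2≤k , (λ ()) , (λ ())))

    module I (j : ℕ) (1≤j : 1 ≤ j) (j< : j < k) = Inner (p E) k 0 (inj E) B.basis (e≥0 (p E 0))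
      (λ l o → e-diff (o (ℕₚ.<-trans (s≤s z≤n) 2≤k))) v out j 1≤j j<

    at-0₄ : m M (p E 0) v ≡ 4 → ⊥
    at-0₄ ≡4 with bond-4 _ _ p₀≢p₁ m₀₁
    ... | inj₁ (q , r) = Attach.forbid₂ E v out 0 (ℕₚ.<-trans (s≤s z≤n) 2≤k) (≡4⇒≢2 ≡4) ≡4 (star-sym 1 4) 1ℤ (+ 2)
            (star-B-oriented {q = p E} q r) (+ 2 ∷ + 1 ∷ []) 2≤k (s≤s z≤n) 0 refl refl
    ... | inj₂ (q , r) = Attach.forbid₂ E v out 0 (ℕₚ.<-trans (s≤s z≤n) 2≤k) (≡4⇒≢2 ≡4) ≡4 (star-sym 1 4) (+ 2) 1ℤ
            (star-B-oriented {q = p E} q r) (+ 2 ∷ + 2 ∷ []) 2≤k (s≤s z≤n) 0 refl refl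

    at-0₃ : 4 ≤ k → m M (p E 0) v ≢ 2 → ⊥
    at-0₃ 4≤k att with bond-4 _ _ p₀≢p₁ m₀₁
    ... | inj₁ (q , r) = Attach.forbid₁ E v out 0 (ℕₚ.<-trans (s≤s z≤n) 2≤k) att (star-sym 1 4) 1ℤ (+ 2)
            (star-B-oriented {q = p E} q r) (+ 4 ∷ + 3 ∷ + 2 ∷ + 1 ∷ []) 4≤k (s≤s z≤n) 1 refl refl
    ... | inj₂ (q , r) = Attach.forbid₁ E v out 0 (ℕₚ.<-trans (s≤s z≤n) 2≤k) att (star-sym 1 4) (+ 2) 1ℤ
            (star-B-oriented {q = p E} q r) (+ 2 ∷ + 3 ∷ + 2 ∷ + 1 ∷ []) 4≤k (s≤s z≤n) 0 refl refl

    grow : ∀ j → j < k → m M (p E j) v ≢ 2 → Extension (p E) k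
    grow j j< att with Attach.3or4 E v out j j< att
    grow zero j< att    | inj₂ ≡4 = ⊥-elim (at-0₄ ≡4)
    grow (suc j) j< att | inj₂ ≡4 = ⊥-elim (I.four (suc j) (s≤s z≤n) j< ≡4)
    grow (suc j) j< att | inj₁ ≡3 with inner-tail j<
    ... | inj₂ sj< = ⊥-elim (I.three (suc j) (s≤s z≤n) j< sj< att)
    ... | inj₁ eq  = star-appended E v out (suc j) j< ≡3 (s≤s z≤n) eq 2≤k (dB (ℕₚ.m≤n⇒m≤1+n 2≤k)) (only′ j< att)
    grow zero j< att    | inj₁ ≡3 with k ℕ.≟ 2 | k ℕ.≟ 3
    ... | yes refl | _ = through (swap 0) (swap-<′ 2≤k) (λ {b} _ → swap-involutive 0 b)
          (star-appended {1} {4} {2} (relabel (swap 0) (swap-<′ 2≤k) (λ _ _ → swap-inj) (λ {a} {b} → sym₂ a b) E) v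
            (λ b< → out (swap-<′ 2≤k b<)) 1 (s≤s (s≤s z≤n)) ≡3 (s≤s z≤n) refl (s≤s (s≤s z≤n)) (dB (s≤s (s≤s z≤n)))
            (λ b b< b≢1 → only′ j< att (swap 0 b) (swap-<′ 2≤k b<) (λ q → b≢1 (trans (≡-sym (swap-involutive 0 b)) (cong (swap 0) q)))))
      where
      sym₂ : ∀ a b → a < 2 → b < 2 → star 1 4 (swap 0 a) (swap 0 b) ≡ star 1 4 a b
      sym₂ 0 0 _ _ = refl
      sym₂ 0 1 _ _ = refl
      sym₂ 1 0 _ _ = refl
      sym₂ 1 1 _ _ = refl
      sym₂ (suc (suc a)) b (s≤s (s≤s ())) _
      sym₂ 0 (suc (suc b)) _ (s≤s (s≤s ()))
      sym₂ 1 (suc (suc b)) _ (s≤s (s≤s ()))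
    ... | no _ | yes refl = prepended E v out dF three row (λ { 0 → refl ; 1 → refl ; (suc (suc b)) → refl }) refl
      where
      three : ∀ a b → a < 3 → b < 3 → labF (suc a) (suc b) ≡ star 1 4 a b
      three 0 0 _ _ = refl
      three 0 1 _ _ = refl
      three 0 2 _ _ = refl
      three 1 0 _ _ = refl
      three 1 1 _ _ = refl
      three 1 2 _ _ = refl
      three 2 0 _ _ = refl
      three 2 1 _ _ = refl
      three 2 2 _ _ = refl
      three (suc (suc (suc a))) b (s≤s (s≤s (s≤s ()))) _
      three 0 (suc (suc (suc b))) _ (s≤s (s≤s (s≤s ())))
      three 1 (suc (suc (suc b))) _ (s≤s (s≤s (s≤s ())))
      three 2 (suc (suc (suc b))) _ (s≤s (s≤s (s≤s ())))
      row : ∀ b → b < 3 → m M (p E b) v ≡ labF 0 (suc b)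
      row 0 _ = ≡3
      row (suc b) b< = trans (only′ j< att (suc b) b< (λ ())) (far b)
        where far : ∀ b → 2 ≡ labF 0 (suc (suc b))
              far zero    = refl
              far (suc b) = refl
    ... | no k≢2 | no k≢3 = ⊥-elim (at-0₃ (ℕₚ.≤∧≢⇒< (ℕₚ.≤∧≢⇒< 2≤k (k≢2 ∘ ≡-sym)) (k≢3 ∘ ≡-sym)) att)

  star23-swap : ∀ a b → star 2 3 (swap 0 a) (swap 0 b) ≡ star 2 3 a b
  star23-swap zero          zero          = refl
  star23-swap zero          (suc zero)    = refl
  star23-swap zero          (suc (suc zero)) = refl
  star23-swap zero          (suc (suc (suc b))) = refl
  star23-swap (suc zero)    zero          = refl
  star23-swap (suc zero)    (suc zero)    = refl
  star23-swap (suc zero)    (suc (suc zero)) = refl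
  star23-swap (suc zero)    (suc (suc (suc b))) = refl
  star23-swap (suc (suc zero)) zero       = refl
  star23-swap (suc (suc (suc a))) zero    = refl
  star23-swap (suc (suc zero)) (suc zero) = refl
  star23-swap (suc (suc (suc a))) (suc zero) = refl
  star23-swap (suc (suc a)) (suc (suc b)) = refl

  swapped : ∀ {k} → 2 ≤ k → Embedding M (star 2 3) k → Embedding M (star 2 3) k
  swapped 2≤k = relabel (swap 0) (swap-<′ 2≤k) (λ _ _ → swap-inj) (λ {a} {b} _ _ → star23-swap a b)

  module GrowD {k : ℕ} (E : Embedding M (star 2 3) k) (4≤k : 4 ≤ k) (v : Fin n) (out : Avoids (p E) k v) where

    private
      2<k : 2 < k
      2<k = ℕₚ.<-trans (s≤s (s≤s (s≤s z≤n))) 4≤k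
      1<k : 1 < k
      1<k = ℕₚ.<-trans (s≤s (s≤s z≤n)) 2<k
      0<k : 0 < k
      0<k = ℕₚ.<-trans (s≤s z≤n) 1<k
      module D = TypeD M m≤4 E 2<k

    only′ : ∀ {j} → j < k → m M (p E j) v ≢ 2 → ∀ b → b < k → b ≢ j → m M (p E b) v ≡ 2
    only′ = Attached.only E v out 1 2 chained-star (inj₂ (refl , s≤s z≤n , 2<k , (λ ()) , (λ ())))

    E₁≥0 : ∀ l → 0ℤ ≤ᶻ D.E 1 l
    E₁≥0 l = subst (0ℤ ≤ᶻ_) (lem (e (p E 0) l) (e (p E 1) l)) (0≤+ (e≥0 (p E 0) l) (e≥0 (p E 1) l))
      where lem : ∀ x y → x + y ≡ (x + (- 1ℤ) * y) + + 2 * y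
            lem = solve-∀

    module I (j : ℕ) (2≤j : 2 ≤ j) (j< : j < k) = Inner (p E) k 1 (inj E) D.basis E₁≥0
      (λ l o → cong₂ (λ x y → x + (- 1ℤ) * y) (e-diff (o 0<k)) (e-diff (o 1<k))) v out j 2≤j j<

    no4 : ∀ a b → a < b → b < k → star 2 3 a b ≡ 4 → c (p E a) (p E b) ≡ 0ℤ × c (p E b) (p E a) ≡ 0ℤ
    no4 a b _ _ q = ⊥-elim (star3≢4 2 a b q)

    at-1 : m M (p E 1) v ≢ 2 → Extension (p E) k
    at-1 att with Attach.3or4 E v out 1 1<k att
    ... | inj₂ ≡4 = ⊥-elim (Attach.forbid₂ E v out 1 1<k att ≡4 (star-sym 2 3) 0ℤ 0ℤ no4 (+ 1 ∷ + 2 ∷ + 2 ∷ + 1 ∷ []) 4≤k (s≤s (s≤s z≤n)) 0 refl refl)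
    ... | inj₁ ≡3 with k ℕ.≟ 4 | k ℕ.≤? 7
    ... | yes refl | _ = through rot rot< (λ {b} _ → rot-rot b)
          (star-appended {2} {3} {4} (relabel rot rot< (λ {a} {b} _ _ q → trans (≡-sym (rot-rot a)) (trans (cong rot q) (rot-rot b))) (λ {a} {b} → sym₄ a b) E) v
            (λ b< → out (rot< b<)) 3 (s≤s (s≤s (s≤s (s≤s z≤n)))) ≡3 (s≤s z≤n) refl (s≤s (s≤s (s≤s z≤n))) (dD (s≤s (s≤s (s≤s (s≤s z≤n)))))
            (λ b b< b≢3 → only′ 1<k att (rot b) (rot< b<) (λ q → b≢3 (trans (≡-sym (rot-rot b)) (cong rot q)))))
      where
      rot : ℕ → ℕ
      rot 1 = 3
      rot 3 = 1
      rot b = b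
      rot-rot : ∀ b → rot (rot b) ≡ b
      rot-rot 0 = refl
      rot-rot 1 = refl
      rot-rot 2 = refl
      rot-rot 3 = refl
      rot-rot (suc (suc (suc (suc b)))) = refl
      rot< : ∀ {b} → b < 4 → rot b < 4
      rot< {0} _ = s≤s z≤n
      rot< {1} _ = s≤s (s≤s (s≤s (s≤s z≤n)))
      rot< {2} _ = s≤s (s≤s (s≤s z≤n))
      rot< {3} _ = s≤s (s≤s z≤n)
      rot< {suc (suc (suc (suc b)))} (s≤s (s≤s (s≤s (s≤s ()))))
      sym₄ : ∀ a b → a < 4 → b < 4 → star 2 3 (rot a) (rot b) ≡ star 2 3 a b
      sym₄ 0 0 _ _ = refl
      sym₄ 0 1 _ _ = refl
      sym₄ 0 2 _ _ = refl
      sym₄ 0 3 _ _ = refl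
      sym₄ 1 0 _ _ = refl
      sym₄ 1 1 _ _ = refl
      sym₄ 1 2 _ _ = refl
      sym₄ 1 3 _ _ = refl
      sym₄ 2 0 _ _ = refl
      sym₄ 2 1 _ _ = refl
      sym₄ 2 2 _ _ = refl
      sym₄ 2 3 _ _ = refl
      sym₄ 3 0 _ _ = refl
      sym₄ 3 1 _ _ = refl
      sym₄ 3 2 _ _ = refl
      sym₄ 3 3 _ _ = refl
      sym₄ (suc (suc (suc (suc a)))) b (s≤s (s≤s (s≤s (s≤s ())))) _
      sym₄ 0 (suc (suc (suc (suc b)))) _ (s≤s (s≤s (s≤s (s≤s ()))))
      sym₄ 1 (suc (suc (suc (suc b)))) _ (s≤s (s≤s (s≤s (s≤s ()))))
      sym₄ 2 (suc (suc (suc (suc b)))) _ (s≤s (s≤s (s≤s (s≤s ()))))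
      sym₄ 3 (suc (suc (suc (suc b)))) _ (s≤s (s≤s (s≤s (s≤s ()))))
    ... | no k≢4 | yes k≤7 = extension (dE (s≤s (ℕₚ.≤∧≢⇒< 4≤k (k≢4 ∘ ≡-sym))) (s≤s k≤7))
          (relabel (swap 0) (swap-<′ (s≤s 0<k)) (λ _ _ → swap-inj) (λ {a} {b} _ _ → twice a b) (prepend {lab′ = lab″} E v out inner row sym″ refl))
          (λ { zero _ → 0 , s≤s z≤n , refl ; (suc b) b< → suc (suc b) , s≤s b< , refl })
      where
      lab″ : ℕ → ℕ → ℕ
      lab″ a b = star 3 3 (swap 0 a) (swap 0 b)
      twice : ∀ a b → lab″ (swap 0 a) (swap 0 b) ≡ star 3 3 a b
      twice a b = cong₂ (star 3 3) (swap-involutive 0 a) (swap-involutive 0 b)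
      inner : ∀ a b → a < k → b < k → lab″ (suc a) (suc b) ≡ star 2 3 a b
      inner zero    zero    _ _ = refl
      inner zero    (suc b) _ _ = refl
      inner (suc a) zero    _ _ = refl
      inner (suc a) (suc b) _ _ = refl
      row : ∀ b → b < k → m M (p E b) v ≡ lab″ 0 (suc b)
      row zero             b< = only′ 1<k att 0 b< (λ ())
      row (suc zero)       b< = ≡3
      row (suc (suc b))    b< = only′ 1<k att (suc (suc b)) b< (λ ())
      sym″ : ∀ b → lab″ (suc b) 0 ≡ lab″ 0 (suc b)
      sym″ b = star-sym 3 3 (swap 0 (suc b)) 1
    ... | no _ | no k≰7 = ⊥-elim (Attach.forbid₁ E v out 1 1<k att (star-sym 2 3) 0ℤ 0ℤ no4
          (+ 3 ∷ + 4 ∷ + 6 ∷ + 5 ∷ + 4 ∷ + 3 ∷ + 2 ∷ + 1 ∷ []) (ℕₚ.≰⇒> k≰7) (s≤s (s≤s z≤n)) 1 refl refl)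

    high : ∀ j → 2 ≤ j → j < k → m M (p E j) v ≢ 2 → Extension (p E) k
    high j 2≤j j< att with Attach.3or4 E v out j j< att
    ... | inj₂ ≡4 = ⊥-elim (I.four j 2≤j j< ≡4)
    ... | inj₁ ≡3 with inner-tail j<
    ...   | inj₂ sj< = ⊥-elim (I.three j 2≤j j< sj< att)
    ...   | inj₁ eq  = star-appended E v out j j< ≡3 (ℕₚ.≤-trans (s≤s z≤n) 2≤j) eq 2<k (dD (ℕₚ.m≤n⇒m≤1+n 4≤k)) (only′ j< att)

  growD : ∀ {k} (E : Embedding M (star 2 3) k) → 4 ≤ k → ∀ v → Avoids (p E) k v → ∀ j → j < k → m M (p E j) v ≢ 2 → Extension (p E) k
  growD E 4≤k v out zero j< att = through (swap 0) (swap-<′ 2≤k) (λ {b} _ → swap-involutive 0 b)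
    (GrowD.at-1 (swapped 2≤k E) 4≤k v (λ b< → out (swap-<′ 2≤k b<)) att)
    where 2≤k = ℕₚ.≤-trans (s≤s (s≤s z≤n)) 4≤k
  growD E 4≤k v out (suc zero) j< att = GrowD.at-1 E 4≤k v out att
  growD E 4≤k v out (suc (suc j)) j< att = GrowD.high E 4≤k v out (suc (suc j)) (s≤s (s≤s z≤n)) j< att

  module GrowE {k : ℕ} (E : Embedding M (star 3 3) k) (v : Fin n) (out : Avoids (p E) k v) where

    no4 : ∀ a b → a < b → b < k → star 3 3 a b ≡ 4 → c (p E a) (p E b) ≡ 0ℤ × c (p E b) (p E a) ≡ 0ℤ
    no4 a b _ _ q = ⊥-elim (star3≢4 3 a b q)

    affine : ∀ μs → length μs ≤ k → ∀ j → j < length μs → m M (p E j) v ≢ 2 → ∀ ν → at μs j ≡ + 2 * + suc ν →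
             dominates (λ a b → entry₄ 0ℤ 0ℤ (star 3 3 a b) a b) μs j (+ suc ν * 1ℤ) ≡ true → Extension (p E) k
    affine μs le j j< att ν μⱼ ok = ⊥-elim (Attach.forbid₁ E v out j (ℕₚ.<-≤-trans j< le) att (star-sym 3 3) 0ℤ 0ℤ no4 μs le j< ν μⱼ ok)

    affine₄ : ∀ μs → length μs ≤ k → ∀ j → j < length μs → m M (p E j) v ≡ 4 → ∀ ν → at μs j ≡ + 2 * + suc ν →
              dominates (λ a b → entry₄ 0ℤ 0ℤ (star 3 3 a b) a b) μs j (+ suc ν * + 2) ≡ true → Extension (p E) k
    affine₄ μs le j j< ≡4 ν μⱼ ok = ⊥-elim (Attach.forbid₂ E v out j (ℕₚ.<-≤-trans j< le) (≡4⇒≢2 ≡4) ≡4 (star-sym 3 3) 0ℤ 0ℤ no4 μs le j< ν μⱼ ok)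

    only′ : 3 < k → ∀ {j} → j < k → m M (p E j) v ≢ 2 → ∀ b → b < k → b ≢ j → m M (p E b) v ≡ 2
    only′ 3<k = Attached.only E v out 1 3 chained-star (inj₂ (refl , s≤s z≤n , 3<k , (λ ()) , (λ ())))

    le : ∀ a → T (a ℕ.≤ᵇ k) → a ≤ k
    le a = ℕₚ.≤ᵇ⇒≤ a k

    -- The vertices of E₆ at which every additional edge produces an affine diagram.
    common : 6 ≤ k → ∀ j → j < 5 → j ≢ 1 → m M (p E j) v ≢ 2 → Extension (p E) k
    common 6≤k 0 _ _ att = affine (+ 2 ∷ + 1 ∷ + 2 ∷ + 3 ∷ + 2 ∷ + 1 ∷ []) 6≤k 0 (s≤s z≤n) att 0 refl refl
    common 6≤k 1 _ q att = ⊥-elim (q refl)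
    common 6≤k 2 _ _ att = affine (+ 1 ∷ + 1 ∷ + 2 ∷ + 2 ∷ + 1 ∷ []) (ℕₚ.<⇒≤ 6≤k) 2 (s≤s (s≤s (s≤s z≤n))) att 0 refl refl
    common 6≤k 3 _ _ att = affine (+ 1 ∷ + 0 ∷ + 1 ∷ + 2 ∷ + 1 ∷ []) (ℕₚ.<⇒≤ 6≤k) 3 (s≤s (s≤s (s≤s (s≤s z≤n)))) att 0 refl refl
    common 6≤k 4 _ _ att = affine (+ 1 ∷ + 0 ∷ + 1 ∷ + 2 ∷ + 2 ∷ + 1 ∷ []) 6≤k 4 (s≤s (s≤s (s≤s (s≤s (s≤s z≤n))))) att 0 refl refl
    common 6≤k (suc (suc (suc (suc (suc j))))) (s≤s (s≤s (s≤s (s≤s (s≤s ()))))) _ _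

    at-1 : 7 ≤ k → m M (p E 1) v ≢ 2 → Extension (p E) k
    at-1 7≤k att = affine (+ 2 ∷ + 2 ∷ + 3 ∷ + 4 ∷ + 3 ∷ + 2 ∷ + 1 ∷ []) 7≤k 1 (s≤s (s≤s z≤n)) att 0 refl refl

    at-5 : 7 ≤ k → m M (p E 5) v ≢ 2 → Extension (p E) k
    at-5 7≤k att = affine (+ 1 ∷ + 0 ∷ + 1 ∷ + 2 ∷ + 2 ∷ + 2 ∷ + 1 ∷ []) 7≤k 5 (ℕₚ.≤ᵇ⇒≤ 6 7 tt) att 0 refl refl

  last-6 : (E : Embedding M (star 3 3) 6) → ∀ v → Avoids (p E) 6 v → m M (p E 5) v ≢ 2 → Extension (p E) 6
  last-6 E v out att with Attach.3or4 E v out 5 (ℕₚ.≤ᵇ⇒≤ 6 6 tt) att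
  ... | inj₂ ≡4 = GrowE.affine₄ E v out (+ 1 ∷ + 0 ∷ + 1 ∷ + 2 ∷ + 2 ∷ + 2 ∷ []) ℕₚ.≤-refl 5 (ℕₚ.≤ᵇ⇒≤ 6 6 tt) ≡4 0 refl refl
  ... | inj₁ ≡3 = star-appended E v out 5 (ℕₚ.≤ᵇ⇒≤ 6 6 tt) ≡3 (s≤s z≤n) refl (ℕₚ.≤ᵇ⇒≤ 4 6 tt) (dE (ℕₚ.≤ᵇ⇒≤ 6 7 tt) (ℕₚ.≤ᵇ⇒≤ 7 8 tt))
        (GrowE.only′ E v out (ℕₚ.≤ᵇ⇒≤ 4 6 tt) (ℕₚ.≤ᵇ⇒≤ 6 6 tt) att)

  mirror : ℕ → ℕ
  mirror 0 = 0
  mirror (suc b) = suc (reflect 5 b)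

  mirror-< : ∀ {b} → b < 6 → mirror b < 6
  mirror-< {zero}  _        = s≤s z≤n
  mirror-< {suc b} (s≤s lt) = s≤s (reflect-< lt)

  mirror-mirror : ∀ {b} → b < 6 → mirror (mirror b) ≡ b
  mirror-mirror {zero}  _        = refl
  mirror-mirror {suc b} (s≤s lt) = cong suc (reflect-reflect lt)

  mirrored : Embedding M (star 3 3) 6 → Embedding M (star 3 3) 6
  mirrored = relabel mirror mirror-< (λ a< b< q → trans (≡-sym (mirror-mirror a<)) (trans (cong mirror q) (mirror-mirror b<)))
    (λ {a} {b} → same a b)
    where
    spoke : ∀ b → b < 5 → star 3 3 0 (mirror (suc b)) ≡ star 3 3 0 (suc b)
    spoke 0 _ = refl
    spoke 1 _ = refl
    spoke 2 _ = refl
    spoke 3 _ = refl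
    spoke 4 _ = refl
    spoke (suc (suc (suc (suc (suc b))))) (s≤s (s≤s (s≤s (s≤s (s≤s ())))))
    same : ∀ a b → a < 6 → b < 6 → star 3 3 (mirror a) (mirror b) ≡ star 3 3 a b
    same zero    zero    _ _ = refl
    same zero    (suc b) _ (s≤s b<) = spoke b b<
    same (suc a) zero    (s≤s a<) _ = trans (star-sym 3 3 (mirror (suc a)) 0) (trans (spoke a a<) (star-sym 3 3 0 (suc a)))
    same (suc a) (suc b) (s≤s a<) (s≤s b<) = chain-reflect a< b<

  grow-6 : (E : Embedding M (star 3 3) 6) → ∀ v → Avoids (p E) 6 v → ∀ j → j < 6 → m M (p E j) v ≢ 2 → Extension (p E) 6
  grow-6 E v out 1 _ att = through mirror mirror-< mirror-mirror (last-6 (mirrored E) v (λ b< → out (mirror-< b<)) att)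
  grow-6 E v out 5 _ att = last-6 E v out att
  grow-6 E v out 0 _ att = GrowE.common E v out ℕₚ.≤-refl 0 (s≤s z≤n) (λ ()) att
  grow-6 E v out 2 _ att = GrowE.common E v out ℕₚ.≤-refl 2 (ℕₚ.≤ᵇ⇒≤ 3 5 tt) (λ ()) att
  grow-6 E v out 3 _ att = GrowE.common E v out ℕₚ.≤-refl 3 (ℕₚ.≤ᵇ⇒≤ 4 5 tt) (λ ()) att
  grow-6 E v out 4 _ att = GrowE.common E v out ℕₚ.≤-refl 4 (ℕₚ.≤ᵇ⇒≤ 5 5 tt) (λ ()) att
  grow-6 E v out (suc (suc (suc (suc (suc (suc j)))))) (s≤s (s≤s (s≤s (s≤s (s≤s (s≤s ())))))) _

  grow-7 : (E : Embedding M (star 3 3) 7) → ∀ v → Avoids (p E) 7 v → ∀ j → j < 7 → m M (p E j) v ≢ 2 → Extension (p E) 7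
  grow-7 E v out 0 _ att = GrowE.common E v out (ℕₚ.≤ᵇ⇒≤ 6 7 tt) 0 (s≤s z≤n) (λ ()) att
  grow-7 E v out 1 _ att = GrowE.at-1 E v out ℕₚ.≤-refl att
  grow-7 E v out 2 _ att = GrowE.common E v out (ℕₚ.≤ᵇ⇒≤ 6 7 tt) 2 (ℕₚ.≤ᵇ⇒≤ 3 5 tt) (λ ()) att
  grow-7 E v out 3 _ att = GrowE.common E v out (ℕₚ.≤ᵇ⇒≤ 6 7 tt) 3 (ℕₚ.≤ᵇ⇒≤ 4 5 tt) (λ ()) att
  grow-7 E v out 4 _ att = GrowE.common E v out (ℕₚ.≤ᵇ⇒≤ 6 7 tt) 4 (ℕₚ.≤ᵇ⇒≤ 5 5 tt) (λ ()) att
  grow-7 E v out 5 _ att = GrowE.at-5 E v out ℕₚ.≤-refl att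
  grow-7 E v out 6 j< att with Attach.3or4 E v out 6 j< att
  ... | inj₂ ≡4 = GrowE.affine₄ E v out (+ 1 ∷ + 0 ∷ + 1 ∷ + 2 ∷ + 2 ∷ + 2 ∷ + 2 ∷ []) ℕₚ.≤-refl 6 j< ≡4 0 refl refl
  ... | inj₁ ≡3 = star-appended E v out 6 j< ≡3 (s≤s z≤n) refl (ℕₚ.≤ᵇ⇒≤ 4 7 tt) (dE (ℕₚ.≤ᵇ⇒≤ 6 8 tt) ℕₚ.≤-refl)
        (GrowE.only′ E v out (ℕₚ.≤ᵇ⇒≤ 4 7 tt) j< att)
  grow-7 E v out (suc (suc (suc (suc (suc (suc (suc j))))))) (s≤s (s≤s (s≤s (s≤s (s≤s (s≤s (s≤s ()))))))) _

  grow-8 : (E : Embedding M (star 3 3) 8) → ∀ v → Avoids (p E) 8 v → ∀ j → j < 8 → m M (p E j) v ≢ 2 → Extension (p E) 8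
  grow-8 E v out 0 _ att = GrowE.common E v out (ℕₚ.≤ᵇ⇒≤ 6 8 tt) 0 (s≤s z≤n) (λ ()) att
  grow-8 E v out 1 _ att = GrowE.at-1 E v out (ℕₚ.≤ᵇ⇒≤ 7 8 tt) att
  grow-8 E v out 2 _ att = GrowE.common E v out (ℕₚ.≤ᵇ⇒≤ 6 8 tt) 2 (ℕₚ.≤ᵇ⇒≤ 3 5 tt) (λ ()) att
  grow-8 E v out 3 _ att = GrowE.common E v out (ℕₚ.≤ᵇ⇒≤ 6 8 tt) 3 (ℕₚ.≤ᵇ⇒≤ 4 5 tt) (λ ()) att
  grow-8 E v out 4 _ att = GrowE.common E v out (ℕₚ.≤ᵇ⇒≤ 6 8 tt) 4 (ℕₚ.≤ᵇ⇒≤ 5 5 tt) (λ ()) att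
  grow-8 E v out 5 _ att = GrowE.at-5 E v out (ℕₚ.≤ᵇ⇒≤ 7 8 tt) att
  grow-8 E v out 6 _ att = GrowE.affine E v out (+ 1 ∷ + 0 ∷ + 1 ∷ + 2 ∷ + 2 ∷ + 2 ∷ + 2 ∷ + 1 ∷ []) ℕₚ.≤-refl 6 (ℕₚ.≤ᵇ⇒≤ 7 8 tt) att 0 refl refl
  grow-8 E v out 7 _ att = GrowE.affine E v out (+ 3 ∷ + 2 ∷ + 4 ∷ + 6 ∷ + 5 ∷ + 4 ∷ + 3 ∷ + 2 ∷ []) ℕₚ.≤-refl 7 ℕₚ.≤-refl att 0 refl refl
  grow-8 E v out (suc (suc (suc (suc (suc (suc (suc (suc j)))))))) (s≤s (s≤s (s≤s (s≤s (s≤s (s≤s (s≤s (s≤s ())))))))) _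

  growE : ∀ {k} (E : Embedding M (star 3 3) k) → 6 ≤ k → k ≤ 8 → ∀ v → Avoids (p E) k v → ∀ j → j < k → m M (p E j) v ≢ 2 → Extension (p E) k
  growE {6} E _ _ = grow-6 E
  growE {7} E _ _ = grow-7 E
  growE {8} E _ _ = grow-8 E
  growE {0} E () _
  growE {1} E (s≤s ()) _
  growE {2} E (s≤s (s≤s ())) _
  growE {3} E (s≤s (s≤s (s≤s ()))) _
  growE {4} E (s≤s (s≤s (s≤s (s≤s ())))) _
  growE {5} E (s≤s (s≤s (s≤s (s≤s (s≤s ()))))) _
  growE {suc (suc (suc (suc (suc (suc (suc (suc (suc k))))))))} E _ (s≤s (s≤s (s≤s (s≤s (s≤s (s≤s (s≤s (s≤s ()))))))))

  growF : (E : Embedding M labF 4) → ∀ v → Avoids (p E) 4 v → ∀ j → j < 4 → m M (p E j) v ≢ 2 → Extension (p E) 4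
  growF E v out j j< att with bond-4 (p E 1) (p E 2) (λ q → case inj E (ℕₚ.≤ᵇ⇒≤ 2 4 tt) (ℕₚ.≤ᵇ⇒≤ 3 4 tt) q of λ ())
                              (lab≡ E (ℕₚ.≤ᵇ⇒≤ 2 4 tt) (ℕₚ.≤ᵇ⇒≤ 3 4 tt))
  growF E v out 0 j< att | inj₁ (q , r) = ⊥-elim (Attach.forbid₁ E v out 0 j< att labF-sym 1ℤ (+ 2) (labF-oriented {q = p E} q r)
    (+ 2 ∷ + 3 ∷ + 2 ∷ + 1 ∷ []) ℕₚ.≤-refl j< 0 refl refl)
  growF E v out 1 j< att | inj₁ (q , r) = ⊥-elim (Attach.forbid₁ E v out 1 j< att labF-sym 1ℤ (+ 2) (labF-oriented {q = p E} q r)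
    (+ 1 ∷ + 2 ∷ + 1 ∷ + 0 ∷ []) ℕₚ.≤-refl j< 0 refl refl)
  growF E v out 2 j< att | inj₁ (q , r) = ⊥-elim (Attach.forbid₁ E v out 2 j< att labF-sym 1ℤ (+ 2) (labF-oriented {q = p E} q r)
    (+ 0 ∷ + 2 ∷ + 2 ∷ + 1 ∷ []) ℕₚ.≤-refl j< 0 refl refl)
  growF E v out 3 j< att | inj₁ (q , r) = ⊥-elim (Attach.forbid₁ E v out 3 j< att labF-sym 1ℤ (+ 2) (labF-oriented {q = p E} q r)
    (+ 2 ∷ + 4 ∷ + 3 ∷ + 2 ∷ []) ℕₚ.≤-refl j< 0 refl refl)
  growF E v out 0 j< att | inj₂ (q , r) = ⊥-elim (Attach.forbid₁ E v out 0 j< att labF-sym (+ 2) 1ℤ (labF-oriented {q = p E} q r)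
    (+ 2 ∷ + 3 ∷ + 4 ∷ + 2 ∷ []) ℕₚ.≤-refl j< 0 refl refl)
  growF E v out 1 j< att | inj₂ (q , r) = ⊥-elim (Attach.forbid₁ E v out 1 j< att labF-sym (+ 2) 1ℤ (labF-oriented {q = p E} q r)
    (+ 1 ∷ + 2 ∷ + 2 ∷ + 0 ∷ []) ℕₚ.≤-refl j< 0 refl refl)
  growF E v out 2 j< att | inj₂ (q , r) = ⊥-elim (Attach.forbid₁ E v out 2 j< att labF-sym (+ 2) 1ℤ (labF-oriented {q = p E} q r)
    (+ 0 ∷ + 1 ∷ + 2 ∷ + 1 ∷ []) ℕₚ.≤-refl j< 0 refl refl)
  growF E v out 3 j< att | inj₂ (q , r) = ⊥-elim (Attach.forbid₁ E v out 3 j< att labF-sym (+ 2) 1ℤ (labF-oriented {q = p E} q r)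
    (+ 1 ∷ + 2 ∷ + 3 ∷ + 2 ∷ []) ℕₚ.≤-refl j< 0 refl refl)
  growF E v out (suc (suc (suc (suc j)))) (s≤s (s≤s (s≤s (s≤s ())))) att | _

  grow : ∀ {lab k} → Diagram lab k → (E : Embedding M lab k) → ∀ v → Avoids (p E) k v → ∀ j → j < k → m M (p E j) v ≢ 2 → Extension (p E) k
  grow (dA _)     E v out j = growA E v out j
  grow (dB 2≤k)   E v out j = GrowB.grow E 2≤k v out j
  grow (dD 4≤k)   E v out j = growD E 4≤k v out j
  grow (dE le le′) E v out j = growE E le le′ v out j
  grow dF         E v out j = growF E v out j

  record ComponentOf (i : Fin n) : Set where
    constructor component
    field
      {lab}    : ℕ → ℕ → ℕ
      {size}   : ℕ
      diagram  : Diagram lab size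
      embed    : Embedding M lab size
      position : ℕ
      position< : position < size
      position≡ : p embed position ≡ i
      closed   : Closed M (p embed) size

  size≤n : ∀ {lab k} (E : Embedding M lab k) → k ≤ n
  size≤n E = Fₚ.injective⇒≤ {f = λ a → p E (toℕ a)}
    (λ {a} {b} q → Fₚ.toℕ-injective (inj E (Fₚ.toℕ<n a) (Fₚ.toℕ<n b) q))

  complete-component : ∀ N {lab k i} → Diagram lab k → (E : Embedding M lab k) → (∃ λ b → b < k × p E b ≡ i) → n < N ℕ.+ k → ComponentOf i
  complete-component zero    d E at-i n< = ⊥-elim (ℕₚ.<⇒≱ n< (size≤n E))
  complete-component (suc N) {lab} {k} {i} d E (b , b< , eq) n<
    with Fₚ.any? (λ v → (¬? (ℕₚ.anyUpTo? (λ a → p E a F.≟ v) k)) ×-dec ℕₚ.anyUpTo? (λ a → ¬? (m M (p E a) v ℕ.≟ 2)) k)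
  ... | yes (v , out , a , a< , att) with grow d E v (λ b< q → out (_ , b< , q)) a a< att
  ...   | extension d′ E′ cov with cov b b<
  ...     | b′ , b′< , eq′ = complete-component N d′ E′ (b′ , b′< , trans eq′ eq) (subst (n <_) (≡-sym (ℕₚ.+-suc N k)) n<)
  complete-component (suc N) {lab} {k} {i} d E (b , b< , eq) n< | no none = component d E b b< eq closed
    where
    closed : Closed M (p E) k
    closed {a} a< j out with m M (p E a) j ℕ.≟ 2
    ... | yes q = q
    ... | no q  = ⊥-elim (none (j , (λ (b , b< , r) → out b< r) , a , a< , q))

  classify : ∀ i → ComponentOf i
  classify i = complete-component (suc n) (dA (s≤s z≤n)) single (0 , s≤s z≤n , refl) (ℕₚ.m≤m+n (suc n) 1)
    where
    single : Embedding M chain 1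
    single .p _ = i
    single .inj  {zero}  {zero}  _ _ _ = refl
    single .inj  {suc a} (s≤s ()) _ _
    single .inj  {zero}  {suc b} _ (s≤s ()) _
    single .lab≡ {zero}  {zero}  _ _ = diag M i
    single .lab≡ {suc a} (s≤s ()) _
    single .lab≡ {zero}  {suc b} _ (s≤s ())

-- The exceptional types

-- f and g are fuel, for the enumeration of coset representatives and for the passage to J-dominant weights.
-- The word u, found by a search, negates all simple roots and contains the letter i exactly d times.
record Certificate (lab : ℕ → ℕ → ℕ) (k i : ℕ) (u : List ℕ) (d f g : ℕ) : Set where
  constructor certify
  field
    valid : verdictFrom (cartan lab k) i (others k i) (commuting lab k i) k u d f g (neighbours lab k i) ≡ true

w-F₄-0 : List ℕ
w-F₄-0 =
  0 ∷ 1 ∷ 2 ∷ 3 ∷ 1 ∷ 2 ∷ 1 ∷ 0 ∷ 1 ∷ 2 ∷ 3 ∷ 1 ∷ 2 ∷ 1 ∷ 0 ∷ 1 ∷ 2 ∷ 1 ∷ 2 ∷ 3 ∷ 2 ∷ 1 ∷ 2 ∷ 3 ∷ []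

F₄-0 : Certificate labF 4 0 w-F₄-0 3 100 200
F₄-0 = certify refl

w-F₄-1 : List ℕ
w-F₄-1 =
  1 ∷ 2 ∷ 0 ∷ 1 ∷ 3 ∷ 2 ∷ 0 ∷ 1 ∷ 3 ∷ 2 ∷ 0 ∷ 1 ∷ 3 ∷ 2 ∷ 0 ∷ 1 ∷ 3 ∷ 2 ∷ 0 ∷ 1 ∷ 0 ∷ 2 ∷ 3 ∷ 2 ∷ []

F₄-1 : Certificate labF 4 1 w-F₄-1 6 100 200
F₄-1 = certify refl

w-F₄-2 : List ℕ
w-F₄-2 =
  2 ∷ 3 ∷ 1 ∷ 2 ∷ 3 ∷ 0 ∷ 1 ∷ 2 ∷ 3 ∷ 0 ∷ 1 ∷ 2 ∷ 3 ∷ 0 ∷ 1 ∷ 2 ∷ 3 ∷ 0 ∷ 1 ∷ 2 ∷ 0 ∷ 1 ∷ 0 ∷ 3 ∷ []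

F₄-2 : Certificate labF 4 2 w-F₄-2 6 100 200
F₄-2 = certify refl

w-F₄-3 : List ℕ
w-F₄-3 =
  3 ∷ 2 ∷ 1 ∷ 2 ∷ 0 ∷ 1 ∷ 2 ∷ 3 ∷ 2 ∷ 1 ∷ 2 ∷ 0 ∷ 1 ∷ 2 ∷ 3 ∷ 0 ∷ 1 ∷ 0 ∷ 2 ∷ 1 ∷ 0 ∷ 2 ∷ 1 ∷ 2 ∷ []

F₄-3 : Certificate labF 4 3 w-F₄-3 3 100 200
F₄-3 = certify refl

w-E₆-0 : List ℕ
w-E₆-0 =
  0 ∷ 3 ∷ 4 ∷ 5 ∷ 2 ∷ 3 ∷ 4 ∷ 1 ∷ 2 ∷ 3 ∷ 0 ∷ 3 ∷ 4 ∷ 5 ∷ 2 ∷ 3 ∷ 4 ∷ 1 ∷ 2 ∷ 3 ∷ 0 ∷ 1 ∷ 2 ∷ 1 ∷ 3 ∷ 2 ∷ 1 ∷ 4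
  ∷ 3 ∷ 2 ∷ 1 ∷ 5 ∷ 4 ∷ 3 ∷ 2 ∷ 1 ∷ []

E₆-0 : Certificate (star 3 3) 6 0 w-E₆-0 3 100 200
E₆-0 = certify refl

w-E₆-1 : List ℕ
w-E₆-1 =
  5 ∷ 4 ∷ 3 ∷ 2 ∷ 1 ∷ 0 ∷ 3 ∷ 4 ∷ 5 ∷ 2 ∷ 3 ∷ 4 ∷ 0 ∷ 3 ∷ 2 ∷ 1 ∷ 0 ∷ 2 ∷ 3 ∷ 0 ∷ 2 ∷ 3 ∷ 4 ∷ 3 ∷ 0 ∷ 2 ∷ 3 ∷ 4
  ∷ 5 ∷ 4 ∷ 3 ∷ 0 ∷ 2 ∷ 3 ∷ 4 ∷ 5 ∷ []

E₆-1 : Certificate (star 3 3) 6 1 w-E₆-1 2 100 200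
E₆-1 = certify refl

w-E₆-2 : List ℕ
w-E₆-2 =
  4 ∷ 3 ∷ 2 ∷ 5 ∷ 4 ∷ 0 ∷ 3 ∷ 1 ∷ 2 ∷ 4 ∷ 5 ∷ 3 ∷ 4 ∷ 0 ∷ 3 ∷ 1 ∷ 2 ∷ 4 ∷ 5 ∷ 3 ∷ 4 ∷ 0 ∷ 3 ∷ 1 ∷ 2 ∷ 0 ∷ 1 ∷ 3
  ∷ 0 ∷ 4 ∷ 3 ∷ 0 ∷ 5 ∷ 4 ∷ 3 ∷ 0 ∷ []

E₆-2 : Certificate (star 3 3) 6 2 w-E₆-2 4 100 200
E₆-2 = certify refl

w-E₆-3 : List ℕ
w-E₆-3 =
  3 ∷ 4 ∷ 2 ∷ 0 ∷ 3 ∷ 5 ∷ 4 ∷ 1 ∷ 2 ∷ 0 ∷ 3 ∷ 5 ∷ 4 ∷ 1 ∷ 2 ∷ 0 ∷ 3 ∷ 5 ∷ 4 ∷ 1 ∷ 2 ∷ 0 ∷ 3 ∷ 5 ∷ 4 ∷ 1 ∷ 2 ∷ 0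
  ∷ 3 ∷ 0 ∷ 1 ∷ 2 ∷ 1 ∷ 4 ∷ 5 ∷ 4 ∷ []

E₆-3 : Certificate (star 3 3) 6 3 w-E₆-3 6 100 200
E₆-3 = certify refl

w-E₆-4 : List ℕ
w-E₆-4 =
  2 ∷ 3 ∷ 4 ∷ 5 ∷ 1 ∷ 2 ∷ 0 ∷ 3 ∷ 4 ∷ 5 ∷ 2 ∷ 3 ∷ 1 ∷ 2 ∷ 0 ∷ 3 ∷ 4 ∷ 5 ∷ 2 ∷ 3 ∷ 1 ∷ 2 ∷ 0 ∷ 3 ∷ 4 ∷ 0 ∷ 1 ∷ 2
  ∷ 1 ∷ 3 ∷ 0 ∷ 2 ∷ 1 ∷ 3 ∷ 2 ∷ 5 ∷ []

E₆-4 : Certificate (star 3 3) 6 4 w-E₆-4 4 100 200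
E₆-4 = certify refl

w-E₆-5 : List ℕ
w-E₆-5 =
  1 ∷ 2 ∷ 3 ∷ 4 ∷ 5 ∷ 0 ∷ 3 ∷ 4 ∷ 2 ∷ 3 ∷ 1 ∷ 2 ∷ 0 ∷ 3 ∷ 4 ∷ 5 ∷ 0 ∷ 1 ∷ 2 ∷ 1 ∷ 3 ∷ 0 ∷ 2 ∷ 1 ∷ 3 ∷ 2 ∷ 4 ∷ 3
  ∷ 0 ∷ 2 ∷ 1 ∷ 3 ∷ 2 ∷ 4 ∷ 3 ∷ 0 ∷ []

E₆-5 : Certificate (star 3 3) 6 5 w-E₆-5 2 100 200
E₆-5 = certify refl

w-E₇-0 : List ℕ
w-E₇-0 =
  0 ∷ 3 ∷ 4 ∷ 2 ∷ 3 ∷ 0 ∷ 5 ∷ 6 ∷ 4 ∷ 5 ∷ 3 ∷ 4 ∷ 1 ∷ 2 ∷ 3 ∷ 0 ∷ 4 ∷ 5 ∷ 6 ∷ 3 ∷ 4 ∷ 5 ∷ 2 ∷ 3 ∷ 4 ∷ 1 ∷ 2 ∷ 3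
  ∷ 0 ∷ 4 ∷ 5 ∷ 6 ∷ 3 ∷ 4 ∷ 5 ∷ 2 ∷ 3 ∷ 4 ∷ 1 ∷ 2 ∷ 3 ∷ 0 ∷ 1 ∷ 2 ∷ 1 ∷ 3 ∷ 2 ∷ 1 ∷ 4 ∷ 3 ∷ 2 ∷ 1 ∷ 5 ∷ 4 ∷ 3 ∷
  2 ∷ 1 ∷ 6 ∷ 5 ∷ 4 ∷ 3 ∷ 2 ∷ 1 ∷ []

E₇-0 : Certificate (star 3 3) 7 0 w-E₇-0 5 100 200
E₇-0 = certify refl

w-E₇-1 : List ℕ
w-E₇-1 =
  1 ∷ 2 ∷ 3 ∷ 4 ∷ 5 ∷ 6 ∷ 0 ∷ 3 ∷ 4 ∷ 5 ∷ 2 ∷ 3 ∷ 4 ∷ 0 ∷ 3 ∷ 2 ∷ 1 ∷ 2 ∷ 3 ∷ 4 ∷ 5 ∷ 6 ∷ 0 ∷ 3 ∷ 4 ∷ 5 ∷ 2 ∷ 3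
  ∷ 4 ∷ 0 ∷ 3 ∷ 2 ∷ 1 ∷ 0 ∷ 2 ∷ 3 ∷ 0 ∷ 2 ∷ 3 ∷ 4 ∷ 3 ∷ 0 ∷ 2 ∷ 3 ∷ 4 ∷ 5 ∷ 4 ∷ 3 ∷ 0 ∷ 2 ∷ 3 ∷ 4 ∷ 5 ∷ 6 ∷ 5 ∷
  4 ∷ 3 ∷ 0 ∷ 2 ∷ 3 ∷ 4 ∷ 5 ∷ 6 ∷ []

E₇-1 : Certificate (star 3 3) 7 1 w-E₇-1 3 100 200
E₇-1 = certify refl

w-E₇-2 : List ℕ
w-E₇-2 =
  2 ∷ 3 ∷ 4 ∷ 0 ∷ 3 ∷ 1 ∷ 2 ∷ 5 ∷ 6 ∷ 4 ∷ 5 ∷ 3 ∷ 4 ∷ 0 ∷ 3 ∷ 1 ∷ 2 ∷ 5 ∷ 6 ∷ 4 ∷ 5 ∷ 3 ∷ 4 ∷ 0 ∷ 3 ∷ 1 ∷ 2 ∷ 5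
  ∷ 6 ∷ 4 ∷ 5 ∷ 3 ∷ 4 ∷ 0 ∷ 3 ∷ 1 ∷ 2 ∷ 5 ∷ 6 ∷ 4 ∷ 5 ∷ 3 ∷ 4 ∷ 0 ∷ 3 ∷ 1 ∷ 2 ∷ 0 ∷ 1 ∷ 3 ∷ 0 ∷ 4 ∷ 3 ∷ 0 ∷ 5 ∷
  4 ∷ 3 ∷ 0 ∷ 6 ∷ 5 ∷ 4 ∷ 3 ∷ 0 ∷ []

E₇-2 : Certificate (star 3 3) 7 2 w-E₇-2 6 100 200
E₇-2 = certify refl

w-E₇-3 : List ℕ
w-E₇-3 =
  3 ∷ 4 ∷ 2 ∷ 0 ∷ 3 ∷ 5 ∷ 4 ∷ 1 ∷ 2 ∷ 0 ∷ 3 ∷ 6 ∷ 5 ∷ 4 ∷ 1 ∷ 2 ∷ 0 ∷ 3 ∷ 6 ∷ 5 ∷ 4 ∷ 1 ∷ 2 ∷ 0 ∷ 3 ∷ 6 ∷ 5 ∷ 4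
  ∷ 1 ∷ 2 ∷ 0 ∷ 3 ∷ 6 ∷ 5 ∷ 4 ∷ 1 ∷ 2 ∷ 0 ∷ 3 ∷ 6 ∷ 5 ∷ 4 ∷ 1 ∷ 2 ∷ 0 ∷ 3 ∷ 6 ∷ 5 ∷ 4 ∷ 1 ∷ 2 ∷ 0 ∷ 3 ∷ 0 ∷ 1 ∷
  2 ∷ 1 ∷ 4 ∷ 5 ∷ 4 ∷ 6 ∷ 5 ∷ 4 ∷ []

E₇-3 : Certificate (star 3 3) 7 3 w-E₇-3 9 100 200
E₇-3 = certify refl

w-E₇-4 : List ℕ
w-E₇-4 =
  4 ∷ 5 ∷ 3 ∷ 2 ∷ 0 ∷ 3 ∷ 4 ∷ 6 ∷ 5 ∷ 3 ∷ 1 ∷ 2 ∷ 0 ∷ 3 ∷ 4 ∷ 6 ∷ 5 ∷ 3 ∷ 1 ∷ 2 ∷ 0 ∷ 3 ∷ 4 ∷ 6 ∷ 5 ∷ 2 ∷ 3 ∷ 1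
  ∷ 2 ∷ 0 ∷ 3 ∷ 4 ∷ 6 ∷ 5 ∷ 2 ∷ 3 ∷ 1 ∷ 2 ∷ 0 ∷ 3 ∷ 4 ∷ 6 ∷ 5 ∷ 2 ∷ 3 ∷ 1 ∷ 2 ∷ 0 ∷ 3 ∷ 4 ∷ 0 ∷ 1 ∷ 2 ∷ 1 ∷ 3 ∷
  0 ∷ 2 ∷ 1 ∷ 3 ∷ 2 ∷ 5 ∷ 6 ∷ 5 ∷ []

E₇-4 : Certificate (star 3 3) 7 4 w-E₇-4 7 100 200
E₇-4 = certify refl

w-E₇-5 : List ℕ
w-E₇-5 =
  5 ∷ 6 ∷ 4 ∷ 3 ∷ 2 ∷ 0 ∷ 3 ∷ 4 ∷ 5 ∷ 6 ∷ 4 ∷ 3 ∷ 1 ∷ 2 ∷ 0 ∷ 3 ∷ 4 ∷ 5 ∷ 6 ∷ 0 ∷ 3 ∷ 4 ∷ 2 ∷ 3 ∷ 1 ∷ 2 ∷ 0 ∷ 3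
  ∷ 4 ∷ 5 ∷ 6 ∷ 0 ∷ 3 ∷ 4 ∷ 2 ∷ 3 ∷ 1 ∷ 2 ∷ 0 ∷ 3 ∷ 4 ∷ 5 ∷ 0 ∷ 1 ∷ 2 ∷ 1 ∷ 3 ∷ 0 ∷ 2 ∷ 1 ∷ 3 ∷ 2 ∷ 4 ∷ 3 ∷ 0 ∷
  2 ∷ 1 ∷ 3 ∷ 2 ∷ 4 ∷ 3 ∷ 0 ∷ 6 ∷ []

E₇-5 : Certificate (star 3 3) 7 5 w-E₇-5 5 100 200
E₇-5 = certify refl

w-E₇-6 : List ℕ
w-E₇-6 =
  6 ∷ 5 ∷ 4 ∷ 3 ∷ 2 ∷ 0 ∷ 3 ∷ 4 ∷ 5 ∷ 6 ∷ 1 ∷ 2 ∷ 3 ∷ 4 ∷ 5 ∷ 0 ∷ 3 ∷ 4 ∷ 2 ∷ 3 ∷ 1 ∷ 2 ∷ 0 ∷ 3 ∷ 4 ∷ 5 ∷ 6 ∷ 0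
  ∷ 1 ∷ 2 ∷ 1 ∷ 3 ∷ 0 ∷ 2 ∷ 1 ∷ 3 ∷ 2 ∷ 4 ∷ 3 ∷ 0 ∷ 2 ∷ 1 ∷ 3 ∷ 2 ∷ 4 ∷ 3 ∷ 0 ∷ 5 ∷ 4 ∷ 3 ∷ 0 ∷ 2 ∷ 1 ∷ 3 ∷ 2 ∷
  4 ∷ 3 ∷ 0 ∷ 5 ∷ 4 ∷ 3 ∷ 2 ∷ 1 ∷ []

E₇-6 : Certificate (star 3 3) 7 6 w-E₇-6 3 100 200
E₇-6 = certify refl

w-E₈-0 : List ℕ
w-E₈-0 =
  0 ∷ 3 ∷ 4 ∷ 2 ∷ 3 ∷ 0 ∷ 5 ∷ 6 ∷ 4 ∷ 5 ∷ 3 ∷ 4 ∷ 1 ∷ 2 ∷ 3 ∷ 0 ∷ 7 ∷ 4 ∷ 5 ∷ 6 ∷ 3 ∷ 4 ∷ 5 ∷ 2 ∷ 3 ∷ 4 ∷ 1 ∷ 2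
  ∷ 3 ∷ 0 ∷ 7 ∷ 4 ∷ 5 ∷ 6 ∷ 3 ∷ 4 ∷ 5 ∷ 2 ∷ 3 ∷ 4 ∷ 1 ∷ 2 ∷ 3 ∷ 0 ∷ 5 ∷ 6 ∷ 7 ∷ 4 ∷ 5 ∷ 6 ∷ 3 ∷ 4 ∷ 5 ∷ 2 ∷ 3 ∷
  4 ∷ 1 ∷ 2 ∷ 3 ∷ 0 ∷ 5 ∷ 6 ∷ 7 ∷ 4 ∷ 5 ∷ 6 ∷ 3 ∷ 4 ∷ 5 ∷ 2 ∷ 3 ∷ 4 ∷ 1 ∷ 2 ∷ 3 ∷ 0 ∷ 5 ∷ 6 ∷ 7 ∷ 4 ∷ 5 ∷ 6 ∷ 3
  ∷ 4 ∷ 5 ∷ 2 ∷ 3 ∷ 4 ∷ 1 ∷ 2 ∷ 3 ∷ 0 ∷ 1 ∷ 2 ∷ 1 ∷ 3 ∷ 2 ∷ 1 ∷ 4 ∷ 3 ∷ 2 ∷ 1 ∷ 5 ∷ 4 ∷ 3 ∷ 2 ∷ 1 ∷ 6 ∷ 5 ∷ 4 ∷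
  3 ∷ 2 ∷ 1 ∷ 7 ∷ 6 ∷ 5 ∷ 4 ∷ 3 ∷ 2 ∷ 1 ∷ []

E₈-0 : Certificate (star 3 3) 8 0 w-E₈-0 8 100 200
E₈-0 = certify refl

w-E₈-1 : List ℕ
w-E₈-1 =
  1 ∷ 2 ∷ 3 ∷ 4 ∷ 5 ∷ 6 ∷ 0 ∷ 3 ∷ 4 ∷ 5 ∷ 2 ∷ 3 ∷ 4 ∷ 0 ∷ 3 ∷ 2 ∷ 1 ∷ 7 ∷ 2 ∷ 3 ∷ 4 ∷ 5 ∷ 6 ∷ 0 ∷ 3 ∷ 4 ∷ 5 ∷ 2
  ∷ 3 ∷ 4 ∷ 0 ∷ 3 ∷ 2 ∷ 1 ∷ 0 ∷ 3 ∷ 4 ∷ 5 ∷ 6 ∷ 7 ∷ 2 ∷ 3 ∷ 4 ∷ 5 ∷ 6 ∷ 0 ∷ 3 ∷ 4 ∷ 5 ∷ 2 ∷ 3 ∷ 4 ∷ 0 ∷ 3 ∷ 2 ∷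
  1 ∷ 0 ∷ 3 ∷ 4 ∷ 5 ∷ 6 ∷ 7 ∷ 2 ∷ 3 ∷ 4 ∷ 5 ∷ 6 ∷ 0 ∷ 3 ∷ 4 ∷ 5 ∷ 2 ∷ 3 ∷ 4 ∷ 0 ∷ 3 ∷ 2 ∷ 1 ∷ 0 ∷ 2 ∷ 3 ∷ 0 ∷ 2
  ∷ 3 ∷ 4 ∷ 3 ∷ 0 ∷ 2 ∷ 3 ∷ 4 ∷ 5 ∷ 4 ∷ 3 ∷ 0 ∷ 2 ∷ 3 ∷ 4 ∷ 5 ∷ 6 ∷ 5 ∷ 4 ∷ 3 ∷ 0 ∷ 2 ∷ 3 ∷ 4 ∷ 5 ∷ 6 ∷ 7 ∷ 6 ∷
  5 ∷ 4 ∷ 3 ∷ 0 ∷ 2 ∷ 3 ∷ 4 ∷ 5 ∷ 6 ∷ 7 ∷ []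

E₈-1 : Certificate (star 3 3) 8 1 w-E₈-1 5 100 200
E₈-1 = certify refl

w-E₈-2 : List ℕ
w-E₈-2 =
  2 ∷ 3 ∷ 4 ∷ 0 ∷ 3 ∷ 1 ∷ 2 ∷ 5 ∷ 6 ∷ 4 ∷ 5 ∷ 3 ∷ 4 ∷ 0 ∷ 3 ∷ 1 ∷ 2 ∷ 7 ∷ 5 ∷ 6 ∷ 4 ∷ 5 ∷ 3 ∷ 4 ∷ 0 ∷ 3 ∷ 1 ∷ 2
  ∷ 7 ∷ 5 ∷ 6 ∷ 4 ∷ 5 ∷ 3 ∷ 4 ∷ 0 ∷ 3 ∷ 1 ∷ 2 ∷ 7 ∷ 5 ∷ 6 ∷ 4 ∷ 5 ∷ 3 ∷ 4 ∷ 0 ∷ 3 ∷ 1 ∷ 2 ∷ 6 ∷ 7 ∷ 5 ∷ 6 ∷ 4 ∷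
  5 ∷ 3 ∷ 4 ∷ 0 ∷ 3 ∷ 1 ∷ 2 ∷ 6 ∷ 7 ∷ 5 ∷ 6 ∷ 4 ∷ 5 ∷ 3 ∷ 4 ∷ 0 ∷ 3 ∷ 1 ∷ 2 ∷ 6 ∷ 7 ∷ 5 ∷ 6 ∷ 4 ∷ 5 ∷ 3 ∷ 4 ∷ 0
  ∷ 3 ∷ 1 ∷ 2 ∷ 6 ∷ 7 ∷ 5 ∷ 6 ∷ 4 ∷ 5 ∷ 3 ∷ 4 ∷ 0 ∷ 3 ∷ 1 ∷ 2 ∷ 0 ∷ 1 ∷ 3 ∷ 0 ∷ 4 ∷ 3 ∷ 0 ∷ 5 ∷ 4 ∷ 3 ∷ 0 ∷ 6 ∷
  5 ∷ 4 ∷ 3 ∷ 0 ∷ 7 ∷ 6 ∷ 5 ∷ 4 ∷ 3 ∷ 0 ∷ []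

E₈-2 : Certificate (star 3 3) 8 2 w-E₈-2 10 100 200
E₈-2 = certify refl

w-E₈-3 : List ℕ
w-E₈-3 =
  3 ∷ 4 ∷ 2 ∷ 0 ∷ 3 ∷ 5 ∷ 4 ∷ 1 ∷ 2 ∷ 0 ∷ 3 ∷ 6 ∷ 5 ∷ 4 ∷ 1 ∷ 2 ∷ 0 ∷ 3 ∷ 7 ∷ 6 ∷ 5 ∷ 4 ∷ 1 ∷ 2 ∷ 0 ∷ 3 ∷ 7 ∷ 6
  ∷ 5 ∷ 4 ∷ 1 ∷ 2 ∷ 0 ∷ 3 ∷ 7 ∷ 6 ∷ 5 ∷ 4 ∷ 1 ∷ 2 ∷ 0 ∷ 3 ∷ 7 ∷ 6 ∷ 5 ∷ 4 ∷ 1 ∷ 2 ∷ 0 ∷ 3 ∷ 7 ∷ 6 ∷ 5 ∷ 4 ∷ 1 ∷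
  2 ∷ 0 ∷ 3 ∷ 7 ∷ 6 ∷ 5 ∷ 4 ∷ 1 ∷ 2 ∷ 0 ∷ 3 ∷ 7 ∷ 6 ∷ 5 ∷ 4 ∷ 1 ∷ 2 ∷ 0 ∷ 3 ∷ 7 ∷ 6 ∷ 5 ∷ 4 ∷ 1 ∷ 2 ∷ 0 ∷ 3 ∷ 7
  ∷ 6 ∷ 5 ∷ 4 ∷ 1 ∷ 2 ∷ 0 ∷ 3 ∷ 7 ∷ 6 ∷ 5 ∷ 4 ∷ 1 ∷ 2 ∷ 0 ∷ 3 ∷ 7 ∷ 6 ∷ 5 ∷ 4 ∷ 1 ∷ 2 ∷ 0 ∷ 3 ∷ 0 ∷ 1 ∷ 2 ∷ 1 ∷
  4 ∷ 5 ∷ 4 ∷ 6 ∷ 5 ∷ 4 ∷ 7 ∷ 6 ∷ 5 ∷ 4 ∷ []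

E₈-3 : Certificate (star 3 3) 8 3 w-E₈-3 15 100 200
E₈-3 = certify refl

w-E₈-4 : List ℕ
w-E₈-4 =
  4 ∷ 5 ∷ 3 ∷ 2 ∷ 0 ∷ 3 ∷ 4 ∷ 6 ∷ 5 ∷ 3 ∷ 1 ∷ 2 ∷ 0 ∷ 3 ∷ 4 ∷ 7 ∷ 6 ∷ 5 ∷ 3 ∷ 1 ∷ 2 ∷ 0 ∷ 3 ∷ 4 ∷ 7 ∷ 6 ∷ 5 ∷ 2
  ∷ 3 ∷ 1 ∷ 2 ∷ 0 ∷ 3 ∷ 4 ∷ 7 ∷ 6 ∷ 5 ∷ 2 ∷ 3 ∷ 1 ∷ 2 ∷ 0 ∷ 3 ∷ 4 ∷ 7 ∷ 6 ∷ 5 ∷ 2 ∷ 3 ∷ 1 ∷ 2 ∷ 0 ∷ 3 ∷ 4 ∷ 7 ∷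
  6 ∷ 5 ∷ 2 ∷ 3 ∷ 1 ∷ 2 ∷ 0 ∷ 3 ∷ 4 ∷ 7 ∷ 6 ∷ 5 ∷ 2 ∷ 3 ∷ 1 ∷ 2 ∷ 0 ∷ 3 ∷ 4 ∷ 7 ∷ 6 ∷ 5 ∷ 2 ∷ 3 ∷ 1 ∷ 2 ∷ 0 ∷ 3
  ∷ 4 ∷ 7 ∷ 6 ∷ 5 ∷ 2 ∷ 3 ∷ 1 ∷ 2 ∷ 0 ∷ 3 ∷ 4 ∷ 7 ∷ 6 ∷ 5 ∷ 2 ∷ 3 ∷ 1 ∷ 2 ∷ 0 ∷ 3 ∷ 4 ∷ 0 ∷ 1 ∷ 2 ∷ 1 ∷ 3 ∷ 0 ∷
  2 ∷ 1 ∷ 3 ∷ 2 ∷ 5 ∷ 6 ∷ 5 ∷ 7 ∷ 6 ∷ 5 ∷ []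

E₈-4 : Certificate (star 3 3) 8 4 w-E₈-4 12 100 200
E₈-4 = certify refl

w-E₈-5 : List ℕ
w-E₈-5 =
  5 ∷ 6 ∷ 4 ∷ 3 ∷ 2 ∷ 0 ∷ 3 ∷ 4 ∷ 5 ∷ 7 ∷ 6 ∷ 4 ∷ 3 ∷ 1 ∷ 2 ∷ 0 ∷ 3 ∷ 4 ∷ 5 ∷ 7 ∷ 6 ∷ 0 ∷ 3 ∷ 4 ∷ 2 ∷ 3 ∷ 1 ∷ 2
  ∷ 0 ∷ 3 ∷ 4 ∷ 5 ∷ 7 ∷ 6 ∷ 0 ∷ 3 ∷ 4 ∷ 2 ∷ 3 ∷ 1 ∷ 2 ∷ 0 ∷ 3 ∷ 4 ∷ 5 ∷ 7 ∷ 6 ∷ 0 ∷ 3 ∷ 4 ∷ 2 ∷ 3 ∷ 1 ∷ 2 ∷ 0 ∷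
  3 ∷ 4 ∷ 5 ∷ 7 ∷ 6 ∷ 0 ∷ 3 ∷ 4 ∷ 2 ∷ 3 ∷ 1 ∷ 2 ∷ 0 ∷ 3 ∷ 4 ∷ 5 ∷ 7 ∷ 6 ∷ 0 ∷ 3 ∷ 4 ∷ 2 ∷ 3 ∷ 1 ∷ 2 ∷ 0 ∷ 3 ∷ 4
  ∷ 5 ∷ 7 ∷ 6 ∷ 0 ∷ 3 ∷ 4 ∷ 2 ∷ 3 ∷ 1 ∷ 2 ∷ 0 ∷ 3 ∷ 4 ∷ 5 ∷ 0 ∷ 1 ∷ 2 ∷ 1 ∷ 3 ∷ 0 ∷ 2 ∷ 1 ∷ 3 ∷ 2 ∷ 4 ∷ 3 ∷ 0 ∷
  2 ∷ 1 ∷ 3 ∷ 2 ∷ 4 ∷ 3 ∷ 0 ∷ 6 ∷ 7 ∷ 6 ∷ []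

E₈-5 : Certificate (star 3 3) 8 5 w-E₈-5 9 100 200
E₈-5 = certify refl

w-E₈-6 : List ℕ
w-E₈-6 =
  6 ∷ 7 ∷ 5 ∷ 4 ∷ 3 ∷ 2 ∷ 0 ∷ 3 ∷ 4 ∷ 5 ∷ 6 ∷ 7 ∷ 1 ∷ 2 ∷ 3 ∷ 4 ∷ 5 ∷ 0 ∷ 3 ∷ 4 ∷ 2 ∷ 3 ∷ 1 ∷ 2 ∷ 0 ∷ 3 ∷ 4 ∷ 5
  ∷ 6 ∷ 7 ∷ 1 ∷ 2 ∷ 3 ∷ 4 ∷ 5 ∷ 0 ∷ 3 ∷ 4 ∷ 2 ∷ 3 ∷ 1 ∷ 2 ∷ 0 ∷ 3 ∷ 4 ∷ 5 ∷ 6 ∷ 7 ∷ 1 ∷ 2 ∷ 3 ∷ 4 ∷ 5 ∷ 0 ∷ 3 ∷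
  4 ∷ 2 ∷ 3 ∷ 1 ∷ 2 ∷ 0 ∷ 3 ∷ 4 ∷ 5 ∷ 6 ∷ 7 ∷ 1 ∷ 2 ∷ 3 ∷ 4 ∷ 5 ∷ 0 ∷ 3 ∷ 4 ∷ 2 ∷ 3 ∷ 1 ∷ 2 ∷ 0 ∷ 3 ∷ 4 ∷ 5 ∷ 6
  ∷ 0 ∷ 1 ∷ 2 ∷ 1 ∷ 3 ∷ 0 ∷ 2 ∷ 1 ∷ 3 ∷ 2 ∷ 4 ∷ 3 ∷ 0 ∷ 2 ∷ 1 ∷ 3 ∷ 2 ∷ 4 ∷ 3 ∷ 0 ∷ 5 ∷ 4 ∷ 3 ∷ 0 ∷ 2 ∷ 1 ∷ 3 ∷
  2 ∷ 4 ∷ 3 ∷ 0 ∷ 5 ∷ 4 ∷ 3 ∷ 2 ∷ 1 ∷ 7 ∷ []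

E₈-6 : Certificate (star 3 3) 8 6 w-E₈-6 6 100 200
E₈-6 = certify refl

w-E₈-7 : List ℕ
w-E₈-7 =
  7 ∷ 6 ∷ 5 ∷ 4 ∷ 3 ∷ 2 ∷ 0 ∷ 3 ∷ 4 ∷ 5 ∷ 6 ∷ 1 ∷ 2 ∷ 3 ∷ 4 ∷ 5 ∷ 0 ∷ 3 ∷ 4 ∷ 2 ∷ 3 ∷ 1 ∷ 2 ∷ 0 ∷ 3 ∷ 4 ∷ 5 ∷ 6
  ∷ 7 ∷ 6 ∷ 5 ∷ 4 ∷ 3 ∷ 2 ∷ 0 ∷ 3 ∷ 4 ∷ 5 ∷ 6 ∷ 1 ∷ 2 ∷ 3 ∷ 4 ∷ 5 ∷ 0 ∷ 3 ∷ 4 ∷ 2 ∷ 3 ∷ 1 ∷ 2 ∷ 0 ∷ 3 ∷ 4 ∷ 5 ∷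
  6 ∷ 7 ∷ 0 ∷ 1 ∷ 2 ∷ 1 ∷ 3 ∷ 0 ∷ 2 ∷ 1 ∷ 3 ∷ 2 ∷ 4 ∷ 3 ∷ 0 ∷ 2 ∷ 1 ∷ 3 ∷ 2 ∷ 4 ∷ 3 ∷ 0 ∷ 5 ∷ 4 ∷ 3 ∷ 0 ∷ 2 ∷ 1
  ∷ 3 ∷ 2 ∷ 4 ∷ 3 ∷ 0 ∷ 5 ∷ 4 ∷ 3 ∷ 2 ∷ 1 ∷ 6 ∷ 5 ∷ 4 ∷ 3 ∷ 0 ∷ 2 ∷ 1 ∷ 3 ∷ 2 ∷ 4 ∷ 3 ∷ 0 ∷ 5 ∷ 4 ∷ 3 ∷ 2 ∷ 1 ∷
  6 ∷ 5 ∷ 4 ∷ 3 ∷ 0 ∷ 2 ∷ 3 ∷ 4 ∷ 5 ∷ 6 ∷ []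

E₈-7 : Certificate (star 3 3) 8 7 w-E₈-7 3 100 200
E₈-7 = certify refl

-- The rows of the Cartan matrix

module Rows {n : ℕ} (M : CoxeterMatrix n) (v : Fin n → ℕ) where

  Leaf : Fin n → Fin n → Set
  Leaf i j = ∀ l → l ≢ i → l ≢ j → m M i l ≡ 2

  leaf? : ∀ i j → Dec (Leaf i j)
  leaf? i j = Fₚ.all? (λ l → ¬? (l F.≟ i) →-dec (¬? (l F.≟ j) →-dec (m M i l ℕ.≟ 2)))

  -- Six times the absolute value of the Cartan matrix entry at an edge labelled 4: -2 and -1 when i is
  -- an end of the diagram (or when only j is), and -4/3, -3/2 when neither is, as in type F₄.
  weight₄ : ∀ {i j} → Dec (Leaf i j) → Dec (Leaf j i) → ℕ
  weight₄ {i} {j} (yes _) (yes _) = if toℕ i ℕ.<ᵇ toℕ j then 6 else 12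
  weight₄         (yes _) (no _)  = 12
  weight₄         (no _)  (yes _) = 6
  weight₄ {i} {j} (no _)  (no _)  = if toℕ i ℕ.<ᵇ toℕ j then 8 else 9

  sixfold : ℕ → Fin n → Fin n → ℕ
  sixfold 3 i j = 6
  sixfold 4 i j = weight₄ (leaf? i j) (leaf? j i)
  sixfold _ i j = 0

  coef : Fin n → Fin n → ℤ
  coef i j with i F.≟ j
  ... | yes _ = + 12
  ... | no  _ = - + sixfold (m M i j) i j

  coef-diag : ∀ i → coef i i ≡ + 12
  coef-diag i with i F.≟ i
  ... | yes _ = refl
  ... | no q  = ⊥-elim (q refl)

  coef-off : ∀ {i j} → i ≢ j → coef i j ≡ - + sixfold (m M i j) i j
  coef-off {i} {j} i≢j with i F.≟ j
  ... | yes q = ⊥-elim (i≢j q)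
  ... | no _  = refl

  Row : Fin n → Set
  Row i = 0ℤ ≤ᶻ sum (λ l → coef i l * + v l)

  total : List (Fin n × ℕ) → ℕ
  total []            = 0
  total ((q , w) ∷ L) = w ℕ.* v q ℕ.+ total L

  private
    δᶻ : Fin n → Fin n → ℤ
    δᶻ i j with i F.≟ j
    ... | yes _ = 1ℤ
    ... | no _  = 0ℤ

    δᶻ-same : ∀ i → δᶻ i i ≡ 1ℤ
    δᶻ-same i with i F.≟ i
    ... | yes _ = refl
    ... | no q  = ⊥-elim (q refl)

    δᶻ-diff : ∀ {i j} → i ≢ j → δᶻ i j ≡ 0ℤ
    δᶻ-diff {i} {j} q with i F.≟ j
    ... | yes r = ⊥-elim (q r)
    ... | no _  = refl

    δᶻ≥0 : ∀ i j → 0ℤ ≤ᶻ δᶻ i j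
    δᶻ≥0 i j with i F.≟ j
    ... | yes _ = +≤+ z≤n
    ... | no _  = +≤+ z≤n

    sum-δᶻ : ∀ {k} (i : Fin k) (f g : Fin k → ℤ) → (∀ j → j ≢ i → g j ≡ 0ℤ) → g i ≡ 1ℤ → sum (λ j → f j * g j) ≡ f i
    sum-δᶻ {suc k} F.zero f g off on = trans (cong₂ _+_ (trans (cong (f F.zero *_) on) (ℤₚ.*-identityʳ (f F.zero)))
        (trans (sum-cong-≗ (λ j → trans (cong (f (F.suc j) *_) (off (F.suc j) (λ ()))) (ℤₚ.*-zeroʳ (f (F.suc j)))))
               (sum-replicate-zero k))) (ℤₚ.+-identityʳ (f F.zero))
    sum-δᶻ {suc k} (F.suc i) f g off on = trans (cong₂ _+_
        (trans (cong (f F.zero *_) (off F.zero (λ ()))) (ℤₚ.*-zeroʳ (f F.zero)))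
        (sum-δᶻ i (f ∘ F.suc) (g ∘ F.suc) (λ j j≢i → off (F.suc j) (j≢i ∘ Fₚ.suc-injective)) on))
      (ℤₚ.+-identityˡ (f (F.suc i)))

    spread : List (Fin n × ℕ) → Fin n → ℤ
    spread []            l = 0ℤ
    spread ((q , w) ∷ L) l = (+ w * + v l) * δᶻ q l + spread L l

    term≥0 : ∀ w q l → 0ℤ ≤ᶻ (+ w * + v l) * δᶻ q l
    term≥0 w q l = 0≤* (0≤* {+ w} {+ v l} (+≤+ z≤n) (+≤+ z≤n)) (δᶻ≥0 q l)

    spread≥0 : ∀ L l → 0ℤ ≤ᶻ spread L l
    spread≥0 []            l = ℤₚ.≤-refl
    spread≥0 ((q , w) ∷ L) l = 0≤+ (term≥0 w q l) (spread≥0 L l)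

    spread-∈ : ∀ L {l w} → (l , w) ∈ L → + w * + v l ≤ᶻ spread L l
    spread-∈ ((q , w) ∷ L) {l} (here refl) = subst₂ _≤ᶻ_ (ℤₚ.+-identityʳ (+ w * + v l))
      (cong (_+ spread L l) (trans (≡-sym (ℤₚ.*-identityʳ (+ w * + v l))) (cong ((+ w * + v l) *_) (≡-sym (δᶻ-same l)))))
      (ℤₚ.+-monoʳ-≤ (+ w * + v l) (spread≥0 L l))
    spread-∈ ((q , w′) ∷ L) {l} {w} (there l∈) = subst (_≤ᶻ spread ((q , w′) ∷ L) l) (ℤₚ.+-identityˡ (+ w * + v l))
      (ℤₚ.+-mono-≤ (term≥0 w′ q l) (spread-∈ L l∈))

    sum-spread : ∀ L → sum (spread L) ≡ + total L
    sum-spread []            = sum-replicate-zero n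
    sum-spread ((q , w) ∷ L) = trans (∑-distrib-+ (λ l → (+ w * + v l) * δᶻ q l) (spread L))
      (cong₂ _+_ (trans (sum-δᶻ q (λ l → + w * + v l) (δᶻ q) (λ j q′ → δᶻ-diff (q′ ∘ ≡-sym)) (δᶻ-same q)) (≡-sym (ℤₚ.pos-* w (v q))))
        (sum-spread L))

    sum-mono : ∀ {k} (f g : Fin k → ℤ) → (∀ i → f i ≤ᶻ g i) → sum f ≤ᶻ sum g
    sum-mono {zero}  f g h = ℤₚ.≤-refl
    sum-mono {suc k} f g h = ℤₚ.+-mono-≤ (h F.zero) (sum-mono (f ∘ F.suc) (g ∘ F.suc) (h ∘ F.suc))

  row : ∀ i L → (∀ l → l ≢ i → m M i l ≡ 2 ⊎ ∃ λ w → (l , w) ∈ L × sixfold (m M i l) i l ≤ w) →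
        total L ≤ 12 ℕ.* v i → Row i
  row i L cover bound = ℤₚ.≤-trans main (sum-mono lower (λ l → coef i l * + v l) pointwise)
    where
    lower : Fin n → ℤ
    lower l = (+ 12 * + v l) * δᶻ i l + (- 1ℤ) * spread L l
    main : 0ℤ ≤ᶻ sum lower
    main = subst (0ℤ ≤ᶻ_) (≡-sym (trans (∑-distrib-+ (λ l → (+ 12 * + v l) * δᶻ i l) (λ l → (- 1ℤ) * spread L l))
      (cong₂ _+_ (trans (sum-δᶻ i (λ l → + 12 * + v l) (δᶻ i) (λ j q → δᶻ-diff (q ∘ ≡-sym)) (δᶻ-same i)) (≡-sym (ℤₚ.pos-* 12 (v i))))
        (trans (≡-sym (*-distribˡ-sum (- 1ℤ) (spread L))) (trans (ℤₚ.-1*i≡-i (sum (spread L))) (cong -_ (sum-spread L)))))))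
      (ℤₚ.i≤j⇒0≤j-i (+≤+ bound))
    neg≤0 : ∀ {z} → 0ℤ ≤ᶻ z → (- 1ℤ) * z ≤ᶻ 0ℤ
    neg≤0 {z} q = subst (_≤ᶻ 0ℤ) (≡-sym (ℤₚ.-1*i≡-i z)) (ℤₚ.neg-mono-≤ q)
    pointwise : ∀ l → lower l ≤ᶻ coef i l * + v l
    pointwise l with i F.≟ l
    ... | yes refl = subst₂ _≤ᶻ_ refl (ℤₚ.+-identityʳ (+ 12 * + v i)) (ℤₚ.+-mono-≤
          (ℤₚ.≤-reflexive (trans (cong ((+ 12 * + v i) *_) refl) (ℤₚ.*-identityʳ (+ 12 * + v i)))) (neg≤0 (spread≥0 L i)))
    ... | no i≢l = subst (_≤ᶻ - + sixfold (m M i l) i l * + v l)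
          (≡-sym (trans (cong (_+ (- 1ℤ) * spread L l) (ℤₚ.*-zeroʳ (+ 12 * + v l))) (ℤₚ.+-identityˡ _)))
          (off (cover l (i≢l ∘ ≡-sym)))
      where
      off : m M i l ≡ 2 ⊎ (∃ λ w → (l , w) ∈ L × sixfold (m M i l) i l ≤ w) → (- 1ℤ) * spread L l ≤ᶻ - + sixfold (m M i l) i l * + v l
      off (inj₁ q) rewrite q = neg≤0 (spread≥0 L l)
      off (inj₂ (w , l∈ , le)) = subst₂ _≤ᶻ_ (≡-sym (ℤₚ.-1*i≡-i (spread L l)))
        (ℤₚ.neg-distribˡ-* (+ sixfold (m M i l) i l) (+ v l))
        (ℤₚ.neg-mono-≤ (ℤₚ.≤-trans (ℤₚ.*-monoʳ-≤-nonNeg (+ v l) (+≤+ le)) (spread-∈ L l∈)))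

  weight₄≤12 : ∀ {i j} (x : Dec (Leaf i j)) (y : Dec (Leaf j i)) → weight₄ x y ≤ 12
  weight₄≤12 {i} {j} (yes _) (yes _) with toℕ i ℕ.<ᵇ toℕ j
  ... | true  = ℕₚ.≤ᵇ⇒≤ 6 12 tt
  ... | false = ℕₚ.≤-refl
  weight₄≤12 (yes _) (no _) = ℕₚ.≤-refl
  weight₄≤12 (no _) (yes _) = ℕₚ.≤ᵇ⇒≤ 6 12 tt
  weight₄≤12 {i} {j} (no _) (no _) with toℕ i ℕ.<ᵇ toℕ j
  ... | true  = ℕₚ.≤ᵇ⇒≤ 8 12 tt
  ... | false = ℕₚ.≤ᵇ⇒≤ 9 12 tt

  weight₄≤9 : ∀ {i j} (x : Dec (Leaf i j)) (y : Dec (Leaf j i)) → ¬ Leaf i j → weight₄ x y ≤ 9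
  weight₄≤9 (yes l) y ¬l = ⊥-elim (¬l l)
  weight₄≤9 (no _) (yes _) _ = ℕₚ.≤ᵇ⇒≤ 6 9 tt
  weight₄≤9 {i} {j} (no _) (no _) _ with toℕ i ℕ.<ᵇ toℕ j
  ... | true  = ℕₚ.≤ᵇ⇒≤ 8 9 tt
  ... | false = ℕₚ.≤-refl

  weight₄≤6 : ∀ {i j} (x : Dec (Leaf i j)) (y : Dec (Leaf j i)) → ¬ Leaf i j → Leaf j i → weight₄ x y ≤ 6
  weight₄≤6 (yes l) y ¬l _ = ⊥-elim (¬l l)
  weight₄≤6 (no _) (no ¬l) _ l = ⊥-elim (¬l l)
  weight₄≤6 (no _) (yes _) _ _ = ℕₚ.≤-refl

  module InComponent {lab : ℕ → ℕ → ℕ} {k : ℕ} (E : Embedding M lab k) (closed : Closed M (Embedding.p E) k) where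
    open Embedding E

    row-at : ∀ {b} → b < k → (L : List (ℕ × ℕ)) →
             (∀ b′ → b′ < k → b′ ≢ b → lab b b′ ≡ 2 ⊎ ∃ λ w → (b′ , w) ∈ L × sixfold (lab b b′) (p b) (p b′) ≤ w) →
             total (L.map (λ (b′ , w) → p b′ , w) L) ≤ 12 ℕ.* v (p b) → Row (p b)
    row-at {b} b< L cover bound = row (p b) (L.map (λ (b′ , w) → p b′ , w) L) cover′ bound
      where
      cover′ : ∀ l → l ≢ p b → m M (p b) l ≡ 2 ⊎ ∃ λ w → (l , w) ∈ L.map (λ (b′ , w) → p b′ , w) L × sixfold (m M (p b) l) (p b) l ≤ w
      cover′ l l≢ with ℕₚ.anyUpTo? (λ b → p b F.≟ l) k
      ... | no ¬in = inj₁ (closed b< l (λ b′< q → ¬in (_ , b′< , q)))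
      ... | yes (b′ , b′< , refl) with cover b′ b′< (λ q → l≢ (cong p q))
      ...   | inj₁ q = inj₁ (trans (lab≡ b< b′<) q)
      ...   | inj₂ (w , w∈ , le) = inj₂ (w , ∈-map⁺ (λ (b′ , w) → p b′ , w) w∈ ,
                subst (λ z → sixfold z (p b) (p b′) ≤ w) (≡-sym (lab≡ b< b′<)) le)

chain-neighbour : ∀ a b → b ≢ a → chain a b ≡ 2 ⊎ (chain a b ≡ 3 × (suc b ≡ a ⊎ b ≡ suc a))
chain-neighbour zero          zero          q = ⊥-elim (q refl)
chain-neighbour zero          (suc zero)    q = inj₂ (refl , inj₂ refl)
chain-neighbour zero          (suc (suc b)) q = inj₁ refl
chain-neighbour (suc zero)    zero          q = inj₂ (refl , inj₁ refl)
chain-neighbour (suc (suc a)) zero          q = inj₁ refl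
chain-neighbour (suc a)       (suc b)       q with chain-neighbour a b (q ∘ cong suc)
... | inj₁ far              = inj₁ far
... | inj₂ (near , inj₁ r)  = inj₂ (near , inj₁ (cong suc r))
... | inj₂ (near , inj₂ r)  = inj₂ (near , inj₂ (cong suc r))

before : ℕ → List ℕ
before zero    = []
before (suc b) = b ∷ []

after : ℕ → ℕ → List ℕ
after b zero    = []
after b (suc _) = suc b ∷ []

chain-covered : ∀ {k} b m → b ℕ.+ suc m ≡ k → ∀ b′ → b′ < k → b′ ≢ b →
                chain b b′ ≡ 2 ⊎ (chain b b′ ≡ 3 × b′ ∈ before b ++ after b m)
chain-covered b m k≡ b′ b′< b′≢b with chain-neighbour b b′ b′≢b
... | inj₁ far = inj₁ far
chain-covered (suc b) m k≡ b′ b′< b′≢b | inj₂ (near , inj₁ refl) = inj₂ (near , here refl)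
chain-covered b zero    refl b′ b′< b′≢b | inj₂ (near , inj₂ refl) = ⊥-elim (ℕₚ.<-irrefl (ℕₚ.+-comm 1 b) b′<)
chain-covered b (suc m) k≡ b′ b′< b′≢b | inj₂ (near , inj₂ refl) = inj₂ (near , Anyₚ.++⁺ʳ (before b) (here refl))

sandwich : ∀ {k b} → b < k → ∃ λ m → b ℕ.+ suc m ≡ k
sandwich {k} {b} b< = k ℕ.∸ suc b , trans (ℕₚ.+-suc b (k ℕ.∸ suc b)) (ℕₚ.m+[n∸m]≡n b<)

module ComponentRows {n : ℕ} (M : CoxeterMatrix n) (m≤4 : ∀ i j → m M i j ≤ 4)
  (w₀ : Word n) (longest : IsLongestWord M w₀)
  (v : Fin n → ℕ) (occ : ∀ i → IsMinOccurrences M w₀ i (v i)) where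

  open Rows M v
  open Classification M m≤4 w₀ longest using (reversed; swapped; bond-4; ComponentOf; component; classify)
  open Embeddings M using (relabel)
  open Embedding

  closed-relabel : ∀ {q : ℕ → Fin n} {k} (σ : ℕ → ℕ) → (∀ {b} → b < k → σ b < k) → (∀ {b} → b < k → σ (σ b) ≡ b) →
                   Closed M q k → Closed M (q ∘ σ) k
  closed-relabel {q} σ σ< σσ closed a< j out = closed (σ< a<) j (λ b< r → out (σ< b<) (trans (cong q (σσ b<)) r))

  module Simple {lab : ℕ → ℕ → ℕ} {k : ℕ} (E : Embedding M lab k) (closed : Closed M (p E) k) where
    open InComponent E closed public

    V : ℕ → ℕ
    V b = v (p E b)

    load : List ℕ → ℕ
    load []      = 0
    load (b ∷ N) = V b ℕ.+ load N

    total-load : ∀ N → total (L.map (λ (b , w) → p E b , w) (L.map (_, 6) N)) ≡ 6 ℕ.* load N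
    total-load []      = refl
    total-load (b ∷ N) = trans (cong (6 ℕ.* V b ℕ.+_) (total-load N)) (≡-sym (ℕₚ.*-distribˡ-+ 6 (V b) (load N)))

    doubled : ∀ z → 6 ℕ.* (z ℕ.+ z) ≡ 12 ℕ.* z
    doubled z = trans (ℕₚ.*-distribˡ-+ 6 z z) (≡-sym (ℕₚ.*-distribʳ-+ z 6 6))

    simple-row : ∀ {b} → b < k → (N : List ℕ) → (∀ b′ → b′ < k → b′ ≢ b → lab b b′ ≡ 2 ⊎ (lab b b′ ≡ 3 × b′ ∈ N)) →
                 load N ≤ V b ℕ.+ V b → Row (p E b)
    simple-row {b} b< N cover bound = row-at b< (L.map (_, 6) N) cover′
      (subst₂ _≤_ (≡-sym (total-load N)) (doubled (V b)) (ℕₚ.*-monoʳ-≤ 6 bound))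
      where
      cover′ : ∀ b′ → b′ < k → b′ ≢ b → lab b b′ ≡ 2 ⊎ ∃ λ w → (b′ , w) ∈ L.map (_, 6) N × sixfold (lab b b′) (p E b) (p E b′) ≤ w
      cover′ b′ b′< q with cover b′ b′< q
      ... | inj₁ e        = inj₁ e
      ... | inj₂ (e , b∈) = inj₂ (6 , ∈-map⁺ (_, 6) b∈ , ℕₚ.≤-reflexive (cong (λ z → sixfold z (p E b) (p E b′)) e))

  module RowsA {k : ℕ} (E : Embedding M chain k) (closed : Closed M (p E) k) where
    open Simple E closed
    module A  = TypeA M m≤4 E closed w₀ longest
    module A′ = TypeA M m≤4 (reversed E) (closed-relabel {p E} (reflect k) reflect-< reflect-reflect closed) w₀ longest

    upper : ∀ {b m} → b ℕ.+ suc m ≡ k → V b ≤ suc m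
    upper {b} {m} refl = subst (V b ≤_) (ℕₚ.m+n∸m≡n b (suc m)) (A.upper (ℕₚ.m<m+n b (s≤s z≤n)) (occ _))

    upper′ : ∀ {b} → b < k → V b ≤ suc b
    upper′ {b} b< = subst₂ (λ x y → v (p E x) ≤ y) (reflect-reflect b<)
      (ℕₚ.m∸[m∸n]≡n b<) (A′.upper (reflect-< b<) (occ _))

    lower : ∀ {b m} → b ℕ.+ suc m ≡ k → suc b ≤ V b ⊎ suc m ≤ V b
    lower {b} {m} refl with proj₁ (occ (p E b))
    ... | u , _ , u~ , u≡ with A.Lower.lower b (ℕₚ.m<m+n b (s≤s z≤n)) u u~
    ...   | inj₁ q = inj₁ (subst (suc b ≤_) u≡ q)
    ...   | inj₂ q = inj₂ (subst₂ _≤_ (ℕₚ.m+n∸m≡n b (suc m)) u≡ q)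

    bound : ∀ b m → b ℕ.+ suc m ≡ k → load (before b ++ after b m) ≤ V b ℕ.+ V b
    bound zero zero k≡ = z≤n
    bound zero (suc m) k≡ with lower k≡
    ... | inj₁ q = ℕₚ.≤-trans (ℕₚ.≤-reflexive (ℕₚ.+-identityʳ (V 1)))
                     (ℕₚ.≤-trans (upper′ (subst (1 <_) k≡ (s≤s (s≤s z≤n)))) (ℕₚ.+-mono-≤ q q))
    ... | inj₂ q = ℕₚ.≤-trans (ℕₚ.≤-reflexive (ℕₚ.+-identityʳ (V 1)))
                     (ℕₚ.≤-trans (upper {1} {m} k≡) (ℕₚ.≤-trans (ℕₚ.≤-trans (ℕₚ.n≤1+n _) q) (ℕₚ.m≤m+n (V 0) (V 0))))
    bound (suc b) m k≡ with lower k≡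
    ... | inj₁ q = ℕₚ.≤-trans (ℕₚ.+-mono-≤ (upper′ (subst (b <_) k≡ (ℕₚ.m≤n⇒m≤n+o (suc m) ℕₚ.≤-refl))) (next m k≡))
                     (ℕₚ.≤-trans (ℕₚ.≤-reflexive (ℕₚ.+-suc (suc b) (suc (suc b)))) (ℕₚ.+-mono-≤ q q))
      where
      next : ∀ m → suc b ℕ.+ suc m ≡ k → load (after (suc b) m) ≤ suc (suc (suc b))
      next zero    _  = z≤n
      next (suc m) k≡ = ℕₚ.≤-trans (ℕₚ.≤-reflexive (ℕₚ.+-identityʳ (V (suc (suc b)))))
        (upper′ (subst (suc (suc b) <_) k≡ (subst (_≤ suc b ℕ.+ suc (suc m)) (ℕₚ.+-comm (suc b) 2) (ℕₚ.+-monoʳ-≤ (suc b) (s≤s (s≤s z≤n))))))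
    ... | inj₂ q = ℕₚ.≤-trans (ℕₚ.+-mono-≤ (upper {b} {suc m} (trans (ℕₚ.+-suc b (suc m)) k≡)) (next m k≡))
                     (ℕₚ.≤-trans (ℕₚ.≤-reflexive (≡-sym (ℕₚ.+-suc (suc m) m))) (ℕₚ.+-mono-≤ q q))
      where
      next : ∀ m → suc b ℕ.+ suc m ≡ k → load (after (suc b) m) ≤ m
      next zero    _  = z≤n
      next (suc m) k≡ = ℕₚ.≤-trans (ℕₚ.≤-reflexive (ℕₚ.+-identityʳ (V (suc (suc b)))))
        (upper {suc (suc b)} {m} (trans (≡-sym (ℕₚ.+-suc (suc b) (suc m))) k≡))

    rows : ∀ b → b < k → Row (p E b)
    rows b b< = let m , k≡ = sandwich b< in simple-row b< (before b ++ after b m) (chain-covered b m k≡) (bound b m k≡)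

  module Tail {lab : ℕ → ℕ → ℕ} {k : ℕ} (E : Embedding M lab k) (closed : Closed M (p E) k) where
    open Simple E closed

    -- Beyond the branch node the numbers of occurrences are k - b + 1, which are concave, even at the end.
    tail-row : ∀ b m → (k≡ : suc b ℕ.+ suc m ≡ k) →
               (∀ b′ → b′ < k → b′ ≢ suc b → lab (suc b) b′ ≡ 2 ⊎ lab (suc b) b′ ≡ chain (suc b) b′) →
               (∀ b′ m → b ≤ b′ → b′ ℕ.+ suc m ≡ k → V b′ ≡ suc (suc m)) → Row (p E (suc b))
    tail-row b m k≡ path value = simple-row (subst (suc b <_) k≡ (ℕₚ.m<m+n (suc b) (s≤s z≤n))) (b ∷ after (suc b) m) cover
      (subst₂ _≤_ (cong (ℕ._+ load (after (suc b) m)) (≡-sym (value b (suc m) ℕₚ.≤-refl (trans (ℕₚ.+-suc b (suc m)) k≡))))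
        (≡-sym (cong₂ ℕ._+_ here≡ here≡)) (bound m k≡))
      where
      here≡ : V (suc b) ≡ suc (suc m)
      here≡ = value (suc b) m (ℕₚ.n≤1+n b) k≡
      cover : ∀ b′ → b′ < k → b′ ≢ suc b → lab (suc b) b′ ≡ 2 ⊎ (lab (suc b) b′ ≡ 3 × b′ ∈ b ∷ after (suc b) m)
      cover b′ b′< ne with path b′ b′< ne
      ... | inj₁ q = inj₁ q
      ... | inj₂ q with chain-covered (suc b) m k≡ b′ b′< ne
      ...   | inj₁ r        = inj₁ (trans q r)
      ...   | inj₂ (r , b∈) = inj₂ (trans q r , b∈)
      bound : ∀ m → suc b ℕ.+ suc m ≡ k → suc (suc (suc m)) ℕ.+ load (after (suc b) m) ≤ suc (suc m) ℕ.+ suc (suc m)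
      bound zero    _  = ℕₚ.≤ᵇ⇒≤ 3 4 tt
      bound (suc m) k≡ = ℕₚ.≤-reflexive (trans (cong (suc (suc (suc (suc m))) ℕ.+_) (trans (ℕₚ.+-identityʳ (V (suc (suc b))))
        (value (suc (suc b)) m (ℕₚ.m≤n⇒m≤o+n 2 ℕₚ.≤-refl) (trans (≡-sym (ℕₚ.+-suc (suc b) (suc m))) k≡))))
        (≡-sym (ℕₚ.+-suc (suc (suc (suc m))) (suc (suc m)))))

  module RowsB {k : ℕ} (E : Embedding M (star 1 4) k) (2≤k : 2 ≤ k) (closed : Closed M (p E) k) where
    open Simple E closed
    module B = TypeB.Values M m≤4 E 2≤k closed w₀ longest

    0<k : 0 < k
    0<k = ℕₚ.<-trans (s≤s z≤n) 2≤k

    V₀ : V 0 ≡ k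
    V₀ = B.value-0 (occ (p E 0))

    V> : ∀ b m → 1 ≤ b → b ℕ.+ suc m ≡ k → V b ≡ suc (suc m)
    V> b m 1≤b k≡ = B.value b m 1≤b k≡ (occ (p E b))

    V₁ : V 1 ≡ k
    V₁ = let m , k≡ = sandwich 2≤k in trans (V> 1 m ℕₚ.≤-refl k≡) k≡

    row-0 : Row (p E 0)
    row-0 = row-at 0<k ((1 , 12) ∷ []) cover (ℕₚ.≤-reflexive (trans (ℕₚ.+-identityʳ _) (cong (12 ℕ.*_) (trans V₁ (≡-sym V₀)))))
      where
      cover : ∀ b′ → b′ < k → b′ ≢ 0 → star 1 4 0 b′ ≡ 2 ⊎ ∃ λ w → (b′ , w) ∈ (1 , 12) ∷ [] × sixfold (star 1 4 0 b′) (p E 0) (p E b′) ≤ w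
      cover zero          _ q = ⊥-elim (q refl)
      cover (suc zero)    _ _ = inj₂ (12 , here refl , weight₄≤12 (leaf? _ _) (leaf? _ _))
      cover (suc (suc b)) _ _ = inj₁ refl

    leaf₀₁ : Leaf (p E 0) (p E 1)
    leaf₀₁ l l≢0 l≢1 with ℕₚ.anyUpTo? (λ b → p E b F.≟ l) k
    ... | no ¬in = closed 0<k l (λ b< q → ¬in (_ , b< , q))
    ... | yes (zero        , _ , r) = ⊥-elim (l≢0 (≡-sym r))
    ... | yes (suc zero    , _ , r) = ⊥-elim (l≢1 (≡-sym r))
    ... | yes (suc (suc b) , b< , refl) = lab≡ E 0<k b<

    row-1 : ∀ m → 2 ℕ.+ m ≡ k → Row (p E 1)
    row-1 zero refl = row-at 2≤k ((0 , 12) ∷ []) cover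
      (ℕₚ.≤-reflexive (trans (ℕₚ.+-identityʳ _) (cong (12 ℕ.*_) (trans V₀ (≡-sym V₁)))))
      where
      cover : ∀ b′ → b′ < 2 → b′ ≢ 1 → star 1 4 1 b′ ≡ 2 ⊎ ∃ λ w → (b′ , w) ∈ (0 , 12) ∷ [] × sixfold (star 1 4 1 b′) (p E 1) (p E b′) ≤ w
      cover zero          _ _ = inj₂ (12 , here refl , weight₄≤12 (leaf? _ _) (leaf? _ _))
      cover (suc zero)    _ q = ⊥-elim (q refl)
      cover (suc (suc b)) (s≤s (s≤s ())) _
    row-1 (suc m) k≡ = row-at 2≤k ((0 , 6) ∷ (2 , 6) ∷ []) cover bound
      where
      2<k : 2 < k
      2<k = subst (2 <_) k≡ (s≤s (s≤s (s≤s z≤n)))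
      ¬leaf₁₀ : ¬ Leaf (p E 1) (p E 0)
      ¬leaf₁₀ isolated = case trans (≡-sym (lab≡ E 2≤k 2<k)) (isolated (p E 2)
        (λ q → case inj E 2<k 2≤k q of λ ()) (λ q → case inj E 2<k 0<k q of λ ())) of λ ()
      cover : ∀ b′ → b′ < k → b′ ≢ 1 → star 1 4 1 b′ ≡ 2 ⊎ ∃ λ w → (b′ , w) ∈ (0 , 6) ∷ (2 , 6) ∷ [] × sixfold (star 1 4 1 b′) (p E 1) (p E b′) ≤ w
      cover zero                _ _ = inj₂ (6 , here refl , weight₄≤6 (leaf? _ _) (leaf? _ _) ¬leaf₁₀ leaf₀₁)
      cover (suc zero)          _ q = ⊥-elim (q refl)
      cover (suc (suc zero))    _ _ = inj₂ (6 , there (here refl) , ℕₚ.≤-refl)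
      cover (suc (suc (suc b))) _ _ = inj₁ refl
      bound : 6 ℕ.* V 0 ℕ.+ (6 ℕ.* V 2 ℕ.+ 0) ≤ 12 ℕ.* V 1
      bound = subst₂ _≤_ (cong₂ (λ x y → 6 ℕ.* x ℕ.+ (6 ℕ.* y ℕ.+ 0)) (≡-sym V₀) (≡-sym (V> 2 m (s≤s z≤n) k≡)))
        (trans (doubled k) (cong (12 ℕ.*_) (≡-sym V₁)))
        (subst (_≤ 6 ℕ.* (k ℕ.+ k)) (trans (ℕₚ.*-distribˡ-+ 6 k (2 ℕ.+ m)) (cong (6 ℕ.* k ℕ.+_) (≡-sym (ℕₚ.+-identityʳ _))))
          (ℕₚ.*-monoʳ-≤ 6 (ℕₚ.+-monoʳ-≤ k (subst (2 ℕ.+ m ≤_) k≡ (ℕₚ.n≤1+n _)))))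

    rows : ∀ b → b < k → Row (p E b)
    rows zero          _ = row-0
    rows (suc zero)    _ = row-1 (k ℕ.∸ 2) (ℕₚ.m+[n∸m]≡n 2≤k)
    rows (suc (suc b)) b< = let m , k≡ = sandwich b< in Tail.tail-row E closed (suc b) m k≡ path
        (λ b′ m′ le → V> b′ m′ (ℕₚ.≤-trans (s≤s z≤n) le))
      where
      path : ∀ b′ → b′ < k → b′ ≢ suc (suc b) → star 1 4 (suc (suc b)) b′ ≡ 2 ⊎ star 1 4 (suc (suc b)) b′ ≡ chain (suc (suc b)) b′
      path zero    _ _ = inj₁ refl
      path (suc b) _ _ = inj₂ refl

  halve : ∀ k → ∃ λ o → ∃ λ r → o ≤ 1 × o ℕ.+ (r ℕ.+ r) ≡ k
  halve zero          = 0 , 0 , z≤n , refl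
  halve (suc zero)    = 1 , 0 , s≤s z≤n , refl
  halve (suc (suc k)) = let o , r , o≤1 , k≡ = halve k in o , suc r , o≤1 ,
    trans (cong (λ z → o ℕ.+ suc z) (ℕₚ.+-suc r r)) (trans (ℕₚ.+-suc o (suc (r ℕ.+ r))) (cong suc (trans (ℕₚ.+-suc o (r ℕ.+ r)) (cong suc k≡))))

  module RowsD {k : ℕ} (E : Embedding M (star 2 3) k) (4≤k : 4 ≤ k) (closed : Closed M (p E) k) where
    open Simple E closed

    3≤k : 3 ≤ k
    3≤k = ℕₚ.<⇒≤ 4≤k

    2≤k : 2 ≤ k
    2≤k = ℕₚ.<⇒≤ 3≤k

    module D  = TypeD.Values M m≤4 E 3≤k closed w₀ longest
    module D′ = TypeD.Values M m≤4 (swapped 2≤k E) 3≤k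
      (closed-relabel {p E} (swap 0) (swap-< 0 _ 2≤k) (λ _ → swap-involutive 0 _) closed) w₀ longest

    V> : ∀ b m → 2 ≤ b → b ℕ.+ suc m ≡ k → V b ≡ suc (suc m)
    V> b m 2≤b k≡ = D.value b m 2≤b k≡ (occ (p E b))

    module Ends (o r : ℕ) (o≤1 : o ≤ 1) (k≡ : o ℕ.+ (r ℕ.+ r) ≡ k) where

      V₀ : V 0 ≡ r
      V₀ = D.value-0 o r o≤1 k≡ (occ (p E 0))

      V₁ : V 1 ≡ r
      V₁ = D′.value-0 o r o≤1 k≡ (occ (p E 1))

      end-bound : ∀ m → 3 ℕ.+ m ≡ k → load (2 ∷ []) ≤ r ℕ.+ r
      end-bound m q = subst (_≤ r ℕ.+ r) (≡-sym (trans (ℕₚ.+-identityʳ (V 2)) (V> 2 m ℕₚ.≤-refl q)))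
        (ℕₚ.≤-pred (ℕₚ.≤-trans (ℕₚ.≤-reflexive (trans q (≡-sym k≡))) (ℕₚ.+-monoˡ-≤ (r ℕ.+ r) o≤1)))

      row-0 : Row (p E 0)
      row-0 = simple-row (ℕₚ.<-trans (s≤s z≤n) 2≤k) (2 ∷ []) cover
          (subst (load (2 ∷ []) ≤_) (cong₂ ℕ._+_ (≡-sym V₀) (≡-sym V₀)) (end-bound (k ℕ.∸ 3) (ℕₚ.m+[n∸m]≡n 3≤k)))
        where
        cover : ∀ b′ → b′ < k → b′ ≢ 0 → star 2 3 0 b′ ≡ 2 ⊎ (star 2 3 0 b′ ≡ 3 × b′ ∈ 2 ∷ [])
        cover zero                _ q = ⊥-elim (q refl)
        cover (suc zero)          _ _ = inj₁ refl
        cover (suc (suc zero))    _ _ = inj₂ (refl , here refl)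
        cover (suc (suc (suc b))) _ _ = inj₁ refl

      row-1 : Row (p E 1)
      row-1 = simple-row 2≤k (2 ∷ []) cover
          (subst (load (2 ∷ []) ≤_) (cong₂ ℕ._+_ (≡-sym V₁) (≡-sym V₁)) (end-bound (k ℕ.∸ 3) (ℕₚ.m+[n∸m]≡n 3≤k)))
        where
        cover : ∀ b′ → b′ < k → b′ ≢ 1 → star 2 3 1 b′ ≡ 2 ⊎ (star 2 3 1 b′ ≡ 3 × b′ ∈ 2 ∷ [])
        cover zero                _ _ = inj₁ refl
        cover (suc zero)          _ q = ⊥-elim (q refl)
        cover (suc (suc zero))    _ _ = inj₂ (refl , here refl)
        cover (suc (suc (suc b))) _ _ = inj₁ refl

      row-2 : ∀ m → 4 ℕ.+ m ≡ k → Row (p E 2)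
      row-2 m q = simple-row 3≤k (0 ∷ 1 ∷ 3 ∷ []) cover (begin
          V 0 ℕ.+ (V 1 ℕ.+ (V 3 ℕ.+ 0)) ≡⟨ cong₂ (λ x y → x ℕ.+ (y ℕ.+ (V 3 ℕ.+ 0))) V₀ V₁ ⟩
          r ℕ.+ (r ℕ.+ (V 3 ℕ.+ 0))     ≡⟨ cong (λ z → r ℕ.+ (r ℕ.+ z)) (trans (ℕₚ.+-identityʳ (V 3)) (V> 3 m (s≤s (s≤s z≤n)) q)) ⟩
          r ℕ.+ (r ℕ.+ (2 ℕ.+ m))       ≡⟨ ℕₚ.+-assoc r r (2 ℕ.+ m) ⟨
          (r ℕ.+ r) ℕ.+ (2 ℕ.+ m)       ≤⟨ ℕₚ.+-monoˡ-≤ (2 ℕ.+ m) (ℕₚ.≤-trans (ℕₚ.m≤n+m (r ℕ.+ r) o) (ℕₚ.≤-reflexive (trans k≡ (≡-sym q)))) ⟩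
          (4 ℕ.+ m) ℕ.+ (2 ℕ.+ m)       ≡⟨ ℕₚ.+-suc (3 ℕ.+ m) (2 ℕ.+ m) ⟨
          (3 ℕ.+ m) ℕ.+ (3 ℕ.+ m)       ≡⟨ cong₂ ℕ._+_ (V> 2 (suc m) ℕₚ.≤-refl q) (V> 2 (suc m) ℕₚ.≤-refl q) ⟨
          V 2 ℕ.+ V 2 ∎)
        where
        open ℕₚ.≤-Reasoning
        cover : ∀ b′ → b′ < k → b′ ≢ 2 → star 2 3 2 b′ ≡ 2 ⊎ (star 2 3 2 b′ ≡ 3 × b′ ∈ 0 ∷ 1 ∷ 3 ∷ [])
        cover zero                      _ _ = inj₂ (refl , here refl)
        cover (suc zero)                _ _ = inj₂ (refl , there (here refl))
        cover (suc (suc zero))          _ q = ⊥-elim (q refl)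
        cover (suc (suc (suc zero)))    _ _ = inj₂ (refl , there (there (here refl)))
        cover (suc (suc (suc (suc b)))) _ _ = inj₁ refl

    rows : ∀ b → b < k → Row (p E b)
    rows zero             _ = let o , r , o≤1 , k≡ = halve k in Ends.row-0 o r o≤1 k≡
    rows (suc zero)       _ = let o , r , o≤1 , k≡ = halve k in Ends.row-1 o r o≤1 k≡
    rows (suc (suc zero)) _ = let o , r , o≤1 , k≡ = halve k in Ends.row-2 o r o≤1 k≡ (k ℕ.∸ 4) (ℕₚ.m+[n∸m]≡n 4≤k)
    rows (suc (suc (suc b))) b< = let m , k≡ = sandwich b< in Tail.tail-row E closed (suc (suc b)) m k≡ path
        (λ b′ m′ le → V> b′ m′ (ℕₚ.≤-trans (s≤s (s≤s z≤n)) le))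
      where
      path : ∀ b′ → b′ < k → b′ ≢ 3 ℕ.+ b → star 2 3 (3 ℕ.+ b) b′ ≡ 2 ⊎ star 2 3 (3 ℕ.+ b) b′ ≡ chain (3 ℕ.+ b) b′
      path zero    _ _ = inj₁ refl
      path (suc b) _ _ = inj₂ refl

star3-label : ∀ t a b → b ≢ a → star t 3 a b ≡ 2 ⊎ star t 3 a b ≡ 3
star3-label t zero    zero    q = ⊥-elim (q refl)
star3-label t zero    (suc b) q with suc b ℕ.≡ᵇ t
... | true  = inj₂ refl
... | false = inj₁ refl
star3-label t (suc a) zero    q with suc a ℕ.≡ᵇ t
... | true  = inj₂ refl
... | false = inj₁ refl
star3-label t (suc a) (suc b) q with chain-neighbour a b (q ∘ cong suc)
... | inj₁ far        = inj₁ far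
... | inj₂ (near , _) = inj₂ near

nth : List ℕ → ℕ → ℕ
nth []      _       = 0
nth (x ∷ _) zero    = x
nth (_ ∷ l) (suc b) = nth l b

module ExceptionalRows {n : ℕ} (M : CoxeterMatrix n) (m≤4 : ∀ i j → m M i j ≤ 4)
  (w₀ : Word n) (longest : IsLongestWord M w₀)
  (v : Fin n → ℕ) (occ : ∀ i → IsMinOccurrences M w₀ i (v i)) where

  open Rows M v
  open ComponentRows M m≤4 w₀ longest v occ using (module Simple; module RowsA; module RowsB; module RowsD; closed-relabel)
  open Classification M m≤4 w₀ longest using (bond-4; ComponentOf; component; classify)
  open Embeddings M using (relabel)
  open Embedding

  module Tabulated {k : ℕ} (E : Embedding M (star 3 3) k) (closed : Closed M (p E) k) (table : List ℕ)
    (V≡ : ∀ b → b < k → v (p E b) ≡ nth table b) where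
    open Simple E closed

    adjacent : ℕ → List ℕ
    adjacent b = filter (λ b′ → star 3 3 b b′ ℕ.≟ 3) (L.upTo k)

    tableLoad : List ℕ → ℕ
    tableLoad []      = 0
    tableLoad (b ∷ N) = nth table b ℕ.+ tableLoad N

    load≡ : ∀ {N} → All (_< k) N → load N ≡ tableLoad N
    load≡ []          = refl
    load≡ (b< ∷ bs<) = cong₂ ℕ._+_ (V≡ _ b<) (load≡ bs<)

    check : ℕ → Bool
    check b = tableLoad (adjacent b) ℕ.≤ᵇ nth table b ℕ.+ nth table b

    rows : T (allᵇ check (L.upTo k)) → ∀ b → b < k → Row (p E b)
    rows ok b b< = simple-row b< (adjacent b) cover
        (subst₂ _≤_ (≡-sym (load≡ (All.tabulate (λ b∈ → ∈-upTo⁻ (proj₁ (∈-filter⁻ (λ b′ → star 3 3 b b′ ℕ.≟ 3) {xs = L.upTo k} b∈))))))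
          (cong₂ ℕ._+_ (≡-sym (V≡ b b<)) (≡-sym (V≡ b b<)))
          (ℕₚ.≤ᵇ⇒≤ _ _ (All.lookup (Allₚ.all⁺ check (L.upTo k) ok) (∈-upTo⁺ b<))))
      where
      cover : ∀ b′ → b′ < k → b′ ≢ b → star 3 3 b b′ ≡ 2 ⊎ (star 3 3 b b′ ≡ 3 × b′ ∈ adjacent b)
      cover b′ b′< ne with star3-label 3 b b′ ne
      ... | inj₁ q = inj₁ q
      ... | inj₂ q = inj₂ (q , ∈-filter⁺ (λ b′ → star 3 3 b b′ ℕ.≟ 3) (∈-upTo⁺ b′<) q)

  module ValuesE {k : ℕ} (E : Embedding M (star 3 3) k) (closed : Closed M (p E) k) where

    value : ∀ i → i < k → ∀ u d {f g} → Certificate (star 3 3) k i u d f g → v (p E i) ≡ d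
    value i i<k u d {f} {g} ok = Certified.Conclusion.minOccurrences≡ M m≤4 E closed
      (λ {a} {b} _ _ q → ⊥-elim (star3≢4 3 a b q)) i i<k w₀ longest u d f g (neighbours (star 3 3) k i) (Certificate.valid ok) (occ (p E i))

  module RowsE₆ (E : Embedding M (star 3 3) 6) (closed : Closed M (p E) 6) where
    open ValuesE E closed

    V≡ : ∀ b → b < 6 → v (p E b) ≡ nth (3 ∷ 2 ∷ 4 ∷ 6 ∷ 4 ∷ 2 ∷ []) b
    V≡ 0 lt = value 0 lt w-E₆-0 3 E₆-0
    V≡ 1 lt = value 1 lt w-E₆-1 2 E₆-1
    V≡ 2 lt = value 2 lt w-E₆-2 4 E₆-2
    V≡ 3 lt = value 3 lt w-E₆-3 6 E₆-3
    V≡ 4 lt = value 4 lt w-E₆-4 4 E₆-4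
    V≡ 5 lt = value 5 lt w-E₆-5 2 E₆-5
    V≡ (suc (suc (suc (suc (suc (suc b)))))) (s≤s (s≤s (s≤s (s≤s (s≤s (s≤s ()))))))

    rows : ∀ b → b < 6 → Row (p E b)
    rows = Tabulated.rows E closed (3 ∷ 2 ∷ 4 ∷ 6 ∷ 4 ∷ 2 ∷ []) V≡ tt

  module RowsE₇ (E : Embedding M (star 3 3) 7) (closed : Closed M (p E) 7) where
    open ValuesE E closed

    V≡ : ∀ b → b < 7 → v (p E b) ≡ nth (5 ∷ 3 ∷ 6 ∷ 9 ∷ 7 ∷ 5 ∷ 3 ∷ []) b
    V≡ 0 lt = value 0 lt w-E₇-0 5 E₇-0
    V≡ 1 lt = value 1 lt w-E₇-1 3 E₇-1
    V≡ 2 lt = value 2 lt w-E₇-2 6 E₇-2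
    V≡ 3 lt = value 3 lt w-E₇-3 9 E₇-3
    V≡ 4 lt = value 4 lt w-E₇-4 7 E₇-4
    V≡ 5 lt = value 5 lt w-E₇-5 5 E₇-5
    V≡ 6 lt = value 6 lt w-E₇-6 3 E₇-6
    V≡ (suc (suc (suc (suc (suc (suc (suc b))))))) (s≤s (s≤s (s≤s (s≤s (s≤s (s≤s (s≤s ())))))))

    rows : ∀ b → b < 7 → Row (p E b)
    rows = Tabulated.rows E closed (5 ∷ 3 ∷ 6 ∷ 9 ∷ 7 ∷ 5 ∷ 3 ∷ []) V≡ tt

  module RowsE₈ (E : Embedding M (star 3 3) 8) (closed : Closed M (p E) 8) where
    open ValuesE E closed

    V≡ : ∀ b → b < 8 → v (p E b) ≡ nth (8 ∷ 5 ∷ 10 ∷ 15 ∷ 12 ∷ 9 ∷ 6 ∷ 3 ∷ []) b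
    V≡ 0 lt = value 0 lt w-E₈-0 8 E₈-0
    V≡ 1 lt = value 1 lt w-E₈-1 5 E₈-1
    V≡ 2 lt = value 2 lt w-E₈-2 10 E₈-2
    V≡ 3 lt = value 3 lt w-E₈-3 15 E₈-3
    V≡ 4 lt = value 4 lt w-E₈-4 12 E₈-4
    V≡ 5 lt = value 5 lt w-E₈-5 9 E₈-5
    V≡ 6 lt = value 6 lt w-E₈-6 6 E₈-6
    V≡ 7 lt = value 7 lt w-E₈-7 3 E₈-7
    V≡ (suc (suc (suc (suc (suc (suc (suc (suc b)))))))) (s≤s (s≤s (s≤s (s≤s (s≤s (s≤s (s≤s (s≤s ()))))))))

    rows : ∀ b → b < 8 → Row (p E b)
    rows = Tabulated.rows E closed (8 ∷ 5 ∷ 10 ∷ 15 ∷ 12 ∷ 9 ∷ 6 ∷ 3 ∷ []) V≡ tt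

  rowsE : ∀ {k} → 6 ≤ k → k ≤ 8 → (E : Embedding M (star 3 3) k) → Closed M (p E) k → ∀ b → b < k → Row (p E b)
  rowsE {6} _ _ = RowsE₆.rows
  rowsE {7} _ _ = RowsE₇.rows
  rowsE {8} _ _ = RowsE₈.rows
  rowsE {0} () _
  rowsE {1} (s≤s ()) _
  rowsE {2} (s≤s (s≤s ())) _
  rowsE {3} (s≤s (s≤s (s≤s ()))) _
  rowsE {4} (s≤s (s≤s (s≤s (s≤s ())))) _
  rowsE {5} (s≤s (s≤s (s≤s (s≤s (s≤s ()))))) _
  rowsE {suc (suc (suc (suc (suc (suc (suc (suc (suc k))))))))} _ (s≤s (s≤s (s≤s (s≤s (s≤s (s≤s (s≤s (s≤s ()))))))))

  module ValuesF (E : Embedding M labF 4) (closed : Closed M (p E) 4)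
    (oriented : Lattice.c M m≤4 (p E 2) (p E 1) ≡ 1ℤ) where

    oriented′ : ∀ {a b} → a < b → b < 4 → labF a b ≡ 4 → Lattice.c M m≤4 (p E b) (p E a) ≡ 1ℤ
    oriented′ {1} {2} _ _ _ = oriented
    oriented′ {0} {b} _ _ q = ⊥-elim (chain≢4 0 b q)
    oriented′ {1} {0} () _ _
    oriented′ {1} {1} (s≤s ()) _ _
    oriented′ {1} {suc (suc (suc b))} _ _ q = ⊥-elim (chain≢4 1 (3 ℕ.+ b) q)
    oriented′ {2} {0} () _ _
    oriented′ {2} {1} (s≤s ()) _ _
    oriented′ {2} {suc (suc b)} _ _ q = ⊥-elim (chain≢4 2 (2 ℕ.+ b) q)
    oriented′ {suc (suc (suc a))} {b} _ _ q = ⊥-elim (chain≢4 (3 ℕ.+ a) b q)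

    value : ∀ i → i < 4 → ∀ u d {f g} → Certificate labF 4 i u d f g → v (p E i) ≡ d
    value i i<4 u d {f} {g} ok = Certified.Conclusion.minOccurrences≡ M m≤4 E closed
      (λ {a} {b} → oriented′ {a} {b}) i i<4 w₀ longest u d f g (neighbours labF 4 i) (Certificate.valid ok) (occ (p E i))

  0<4 : 0 < 4
  0<4 = s≤s z≤n

  1<4 : 1 < 4
  1<4 = ℕₚ.≤ᵇ⇒≤ 2 4 tt

  2<4 : 2 < 4
  2<4 = ℕₚ.≤ᵇ⇒≤ 3 4 tt

  3<4 : 3 < 4
  3<4 = ℕₚ.≤-refl

  labF-reflect : ∀ {a b} → a < 4 → b < 4 → labF (reflect 4 a) (reflect 4 b) ≡ labF a b
  labF-reflect {0} {0} _ _ = refl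
  labF-reflect {0} {1} _ _ = refl
  labF-reflect {0} {2} _ _ = refl
  labF-reflect {0} {3} _ _ = refl
  labF-reflect {0} {suc (suc (suc (suc b)))} _ (s≤s (s≤s (s≤s (s≤s ()))))
  labF-reflect {1} {0} _ _ = refl
  labF-reflect {1} {1} _ _ = refl
  labF-reflect {1} {2} _ _ = refl
  labF-reflect {1} {3} _ _ = refl
  labF-reflect {1} {suc (suc (suc (suc b)))} _ (s≤s (s≤s (s≤s (s≤s ()))))
  labF-reflect {2} {0} _ _ = refl
  labF-reflect {2} {1} _ _ = refl
  labF-reflect {2} {2} _ _ = refl
  labF-reflect {2} {3} _ _ = refl
  labF-reflect {2} {suc (suc (suc (suc b)))} _ (s≤s (s≤s (s≤s (s≤s ()))))
  labF-reflect {3} {0} _ _ = refl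
  labF-reflect {3} {1} _ _ = refl
  labF-reflect {3} {2} _ _ = refl
  labF-reflect {3} {3} _ _ = refl
  labF-reflect {3} {suc (suc (suc (suc b)))} _ (s≤s (s≤s (s≤s (s≤s ()))))
  labF-reflect {suc (suc (suc (suc a)))} (s≤s (s≤s (s≤s (s≤s ())))) _

  module RowsF (E : Embedding M labF 4) (closed : Closed M (p E) 4) where
    open Simple E closed

    mirrorF : Embedding M labF 4
    mirrorF = relabel (reflect 4) reflect-<
      (λ a< b< q → trans (≡-sym (reflect-reflect a<)) (trans (cong (reflect 4) q) (reflect-reflect b<))) labF-reflect E

    values : V 0 ≡ 3 × V 1 ≡ 6 × V 2 ≡ 6 × V 3 ≡ 3
    values with bond-4 (p E 2) (p E 1) (λ q → case inj E 2<4 1<4 q of λ ()) (lab≡ E 2<4 1<4)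
    ... | inj₁ (q , _) = value 0 0<4 w-F₄-0 3 F₄-0 , value 1 1<4 w-F₄-1 6 F₄-1 , value 2 2<4 w-F₄-2 6 F₄-2 , value 3 3<4 w-F₄-3 3 F₄-3
      where open ValuesF E closed q
    ... | inj₂ (_ , q) = value 3 3<4 w-F₄-3 3 F₄-3 , value 2 2<4 w-F₄-2 6 F₄-2 , value 1 1<4 w-F₄-1 6 F₄-1 , value 0 0<4 w-F₄-0 3 F₄-0
      where open ValuesF mirrorF (closed-relabel {p E} (reflect 4) reflect-< reflect-reflect closed) q

    V₀ : V 0 ≡ 3
    V₀ = proj₁ values

    V₁ : V 1 ≡ 6
    V₁ = proj₁ (proj₂ values)

    V₂ : V 2 ≡ 6
    V₂ = proj₁ (proj₂ (proj₂ values))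

    V₃ : V 3 ≡ 3
    V₃ = proj₂ (proj₂ (proj₂ values))

    ¬leaf₁₂ : ¬ Leaf (p E 1) (p E 2)
    ¬leaf₁₂ isolated = case trans (≡-sym (lab≡ E 1<4 0<4)) (isolated (p E 0)
      (λ q → case inj E 0<4 1<4 q of λ ()) (λ q → case inj E 0<4 2<4 q of λ ())) of λ ()

    ¬leaf₂₁ : ¬ Leaf (p E 2) (p E 1)
    ¬leaf₂₁ isolated = case trans (≡-sym (lab≡ E 2<4 3<4)) (isolated (p E 3)
      (λ q → case inj E 3<4 2<4 q of λ ()) (λ q → case inj E 3<4 1<4 q of λ ())) of λ ()

    row-0 : Row (p E 0)
    row-0 = row-at 0<4 ((1 , 6) ∷ []) cover bound
      where
      cover : ∀ b′ → b′ < 4 → b′ ≢ 0 → labF 0 b′ ≡ 2 ⊎ ∃ λ w → (b′ , w) ∈ (1 , 6) ∷ [] × sixfold (labF 0 b′) (p E 0) (p E b′) ≤ w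
      cover 0 _ q = ⊥-elim (q refl)
      cover 1 _ _ = inj₂ (6 , here refl , ℕₚ.≤-refl)
      cover 2 _ _ = inj₁ refl
      cover 3 _ _ = inj₁ refl
      cover (suc (suc (suc (suc b)))) (s≤s (s≤s (s≤s (s≤s ()))))
      bound : 6 ℕ.* V 1 ℕ.+ 0 ≤ 12 ℕ.* V 0
      bound rewrite V₀ | V₁ = ℕₚ.≤ᵇ⇒≤ 36 36 tt

    row-1 : Row (p E 1)
    row-1 = row-at 1<4 ((0 , 6) ∷ (2 , 9) ∷ []) cover bound
      where
      cover : ∀ b′ → b′ < 4 → b′ ≢ 1 → labF 1 b′ ≡ 2 ⊎ ∃ λ w → (b′ , w) ∈ (0 , 6) ∷ (2 , 9) ∷ [] × sixfold (labF 1 b′) (p E 1) (p E b′) ≤ w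
      cover 0 _ _ = inj₂ (6 , here refl , ℕₚ.≤-refl)
      cover 1 _ q = ⊥-elim (q refl)
      cover 2 _ _ = inj₂ (9 , there (here refl) , weight₄≤9 (leaf? _ _) (leaf? _ _) ¬leaf₁₂)
      cover 3 _ _ = inj₁ refl
      cover (suc (suc (suc (suc b)))) (s≤s (s≤s (s≤s (s≤s ()))))
      bound : 6 ℕ.* V 0 ℕ.+ (9 ℕ.* V 2 ℕ.+ 0) ≤ 12 ℕ.* V 1
      bound rewrite V₀ | V₁ | V₂ = ℕₚ.≤ᵇ⇒≤ 72 72 tt

    row-2 : Row (p E 2)
    row-2 = row-at 2<4 ((1 , 9) ∷ (3 , 6) ∷ []) cover bound
      where
      cover : ∀ b′ → b′ < 4 → b′ ≢ 2 → labF 2 b′ ≡ 2 ⊎ ∃ λ w → (b′ , w) ∈ (1 , 9) ∷ (3 , 6) ∷ [] × sixfold (labF 2 b′) (p E 2) (p E b′) ≤ w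
      cover 0 _ _ = inj₁ refl
      cover 1 _ _ = inj₂ (9 , here refl , weight₄≤9 (leaf? _ _) (leaf? _ _) ¬leaf₂₁)
      cover 2 _ q = ⊥-elim (q refl)
      cover 3 _ _ = inj₂ (6 , there (here refl) , ℕₚ.≤-refl)
      cover (suc (suc (suc (suc b)))) (s≤s (s≤s (s≤s (s≤s ()))))
      bound : 9 ℕ.* V 1 ℕ.+ (6 ℕ.* V 3 ℕ.+ 0) ≤ 12 ℕ.* V 2
      bound rewrite V₁ | V₂ | V₃ = ℕₚ.≤ᵇ⇒≤ 72 72 tt

    row-3 : Row (p E 3)
    row-3 = row-at 3<4 ((2 , 6) ∷ []) cover bound
      where
      cover : ∀ b′ → b′ < 4 → b′ ≢ 3 → labF 3 b′ ≡ 2 ⊎ ∃ λ w → (b′ , w) ∈ (2 , 6) ∷ [] × sixfold (labF 3 b′) (p E 3) (p E b′) ≤ w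
      cover 0 _ _ = inj₁ refl
      cover 1 _ _ = inj₁ refl
      cover 2 _ _ = inj₂ (6 , here refl , ℕₚ.≤-refl)
      cover 3 _ q = ⊥-elim (q refl)
      cover (suc (suc (suc (suc b)))) (s≤s (s≤s (s≤s (s≤s ()))))
      bound : 6 ℕ.* V 2 ℕ.+ 0 ≤ 12 ℕ.* V 3
      bound rewrite V₂ | V₃ = ℕₚ.≤ᵇ⇒≤ 36 36 tt

    rows : ∀ b → b < 4 → Row (p E b)
    rows 0 _ = row-0
    rows 1 _ = row-1
    rows 2 _ = row-2
    rows 3 _ = row-3
    rows (suc (suc (suc (suc b)))) (s≤s (s≤s (s≤s (s≤s ()))))

  rows : ∀ i → Row i
  rows i with classify i
  ... | component (dA _)        E b b< refl closed = RowsA.rows E closed b b<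
  ... | component (dB 2≤k)      E b b< refl closed = RowsB.rows E 2≤k closed b b<
  ... | component (dD 4≤k)      E b b< refl closed = RowsD.rows E 4≤k closed b b<
  ... | component (dE 6≤k k≤8) E b b< refl closed = rowsE 6≤k k≤8 E closed b b<
  ... | component dF            E b b< refl closed = RowsF.rows E closed b b<

-- The matrix over the reals

module CartanEntries {n : ℕ} (M : CoxeterMatrix n) (m≤4 : ∀ i j → m M i j ≤ 4) (v : Fin n → ℕ) where

  open Rows M v

  label-cases : ∀ i j → i ≢ j → m M i j ≡ 2 ⊎ m M i j ≡ 3 ⊎ m M i j ≡ 4
  label-cases i j i≢j with m M i j | m≤4 i j | offdiag M i j i≢j
  ... | 0 | _ | ()
  ... | 1 | _ | s≤s ()
  ... | 2 | _ | _ = inj₁ refl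
  ... | 3 | _ | _ = inj₂ (inj₁ refl)
  ... | 4 | _ | _ = inj₂ (inj₂ refl)
  ... | suc (suc (suc (suc (suc _)))) | s≤s (s≤s (s≤s (s≤s ()))) | _

  oriented-product : ∀ {i j : Fin n} → i ≢ j → ∀ a b →
    (if toℕ i ℕ.<ᵇ toℕ j then a else b) ℕ.* (if toℕ j ℕ.<ᵇ toℕ i then a else b) ≡ a ℕ.* b
  oriented-product {i} {j} i≢j a b with ℕₚ.<-cmp (toℕ i) (toℕ j)
  ... | tri≈ _ q _ = ⊥-elim (i≢j (Fₚ.toℕ-injective q))
  ... | tri< lt _ ≯ with toℕ i ℕ.<ᵇ toℕ j | ℕₚ.<⇒<ᵇ lt | toℕ j ℕ.<ᵇ toℕ i in gt
  ...   | true | _ | true  = ⊥-elim (≯ (ℕₚ.<ᵇ⇒< _ _ (subst T (≡-sym gt) tt)))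
  ...   | true | _ | false = refl
  oriented-product {i} {j} i≢j a b | tri> ≮ _ gt with toℕ j ℕ.<ᵇ toℕ i | ℕₚ.<⇒<ᵇ gt | toℕ i ℕ.<ᵇ toℕ j in lt
  ...   | true | _ | true  = ⊥-elim (≮ (ℕₚ.<ᵇ⇒< _ _ (subst T (≡-sym lt) tt)))
  ...   | true | _ | false = ℕₚ.*-comm b a

  weight₄-product : ∀ {i j} → i ≢ j → (x : Dec (Leaf i j)) (y : Dec (Leaf j i)) → weight₄ x y ℕ.* weight₄ y x ≡ 72
  weight₄-product i≢j (yes _) (yes _) = oriented-product i≢j 6 12
  weight₄-product i≢j (yes _) (no _)  = refl
  weight₄-product i≢j (no _)  (yes _) = refl
  weight₄-product i≢j (no _)  (no _)  = oriented-product i≢j 8 9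

  sixfold-product : ∀ {i j} → i ≢ j → ∀ x → x ≡ 2 ⊎ x ≡ 3 ⊎ x ≡ 4 → sixfold x i j ℕ.* sixfold x j i ≡ fourCos² x ℕ.* (6 ℕ.* 6)
  sixfold-product i≢j _ (inj₁ refl)        = refl
  sixfold-product i≢j _ (inj₂ (inj₁ refl)) = refl
  sixfold-product {i} {j} i≢j _ (inj₂ (inj₂ refl)) = weight₄-product i≢j (leaf? i j) (leaf? j i)

module Reals (R : RealField) where

  open RealField R public using (Carrier; _≈_; 0#; 1#; fromℕ; commRing; isTotalOrder; 0≉1; inverse)
    renaming (_+_ to _+ʳ_; _*_ to _*ʳ_; -_ to -ʳ_; _≤_ to infix 4 _≤ʳ_; sum to sumʳ)
  open CommutativeRing commRing using (setoid; ring; semiring; +-cong; *-cong; +-congˡ; *-congˡ; *-congʳ; -‿cong; -‿inverseʳ;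
    +-identityˡ; +-identityʳ; *-identityˡ; *-identityʳ; *-comm; *-assoc; distribʳ; zeroˡ; zeroʳ; +-monoid; +-commutativeMonoid)
    renaming (refl to ≈-refl; sym to ≈-sym; trans to ≈-trans; reflexive to ≈-reflexive) public
  open import Algebra.Properties.Ring ring using (-‿distribˡ-*; -‿distribʳ-*; -‿involutive; -0#≈0#; -‿+-comm)
  open import Algebra.Properties.Monoid.Mult +-monoid using (×-homo-+)
  open import Algebra.Properties.Semiring.Mult semiring using (×1-homo-*)
  open import Algebra.Properties.CommutativeSemigroup (CommutativeRing.*-commutativeSemigroup commRing)
    using () renaming (interchange to *-interchange)
  open import Algebra.Properties.CommutativeSemigroup (CommutativeMonoid.commutativeSemigroup +-commutativeMonoid)
    using () renaming (interchange to +-interchange)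
  open IsTotalOrder isTotalOrder using (total; antisym) renaming (reflexive to ≤-reflexive; trans to ≤-trans)
  open import Relation.Binary.Reasoning.Setoid setoid

  fromℤ : ℤ → Carrier
  fromℤ (+ k)    = fromℕ k
  fromℤ -[1+ k ] = -ʳ fromℕ (suc k)

  fromℤ-neg : ∀ z → fromℤ (- z) ≈ -ʳ fromℤ z
  fromℤ-neg (+ zero)  = ≈-sym -0#≈0#
  fromℤ-neg (+ suc k) = ≈-refl
  fromℤ-neg -[1+ k ]  = ≈-sym (-‿involutive (fromℕ (suc k)))

  fromℤ-⊖ : ∀ a b → fromℤ (a ℤ.⊖ b) ≈ fromℕ a +ʳ -ʳ fromℕ b
  fromℤ-⊖ a zero = begin
    fromℤ (a ℤ.⊖ 0)        ≈⟨ ≈-reflexive (cong fromℤ (ℤₚ.⊖-≥ (z≤n {a}))) ⟩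
    fromℕ a                ≈⟨ +-identityʳ (fromℕ a) ⟨
    fromℕ a +ʳ 0#          ≈⟨ +-congˡ -0#≈0# ⟨
    fromℕ a +ʳ -ʳ fromℕ 0  ∎
  fromℤ-⊖ zero (suc b) = ≈-sym (+-identityˡ (-ʳ fromℕ (suc b)))
  fromℤ-⊖ (suc a) (suc b) = begin
    fromℤ (suc a ℤ.⊖ suc b)                        ≈⟨ ≈-reflexive (cong fromℤ (ℤₚ.[1+m]⊖[1+n]≡m⊖n a b)) ⟩
    fromℤ (a ℤ.⊖ b)                                ≈⟨ fromℤ-⊖ a b ⟩
    fromℕ a +ʳ -ʳ fromℕ b                          ≈⟨ +-identityˡ _ ⟨
    0# +ʳ (fromℕ a +ʳ -ʳ fromℕ b)                  ≈⟨ +-cong (-‿inverseʳ 1#) ≈-refl ⟨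
    (1# +ʳ -ʳ 1#) +ʳ (fromℕ a +ʳ -ʳ fromℕ b)       ≈⟨ +-interchange 1# (-ʳ 1#) (fromℕ a) (-ʳ fromℕ b) ⟩
    (1# +ʳ fromℕ a) +ʳ (-ʳ 1# +ʳ -ʳ fromℕ b)       ≈⟨ +-congˡ (-‿+-comm 1# (fromℕ b)) ⟩
    fromℕ (suc a) +ʳ -ʳ fromℕ (suc b)              ∎

  fromℤ-+ : ∀ x y → fromℤ (x + y) ≈ fromℤ x +ʳ fromℤ y
  fromℤ-+ (+ a)    (+ b)    = ×-homo-+ 1# a b
  fromℤ-+ (+ a)    -[1+ b ] = fromℤ-⊖ a (suc b)
  fromℤ-+ -[1+ a ] (+ b)    = ≈-trans (fromℤ-⊖ b (suc a)) (CommutativeRing.+-comm commRing (fromℕ b) (-ʳ fromℕ (suc a)))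
  fromℤ-+ -[1+ a ] -[1+ b ] = begin
    -ʳ fromℕ (suc (suc (a ℕ.+ b)))          ≈⟨ -‿cong (≈-reflexive (cong fromℕ (≡-sym (cong suc (ℕₚ.+-suc a b))))) ⟩
    -ʳ fromℕ (suc a ℕ.+ suc b)              ≈⟨ -‿cong (×-homo-+ 1# (suc a) (suc b)) ⟩
    -ʳ (fromℕ (suc a) +ʳ fromℕ (suc b))     ≈⟨ -‿+-comm (fromℕ (suc a)) (fromℕ (suc b)) ⟨
    -ʳ fromℕ (suc a) +ʳ -ʳ fromℕ (suc b)    ∎

  fromℤ-* : ∀ x k → fromℤ (x * + k) ≈ fromℤ x *ʳ fromℕ k
  fromℤ-* (+ a) k = ≈-trans (≈-reflexive (cong fromℤ (≡-sym (ℤₚ.pos-* a k)))) (×1-homo-* a k)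
  fromℤ-* -[1+ a ] k = begin
    fromℤ (-[1+ a ] * + k)             ≈⟨ ≈-reflexive (cong fromℤ (≡-sym (ℤₚ.neg-distribˡ-* (+ suc a) (+ k)))) ⟩
    fromℤ (- (+ suc a * + k))          ≈⟨ fromℤ-neg (+ suc a * + k) ⟩
    -ʳ fromℤ (+ suc a * + k)           ≈⟨ -‿cong (fromℤ-* (+ suc a) k) ⟩
    -ʳ (fromℕ (suc a) *ʳ fromℕ k)      ≈⟨ -‿distribˡ-* (fromℕ (suc a)) (fromℕ k) ⟩
    fromℤ -[1+ a ] *ʳ fromℕ k          ∎

  sum-fromℤ : ∀ {n} y (f : Fin n → ℤ) (w : Fin n → ℕ) →
              sumʳ (λ j → (fromℤ (f j) *ʳ y) *ʳ fromℕ (w j)) ≈ fromℤ (sum (λ j → f j * + w j)) *ʳ y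
  sum-fromℤ {zero}  y f w = ≈-sym (zeroˡ y)
  sum-fromℤ {suc n} y f w = begin
    (fromℤ x *ʳ y) *ʳ fromℕ a +ʳ sumʳ (λ j → (fromℤ (f (F.suc j)) *ʳ y) *ʳ fromℕ (w (F.suc j)))
      ≈⟨ +-cong head (sum-fromℤ y (f ∘ F.suc) (w ∘ F.suc)) ⟩
    fromℤ (x * + a) *ʳ y +ʳ fromℤ rest *ʳ y   ≈⟨ distribʳ y (fromℤ (x * + a)) (fromℤ rest) ⟨
    (fromℤ (x * + a) +ʳ fromℤ rest) *ʳ y      ≈⟨ *-congʳ (fromℤ-+ (x * + a) rest) ⟨
    fromℤ (x * + a + rest) *ʳ y               ∎
    where
    x    = f F.zero
    a    = w F.zero
    rest = sum (λ j → f (F.suc j) * + w (F.suc j))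
    head : (fromℤ x *ʳ y) *ʳ fromℕ a ≈ fromℤ (x * + a) *ʳ y
    head = begin
      (fromℤ x *ʳ y) *ʳ fromℕ a   ≈⟨ *-assoc (fromℤ x) y (fromℕ a) ⟩
      fromℤ x *ʳ (y *ʳ fromℕ a)   ≈⟨ *-congˡ (*-comm y (fromℕ a)) ⟩
      fromℤ x *ʳ (fromℕ a *ʳ y)   ≈⟨ *-assoc (fromℤ x) (fromℕ a) y ⟨
      (fromℤ x *ʳ fromℕ a) *ʳ y   ≈⟨ *-congʳ (fromℤ-* x a) ⟨
      fromℤ (x * + a) *ʳ y        ∎

  ≤-respʳ : ∀ {x y z} → y ≈ z → x ≤ʳ y → x ≤ʳ z
  ≤-respʳ q le = ≤-trans le (≤-reflexive q)

  ≤-respˡ : ∀ {x y z} → x ≈ y → x ≤ʳ z → y ≤ʳ z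
  ≤-respˡ q le = ≤-trans (≤-reflexive (≈-sym q)) le

  neg≥0 : ∀ {x} → x ≤ʳ 0# → 0# ≤ʳ -ʳ x
  neg≥0 {x} le = ≤-respˡ (-‿inverseʳ x) (≤-respʳ (+-identityˡ (-ʳ x)) (RealField.+-mono-≤ R (-ʳ x) le))

  neg≤0 : ∀ {x} → 0# ≤ʳ x → -ʳ x ≤ʳ 0#
  neg≤0 {x} le = ≤-respˡ (+-identityˡ (-ʳ x)) (≤-respʳ (-‿inverseʳ x) (RealField.+-mono-≤ R (-ʳ x) le))

  neg-square : ∀ x y → -ʳ x *ʳ -ʳ y ≈ x *ʳ y
  neg-square x y = ≈-trans (≈-sym (-‿distribˡ-* x (-ʳ y)))
    (≈-trans (-‿cong (≈-sym (-‿distribʳ-* x y))) (-‿involutive (x *ʳ y)))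

  0≤1 : 0# ≤ʳ 1#
  0≤1 with total 0# 1#
  ... | inj₁ le = le
  ... | inj₂ ge = ≤-respʳ (≈-trans (neg-square 1# 1#) (*-identityˡ 1#)) (RealField.*-nonneg R (neg≥0 ge) (neg≥0 ge))

  1≤fromℕ-suc : ∀ k → 0# ≤ʳ fromℕ k × 1# ≤ʳ fromℕ (suc k)
  1≤fromℕ-suc k = nonneg k , above k (nonneg k)
    where
    above : ∀ k → 0# ≤ʳ fromℕ k → 1# ≤ʳ fromℕ (suc k)
    above k le = ≤-respˡ (+-identityˡ 1#) (≤-respʳ (CommutativeRing.+-comm commRing (fromℕ k) 1#) (RealField.+-mono-≤ R 1# le))
    nonneg : ∀ k → 0# ≤ʳ fromℕ k
    nonneg zero    = ≤-reflexive ≈-refl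
    nonneg (suc k) = ≤-trans 0≤1 (above k (nonneg k))

  fromℕ≥0 : ∀ k → 0# ≤ʳ fromℕ k
  fromℕ≥0 k = proj₁ (1≤fromℕ-suc k)

  fromℕ-suc≉0 : ∀ k → ¬ (fromℕ (suc k) ≈ 0#)
  fromℕ-suc≉0 k q = 0≉1 (antisym 0≤1 (≤-respʳ q (proj₂ (1≤fromℕ-suc k))))

  fromℤ≥0 : ∀ {z} → 0ℤ ≤ᶻ z → 0# ≤ʳ fromℤ z
  fromℤ≥0 (+≤+ {n = k} _) = fromℕ≥0 k

  sixth : Carrier
  sixth = proj₁ (inverse (fromℕ 6) (fromℕ-suc≉0 5))

  6*sixth : fromℕ 6 *ʳ sixth ≈ 1#
  6*sixth = proj₂ (inverse (fromℕ 6) (fromℕ-suc≉0 5))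

  sixth≥0 : 0# ≤ʳ sixth
  sixth≥0 with total 0# sixth
  ... | inj₁ le = le
  ... | inj₂ ge = ⊥-elim (0≉1 (antisym 0≤1 (≤-respˡ (-‿involutive 1#) (neg≤0 (≤-respʳ
          (≈-trans (≈-sym (-‿distribʳ-* (fromℕ 6) sixth)) (-‿cong 6*sixth)) (RealField.*-nonneg R (fromℕ≥0 6) (neg≥0 ge)))))))

  multiple-of-6 : ∀ k → fromℕ (k ℕ.* 6) *ʳ sixth ≈ fromℕ k
  multiple-of-6 k = begin
    fromℕ (k ℕ.* 6) *ʳ sixth         ≈⟨ *-congʳ (×1-homo-* k 6) ⟩
    (fromℕ k *ʳ fromℕ 6) *ʳ sixth    ≈⟨ *-assoc (fromℕ k) (fromℕ 6) sixth ⟩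
    fromℕ k *ʳ (fromℕ 6 *ʳ sixth)    ≈⟨ *-congˡ 6*sixth ⟩
    fromℕ k *ʳ 1#                    ≈⟨ *-identityʳ (fromℕ k) ⟩
    fromℕ k                          ∎

  module CartanMatrix {n : ℕ} (M : CoxeterMatrix n) (m≤4 : ∀ i j → m M i j ≤ 4) (v : Fin n → ℕ) where
    open Rows M v
    open CartanEntries M m≤4 v

    A : Matrix R n
    A i j = fromℤ (coef i j) *ʳ sixth

    weight : Fin n → Fin n → ℕ
    weight i j = sixfold (m M i j) i j

    entry-off : ∀ {i j} → i ≢ j → A i j ≈ -ʳ (fromℕ (weight i j) *ʳ sixth)
    entry-off {i} {j} i≢j = begin
      fromℤ (coef i j) *ʳ sixth              ≈⟨ *-congʳ (≈-reflexive (cong fromℤ (coef-off i≢j))) ⟩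
      fromℤ (- + weight i j) *ʳ sixth        ≈⟨ *-congʳ (fromℤ-neg (+ weight i j)) ⟩
      -ʳ fromℕ (weight i j) *ʳ sixth         ≈⟨ -‿distribˡ-* (fromℕ (weight i j)) sixth ⟨
      -ʳ (fromℕ (weight i j) *ʳ sixth)       ∎

    entry-2 : ∀ i j → i ≢ j → m M i j ≡ 2 → A i j ≈ 0#
    entry-2 i j i≢j q = ≈-trans (entry-off i≢j)
      (≈-trans (-‿cong (≈-trans (*-congʳ (≈-reflexive (cong (λ x → fromℕ (sixfold x i j)) q))) (zeroˡ sixth))) -0#≈0#)

    entry-3 : ∀ i j → m M i j ≡ 3 → A i j ≈ -ʳ 1#
    entry-3 i j q = ≈-trans (entry-off i≢j)
      (-‿cong (≈-trans (*-congʳ (≈-reflexive (cong (λ x → fromℕ (sixfold x i j)) q))) 6*sixth))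
      where
      i≢j : i ≢ j
      i≢j refl = case trans (≡-sym (diag M i)) q of λ ()

    entry-product : ∀ i j → i ≢ j → A i j *ʳ A j i ≈ fromℕ (fourCos² (m M i j))
    entry-product i j i≢j = begin
      A i j *ʳ A j i
        ≈⟨ *-cong (entry-off i≢j) (entry-off (i≢j ∘ ≡-sym)) ⟩
      -ʳ (fromℕ (weight i j) *ʳ sixth) *ʳ -ʳ (fromℕ (weight j i) *ʳ sixth)
        ≈⟨ neg-square _ _ ⟩
      (fromℕ (weight i j) *ʳ sixth) *ʳ (fromℕ (weight j i) *ʳ sixth)
        ≈⟨ *-interchange (fromℕ (weight i j)) sixth (fromℕ (weight j i)) sixth ⟩
      (fromℕ (weight i j) *ʳ fromℕ (weight j i)) *ʳ (sixth *ʳ sixth)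
        ≈⟨ *-congʳ (×1-homo-* (weight i j) (weight j i)) ⟨
      fromℕ (weight i j ℕ.* weight j i) *ʳ (sixth *ʳ sixth)
        ≈⟨ *-congʳ (≈-reflexive (cong fromℕ weights)) ⟩
      fromℕ ((k ℕ.* 6) ℕ.* 6) *ʳ (sixth *ʳ sixth)
        ≈⟨ *-assoc (fromℕ ((k ℕ.* 6) ℕ.* 6)) sixth sixth ⟨
      (fromℕ ((k ℕ.* 6) ℕ.* 6) *ʳ sixth) *ʳ sixth
        ≈⟨ *-congʳ (multiple-of-6 (k ℕ.* 6)) ⟩
      fromℕ (k ℕ.* 6) *ʳ sixth
        ≈⟨ multiple-of-6 k ⟩
      fromℕ k ∎
      where
      k = fourCos² (m M i j)
      weights : weight i j ℕ.* weight j i ≡ (k ℕ.* 6) ℕ.* 6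
      weights = trans (cong (λ x → weight i j ℕ.* sixfold x j i) (CoxeterMatrix.sym M j i))
        (trans (sixfold-product i≢j (m M i j) (label-cases i j i≢j)) (≡-sym (ℕₚ.*-assoc k 6 6)))

    nonzero-sym : ∀ i j → i ≢ j → ¬ (A i j ≈ 0#) → ¬ (A j i ≈ 0#)
    nonzero-sym i j i≢j ≉0 q with label-cases i j i≢j
    ... | inj₁ e = ≉0 (entry-2 i j i≢j e)
    ... | inj₂ (inj₁ e) = fromℕ-suc≉0 0 (≈-trans (≈-reflexive (cong (fromℕ ∘ fourCos²) (≡-sym e)))
                            (≈-trans (≈-sym (entry-product i j i≢j)) (≈-trans (*-congˡ q) (zeroʳ (A i j)))))
    ... | inj₂ (inj₂ e) = fromℕ-suc≉0 1 (≈-trans (≈-reflexive (cong (fromℕ ∘ fourCos²) (≡-sym e)))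
                            (≈-trans (≈-sym (entry-product i j i≢j)) (≈-trans (*-congˡ q) (zeroʳ (A i j)))))

    entry≤0 : ∀ i j → i ≢ j → A i j ≤ʳ 0#
    entry≤0 i j i≢j = ≤-respˡ (≈-sym (entry-off i≢j)) (neg≤0 (RealField.*-nonneg R (fromℕ≥0 (weight i j)) sixth≥0))

    isGCM : IsGCM R M A
    isGCM = record
      { diag2   = λ i → ≈-trans (*-congʳ (≈-reflexive (cong fromℤ (coef-diag i)))) (multiple-of-6 2)
      ; nonpos  = entry≤0
      ; negSym  = λ i j i≢j (_ , ≉0) → entry≤0 j i (i≢j ∘ ≡-sym) , nonzero-sym i j i≢j ≉0
      ; product = entry-product
      }

    isRestrictedGCM : IsRestrictedGCM R M A
    isRestrictedGCM = record
      { isGCM      = isGCM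
      ; restricted = λ i j q → entry-3 i j q , entry-3 j i (trans (CoxeterMatrix.sym M j i) q)
      }

    A-row : ∀ i → Row i → 0# ≤ʳ sumʳ (λ j → A i j *ʳ fromℕ (v j))
    A-row i row = ≤-respʳ (≈-sym (sum-fromℤ sixth (coef i) v)) (RealField.*-nonneg R (fromℤ≥0 row) sixth≥0)

theorem5p2 : (R : RealField) → (n : ℕ) → (M : CoxeterMatrix n) →
  IsFinite M → (∀ i j → m M i j ≤ 4) →
  (w0 : Word n) → IsLongestWord M w0 →
  (v : Fin n → ℕ) → (∀ i → IsMinOccurrences M w0 i (v i)) →
  Σ (Matrix R n) λ A → IsRestrictedGCM R M A ×
    (∀ i → RealField._≤_ R (RealField.0# R)
      (RealField.sum R (λ j → RealField._*_ R (A i j) (RealField.fromℕ R (v j)))))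
theorem5p2 R n M _ m≤4 w0 longest v occ =
  A , isRestrictedGCM , λ i → A-row i (ExceptionalRows.rows M m≤4 w0 longest v occ i)
  where open Reals.CartanMatrix R M m≤4 v
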